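{- Let $G$ be a finite group and $m\geq 3$ an integer. Then $G$ has an $m$-Haar graphical representation ($m$-HGR) if and only if none of the following occurs: (a) $m=3$ and $G$ is isomorphic to one of $C_1, C_2, C_3, C_4, C_5, C_2^2, D_6$; (b) $m=4$ and $G$ is isomorphic to one of $C_1, C_2, C_3$; (c) $m=5$ and $G$ is isomorphic to $C_1$ or $C_2$; (d) $6\leq m\leq 9$ and $G\cong C_1$.
   Context: All groups and graphs are finite. $C_n$ denotes the cyclic group of order $n$, $C_2^k$ the elementary abelian group of order $2^k$, and $D_6$ the dihedral group of order $6$. For an integer $m\geq 2$, an $m$-Haar graphical representation ($m$-HGR) of a group $G$ is a graph $\Gamma$ that is regular (all vertices have the same valency) and $m$-partite such that $\mathrm{Aut}(\Gamma)$ is isomorphic to $G$ and acts semiregularly on the vertex set with its $m$ orbits forming the parts of the $m$-partition (and these parts are independent sets). -}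

module Defs where

open import Data.Nat using (ℕ; zero; suc; _+_; _*_; _∸_; _≤_; NonZero; _%_; _/_)
open import Data.Nat.DivMod using (_mod_)
open import Data.Fin using (Fin; toℕ)
open import Data.Fin.Permutation using (Permutation′; _⟨$⟩ʳ_)
open import Data.Bool using (Bool; true; false; if_then_else_)
open import Data.List using (map; allFin)
open import Data.Nat.ListAction using (sum)
open import Data.Product using (Σ; ∃; _×_; _,_)
open import Data.Sum using (_⊎_)
open import Relation.Binary.PropositionalEquality using (_≡_)
open import Relation.Nullary using (¬_)
open import Function.Definitions using (Bijective)

-- Finite groups.  Every finite group of order n is (isomorphic to) a
-- group whose carrier is Fin n; we use this concrete presentation.

record FinGroup : Set where
  field
    order : ℕ
    _·_   : Fin order → Fin order → Fin order
    e     : Fin order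
    inv   : Fin order → Fin order
    assoc : ∀ x y z → (x · y) · z ≡ x · (y · z)
    idˡ   : ∀ x → e · x ≡ x
    idʳ   : ∀ x → x · e ≡ x
    invˡ  : ∀ x → inv x · x ≡ e
    invʳ  : ∀ x → x · inv x ≡ e

record FinTable : Set where
  field
    size : ℕ
    op   : Fin size → Fin size → Fin size

_≅_ : FinGroup → FinTable → Set
G ≅ T = Σ (Fin (FinGroup.order G) → Fin (FinTable.size T)) λ f →
          Bijective _≡_ _≡_ f ×
          (∀ x y → f (FinGroup._·_ G x y) ≡ FinTable.op T (f x) (f y))

Cyc : (n : ℕ) → .{{NonZero n}} → FinTable
Cyc n = record { size = n ; op = λ i j → (toℕ i + toℕ j) mod n }

C2² : FinTable
C2² = record { size = 4 ; op = op }
  where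
  bits : Fin 4 → ℕ × ℕ
  bits i = (toℕ i % 2 , toℕ i / 2)
  op : Fin 4 → Fin 4 → Fin 4
  op i j with bits i | bits j
  ... | (a , b) | (c , d) = ((a + c) % 2 + 2 * ((b + d) % 2)) mod 4

-- Dihedral group D_6 of order 6: element r^a s^b (a < 3, b < 2) is
-- encoded as a + 3b; relation s r = r⁻¹ s, so
-- (r^a s^b)(r^c s^d) = r^(a + (-1)^b c) s^(b + d).
D6 : FinTable
D6 = record { size = 6 ; op = op }
  where
  op : Fin 6 → Fin 6 → Fin 6
  op i j =
    let a = toℕ i % 3 ; b = toℕ i / 3
        c = toℕ j % 3 ; d = toℕ j / 3
        c' = if isZero b then c else (3 ∸ c)
    in ((a + c') % 3 + 3 * ((b + d) % 2)) mod 6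
    where
    isZero : ℕ → Bool
    isZero zero    = true
    isZero (suc _) = false

record Graph : Set where
  field
    N   : ℕ
    adj : Fin N → Fin N → Bool
    sym : ∀ u v → adj u v ≡ adj v u
    irr : ∀ v → adj v v ≡ false

module _ (Γ : Graph) where
  open Graph Γ

  degree : Fin N → ℕ
  degree u = sum (map (λ v → if adj u v then 1 else 0) (allFin N))

  IsRegular : Set
  IsRegular = ∃ λ k → ∀ v → degree v ≡ k

  IsAut : Permutation′ N → Set
  IsAut σ = ∀ u v → adj (σ ⟨$⟩ʳ u) (σ ⟨$⟩ʳ v) ≡ adj u v

-- m-Haar graphical representation of G.
-- Aut(Γ) ≅ G acting semiregularly on V(Γ) is encoded by a left action
-- act of G on the vertices such that
--   * act is an action (act e = id, act (g·h) = act g ∘ act h),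
--   * every act g is an automorphism of Γ,
--   * act is faithful (so g ↦ act g is injective),
--   * every automorphism of Γ equals act g for some g,
-- so g ↦ act g is an isomorphism G ≅ Aut(Γ); and
--   * the action is semiregular (act g v ≡ v ⇒ g ≡ e),
--   * its orbits are exactly the m (nonempty) fibres of part : V → Fin m,
--   * each part is an independent set, and Γ is regular.

record HGR (m : ℕ) (G : FinGroup) : Set where
  open FinGroup G
  field
    Γ        : Graph
  open Graph Γ public
  field
    regular  : IsRegular Γ
    act      : Fin order → Fin N → Fin N
    act-e    : ∀ v → act e v ≡ v
    act-·    : ∀ g h v → act (g · h) v ≡ act g (act h v)
    act-aut  : ∀ g u v → adj (act g u) (act g v) ≡ adj u v
    faithful : ∀ g → (∀ v → act g v ≡ v) → g ≡ e
    onto-Aut : ∀ (σ : Permutation′ N) → IsAut Γ σ →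
                 ∃ λ g → ∀ v → σ ⟨$⟩ʳ v ≡ act g v
    semiregular : ∀ g v → act g v ≡ v → g ≡ e
    part     : Fin N → Fin m
    part-onto : ∀ (i : Fin m) → ∃ λ v → part v ≡ i
    part-orbits : ∀ u v → (part u ≡ part v → ∃ λ g → act g u ≡ v) ×
                  ((∃ λ g → act g u ≡ v) → part u ≡ part v)
    independent : ∀ u v → part u ≡ part v → adj u v ≡ false

HasHGR : ℕ → FinGroup → Set
HasHGR m G = HGR m G

Exceptional : ℕ → FinGroup → Set
Exceptional m G =
    (m ≡ 3 × (G ≅ Cyc 1 ⊎ G ≅ Cyc 2 ⊎ G ≅ Cyc 3 ⊎ G ≅ Cyc 4 ⊎ G ≅ Cyc 5
              ⊎ G ≅ C2² ⊎ G ≅ D6))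
  ⊎ (m ≡ 4 × (G ≅ Cyc 1 ⊎ G ≅ Cyc 2 ⊎ G ≅ Cyc 3))
  ⊎ (m ≡ 5 × (G ≅ Cyc 1 ⊎ G ≅ Cyc 2))
  ⊎ ((6 ≤ m × m ≤ 9) × G ≅ Cyc 1)

{-# OPTIONS --safe #-}
module Submission where

-- An m-HGR of G amounts to connection sets S i j ⊆ G such that the graph on Fin m × G with (i , x) ~ (j , y) iff
-- y x⁻¹ ∈ S i j is regular and has no automorphisms besides the right translations.
--
-- Existence: take connection sets inside a subgroup H whose automorphisms translate every coset of H and whose
-- edges all lie in triangles, and add edges outside H lying in fewer triangles.  Automorphisms preserve the old
-- edges, hence translate every coset of H, and the new edges force these translations to agree.  For m = 3 one
-- generator is added at a time, passing to complements to keep the graph dense in triangles; for m ≥ 4 an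
-- irredundant generating sequence g₁ , … , gᵣ of G over H is added at once, as a set {gᵢ} between two parts and a
-- set {gᵢ₊₁ gᵢ⁻¹} between two others.  H is generated by one or two elements of G, and for m ≥ 10 it is trivial,
-- the base being the square of a path with one edge missing.
--
-- Nonexistence: after reordering the parts and choosing base points only few regular systems of connection sets
-- remain, and each has an automorphism (i , x) ↦ (p i , bᵢ α(x)), α ∈ Aut G, that is not a translation.

open import Defs
open import Data.Nat as ℕ using (ℕ; zero; suc; _+_; _*_; _∸_; _≤_; _<_; z≤n; s≤s; _≡ᵇ_; _<ᵇ_)
import Data.Nat.Properties as ℕₚ
open import Data.Nat.DivMod using (_%_; m≡m%n+[m/n]*n; m%n<n) renaming (_/_ to _div_)
open import Data.Nat.Induction using (<-rec)
open import Data.Nat.ListAction using () renaming (sum to sumL)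
open import Data.Nat.Tactic.RingSolver using (solve-∀)
open import Data.Fin as F using (Fin; zero; suc; toℕ; fromℕ<; combine; remQuot)
import Data.Fin.Properties as Fₚ
open import Data.Fin.Patterns using (0F; 1F; 2F; 3F; 4F; 5F; 6F; 7F; 8F)
open import Data.Fin.Permutation using (Permutation′; _⟨$⟩ʳ_; _⟨$⟩ˡ_; permutation; inverseˡ; inverseʳ)
open import Data.Fin.Subset using (Subset)
import Data.Fin.Subset.Properties as Subₚ
open import Data.Bool using (Bool; true; false; not; _∧_; _∨_; if_then_else_; T)
import Data.Bool.Properties as Bₚ
open import Data.List as L using (List; []; _∷_; map; length; concatMap; allFin; _++_)
import Data.List.Properties as Lₚ
open import Data.List.Relation.Unary.All as All using ([]; _∷_) renaming (All to Allₗ)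
open import Data.List.Relation.Unary.Any using (here; there)
open import Data.List.Relation.Unary.AllPairs using ([]; _∷_)
open import Data.List.Relation.Unary.Unique.Propositional using () renaming (Unique to Uniqueₗ)
open import Data.List.Membership.Propositional using () renaming (_∈_ to _∈ₗ_)
open import Data.List.Membership.Propositional.Properties using (∈-++⁺ˡ; ∈-++⁺ʳ; ∈-allFin)
open import Data.Vec using (Vec; tabulate; lookup)
import Data.Vec.Properties as Vₚ
open import Data.Product using (Σ; ∃; _×_; _,_; proj₁; proj₂)
import Data.Product.Properties as ×ₚ
open import Data.Sum as ⊎ using (_⊎_; inj₁; inj₂)
open import Data.Empty using (⊥; ⊥-elim)
open import Data.Unit using (⊤; tt)
open import Function using (_∘_; id; case_of_)
open import Function.Bundles using (_⇔_; mk⇔)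
open import Function.Definitions using (Bijective)
open import Relation.Binary.Definitions using (tri<; tri≈; tri>)
open import Relation.Nullary using (¬_; Dec; yes; no)
open import Relation.Nullary.Decidable using (⌊_⌋; _×-dec_; _→-dec_; _⊎-dec_; ¬?; toWitness)
open import Relation.Binary.PropositionalEquality using (_≡_; _≢_; refl; sym; trans; cong; cong₂; subst; subst₂; module ≡-Reasoning)
open import Algebra.Properties.CommutativeMonoid.Sum ℕₚ.+-0-commutativeMonoid using (sum; sum-cong-≗; ∑-distrib-+; sum-permute)


-- With three parts, regularity forces equally many new edges between any two parts, so triangles
-- among them have to be tolerated: a new edge is kept in at most one triangle while every old edge
-- lies in two. The enlarged graph no longer has two triangles on every edge, but it is sparse:
-- every automorphism of its multipartite complement is one of its own, and the complement again has
-- two triangles on every edge. Hence the step can be repeated. With more parts the set {gᵢ} alone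
-- would let automorphisms permute the generators. The quotients tie each generator to its
-- predecessor, and irredundance rules out every assignment but the identity. For trivial `G` the
-- question is about asymmetric regular graphs, and the smallest one with more than one vertex has
-- ten vertices. This is where the exceptions up to nine parts come from, and why from ten parts on
-- the base needs no group elements. Base graphs over small groups are certified by evaluating a
-- finite search. Over cyclic groups only exponents in a fixed window around 0 occur in it, so one
-- evaluation serves all sufficiently large orders.

false≢true : ∀ {b} → b ≡ false → b ≡ true → ⊥
false≢true refl ()

≢true : ∀ {b} → b ≢ true → b ≡ false
≢true {false} _ = refl
≢true {true}  p = ⊥-elim (p refl)

⌊⌋-true : ∀ {p} {P : Set p} (d : Dec P) → P → ⌊ d ⌋ ≡ true
⌊⌋-true (yes _) _ = refl
⌊⌋-true (no n)  p = ⊥-elim (n p)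

⌊⌋-sound : ∀ {p} {P : Set p} (d : Dec P) → ⌊ d ⌋ ≡ true → P
⌊⌋-sound (yes p) _ = p

⌊⌋-false : ∀ {p} {P : Set p} (d : Dec P) → ¬ P → ⌊ d ⌋ ≡ false
⌊⌋-false (yes p) n = ⊥-elim (n p)
⌊⌋-false (no _)  _ = refl

∧-split : ∀ {a b} → a ∧ b ≡ true → (a ≡ true) × (b ≡ true)
∧-split {true} {true} refl = refl , refl

bool-ext : ∀ {a b} → (a ≡ true → b ≡ true) → (b ≡ true → a ≡ true) → a ≡ b
bool-ext {false} {false} _ _ = refl
bool-ext {true}  {b}     f _ = sym (f refl)
bool-ext {false} {true}  _ g = g refl

-- Finite groups: word identities, subgroups, orders of elements

module Grp (G : FinGroup) where
  open FinGroup G public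

  El : Set
  El = Fin order

  data Tm : Set where
    var : ℕ → Tm
    ε   : Tm
    _⊙_ : Tm → Tm → Tm
    _⁻  : Tm → Tm

  infixl 7 _⊙_
  infix  8 _⁻

  v0 v1 v2 v3 : Tm
  v0 = var 0
  v1 = var 1
  v2 = var 2
  v3 = var 3

  private
    Wd : Set
    Wd = List (Bool × ℕ)

    push : Bool → ℕ → Wd → Wd
    push b k [] = (b , k) ∷ []
    push b k ((c , l) ∷ w) with k ℕₚ.≟ l | b Bₚ.≟ not c
    ... | yes _ | yes _ = w
    ... | _     | _     = (b , k) ∷ (c , l) ∷ w

    -- The term, inverted when the flag is `false`, is written in front of the accumulator `w`;
    -- cancellation happens letter by letter in `push`.
    flat : Tm → Bool → Wd → Wd
    flat (var k) b     w = push b k w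
    flat ε       b     w = w
    flat (s ⊙ t) true  w = flat s true (flat t true w)
    flat (s ⊙ t) false w = flat t false (flat s false w)
    flat (t ⁻)   b     w = flat t (not b) w

    at : List El → ℕ → El
    at []      _       = e
    at (x ∷ _) zero    = x
    at (_ ∷ ρ) (suc k) = at ρ k

    sgn : Bool → El → El
    sgn true  x = x
    sgn false x = inv x

    wd : List El → Wd → El
    wd ρ []            = e
    wd ρ ((b , k) ∷ w) = sgn b (at ρ k) · wd ρ w

  eval : List El → Tm → El
  eval ρ (var k) = at ρ k
  eval ρ ε       = e
  eval ρ (s ⊙ t) = eval ρ s · eval ρ t
  eval ρ (t ⁻)   = inv (eval ρ t)

  ·-cancelˡ : ∀ x {y z} → x · y ≡ x · z → y ≡ z
  ·-cancelˡ x {y} {z} p = begin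
    y ≡⟨ idˡ y ⟨
    e · y ≡⟨ cong (_· y) (invˡ x) ⟨
    (inv x · x) · y ≡⟨ assoc _ _ _ ⟩
    inv x · (x · y) ≡⟨ cong (inv x ·_) p ⟩
    inv x · (x · z) ≡⟨ assoc _ _ _ ⟨
    (inv x · x) · z ≡⟨ cong (_· z) (invˡ x) ⟩
    e · z ≡⟨ idˡ z ⟩
    z ∎
    where open ≡-Reasoning

  inv-uniq : ∀ x y → x · y ≡ e → inv x ≡ y
  inv-uniq x y p = ·-cancelˡ x (trans (invʳ x) (sym p))

  inv-inv : ∀ x → inv (inv x) ≡ x
  inv-inv x = inv-uniq (inv x) x (invˡ x)

  inv-e : inv e ≡ e
  inv-e = inv-uniq e e (idˡ e)

  private
    sgn-not : ∀ b x → sgn (not b) x ≡ inv (sgn b x)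
    sgn-not true  x = refl
    sgn-not false x = sym (inv-inv x)

    inv-·′ : ∀ x y → inv (x · y) ≡ inv y · inv x
    inv-·′ x y = inv-uniq _ _ (begin
      (x · y) · (inv y · inv x) ≡⟨ assoc _ _ _ ⟩
      x · (y · (inv y · inv x)) ≡⟨ cong (x ·_) (sym (assoc _ _ _)) ⟩
      x · ((y · inv y) · inv x) ≡⟨ cong (λ t → x · (t · inv x)) (invʳ y) ⟩
      x · (e · inv x) ≡⟨ cong (x ·_) (idˡ _) ⟩
      x · inv x ≡⟨ invʳ x ⟩
      e ∎)
      where open ≡-Reasoning

    push-ok : ∀ ρ b k w → wd ρ (push b k w) ≡ sgn b (at ρ k) · wd ρ w
    push-ok ρ b k [] = refl
    push-ok ρ b k ((c , l) ∷ w) with k ℕₚ.≟ l | b Bₚ.≟ not c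
    ... | yes refl | yes refl = sym (begin
      sgn (not c) x · (sgn c x · wd ρ w) ≡⟨ assoc _ _ _ ⟨
      (sgn (not c) x · sgn c x) · wd ρ w ≡⟨ cong (λ t → (t · sgn c x) · wd ρ w) (sgn-not c x) ⟩
      (inv (sgn c x) · sgn c x) · wd ρ w ≡⟨ cong (_· wd ρ w) (invˡ _) ⟩
      e · wd ρ w ≡⟨ idˡ _ ⟩
      wd ρ w ∎)
      where open ≡-Reasoning
            x = at ρ k
    ... | yes refl | no _  = refl
    ... | no _     | yes _ = refl
    ... | no _     | no _  = refl

    flat-ok : ∀ ρ t b w → wd ρ (flat t b w) ≡ sgn b (eval ρ t) · wd ρ w
    flat-ok ρ (var k) b w = push-ok ρ b k w
    flat-ok ρ ε true w = sym (idˡ _)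
    flat-ok ρ ε false w = sym (trans (cong (_· wd ρ w) inv-e) (idˡ _))
    flat-ok ρ (s ⊙ t) true w = trans (flat-ok ρ s true _)
      (trans (cong (eval ρ s ·_) (flat-ok ρ t true w)) (sym (assoc _ _ _)))
    flat-ok ρ (s ⊙ t) false w = trans (flat-ok ρ t false _)
      (trans (cong (inv (eval ρ t) ·_) (flat-ok ρ s false w))
      (trans (sym (assoc _ _ _)) (cong (_· wd ρ w) (sym (inv-·′ _ _)))))
    flat-ok ρ (t ⁻) b w = trans (flat-ok ρ t (not b) w)
      (cong (_· wd ρ w) (trans (sgn-not b _) (lem b (eval ρ t))))
      where
      lem : ∀ b x → inv (sgn b x) ≡ sgn b (inv x)
      lem true  x = refl
      lem false x = refl

  -- Equality of two group words by free reduction.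
  grp : ∀ ρ s t → flat s true [] ≡ flat t true [] → eval ρ s ≡ eval ρ t
  grp ρ s t p = begin
    eval ρ s ≡⟨ idʳ _ ⟨
    eval ρ s · e ≡⟨ flat-ok ρ s true [] ⟨
    wd ρ (flat s true []) ≡⟨ cong (wd ρ) p ⟩
    wd ρ (flat t true []) ≡⟨ flat-ok ρ t true [] ⟩
    eval ρ t · e ≡⟨ idʳ _ ⟩
    eval ρ t ∎
    where open ≡-Reasoning

  inv-· : ∀ x y → inv (x · y) ≡ inv y · inv x
  inv-· x y = inv-·′ x y

  ·-cancelʳ : ∀ z {x y} → x · z ≡ y · z → x ≡ y
  ·-cancelʳ z {x} {y} p = trans (grp (x ∷ z ∷ []) v0 (v0 ⊙ v1 ⊙ v1 ⁻) refl)
    (trans (cong (_· inv z) p) (grp (y ∷ z ∷ []) (v0 ⊙ v1 ⊙ v1 ⁻) v0 refl))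

  inv-injective : ∀ {x y} → inv x ≡ inv y → x ≡ y
  inv-injective {x} {y} p = trans (sym (inv-inv x)) (trans (cong inv p) (inv-inv y))

  infixl 19 _/_
  _/_ : El → El → El
  y / x = y · inv x

  /-· : ∀ y x g → (y · g) / (x · g) ≡ y / x
  /-· y x g = grp (y ∷ x ∷ g ∷ []) (v0 ⊙ v2 ⊙ (v1 ⊙ v2) ⁻) (v0 ⊙ v1 ⁻) refl

  ·-/ : ∀ s x → (s · x) / x ≡ s
  ·-/ s x = grp (s ∷ x ∷ []) (v0 ⊙ v1 ⊙ v1 ⁻) v0 refl

  /-·-cancel : ∀ y x → (y / x) · x ≡ y
  /-·-cancel y x = grp (y ∷ x ∷ []) (v0 ⊙ v1 ⁻ ⊙ v1) v0 refl

  inv-/ : ∀ y x → inv (y / x) ≡ x / y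
  inv-/ y x = grp (y ∷ x ∷ []) ((v0 ⊙ v1 ⁻) ⁻) (v1 ⊙ v0 ⁻) refl

  /-self : ∀ x → x / x ≡ e
  /-self x = invʳ x

  /-≡ : ∀ {y x s} → y / x ≡ s → y ≡ s · x
  /-≡ {y} {x} p = trans (sym (/-·-cancel y x)) (cong (_· x) p)

  /-e : ∀ {y x} → y / x ≡ e → y ≡ x
  /-e {y} {x} p = trans (/-≡ p) (idˡ x)

  record Sub : Set where
    field
      mem  : El → Bool
      e∈   : mem e ≡ true
      ·∈   : ∀ {x y} → mem x ≡ true → mem y ≡ true → mem (x · y) ≡ true
      inv∈ : ∀ {x} → mem x ≡ true → mem (inv x) ≡ true

  open Sub public using (e∈; ·∈; inv∈)

  infix 4 _∈_ _∉_ _⊑_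
  _∈_ _∉_ : El → Sub → Set
  x ∈ H = Sub.mem H x ≡ true
  x ∉ H = Sub.mem H x ≡ false

  _⊑_ : Sub → Sub → Set
  H ⊑ K = ∀ {x} → x ∈ H → x ∈ K

  ∈? : ∀ x H → (x ∈ H) ⊎ (x ∉ H)
  ∈? x H with Sub.mem H x
  ... | true  = inj₁ refl
  ... | false = inj₂ refl

  ∉-∈ : ∀ {H x y} → x ∉ H → y ∈ H → x ≢ y
  ∉-∈ p q refl = false≢true p q

  /∈ : ∀ H {x y} → x ∈ H → y ∈ H → x / y ∈ H
  /∈ H p q = ·∈ H p (inv∈ H q)

  inv∈⁻ : ∀ H {x} → inv x ∈ H → x ∈ H
  inv∈⁻ H {x} p = subst (_∈ H) (inv-inv x) (inv∈ H p)

  ·∉ʳ : ∀ H {x y} → x ∈ H → y ∉ H → x · y ∉ H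
  ·∉ʳ H {x} {y} p q = ≢true λ r → false≢true q
    (subst (_∈ H) (grp (x ∷ y ∷ []) (v0 ⁻ ⊙ (v0 ⊙ v1)) v1 refl) (·∈ H (inv∈ H p) r))

  ·∉ˡ : ∀ H {x y} → x ∉ H → y ∈ H → x · y ∉ H
  ·∉ˡ H {x} {y} p q = ≢true λ r → false≢true p
    (subst (_∈ H) (grp (x ∷ y ∷ []) (v0 ⊙ v1 ⊙ v1 ⁻) v0 refl) (·∈ H r (inv∈ H q)))

  inv∉ : ∀ H {x} → x ∉ H → inv x ∉ H
  inv∉ H p = ≢true λ q → false≢true p (inv∈⁻ H q)

  trivial : Sub
  trivial = record
    { mem = λ x → ⌊ x Fₚ.≟ e ⌋
    ; e∈ = ⌊⌋-true (e Fₚ.≟ e) refl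
    ; ·∈ = λ {x} {y} p q → ⌊⌋-true (x · y Fₚ.≟ e)
        (trans (cong₂ _·_ (⌊⌋-sound (x Fₚ.≟ e) p) (⌊⌋-sound (y Fₚ.≟ e) q)) (idˡ e))
    ; inv∈ = λ {x} p → ⌊⌋-true (inv x Fₚ.≟ e) (trans (cong inv (⌊⌋-sound (x Fₚ.≟ e) p)) inv-e) }

  full : Sub
  full = record { mem = λ _ → true ; e∈ = refl ; ·∈ = λ _ _ → refl ; inv∈ = λ _ → refl }

  fromDec : {P : El → Set} → (∀ x → Dec (P x)) → P e → (∀ {x y} → P x → P y → P (x · y)) →
            (∀ {x} → P x → P (inv x)) → Sub
  fromDec d pe pm pi = record
    { mem = λ x → ⌊ d x ⌋
    ; e∈ = ⌊⌋-true (d e) pe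
    ; ·∈ = λ {x} {y} p q → ⌊⌋-true (d (x · y)) (pm (⌊⌋-sound (d x) p) (⌊⌋-sound (d y) q))
    ; inv∈ = λ {x} p → ⌊⌋-true (d (inv x)) (pi (⌊⌋-sound (d x) p)) }

  private
    Closed : Subset order → Set
    Closed p = (lookup p e ≡ true) × ((∀ x y → lookup p x ≡ true → lookup p y ≡ true → lookup p (x · y) ≡ true)
               × (∀ x → lookup p x ≡ true → lookup p (inv x) ≡ true))

    is? : ∀ (b : Bool) → Dec (b ≡ true)
    is? b = b Bₚ.≟ true

    -- A certificate that `x` is not generated: a subgroup, given as a subset, containing `H` and
    -- `g` but not `x`. Generated elements are those without a certificate, which is decidable
    -- because there are finitely many subsets.
    Sep : Sub → El → El → Subset order → Set
    Sep H g x p = Closed p × ((∀ h → h ∈ H → lookup p h ≡ true) × ((lookup p g ≡ true) × ¬ (lookup p x ≡ true)))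

    sep? : ∀ H g x p → Dec (Sep H g x p)
    sep? H g x p =
      (is? _ ×-dec (Fₚ.all? (λ x → Fₚ.all? λ y → is? (lookup p x) →-dec (is? (lookup p y) →-dec is? (lookup p (x · y))))
        ×-dec Fₚ.all? (λ x → is? (lookup p x) →-dec is? (lookup p (inv x)))))
      ×-dec (Fₚ.all? (λ h → is? (Sub.mem H h) →-dec is? (lookup p h)) ×-dec (is? (lookup p g) ×-dec ¬? (is? (lookup p x))))

    InGen : Sub → El → El → Set
    InGen H g x = ¬ (∃ λ p → Sep H g x p)

    inGen? : ∀ H g x → Dec (InGen H g x)
    inGen? H g x = ¬? (Subₚ.anySubset? (sep? H g x))

  -- The subgroup generated by H and g, as the intersection of all subgroups containing them.
  abstract
    adjoin : Sub → El → Sub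
    adjoin H g = fromDec {InGen H g} (inGen? H g)
      (λ { (p , cl , _ , _ , n) → n (proj₁ cl) })
      (λ { {x} {y} a b (p , cl , h , k , n) → st a p cl h k λ px → st b p cl h k λ py → n (proj₁ (proj₂ cl) x y px py) })
      (λ { {x} a (p , cl , h , k , n) → st a p cl h k λ px → n (proj₂ (proj₂ cl) x px) })
      where
      st : ∀ {x} → InGen H g x → ∀ p → Closed p → (∀ h → h ∈ H → lookup p h ≡ true) → lookup p g ≡ true →
           ((lookup p x ≡ true) → ⊥) → ⊥
      st a p cl h k n = a (p , cl , h , k , n)

    adjoin-⊒ : ∀ H g → H ⊑ adjoin H g
    adjoin-⊒ H g {x} p = ⌊⌋-true (inGen? H g x) (λ { (_ , _ , h , _ , n) → n (h x p) })

    adjoin-∋ : ∀ H g → g ∈ adjoin H g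
    adjoin-∋ H g = ⌊⌋-true (inGen? H g g) (λ { (_ , _ , _ , k , n) → n k })

    adjoin-least : ∀ H g (P : Sub) → H ⊑ P → g ∈ P → adjoin H g ⊑ P
    adjoin-least H g P hp gp {x} q with ∈? x P
    ... | inj₁ r = r
    ... | inj₂ r = ⊥-elim (⌊⌋-sound (inGen? H g x) q (p , (lk e (e∈ P) ,
          (λ x y a b → lk _ (·∈ P (kl x a) (kl y b))) , λ x a → lk _ (inv∈ P (kl x a)))
          , (λ h a → lk h (hp a)) , lk g gp , λ a → false≢true r (kl x a)))
      where
      p : Subset order
      p = tabulate (Sub.mem P)
      lk : ∀ x → x ∈ P → lookup p x ≡ true
      lk x a = trans (Vₚ.lookup∘tabulate (Sub.mem P) x) a
      kl : ∀ x → lookup p x ≡ true → x ∈ P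
      kl x a = trans (sym (Vₚ.lookup∘tabulate (Sub.mem P) x)) a

  gen : El → Sub
  gen a = adjoin trivial a

  gen-∋ : ∀ a → a ∈ gen a
  gen-∋ a = adjoin-∋ trivial a

  triv⊑ : ∀ P → trivial ⊑ P
  triv⊑ P {x} p = subst (_∈ P) (sym (⌊⌋-sound (x Fₚ.≟ e) p)) (e∈ P)

  gen-least : ∀ a P → a ∈ P → gen a ⊑ P
  gen-least a P = adjoin-least trivial a P (triv⊑ P)

  -- Every map commuting with left multiplication by a and b commutes with ⟨a,b⟩; a set of
  -- such elements is a subgroup.
  Equiv : (El → El) → Sub
  Equiv z = fromDec {λ h → ∀ x → z (h · x) ≡ h · z x} (λ h → Fₚ.all? λ x → z (h · x) Fₚ.≟ h · z x)
    (λ x → trans (cong z (idˡ x)) (sym (idˡ _)))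
    (λ {h} {k} p q x → trans (cong z (assoc h k x)) (trans (p _) (trans (cong (h ·_) (q x)) (sym (assoc h k _)))))
    (λ {h} p x → ·-cancelˡ h (trans (sym (p _)) (trans (cong z (grp (h ∷ x ∷ []) (v0 ⊙ (v0 ⁻ ⊙ v1)) v1 refl))
      (grp (h ∷ z x ∷ []) v1 (v0 ⊙ (v0 ⁻ ⊙ v1)) refl))))

  ∈Equiv : ∀ z h → (∀ x → z (h · x) ≡ h · z x) → h ∈ Equiv z
  ∈Equiv z h p = ⌊⌋-true (Fₚ.all? λ x → z (h · x) Fₚ.≟ h · z x) p

  Equiv-elim : ∀ z h → h ∈ Equiv z → ∀ x → z (h · x) ≡ h · z x
  Equiv-elim z h p = ⌊⌋-sound (Fₚ.all? λ x → z (h · x) Fₚ.≟ h · z x) p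

  infixr 30 _^_
  _^_ : El → ℕ → El
  a ^ zero  = e
  a ^ suc k = a · a ^ k

  ^-+ : ∀ a k l → a ^ (k + l) ≡ a ^ k · a ^ l
  ^-+ a zero l = sym (idˡ _)
  ^-+ a (suc k) l = trans (cong (a ·_) (^-+ a k l)) (sym (assoc _ _ _))

  ^-comm : ∀ a k l → a ^ k · a ^ l ≡ a ^ l · a ^ k
  ^-comm a k l = trans (sym (^-+ a k l)) (trans (cong (a ^_) (ℕₚ.+-comm k l)) (^-+ a l k))

  ^-* : ∀ a k l → a ^ (k * l) ≡ (a ^ l) ^ k
  ^-* a zero l = refl
  ^-* a (suc k) l = trans (^-+ a l (k * l)) (cong (a ^ l ·_) (^-* a k l))

  e^ : ∀ k → e ^ k ≡ e
  e^ zero = refl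
  e^ (suc k) = trans (idˡ _) (e^ k)

  ^1 : ∀ a → a ^ 1 ≡ a
  ^1 a = idʳ a

  ^∈ : ∀ H {a} → a ∈ H → ∀ k → a ^ k ∈ H
  ^∈ H p zero = e∈ H
  ^∈ H p (suc k) = ·∈ H p (^∈ H p k)

  ^-∸ : ∀ a {i j} → i ≤ j → a ^ i ≡ a ^ j → a ^ (j ∸ i) ≡ e
  ^-∸ a {i} {j} i≤j p = ·-cancelˡ (a ^ i) (trans (sym (^-+ a i (j ∸ i)))
    (trans (cong (a ^_) (ℕₚ.m+[n∸m]≡n i≤j)) (trans (sym p) (sym (idʳ _)))))

  record HasOrder (a : El) (n : ℕ) : Set where
    field
      pos   : 1 ≤ n
      pow-n : a ^ n ≡ e
      least : ∀ k → 1 ≤ k → k < n → a ^ k ≢ e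

  private
    -- Upward search for the order; the fuel is the distance to the known exponent `n`, so the
    -- search stops there at the latest.
    leastPow : ∀ a n fuel k → k + fuel ≡ n → 1 ≤ k → a ^ n ≡ e → (∀ l → 1 ≤ l → l < k → a ^ l ≢ e) → ∃ (HasOrder a)
    leastPow a n fuel k eq 1≤k p q with a ^ k Fₚ.≟ e
    ... | yes r = k , record { pos = 1≤k ; pow-n = r ; least = q }
    leastPow a n zero k eq 1≤k p q | no r = ⊥-elim (r (subst (λ t → a ^ t ≡ e) (trans (sym eq) (ℕₚ.+-identityʳ k)) p))
    leastPow a n (suc f) k eq 1≤k p q | no r = leastPow a n f (suc k) (trans (sym (ℕₚ.+-suc k f)) eq) (s≤s z≤n) p q′
      where
      q′ : ∀ l → 1 ≤ l → l < suc k → a ^ l ≢ e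
      q′ l 1≤l (s≤s l≤k) with ℕₚ.m≤n⇒m<n∨m≡n l≤k
      ... | inj₁ l<k  = q l 1≤l l<k
      ... | inj₂ refl = r

  hasOrder : ∀ a → ∃ (HasOrder a)
  hasOrder a with Fₚ.pigeonhole (ℕₚ.n<1+n order) (λ (i : Fin (suc order)) → a ^ toℕ i)
  ... | i , j , i<j , p = leastPow a (toℕ j ∸ toℕ i) (toℕ j ∸ toℕ i ∸ 1) 1
          (ℕₚ.m+[n∸m]≡n {1} (ℕₚ.m<n⇒0<n∸m i<j)) (s≤s z≤n) (^-∸ a (ℕₚ.<⇒≤ i<j) p)
          (λ l 1≤l l<1 → ⊥-elim (ℕₚ.<⇒≱ l<1 1≤l))

  ord-inj : ∀ {a n} → HasOrder a n → ∀ {i j} → i < n → j < n → a ^ i ≡ a ^ j → i ≡ j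
  ord-inj {a} {n} o {i} {j} i<n j<n p with ℕₚ.<-cmp i j
  ... | tri≈ _ q _ = q
  ... | tri< i<j _ _ = ⊥-elim (HasOrder.least o (j ∸ i) (ℕₚ.m<n⇒0<n∸m i<j)
          (ℕₚ.≤-<-trans (ℕₚ.m∸n≤m j i) j<n) (^-∸ a (ℕₚ.<⇒≤ i<j) p))
  ... | tri> _ _ j<i = ⊥-elim (HasOrder.least o (i ∸ j) (ℕₚ.m<n⇒0<n∸m j<i)
          (ℕₚ.≤-<-trans (ℕₚ.m∸n≤m i j) i<n) (^-∸ a (ℕₚ.<⇒≤ j<i) (sym p)))

-- Counting by finite sums

sumL-tabulate : ∀ {N} (h : Fin N → ℕ) → sumL (L.tabulate h) ≡ sum h
sumL-tabulate {zero} h = refl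
sumL-tabulate {suc N} h = cong (h zero +_) (sumL-tabulate (h ∘ suc))

sumL-allFin : ∀ {N} (h : Fin N → ℕ) → sumL (map h (allFin N)) ≡ sum h
sumL-allFin {N} h = trans (cong sumL (Lₚ.map-tabulate id h)) (sumL-tabulate h)

sum-↑ : ∀ a {b} (f : Fin (a + b) → ℕ) → sum f ≡ sum (f ∘ (F._↑ˡ b)) + sum (f ∘ (a F.↑ʳ_))
sum-↑ zero f = refl
sum-↑ (suc a) f = trans (cong (f zero +_) (sum-↑ a (f ∘ suc))) (sym (ℕₚ.+-assoc (f zero) _ _))

sum-combine : ∀ m {n} (f : Fin (m * n) → ℕ) → sum f ≡ sum {m} (λ i → sum {n} (λ x → f (combine i x)))
sum-combine zero f = refl
sum-combine (suc m) {n} f = trans (sum-↑ n f) (cong (sum (f ∘ (F._↑ˡ (m * n))) +_) (sum-combine m (f ∘ (n F.↑ʳ_))))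

b2n : Bool → ℕ
b2n b = if b then 1 else 0

cnt : ∀ {k} → (Fin k → Bool) → ℕ
cnt f = sum (λ x → b2n (f x))

cnt-cong : ∀ {k} {f g : Fin k → Bool} → (∀ x → f x ≡ g x) → cnt f ≡ cnt g
cnt-cong p = sum-cong-≗ (λ x → cong b2n (p x))

sum-bij : ∀ {k} (f : Fin k → ℕ) (π π⁻ : Fin k → Fin k) → (∀ x → π (π⁻ x) ≡ x) → (∀ x → π⁻ (π x) ≡ x) →
          sum (f ∘ π) ≡ sum f
sum-bij f π π⁻ p q = sym (sum-permute f (permutation π π⁻ p q))

cnt-bij : ∀ {k} (f : Fin k → Bool) (π π⁻ : Fin k → Fin k) → (∀ x → π (π⁻ x) ≡ x) → (∀ x → π⁻ (π x) ≡ x) →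
          cnt (f ∘ π) ≡ cnt f
cnt-bij f = sum-bij (b2n ∘ f)

b2n-∨ : ∀ a b → (a ≡ true → b ≡ true → ⊥) → b2n (a ∨ b) ≡ b2n a + b2n b
b2n-∨ false b     _ = refl
b2n-∨ true  false _ = refl
b2n-∨ true  true  p = ⊥-elim (p refl refl)

cnt-∨ : ∀ {k} (f g : Fin k → Bool) → (∀ x → f x ≡ true → g x ≡ true → ⊥) →
        cnt (λ x → f x ∨ g x) ≡ cnt f + cnt g
cnt-∨ f g d = trans (sum-cong-≗ (λ x → b2n-∨ (f x) (g x) (d x))) (∑-distrib-+ (b2n ∘ f) (b2n ∘ g))

cnt-false : ∀ {k} → cnt {k} (λ _ → false) ≡ 0
cnt-false {zero} = refl
cnt-false {suc k} = cnt-false {k}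

cnt-single : ∀ {k} (a : Fin k) → cnt (λ x → ⌊ x Fₚ.≟ a ⌋) ≡ 1
cnt-single {suc k} zero = cong suc (cnt-false {k})
cnt-single {suc k} (suc a) = trans (cnt-cong (λ x → lem x)) (cnt-single a)
  where
  lem : ∀ x → ⌊ suc x Fₚ.≟ suc a ⌋ ≡ ⌊ x Fₚ.≟ a ⌋
  lem x with x Fₚ.≟ a
  ... | yes _ = refl
  ... | no _  = refl

-- Set difference H ∖ S for S ⊆ H.
cnt-∖ : ∀ {k} (h s : Fin k → Bool) → (∀ x → s x ≡ true → h x ≡ true) →
        cnt (λ x → h x ∧ not (s x)) + cnt s ≡ cnt h
cnt-∖ h s p = trans (sym (∑-distrib-+ _ (b2n ∘ s))) (sum-cong-≗ (λ x → lem (h x) (s x) (p x)))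
  where
  lem : ∀ a b → (b ≡ true → a ≡ true) → b2n (a ∧ not b) + b2n b ≡ b2n a
  lem false false _ = refl
  lem true  false _ = refl
  lem true  true  _ = refl
  lem false true  q with q refl
  ... | ()

_∈ᶠ_ : ∀ {k} → Fin k → List (Fin k) → Bool
x ∈ᶠ []       = false
x ∈ᶠ (y ∷ ys) = ⌊ x Fₚ.≟ y ⌋ ∨ x ∈ᶠ ys

Distinct : ∀ {k} → List (Fin k) → Set
Distinct []       = ⊤
Distinct (x ∷ xs) = (x ∈ᶠ xs ≡ false) × Distinct xs

cnt-list : ∀ {k} (xs : List (Fin k)) → Distinct xs → cnt (_∈ᶠ xs) ≡ length xs
cnt-list {k} [] _ = cnt-false {k}
cnt-list (x ∷ xs) (p , q) = trans (cnt-∨ (λ y → ⌊ y Fₚ.≟ x ⌋) (_∈ᶠ xs) dis) (cong₂ _+_ (cnt-single x) (cnt-list xs q))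
  where
  dis : ∀ y → ⌊ y Fₚ.≟ x ⌋ ≡ true → y ∈ᶠ xs ≡ true → ⊥
  dis y a b with ⌊⌋-sound (y Fₚ.≟ x) a
  ... | refl = false≢true p b

-- Graphs given by connection sets, their automorphisms and rigidity

module Core (G : FinGroup) (m : ℕ) where
  open Grp G

  Vx : Set
  Vx = Fin m × El

  Conn : Set
  Conn = Fin m → Fin m → El → Bool

  adjC : Conn → Vx → Vx → Bool
  adjC S (i , x) (j , y) = S i j (y / x)

  record IsConn (S : Conn) : Set where
    field
      symC : ∀ i j x → S j i (inv x) ≡ S i j x
      irrC : ∀ i x → S i i x ≡ false

    adj-sym : ∀ u v → adjC S u v ≡ adjC S v u
    adj-sym (i , x) (j , y) = trans (sym (symC i j (y / x))) (cong (S j i) (inv-/ y x))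

    adj-diff : ∀ {u v} → adjC S u v ≡ true → proj₁ u ≢ proj₁ v
    adj-diff {i , x} {j , y} p refl = false≢true (irrC i (y / x)) p

  record Auto (S : Conn) : Set where
    field
      to from : Vx → Vx
      to-from : ∀ v → to (from v) ≡ v
      from-to : ∀ v → from (to v) ≡ v
      pres    : ∀ u v → adjC S (to u) (to v) ≡ adjC S u v

    to-inj : ∀ {u v} → to u ≡ to v → u ≡ v
    to-inj {u} {v} p = trans (sym (from-to u)) (trans (cong from p) (from-to v))

  open Auto public

  flip : ∀ {S} → Auto S → Auto S
  flip {S} σ = record
    { to = from σ ; from = to σ ; to-from = from-to σ ; from-to = to-from σ
    ; pres = λ u v → trans (sym (pres σ (from σ u) (from σ v))) (cong₂ (adjC S) (to-from σ u) (to-from σ v)) }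

  tr : El → Vx → Vx
  tr g (i , x) = i , x · g

  adj-tr : ∀ S g u v → adjC S (tr g u) (tr g v) ≡ adjC S u v
  adj-tr S g (i , x) (j , y) = cong (S i j) (/-· y x g)

  trAuto : ∀ {S} → El → Auto S
  trAuto {S} g = record
    { to = tr g ; from = tr (inv g)
    ; to-from = λ { (i , x) → cong (i ,_) (grp (x ∷ g ∷ []) (v0 ⊙ v1 ⁻ ⊙ v1) v0 refl) }
    ; from-to = λ { (i , x) → cong (i ,_) (grp (x ∷ g ∷ []) (v0 ⊙ v1 ⊙ v1 ⁻) v0 refl) }
    ; pres = adj-tr S g }

  _∘ᴬ_ : ∀ {S} → Auto S → Auto S → Auto S
  σ ∘ᴬ ρ = record
    { to = to σ ∘ to ρ ; from = from ρ ∘ from σ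
    ; to-from = λ v → trans (cong (to σ) (to-from ρ _)) (to-from σ v)
    ; from-to = λ v → trans (cong (from ρ) (from-to σ _)) (from-to ρ v)
    ; pres = λ u v → trans (pres σ _ _) (pres ρ u v) }

  reAuto : ∀ {S S′} (σ : Auto S) → (∀ u v → adjC S′ (to σ u) (to σ v) ≡ adjC S′ u v) → Auto S′
  reAuto σ p = record { to = to σ ; from = from σ ; to-from = to-from σ ; from-to = from-to σ ; pres = p }

  -- The automorphism is one of the whole graph on all of `G`, but only its effect over `H` is
  -- prescribed. Precomposing with right translations transfers this to every coset of `H`; what
  -- stays open is how the translations on different cosets are related.
  Rigid : Sub → Conn → Set
  Rigid H S = ∀ (σ : Auto S) → ∃ λ g → ∀ i x → x ∈ H → to σ (i , x) ≡ (i , x · g)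

  Rigid-block : ∀ {H S} → Rigid H S → (σ : Auto S) → ∀ c → ∃ λ g → ∀ i x → x ∈ H → to σ (i , x · c) ≡ (i , x · g)
  Rigid-block r σ c with r (σ ∘ᴬ trAuto c)
  ... | g , p = g , p

  deg : Conn → Fin m → ℕ
  deg S i = sum (λ j → cnt (S i j))

  toHGR : ∀ {S} → IsConn S → Rigid full S → (k : ℕ) → (∀ i → deg S i ≡ k) → Fin m → HGR m G
  toHGR {S} isC rig k reg i₀ = record
    { Γ = Γ
    ; regular = k , λ v → regular′ (toV v) v refl
    ; act = act
    ; act-e = λ v → trans (cong (λ t → fromV (proj₁ (toV v) , t)) (trans (cong (_ ·_) inv-e) (idʳ _))) (from-to′ v)
    ; act-· = λ g h v → cong fromV (act-comp g h v)
    ; act-aut = λ g u v → trans (cong₂ (adjC S) (to-from′ _) (to-from′ _)) (adj-tr S (inv g) (toV u) (toV v))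
    ; faithful = λ g p → semi g (fromV (i₀ , e)) (p _)
    ; onto-Aut = onto
    ; semiregular = semi
    ; part = proj₁ ∘ toV
    ; part-onto = λ i → fromV (i , e) , cong proj₁ (to-from′ (i , e))
    ; part-orbits = λ u v → orb₁ u v , orb₂ u v
    ; independent = λ u v p → ind (toV u) (toV v) p
    }
    where
    N = m * order
    toV : Fin N → Vx
    toV = remQuot order
    fromV : Vx → Fin N
    fromV (i , x) = combine i x
    to-from′ : ∀ v → toV (fromV v) ≡ v
    to-from′ (i , x) = Fₚ.remQuot-combine i x
    from-to′ : ∀ v → fromV (toV v) ≡ v
    from-to′ v = Fₚ.combine-remQuot {m} order v
    open IsConn isC
    Γ : Graph
    Γ = record { N = N ; adj = λ u v → adjC S (toV u) (toV v)
               ; sym = λ u v → adj-sym (toV u) (toV v) ; irr = λ v → irrC (proj₁ (toV v)) _ }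
    -- Right translations compose in the opposite order, so the inverse is needed for a left action.
    act : El → Fin N → Fin N
    act g v = fromV (tr (inv g) (toV v))
    act-comp : ∀ g h v → tr (inv (g · h)) (toV v) ≡ tr (inv g) (toV (act h v))
    act-comp g h v = trans (cong (proj₁ (toV v) ,_) (grp (proj₂ (toV v) ∷ g ∷ h ∷ []) (v0 ⊙ (v1 ⊙ v2) ⁻) (v0 ⊙ v2 ⁻ ⊙ v1 ⁻) refl))
      (cong (tr (inv g)) (sym (to-from′ _)))
    semi : ∀ g v → act g v ≡ v → g ≡ e
    semi g v p = inv-injective (trans (·-cancelˡ (proj₂ (toV v))
      (trans (cong proj₂ (trans (sym (to-from′ _)) (cong toV p))) (sym (idʳ _)))) (sym inv-e))
    regular′ : ∀ w v → toV v ≡ w → degree Γ v ≡ k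
    regular′ (i , x) v eq = begin
      degree Γ v ≡⟨ sumL-allFin (λ u → b2n (adjC S (toV v) (toV u))) ⟩
      sum (λ u → b2n (adjC S (toV v) (toV u))) ≡⟨ sum-combine m _ ⟩
      sum (λ j → sum (λ y → b2n (adjC S (toV v) (toV (fromV (j , y))))))
        ≡⟨ sum-cong-≗ (λ j → sum-cong-≗ (λ y → cong₂ (λ a b → b2n (adjC S a b)) eq (to-from′ (j , y)))) ⟩
      sum (λ j → cnt (λ y → S i j (y / x)))
        ≡⟨ sum-cong-≗ (λ j → cnt-bij (S i j) (_/ x) (_· x) (λ y → ·-/ y x) (λ y → /-·-cancel y x)) ⟩
      deg S i ≡⟨ reg i ⟩
      k ∎
      where open ≡-Reasoning
    onto : (σ : Permutation′ N) → IsAut Γ σ → ∃ λ g → ∀ v → σ ⟨$⟩ʳ v ≡ act g v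
    onto σ aut with rig (record
      { to = λ v → toV (σ ⟨$⟩ʳ fromV v) ; from = λ v → toV (σ ⟨$⟩ˡ fromV v)
      ; to-from = λ v → trans (cong (λ t → toV (σ ⟨$⟩ʳ t)) (from-to′ _)) (trans (cong toV (inverseʳ σ)) (to-from′ v))
      ; from-to = λ v → trans (cong (λ t → toV (σ ⟨$⟩ˡ t)) (from-to′ _)) (trans (cong toV (inverseˡ σ)) (to-from′ v))
      ; pres = λ u v → trans (aut (fromV u) (fromV v)) (cong₂ (adjC S) (to-from′ u) (to-from′ v)) })
    ... | g , p = inv g , λ v → trans (sym (from-to′ _)) (cong fromV
          (trans (cong (λ t → toV (σ ⟨$⟩ʳ t)) (sym (from-to′ v)))
          (trans (p (proj₁ (toV v)) (proj₂ (toV v)) refl) (cong (λ t → proj₁ (toV v) , proj₂ (toV v) · t) (sym (inv-inv g))))))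
    orb₁ : ∀ u v → proj₁ (toV u) ≡ proj₁ (toV v) → ∃ λ g → act g u ≡ v
    orb₁ u v p = inv (proj₂ (toV v)) · proj₂ (toV u) , trans (cong fromV (cong₂ _,_ p
      (grp (proj₂ (toV u) ∷ proj₂ (toV v) ∷ []) (v0 ⊙ (v1 ⁻ ⊙ v0) ⁻) v1 refl))) (from-to′ v)
    orb₂ : ∀ u v → (∃ λ g → act g u ≡ v) → proj₁ (toV u) ≡ proj₁ (toV v)
    orb₂ u v (g , refl) = sym (cong proj₁ (to-from′ (tr (inv g) (toV u))))
    ind : ∀ a b → proj₁ a ≡ proj₁ b → adjC S a b ≡ false
    ind (i , x) (.i , y) refl = irrC i _

∨-split : ∀ {a b} → a ∨ b ≡ true → (a ≡ true) ⊎ (b ≡ true)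
∨-split {true}  _ = inj₁ refl
∨-split {false} p = inj₂ p

∨-inj₁ : ∀ {a} b → a ≡ true → a ∨ b ≡ true
∨-inj₁ b refl = refl

∨-inj₂ : ∀ a {b} → b ≡ true → a ∨ b ≡ true
∨-inj₂ true  _ = refl
∨-inj₂ false p = p

∨-false : ∀ {a b} → a ≡ false → b ≡ false → a ∨ b ≡ false
∨-false refl refl = refl

-- Two of three pairwise non-equal parts are avoided only by the third.
fin3-same : ∀ (a b c d : Fin 3) → a ≢ c → b ≢ c → a ≢ d → b ≢ d → c ≢ d → a ≡ b
fin3-same = toWitness {a? = Fₚ.all? λ a → Fₚ.all? λ b → Fₚ.all? λ c → Fₚ.all? λ d →
  ¬? (a Fₚ.≟ c) →-dec (¬? (b Fₚ.≟ c) →-dec (¬? (a Fₚ.≟ d) →-dec (¬? (b Fₚ.≟ d) →-dec (¬? (c Fₚ.≟ d) →-dec (a Fₚ.≟ b)))))} tt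

fin3-third : ∀ (i j : Fin 3) → i ≢ j → ∃ λ l → i ≢ l × j ≢ l
fin3-third 0F 0F p = ⊥-elim (p refl)
fin3-third 0F 1F _ = 2F , (λ ()) , λ ()
fin3-third 0F 2F _ = 1F , (λ ()) , λ ()
fin3-third 1F 0F _ = 2F , (λ ()) , λ ()
fin3-third 1F 1F p = ⊥-elim (p refl)
fin3-third 1F 2F _ = 0F , (λ ()) , λ ()
fin3-third 2F 0F _ = 1F , (λ ()) , λ ()
fin3-third 2F 1F _ = 0F , (λ ()) , λ ()
fin3-third 2F 2F p = ⊥-elim (p refl)

fin3-others : ∀ (i : Fin 3) → ∃ λ j → ∃ λ l → i ≢ j × i ≢ l × j ≢ l
fin3-others 0F = 1F , 2F , (λ ()) , (λ ()) , λ ()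
fin3-others 1F = 0F , 2F , (λ ()) , (λ ()) , λ ()
fin3-others 2F = 0F , 1F , (λ ()) , (λ ()) , λ ()

≢-sym : ∀ {A : Set} {x y : A} → x ≢ y → y ≢ x
≢-sym p q = p (sym q)

record Two {A : Set} (P : A → Set) : Set where
  constructor two
  field
    {a b} : A
    a≢b   : a ≢ b
    Pa    : P a
    Pb    : P b

record Three {A : Set} (P : A → Set) : Set where
  constructor three
  field
    {a b c} : A
    a≢b     : a ≢ b
    a≢c     : a ≢ c
    b≢c     : b ≢ c
    Pa      : P a
    Pb      : P b
    Pc      : P c

Three-map : ∀ {A : Set} {P Q : A → Set} → (∀ {x} → P x → Q x) → Three P → Three Q
Three-map f (three p q r x y z) = three p q r (f x) (f y) (f z)

module _ {k : ℕ} {P : Fin k → Set} where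
  avoid1 : Three P → ∀ p → Two (λ z → P z × z ≢ p)
  avoid1 (three {a} {b} {c} a≢b a≢c b≢c Pa Pb Pc) p with a Fₚ.≟ p | b Fₚ.≟ p
  ... | no u | no v = two a≢b (Pa , u) (Pb , v)
  ... | yes refl | _ = two b≢c (Pb , ≢-sym a≢b) (Pc , ≢-sym a≢c)
  ... | no u | yes refl = two a≢c (Pa , u) (Pc , ≢-sym b≢c)

  avoid2 : Three P → ∀ p q → ∃ λ z → P z × z ≢ p × z ≢ q
  avoid2 t p q with avoid1 t p
  ... | two {a} {b} a≢b (Pa , u) (Pb , v) with a Fₚ.≟ q
  ... | no w = a , Pa , u , w
  ... | yes refl = b , Pb , v , ≢-sym a≢b

module Glue (G : FinGroup) (m : ℕ) (i₀ : Fin m) where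
  open Grp G
  open Core G m

  -- Equivariance under `K` gives z x = z (x e) = x (z e), so on `K` the map is the right
  -- translation by `z e`.
  glue : ∀ {S} (σ : Auto S) (z : El → El) → (∀ i c → to σ (i , c) ≡ (i , z c)) → ∀ {K} → K ⊑ Equiv z →
         ∃ λ g → ∀ i x → x ∈ K → to σ (i , x) ≡ (i , x · g)
  glue σ z p {K} q = z e , λ i x x∈K → trans (p i x) (cong (i ,_)
    (trans (cong z (sym (idʳ x))) (Equiv-elim z x (q x∈K) e)))

  -- Rigidity on every coset of `H` yields one map `z`, the same in all parts and `H`-equivariant.
  -- Rigidity over a larger subgroup is thereby reduced to equivariance of `z` under further
  -- generators.
  blockwise : ∀ {H B} → Rigid H B → (σ : Auto B) →
              ∃ λ z → (∀ i c → to σ (i , c) ≡ (i , z c)) × (H ⊑ Equiv z)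
  blockwise {H} rig σ = z , val , λ {h} h∈H → ∈Equiv z h λ c →
      cong proj₂ (trans (sym (val i₀ (h · c))) (proj₂ (Rigid-block {H} rig σ c) i₀ h h∈H))
    where
    z : El → El
    z c = proj₁ (Rigid-block {H} rig σ c)
    val : ∀ i c → to σ (i , c) ≡ (i , z c)
    val i c = trans (cong (λ t → to σ (i , t)) (sym (idˡ c)))
      (trans (proj₂ (Rigid-block {H} rig σ c) i e (e∈ H)) (cong (i ,_) (idˡ _)))

  -- A subset of the edges that every automorphism maps into itself is preserved by automorphisms.
  preserved : ∀ {S B} → (∀ (σ : Auto S) u v → adjC B u v ≡ true → adjC B (to σ u) (to σ v) ≡ true) →
              (σ : Auto S) → Auto B
  preserved {S} {B} f σ = reAuto σ λ u v → bool-ext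
    (λ p → trans (cong₂ (adjC B) (sym (from-to σ u)) (sym (from-to σ v))) (f (flip σ) _ _ p)) (f σ u v)

-- Three parts: rigid graphs and their multipartite complements

module M3 (G : FinGroup) where
  open Grp G
  open Core G 3
  open Glue G 3 0F

  -- Equal sizes on all pairs make the graph regular. `in3` and `out3` trade places under the
  -- complement; three elements are asked for because one must survive two exclusions.
  record Sym3 (H : Sub) (S : Conn) : Set where
    field
      isC   : IsConn S
      supp  : ∀ {i j x} → S i j x ≡ true → x ∈ H
      rigid : Rigid H S
      size  : ℕ
      sz    : ∀ i j → i ≢ j → cnt (S i j) ≡ size
      in3   : ∀ i j → i ≢ j → Three (λ x → S i j x ≡ true)
      out3  : ∀ i j → i ≢ j → Three (λ x → x ∈ H × S i j x ≡ false)
    open IsConn isC public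


  -- Two triangles on every edge are what later separates these edges from newly added ones, which
  -- lie in at most one.
  record Good (H : Sub) : Set where
    field
      S    : Conn
      sym3 : Sym3 H S
      tri2 : ∀ i j x → S i j x ≡ true → ∃ λ l → Two (λ z → S i l z ≡ true × S j l (z / x) ≡ true)

  toHGR₃ : ∀ {S} → Sym3 full S → HGR 3 G
  toHGR₃ {S} s = toHGR isC rigid (size + size) degs 0F
    where
    open Sym3 s
    z0 : ∀ i → cnt (S i i) ≡ 0
    z0 i = trans (cnt-cong (irrC i)) (cnt-false {order})
    degs : ∀ i → deg S i ≡ size + size
    degs 0F rewrite z0 0F | sz 0F 1F (λ ()) | sz 0F 2F (λ ()) | ℕₚ.+-identityʳ size = refl
    degs 1F rewrite z0 1F | sz 1F 0F (λ ()) | sz 1F 2F (λ ()) | ℕₚ.+-identityʳ size = refl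
    degs 2F rewrite z0 2F | sz 2F 0F (λ ()) | sz 2F 1F (λ ()) | ℕₚ.+-identityʳ size = refl

  -- In the multipartite complement, two vertices of one part have adjacent common neighbours,
  -- two non-adjacent vertices of different parts do not.
  record Star (K : Sub) (S : Conn) : Set where
    field
      same : ∀ i y → y ∈ K → y ≢ e → ∃ λ j → ∃ λ l → i ≢ j × i ≢ l × j ≢ l × ∃ λ z₁ → ∃ λ z₂ →
             z₁ ∈ K × z₂ ∈ K × S i j z₁ ≡ false × S i j (z₁ / y) ≡ false ×
             S i l z₂ ≡ false × S i l (z₂ / y) ≡ false × S j l (z₂ / z₁) ≡ false
      diff : ∀ i j y → i ≢ j → y ∈ K → ∃ λ l → i ≢ l × j ≢ l ×
             (∃ λ z → z ∈ K × S i l z ≡ false × S j l (z / y) ≡ false) ×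
             (S i j y ≡ false → Two λ z → z ∈ K × S i l z ≡ false × S j l (z / y) ≡ false)

  -- Inside every coset of `K` the edges of `S` are the pairs that are non-adjacent in the
  -- complement and lie in different parts. `Star` makes both "same part" and "same coset"
  -- recognisable by adjacency, so automorphisms of the complement preserve `S` and rigidity is
  -- inherited.
  module Reset (K : Sub) (S : Conn) (s : Sym3 K S) (st : Star K S) where
    open Sym3 s

    Sᶜ : Conn
    Sᶜ i j x = not ⌊ i Fₚ.≟ j ⌋ ∧ (Sub.mem K x ∧ not (S i j x))

    Sᶜ-intro : ∀ {i j x} → i ≢ j → x ∈ K → S i j x ≡ false → Sᶜ i j x ≡ true
    Sᶜ-intro {i} {j} i≢j p q rewrite ⌊⌋-false (i Fₚ.≟ j) i≢j | p | q = refl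

    Sᶜ-elim : ∀ {i j x} → Sᶜ i j x ≡ true → i ≢ j × x ∈ K × S i j x ≡ false
    Sᶜ-elim {i} {j} {x} p with i Fₚ.≟ j
    ... | no i≢j with Sub.mem K x | S i j x
    ... | true | false = i≢j , refl , refl

    isCᶜ : IsConn Sᶜ
    isCᶜ = record
      { symC = λ i j x → bool-ext
          (λ p → case Sᶜ-elim {j} {i} {inv x} p of λ { (a , b , c) → Sᶜ-intro (≢-sym a) (inv∈⁻ K b) (trans (sym (symC i j x)) c) })
          (λ p → case Sᶜ-elim {i} {j} {x} p of λ { (a , b , c) → Sᶜ-intro (≢-sym a) (inv∈ K b) (trans (symC i j x) c) })
      ; irrC = λ i x → ≢true λ p → proj₁ (Sᶜ-elim {i} {i} {x} p) refl }

    adjᶜ : ∀ (u v : Vx) → proj₁ u ≢ proj₁ v → proj₂ v / proj₂ u ∈ K → adjC S u v ≡ false → adjC Sᶜ u v ≡ true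
    adjᶜ (i , x) (j , y) = Sᶜ-intro

    shift : ∀ z x y → (z · x) / y ≡ z / (y / x)
    shift z x y = grp (z ∷ x ∷ y ∷ []) (v0 ⊙ v1 ⊙ v2 ⁻) (v0 ⊙ (v2 ⊙ v1 ⁻) ⁻) refl

    sameBlock : ∀ {u v w} → adjC Sᶜ u w ≡ true → adjC Sᶜ v w ≡ true → proj₂ v / proj₂ u ∈ K
    sameBlock {i , x} {j , y} {l , z} p q = subst (_∈ K)
      (grp (x ∷ y ∷ z ∷ []) ((v2 ⊙ v1 ⁻) ⁻ ⊙ (v2 ⊙ v0 ⁻)) (v1 ⊙ v0 ⁻) refl)
      (·∈ K (inv∈ K (proj₁ (proj₂ (Sᶜ-elim {j} {l} q)))) (proj₁ (proj₂ (Sᶜ-elim {i} {l} p))))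

    open IsConn isCᶜ using () renaming (adj-diff to diffᶜ)

    -- The two vertices have adjacent common neighbours. Their images occupy two different parts, so
    -- both images of the vertices are left with the third part.
    samePart : (σ : Auto Sᶜ) → ∀ i x y → y / x ∈ K → x ≢ y → proj₁ (to σ (i , x)) ≡ proj₁ (to σ (i , y))
    samePart σ i x y yx∈K x≢y with Star.same st i (y / x) yx∈K (λ p → x≢y (sym (/-e p)))
    ... | j , l , i≢j , i≢l , j≢l , z₁ , z₂ , z₁∈ , z₂∈ , a , b , c , d , f =
      fin3-same _ _ _ _ (im uw₁) (im vw₁) (im uw₂) (im vw₂) (im w₁w₂)
      where
      im : ∀ {u v} → adjC Sᶜ u v ≡ true → proj₁ (to σ u) ≢ proj₁ (to σ v)
      im {u} {v} p = diffᶜ (trans (pres σ u v) p)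
      uw₁ : adjC Sᶜ (i , x) (j , z₁ · x) ≡ true
      uw₁ = trans (cong (Sᶜ i j) (·-/ z₁ x)) (Sᶜ-intro i≢j z₁∈ a)
      uw₂ : adjC Sᶜ (i , x) (l , z₂ · x) ≡ true
      uw₂ = trans (cong (Sᶜ i l) (·-/ z₂ x)) (Sᶜ-intro i≢l z₂∈ c)
      vw₁ : adjC Sᶜ (i , y) (j , z₁ · x) ≡ true
      vw₁ = trans (cong (Sᶜ i j) (shift z₁ x y)) (Sᶜ-intro i≢j (/∈ K z₁∈ yx∈K) b)
      vw₂ : adjC Sᶜ (i , y) (l , z₂ · x) ≡ true
      vw₂ = trans (cong (Sᶜ i l) (shift z₂ x y)) (Sᶜ-intro i≢l (/∈ K z₂∈ yx∈K) d)
      w₁w₂ : adjC Sᶜ (j , z₁ · x) (l , z₂ · x) ≡ true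
      w₁w₂ = trans (cong (Sᶜ j l) (/-· z₂ z₁ x)) (Sᶜ-intro j≢l (/∈ K z₂∈ z₁∈) f)

    -- Non-adjacency is preserved outright and the coset through a common neighbour. If the images
    -- shared a part, `samePart` for the inverse would put the original vertices into one part.
    edge : (σ : Auto Sᶜ) → ∀ u v → adjC S u v ≡ true → adjC S (to σ u) (to σ v) ≡ true
    edge σ u@(i , x) v@(j , y) p with adjC S (to σ u) (to σ v) in eq
    ... | true  = refl
    ... | false = ⊥-elim (false≢true nonadj (adjᶜ (to σ u) (to σ v) parts block eq))
      where
      i≢j = adj-diff {u} {v} p
      yx∈K : y / x ∈ K
      yx∈K = supp p
      nonadj : adjC Sᶜ (to σ u) (to σ v) ≡ false
      nonadj = trans (pres σ u v) (≢true λ q → false≢true (proj₂ (proj₂ (Sᶜ-elim {i} {j} q))) p)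
      block : proj₂ (to σ v) / proj₂ (to σ u) ∈ K
      block with Star.diff st i j (y / x) i≢j yx∈K
      ... | l , i≢l , j≢l , (z , z∈ , a , b) , _ = sameBlock {to σ u} {to σ v} {to σ (l , z · x)}
        (trans (pres σ u _) (trans (cong (Sᶜ i l) (·-/ z x)) (Sᶜ-intro i≢l z∈ a)))
        (trans (pres σ v _) (trans (cong (Sᶜ j l) (shift z x y)) (Sᶜ-intro j≢l (/∈ K z∈ yx∈K) b)))
      parts : proj₁ (to σ u) ≢ proj₁ (to σ v)
      parts q = i≢j (trans (sym (cong proj₁ (from-to σ u))) (trans (back (to σ u) (to σ v) q block) (cong proj₁ (from-to σ v))))
        where
        back : ∀ a b → proj₁ a ≡ proj₁ b → proj₂ b / proj₂ a ∈ K → proj₁ (from σ a) ≡ proj₁ (from σ b)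
        back (a , s) (.a , t) refl r with s Fₚ.≟ t
        ... | yes refl = refl
        ... | no s≢t = samePart (flip σ) a s t r s≢t

    sym3ᶜ : Sym3 K Sᶜ
    sym3ᶜ = record
      { isC = isCᶜ
      ; supp = λ {i} {j} p → proj₁ (proj₂ (Sᶜ-elim {i} {j} p))
      ; rigid = λ σ → rigid (preserved edge σ)
      ; size = cnt (Sub.mem K) ∸ size
      ; sz = λ i j i≢j → trans (cnt-cong (λ x → cong (_∧ (Sub.mem K x ∧ not (S i j x))) (cong not (⌊⌋-false (i Fₚ.≟ j) i≢j))))
          (trans (sym (ℕₚ.m+n∸n≡m _ (cnt (S i j)))) (cong₂ _∸_ (cnt-∖ (Sub.mem K) (S i j) (λ x → supp)) (sz i j i≢j)))
      ; in3 = λ i j i≢j → Three-map (λ { (a , b) → Sᶜ-intro i≢j a b }) (out3 i j i≢j)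
      ; out3 = λ i j i≢j → Three-map (λ {x} p → supp p , ≢true λ q → false≢true (proj₂ (proj₂ (Sᶜ-elim {i} {j} {x} q))) p) (in3 i j i≢j) }

    good : Good K
    good = record { S = Sᶜ ; sym3 = sym3ᶜ ; tri2 = t2 }
      where
      t2 : ∀ i j x → Sᶜ i j x ≡ true → ∃ λ l → Two (λ z → Sᶜ i l z ≡ true × Sᶜ j l (z / x) ≡ true)
      t2 i j x p with Sᶜ-elim {i} {j} {x} p
      ... | i≢j , x∈ , q with Star.diff st i j x i≢j x∈
      ... | l , i≢l , j≢l , _ , tw with tw q
      ... | two a≢b (a∈ , a , a′) (b∈ , b , b′) = l , two a≢b
              (Sᶜ-intro i≢l a∈ a , Sᶜ-intro j≢l (/∈ K a∈ x∈) a′) (Sᶜ-intro i≢l b∈ b , Sᶜ-intro j≢l (/∈ K b∈ x∈) b′)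

-- Certified search for automorphisms

anyᵇ allᵇ : {A : Set} → (A → Bool) → List A → Bool
anyᵇ f []       = false
anyᵇ f (x ∷ xs) = f x ∨ anyᵇ f xs
allᵇ f []       = true
allᵇ f (x ∷ xs) = f x ∧ allᵇ f xs

anyᵇ-find : {A : Set} (f : A → Bool) (xs : List A) → anyᵇ f xs ≡ true → ∃ λ x → f x ≡ true
anyᵇ-find f (x ∷ xs) p with f x in eq
... | true  = x , eq
... | false = anyᵇ-find f xs p

eqB : Bool → Bool → Bool
eqB true  b = b
eqB false b = not b

eqB-refl : ∀ {a b} → a ≡ b → eqB a b ≡ true
eqB-refl {true}  refl = refl
eqB-refl {false} refl = refl

eqF : ∀ {k} → Fin k → Fin k → Bool
eqF zero    zero    = true
eqF zero    (suc _) = false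
eqF (suc _) zero    = false
eqF (suc i) (suc j) = eqF i j

eqF-sound : ∀ {k} {i j : Fin k} → eqF i j ≡ true → i ≡ j
eqF-sound {i = zero}  {zero}  _ = refl
eqF-sound {i = suc i} {suc j} p = cong suc (eqF-sound p)

eqF-refl : ∀ {k} (i : Fin k) → eqF i i ≡ true
eqF-refl zero    = refl
eqF-refl (suc i) = eqF-refl i

allF : ∀ {k} → (Fin k → Bool) → Bool
allF {zero}  f = true
allF {suc k} f = f zero ∧ allF (λ i → f (suc i))

allF-elim : ∀ {k} (f : Fin k → Bool) → allF f ≡ true → ∀ i → f i ≡ true
allF-elim f p zero    = proj₁ (∧-split p)
allF-elim f p (suc i) = allF-elim (λ j → f (suc j)) (proj₂ (∧-split {f zero} p)) i

record BoolEq (C : Set) : Set where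
  field
    eq    : C → C → Bool
    sound : ∀ {c d} → eq c d ≡ true → c ≡ d
    rfl   : ∀ c → eq c c ≡ true

  mem : C → List C → Bool
  mem c = anyᵇ (eq c)

  all-mem : (f : C → Bool) (xs : List C) {c : C} → allᵇ f xs ≡ true → mem c xs ≡ true → f c ≡ true
  all-mem f (x ∷ xs) {c} p q with eq c x in e
  ... | true  = trans (cong f (sound e)) (proj₁ (∧-split p))
  ... | false = all-mem f xs (proj₂ (∧-split {f x} p)) q

  neq : ∀ {c d} → eq c d ≡ false → c ≢ d
  neq {c} p refl = false≢true p (rfl c)

  mem-map : ∀ {D : Set} (φ : D → C) (xs : List D) {c} → mem c (map φ xs) ≡ true → ∃ λ x → φ x ≡ c
  mem-map φ (x ∷ xs) {c} p with eq c (φ x) in e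
  ... | true  = x , sym (sound e)
  ... | false = mem-map φ xs p

  mem-++ : ∀ d xs ys → mem d (xs ++ ys) ≡ true → (mem d xs ≡ true) ⊎ (mem d ys ≡ true)
  mem-++ d [] ys p = inj₂ p
  mem-++ d (x ∷ xs) ys p with ∨-split {eq d x} p
  ... | inj₁ q = inj₁ (∨-inj₁ _ q)
  ... | inj₂ q with mem-++ d xs ys q
  ... | inj₁ r = inj₁ (∨-inj₂ (eq d x) r)
  ... | inj₂ r = inj₂ r

  mem-++ˡ : ∀ d xs ys → mem d xs ≡ true → mem d (xs ++ ys) ≡ true
  mem-++ˡ d (x ∷ xs) ys p with ∨-split {eq d x} p
  ... | inj₁ q = ∨-inj₁ _ q
  ... | inj₂ q = ∨-inj₂ (eq d x) (mem-++ˡ d xs ys q)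

  mem-++ʳ : ∀ d xs ys → mem d ys ≡ true → mem d (xs ++ ys) ≡ true
  mem-++ʳ d [] ys p = p
  mem-++ʳ d (x ∷ xs) ys p = ∨-inj₂ (eq d x) (mem-++ʳ d xs ys p)

-- `V` holds the true vertices and `C` codes on which equality and neighbourhoods evaluate. The
-- hypotheses are restricted to codes in the range `ok`, since outside it the arithmetic of codes
-- need not be faithful.
module Engine {V : Set} (adj : V → V → Bool) {C : Set} (E : BoolEq C) (δ : C → V) (nb : C → List C) (ok : C → Bool)
    (adj-ok : ∀ {c d} → ok c ≡ true → ok d ≡ true → adj (δ c) (δ d) ≡ BoolEq.mem E d (nb c))
    (complete : ∀ {c v} → ok c ≡ true → adj (δ c) v ≡ true → ∃ λ d → (BoolEq.mem E d (nb c) ≡ true) × (δ d ≡ v))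
    (δ-inj : ∀ {c d} → ok c ≡ true → ok d ≡ true → δ c ≡ δ d → c ≡ d) where
  open BoolEq E

  fits : C → C → List (C × C) → Bool
  fits p c [] = true
  fits p c ((p′ , c′) ∷ r) = (eqB (mem c′ (nb c)) (mem p′ (nb p)) ∧ eqB (eq c c′) (eq p p′)) ∧ fits p c r

  -- Positions count back from the vertex placed last, because `search` extends its list at the
  -- front.
  nth : ℕ → C × C → List (C × C) → C × C
  nth k       z []      = z
  nth zero    _ (x ∷ r) = x
  nth (suc k) z (x ∷ r) = nth k z r

  module _ (root : C × C) (req : List C) where
    done : List (C × C) → Bool
    done r = allᵇ (λ q → anyᵇ (λ pc → eq (proj₁ pc) q ∧ eq (proj₂ pc) q) r) req

    -- search extends a partial isomorphism along a list of vertices, each given with the position of an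
    -- already placed neighbour; it succeeds when every full extension fixes all codes of req.
    search : List (ℕ × C) → List (C × C) → Bool
    try : C → List (ℕ × C) → List (C × C) → List C → Bool
    search [] r = done r
    search ((k , p) ∷ ps) r = (ok p ∧ mem p (nb (proj₁ (nth k root r)))) ∧ try p ps r (nb (proj₂ (nth k root r)))
    try p ps r [] = true
    try p ps r (c ∷ cs) = (ok c ∧ (if fits p c r then search ps ((p , c) ∷ r) else true)) ∧ try p ps r cs

    module Sound (f : V → V) (f-inj : ∀ {u v} → f u ≡ f v → u ≡ v) (f-pres : ∀ u v → adj (f u) (f v) ≡ adj u v) where
      Inv : C × C → Set
      Inv (p , c) = (ok p ≡ true) × (ok c ≡ true) × (f (δ p) ≡ δ c)

      AllInv : List (C × C) → Set
      AllInv []      = ⊤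
      AllInv (x ∷ r) = Inv x × AllInv r

      nth-inv : ∀ k r → Inv root → AllInv r → Inv (nth k root r)
      nth-inv k       []      i _ = i
      nth-inv zero    (x ∷ r) _ (i , _) = i
      nth-inv (suc k) (x ∷ r) i (_ , j) = nth-inv k r i j

      fits-ok : ∀ {p c} r → Inv (p , c) → AllInv r → fits p c r ≡ true
      fits-ok [] _ _ = refl
      fits-ok {p} {c} ((p′ , c′) ∷ r) i@(op , oc , q) ((op′ , oc′ , q′) , a)
        rewrite eqB-refl {mem c′ (nb c)} {mem p′ (nb p)} (trans (sym (adj-ok oc oc′)) (trans (cong₂ adj (sym q) (sym q′)) (trans (f-pres _ _) (adj-ok op op′))))
              | eqB-refl {eq c c′} {eq p p′} (bool-ext
                  (λ s → subst (λ t → eq p t ≡ true) (δ-inj op op′ (f-inj (trans q (trans (cong δ (sound s)) (sym q′))))) (rfl p))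
                  (λ s → subst (λ t → eq c t ≡ true) (δ-inj oc oc′ (trans (sym q) (trans (cong (f ∘ δ) (sound s)) q′))) (rfl c)))
              = fits-ok r i a

      done-ok : ∀ r → AllInv r → done r ≡ true → ∀ {q} → mem q req ≡ true → f (δ q) ≡ δ q
      done-ok r a d {q} m = go r a (all-mem (λ q → anyᵇ (λ pc → eq (proj₁ pc) q ∧ eq (proj₂ pc) q) r) req d m)
        where
        go : ∀ r → AllInv r → anyᵇ (λ pc → eq (proj₁ pc) q ∧ eq (proj₂ pc) q) r ≡ true → f (δ q) ≡ δ q
        go ((p , c) ∷ r) ((_ , _ , i) , a) t with eq p q ∧ eq c q in e
        ... | false = go r a t
        ... | true with ∧-split {eq p q} e
        ... | s₁ , s₂ = trans (cong (f ∘ δ) (sym (sound s₁))) (trans i (cong δ (sound s₂)))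

      -- By `complete` the true image of the next vertex is among the codes tried, being adjacent to
      -- the image of a placed neighbour. The branch following `f` is never cut by `fits`, so it
      -- ends in a list describing `f`, and `done` reads the fixed codes off it.
      search-ok : ∀ ps r → Inv root → AllInv r → search ps r ≡ true → ∀ {q} → mem q req ≡ true → f (δ q) ≡ δ q
      try-ok : ∀ p ps r cs {d} → Inv root → ok p ≡ true → f (δ p) ≡ δ d → AllInv r → mem d cs ≡ true → try p ps r cs ≡ true →
               ∀ {q} → mem q req ≡ true → f (δ q) ≡ δ q
      search-ok [] r _ a s m = done-ok r a s m
      search-ok ((k , p) ∷ ps) r ir a s m with ∧-split {ok p ∧ mem p (nb (proj₁ (nth k root r)))} s
      ... | s₁ , s₂ with ∧-split {ok p} s₁ | nth-inv k r ir a
      ... | op , mp | oq , oc , i with complete {proj₂ (nth k root r)} {f (δ p)} oc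
             (trans (cong (λ t → adj t (f (δ p))) (sym i)) (trans (f-pres _ _) (trans (adj-ok oq op) mp)))
      ... | d , md , δd = try-ok p ps r (nb (proj₂ (nth k root r))) ir op (sym δd) a md s₂ m
      try-ok p ps r (c ∷ cs) {d} ir op fd a md s m with ∧-split {ok c ∧ (if fits p c r then search ps ((p , c) ∷ r) else true)} s | eq d c in e
      ... | s₁ , s₂ | false = try-ok p ps r cs ir op fd a md s₂ m
      ... | s₁ , s₂ | true with ∧-split {ok c} s₁ | sound e
      ... | oc , t | refl = search-ok ps ((p , c) ∷ r) ir ((op , oc , fd) , a)
              (trans (sym (cong (λ b → if b then search ps ((p , c) ∷ r) else true) (fits-ok r (op , oc , fd) a))) t) m

-- Labels: evaluating products inside an abstract group

module Labels (G : FinGroup) where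
  open Grp G

  -- A product of labels may leave the range. `mulinj` still recognises it whenever its value has a
  -- label in range, and this is all that adjacency tests need; so a window of exponents of a large
  -- cyclic group qualifies.
  record Lab : Set₁ where
    field
      L      : Set
      E      : BoolEq L
      mul    : L → L → L
      unit   : L
      okL    : L → Bool
      φ      : L → El
      φ-unit : φ unit ≡ e
      ok-unit : okL unit ≡ true
      hom    : ∀ {u v} → okL u ≡ true → okL v ≡ true → φ (mul u v) ≡ φ u · φ v
      mulinj : ∀ {v s u} → okL v ≡ true → okL s ≡ true → okL u ≡ true → φ v ≡ φ s · φ u → v ≡ mul s u
    open BoolEq E public

    injL : ∀ {u v} → okL u ≡ true → okL v ≡ true → φ u ≡ φ v → u ≡ v
    injL {u} {v} p q r = trans (mulinj p ok-unit q (trans r (trans (sym (idˡ _)) (cong (_· φ v) (sym φ-unit)))))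
      (sym (mulinj q ok-unit q (trans (sym (idˡ _)) (cong (_· φ v) (sym φ-unit)))))

  module Base (m′ : ℕ) (Λ : Lab) (conn : Fin (suc m′) → Fin (suc m′) → List (Lab.L Λ)) where
    open Lab Λ
    m = suc m′
    open Core G m

    -- Entries are matched position by position, so a table has to list `conn j i` in the order of
    -- the inverses of `conn i j`.
    inverses : List L → List L → Bool
    inverses [] [] = true
    inverses (s ∷ ss) (t ∷ ts) = eq (mul s t) unit ∧ inverses ss ts
    inverses _ _ = false

    distinct : List L → Bool
    distinct [] = true
    distinct (s ∷ ss) = not (mem s ss) ∧ distinct ss

    empty : List L → Bool
    empty [] = true
    empty _  = false

    pairOK : Fin m → Fin m → Bool
    pairOK i j = (allᵇ okL (conn i j) ∧ distinct (conn i j)) ∧ (inverses (conn i j) (conn j i) ∧ (not (eqF i j) ∨ empty (conn i j)))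

    wellformed : Bool
    wellformed = allF λ i → allF (pairOK i)

    S : Conn
    S i j x = x ∈ᶠ map φ (conn i j)

    Code : Set
    Code = Fin m × L

    EC : BoolEq Code
    EC = record
      { eq = λ { (i , u) (j , v) → eqF i j ∧ eq u v }
      ; sound = λ { {i , u} {j , v} p → cong₂ _,_ (eqF-sound (proj₁ (∧-split {eqF i j} p))) (sound (proj₂ (∧-split {eqF i j} p))) }
      ; rfl = λ { (i , u) → cong₂ _∧_ (eqF-refl i) (rfl u) } }

    row : Fin m → L → Fin m → List Code
    row i u j = map (λ s → j , mul s u) (conn i j)

    rows : ∀ {k} → Fin m → L → (Fin k → Fin m) → List Code
    rows {zero}  i u f = []
    rows {suc k} i u f = row i u (f zero) ++ rows i u (f ∘ suc)

    nb : Code → List Code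
    nb (i , u) = rows i u id

    δ : Code → Vx
    δ (i , u) = i , φ u

    ok : Code → Bool
    ok (i , u) = okL u

    module _ (wf : wellformed ≡ true) where
      private
        wf-ij : ∀ i j → pairOK i j ≡ true
        wf-ij i j = allF-elim (pairOK i) (allF-elim (λ i → allF (pairOK i)) wf i) j

      conn-ok : ∀ i j → allᵇ okL (conn i j) ≡ true
      conn-ok i j = proj₁ (∧-split (proj₁ (∧-split (wf-ij i j))))
      conn-distinct : ∀ i j → distinct (conn i j) ≡ true
      conn-distinct i j = proj₂ (∧-split {allᵇ okL (conn i j)} (proj₁ (∧-split (wf-ij i j))))
      conn-inv : ∀ i j → inverses (conn i j) (conn j i) ≡ true
      conn-inv i j = proj₁ (∧-split (proj₂ (∧-split {allᵇ okL (conn i j) ∧ distinct (conn i j)} (wf-ij i j))))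
      conn-irr : ∀ i → conn i i ≡ []
      conn-irr i with conn i i | eqF i i | eqF-refl i | proj₂ (∧-split {inverses (conn i i) (conn i i)} (proj₂ (∧-split {allᵇ okL (conn i i) ∧ distinct (conn i i)} (wf-ij i i))))
      ... | [] | _ | _ | _ = refl
      ... | _ ∷ _ | .true | refl | ()

      ∈φ-find : ∀ ss {x} → allᵇ okL ss ≡ true → x ∈ᶠ map φ ss ≡ true → ∃ λ s → (okL s ≡ true) × (mem s ss ≡ true) × (x ≡ φ s)
      ∈φ-find (s ∷ ss) {x} o p with ∧-split {okL s} o | x Fₚ.≟ φ s
      ... | os , _ | yes q = s , os , ∨-inj₁ _ (rfl s) , q
      ... | _ , oss | no _ with ∈φ-find ss oss p
      ... | t , ot , mt , q = t , ot , ∨-inj₂ (eq t s) mt , q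

      ∈φ : ∀ ss {s} → mem s ss ≡ true → φ s ∈ᶠ map φ ss ≡ true
      ∈φ (t ∷ ss) {s} p with ∨-split {eq s t} p
      ... | inj₁ q = ∨-inj₁ _ (⌊⌋-true (φ s Fₚ.≟ φ t) (cong φ (sound q)))
      ... | inj₂ q = ∨-inj₂ ⌊ φ s Fₚ.≟ φ t ⌋ (∈φ ss q)

      S-find : ∀ {i j x} → S i j x ≡ true → ∃ λ s → (okL s ≡ true) × (mem s (conn i j) ≡ true) × (x ≡ φ s)
      S-find {i} {j} = ∈φ-find (conn i j) (conn-ok i j)

      inv-mem : ∀ ss ts {x} → allᵇ okL ss ≡ true → allᵇ okL ts ≡ true → inverses ss ts ≡ true → x ∈ᶠ map φ ss ≡ true → inv x ∈ᶠ map φ ts ≡ true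
      inv-mem (s ∷ ss) (t ∷ ts) {x} o₁ o₂ v p with ∧-split {okL s} o₁ | ∧-split {okL t} o₂ | ∧-split {eq (mul s t) unit} v | x Fₚ.≟ φ s
      ... | os , _ | ot , _ | st , _ | yes q = ∨-inj₁ _ (⌊⌋-true (inv x Fₚ.≟ φ t) (trans (cong inv q)
              (inv-uniq (φ s) (φ t) (trans (sym (hom os ot)) (trans (cong φ (sound st)) φ-unit)))))
      ... | _ , o₁′ | _ , o₂′ | _ , v′ | no _ = ∨-inj₂ ⌊ inv x Fₚ.≟ φ t ⌋ (inv-mem ss ts o₁′ o₂′ v′ p)

      isC : IsConn S
      isC = record
        { symC = λ i j x → bool-ext
            (λ p → subst (λ t → S i j t ≡ true) (inv-inv x) (inv-mem (conn j i) (conn i j) (conn-ok j i) (conn-ok i j) (conn-inv j i) p))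
            (inv-mem (conn i j) (conn j i) (conn-ok i j) (conn-ok j i) (conn-inv i j))
        ; irrC = λ i x → cong (λ l → x ∈ᶠ map φ l) (conn-irr i) }

      S-cnt : ∀ i j → cnt (S i j) ≡ length (conn i j)
      S-cnt i j = trans (cnt-list (map φ (conn i j)) (go (conn i j) (conn-ok i j) (conn-distinct i j))) (Lₚ.length-map φ (conn i j))
        where
        go : ∀ ss → allᵇ okL ss ≡ true → distinct ss ≡ true → Distinct (map φ ss)
        go [] _ _ = tt
        go (s ∷ ss) o d = ≢true (λ p → case ∈φ-find ss oss p of λ { (t , ot , mt , q) →
              false≢true (notT (proj₁ (∧-split d))) (subst (λ u → mem u ss ≡ true) (sym (injL os ot q)) mt) }) , go ss oss (proj₂ (∧-split {not (mem s ss)} d))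
          where
          os = proj₁ (∧-split {okL s} o)
          oss = proj₂ (∧-split {okL s} o)
          notT : ∀ {b} → not b ≡ true → b ≡ false
          notT {false} _ = refl

      open BoolEq EC using () renaming (mem to memC; eq to eqC; mem-++ to memC-++; mem-++ˡ to memC-++ˡ; mem-++ʳ to memC-++ʳ)

      row-intro : ∀ {u} j ss {s} → mem s ss ≡ true → memC (j , mul s u) (map (λ s → j , mul s u) ss) ≡ true
      row-intro {u} j (t ∷ ss) {s} p with ∨-split {eq s t} p
      ... | inj₁ q rewrite sound q = ∨-inj₁ _ (BoolEq.rfl EC (j , mul t u))
      ... | inj₂ q = ∨-inj₂ (eqC (j , mul s u) (j , mul t u)) (row-intro {u} j ss q)

      row-elim : ∀ {u} j ss {d} → memC d (map (λ s → j , mul s u) ss) ≡ true → ∃ λ s → (mem s ss ≡ true) × (d ≡ (j , mul s u))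
      row-elim {u} j (t ∷ ss) {d} p with ∨-split {eqC d (j , mul t u)} p
      ... | inj₁ q = t , ∨-inj₁ _ (rfl t) , BoolEq.sound EC {d} {j , mul t u} q
      ... | inj₂ q with row-elim {u} j ss {d} q
      ... | s , ms , r = s , ∨-inj₂ (eq s t) ms , r

      nb-elim : ∀ {k} i u (f : Fin k → Fin m) {d} → memC d (rows i u f) ≡ true → ∃ λ j → ∃ λ s → (mem s (conn i j) ≡ true) × (d ≡ (j , mul s u))
      nb-elim {suc k} i u f {d} p with memC-++ d (row i u (f zero)) (rows i u (f ∘ suc)) p
      ... | inj₁ q with row-elim {u} (f zero) (conn i (f zero)) {d} q
      ... | s , ms , r = f zero , s , ms , r
      nb-elim {suc k} i u f {d} p | inj₂ q = nb-elim i u (f ∘ suc) {d} q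

      nb-intro : ∀ {k} i u (f : Fin k → Fin m) j {s} → mem s (conn i (f j)) ≡ true → memC (f j , mul s u) (rows i u f) ≡ true
      nb-intro i u f zero {s} p = memC-++ˡ (f zero , mul s u) (row i u (f zero)) (rows i u (f ∘ suc)) (row-intro {u} (f zero) (conn i (f zero)) p)
      nb-intro i u f (suc j) {s} p = memC-++ʳ (f (suc j) , mul s u) (row i u (f zero)) (rows i u (f ∘ suc)) (nb-intro i u (f ∘ suc) j p)

      ok-mem : ∀ ss {s} → allᵇ okL ss ≡ true → mem s ss ≡ true → okL s ≡ true
      ok-mem ss = all-mem okL ss

      adj-ok : ∀ {c d} → ok c ≡ true → ok d ≡ true → adjC S (δ c) (δ d) ≡ memC d (nb c)
      adj-ok {i , u} {j , v} ou ov = bool-ext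
        (λ p → case S-find {i} {j} p of λ { (s , os , ms , q) → subst (λ t → memC (j , t) (nb (i , u)) ≡ true) (sym (mulinj ov os ou (/-≡ q))) (nb-intro i u id j ms) })
        (λ p → back (nb-elim i u id {j , v} p))
        where
        back : (∃ λ j′ → ∃ λ s → (mem s (conn i j′) ≡ true) × ((j , v) ≡ (j′ , mul s u))) → adjC S (δ (i , u)) (δ (j , v)) ≡ true
        back (.j , s , ms , refl) = subst (λ t → S i j t ≡ true)
          (trans (sym (·-/ (φ s) (φ u))) (cong (_/ φ u) (sym (hom (ok-mem (conn i j) (conn-ok i j) ms) ou)))) (∈φ (conn i j) ms)

      complete : ∀ {c v} → ok c ≡ true → adjC S (δ c) v ≡ true → ∃ λ d → (memC d (nb c) ≡ true) × (δ d ≡ v)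
      complete {i , u} {j , y} ou p with S-find {i} {j} p
      ... | s , os , ms , q = (j , mul s u) , nb-intro i u id j ms , cong (j ,_) (trans (hom os ou) (sym (/-≡ q)))

      δ-inj : ∀ {c d} → ok c ≡ true → ok d ≡ true → δ c ≡ δ d → c ≡ d
      δ-inj {i , u} {j , v} ou ov p with cong proj₁ p
      ... | refl = cong (i ,_) (injL ou ov (cong proj₂ p))

      open Engine (adjC S) EC δ nb ok adj-ok complete δ-inj

      units : List Code
      units = L.tabulate (λ (j : Fin m) → j , unit)

      required : List L → List Code
      required gens = units ++ map (λ g → zero , g) gens

      -- Up to translation an automorphism sends (0 , e) to some (i , e). Since (0 , e) is among the
      -- codes required to be fixed, the check for i ≠ 0 succeeds only if every branch dies out.
      rootCheck : List L → List (ℕ × Code) → Fin m → Bool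
      rootCheck gens patch i = search ((zero , unit) , (i , unit)) (required gens) patch (((zero , unit) , (i , unit)) ∷ [])

      rigidCheck : List L → List (ℕ × Code) → Bool
      rigidCheck gens patch = allF (rootCheck gens patch)

      open Glue G m zero

      module _ (gens : List L) (patch : List (ℕ × Code)) (ck : rigidCheck gens patch ≡ true) where
        fixed : (σ : Auto S) → ∀ i → to σ (zero , e) ≡ (i , e) → ∀ {q} → memC q (required gens) ≡ true → to σ (δ q) ≡ δ q
        fixed σ i p = Sound.search-ok root (required gens) (to σ) (to-inj σ) (pres σ) patch (root ∷ []) start (start , tt) (allF-elim (rootCheck gens patch) ck i)
          where
          root = (zero , unit) , (i , unit)
          start : (okL unit ≡ true) × (okL unit ≡ true) × (to σ (zero , φ unit) ≡ (i , φ unit))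
          start = ok-unit , ok-unit , trans (cong (λ t → to σ (zero , t)) φ-unit) (trans p (cong (i ,_) (sym φ-unit)))

        tab-mem : ∀ {k} (f : Fin k → Fin m) j ys → memC (f j , unit) (L.tabulate (λ j → f j , unit) ++ ys) ≡ true
        tab-mem f zero ys = ∨-inj₁ _ (BoolEq.rfl EC (f zero , unit))
        tab-mem f (suc j) ys = ∨-inj₂ (eqC (f (suc j) , unit) (f zero , unit)) (tab-mem (f ∘ suc) j ys)

        gen-mem : ∀ {g} gs → mem g gs ≡ true → memC (zero , g) (map (λ g → zero , g) gs) ≡ true
        gen-mem {g} (h ∷ gs) p with ∨-split {eq g h} p
        ... | inj₁ q rewrite sound q = ∨-inj₁ _ (BoolEq.rfl EC (zero , h))
        ... | inj₂ q = ∨-inj₂ (eqC (zero , g) (zero , h)) (gen-mem gs q)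

        module _ (σ : Auto S) where
          z : El → El
          z c = proj₂ (to σ (zero , c))

          -- Translations before and after `σ` bring the image of (0 , e) to the form (i , e)
          -- required by `fixed`.
          σ′ : El → Auto S
          σ′ c = trAuto (inv (z c)) ∘ᴬ (σ ∘ᴬ trAuto c)

          root-ok : ∀ c → to (σ′ c) (zero , e) ≡ (proj₁ (to σ (zero , c)) , e)
          root-ok c = trans (cong (λ t → tr (inv (z c)) (to σ (zero , t))) (idˡ c)) (cong (_ ,_) (invʳ (z c)))

          fix : ∀ c {j u} → memC (j , u) (required gens) ≡ true → to σ (j , φ u · c) ≡ (j , φ u · z c)
          fix c {j} {u} p = trans (sym (from-to (trAuto {S} (inv (z c))) (to σ (j , φ u · c)))) (trans (cong (tr (inv (inv (z c)))) (fixed (σ′ c) _ (root-ok c) {j , u} p))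
            (cong (λ t → j , φ u · t) (inv-inv (z c))))

          val : ∀ j c → to σ (j , c) ≡ (j , z c)
          val j c = trans (cong (λ t → to σ (j , t)) (sym (trans (cong (_· c) φ-unit) (idˡ c))))
            (trans (fix c {j} {unit} (tab-mem id j (map (λ g → zero , g) gens))) (cong (j ,_) (trans (cong (_· z c) φ-unit) (idˡ _))))

          z-gen : ∀ {g} → mem g gens ≡ true → φ g ∈ Equiv z
          z-gen {g} p = ∈Equiv z (φ g) λ c → cong proj₂ (fix c {zero} {g} (memC-++ʳ (zero , g) units (map (λ g → zero , g) gens) (gen-mem gens p)))

        -- Fixing the unit of every part makes the automorphism act by one map `z` in all parts;
        -- fixing the generators in part 0 makes `z` commute with them. `K` enters only as the
        -- subgroup they generate.
        base-rigid : ∀ K → (∀ P → (∀ {g} → mem g gens ≡ true → φ g ∈ P) → K ⊑ P) → Rigid K S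
        base-rigid K least σ = glue σ (z σ) (val σ) {K} (least (Equiv (z σ)) (z-gen σ))

≡ᵇ-refl : ∀ n → (n ≡ᵇ n) ≡ true
≡ᵇ-refl zero    = refl
≡ᵇ-refl (suc n) = ≡ᵇ-refl n

≡ᵇ-sound : ∀ m n → (m ≡ᵇ n) ≡ true → m ≡ n
≡ᵇ-sound zero    zero    _ = refl
≡ᵇ-sound (suc m) (suc n) p = cong suc (≡ᵇ-sound m n p)

Eℕ : BoolEq ℕ
Eℕ = record { eq = _≡ᵇ_ ; sound = λ {c} {d} → ≡ᵇ-sound c d ; rfl = ≡ᵇ-refl }

E× : ∀ {A B : Set} → BoolEq A → BoolEq B → BoolEq (A × B)
E× E F = record
  { eq = λ { (a , b) (c , d) → BoolEq.eq E a c ∧ BoolEq.eq F b d }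
  ; sound = λ { {a , b} {c , d} p → cong₂ _,_ (BoolEq.sound E (proj₁ (∧-split {BoolEq.eq E a c} p))) (BoolEq.sound F (proj₂ (∧-split {BoolEq.eq E a c} p))) }
  ; rfl = λ { (a , b) → cong₂ _∧_ (BoolEq.rfl E a) (BoolEq.rfl F b) } }

<ᵇ-sound : ∀ {m n} → (m <ᵇ n) ≡ true → m < n
<ᵇ-sound {m} {n} p = ℕₚ.<ᵇ⇒< m n (subst T (sym p) tt)

<ᵇ-true : ∀ {m n} → m < n → (m <ᵇ n) ≡ true
<ᵇ-true {m} {n} p with m <ᵇ n | ℕₚ.<⇒<ᵇ p
... | true | _ = refl

<ᵇ-false : ∀ {m n} → (m <ᵇ n) ≡ false → n ≤ m
<ᵇ-false {m} {n} p = ℕₚ.≮⇒≥ λ q → false≢true p (<ᵇ-true q)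

upto : ℕ → List ℕ
upto zero    = []
upto (suc n) = n ∷ upto n

mem-upto : ∀ {k} n → k < n → BoolEq.mem Eℕ k (upto n) ≡ true
mem-upto {k} (suc n) (s≤s k≤n) with ℕₚ.m≤n⇒m<n∨m≡n k≤n
... | inj₁ k<n  = ∨-inj₂ (k ≡ᵇ n) (mem-upto n k<n)
... | inj₂ refl = ∨-inj₁ _ (≡ᵇ-refl k)

all-upto : ∀ (f : ℕ → Bool) n → (∀ k → k < n → f k ≡ true) → allᵇ f (upto n) ≡ true
all-upto f zero    _ = refl
all-upto f (suc n) p = cong₂ _∧_ (p n ℕₚ.≤-refl) (all-upto f n λ k k<n → p k (ℕₚ.m≤n⇒m≤1+n k<n))

allᵇ-++ : ∀ {A : Set} (f : A → Bool) xs ys → allᵇ f xs ≡ true → allᵇ f ys ≡ true → allᵇ f (xs ++ ys) ≡ true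
allᵇ-++ f [] ys p q = q
allᵇ-++ f (x ∷ xs) ys p q = cong₂ _∧_ (proj₁ (∧-split p)) (allᵇ-++ f xs ys (proj₂ (∧-split {f x} p)) q)

allᵇ-map : ∀ {A B : Set} (f : B → Bool) (g : A → B) xs → allᵇ (f ∘ g) xs ≡ true → allᵇ f (map g xs) ≡ true
allᵇ-map f g [] p = refl
allᵇ-map f g (x ∷ xs) p = cong₂ _∧_ (proj₁ (∧-split p)) (allᵇ-map f g xs (proj₂ (∧-split {f (g x)} p)))

allᵇ-cong : ∀ {A : Set} (f g : A → Bool) xs → (∀ x → f x ≡ true → g x ≡ true) → allᵇ f xs ≡ true → allᵇ g xs ≡ true
allᵇ-cong f g [] h p = refl
allᵇ-cong f g (x ∷ xs) h p = cong₂ _∧_ (h x (proj₁ (∧-split p))) (allᵇ-cong f g xs h (proj₂ (∧-split {f x} p)))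

module LabelKinds (G : FinGroup) where
  open Grp G
  open Labels G

  -- In contrast to `Lab`, the range is closed under products and listed by `els`, so that
  -- quantifiers over the subgroup `image` can be evaluated.
  record CLab : Set₁ where
    field
      L        : Set
      E        : BoolEq L
      mul      : L → L → L
      unit     : L
      okL      : L → Bool
      φ        : L → El
      φ-unit   : φ unit ≡ e
      ok-unit  : okL unit ≡ true
      hom      : ∀ {u v} → okL u ≡ true → okL v ≡ true → φ (mul u v) ≡ φ u · φ v
      closed   : ∀ {u v} → okL u ≡ true → okL v ≡ true → okL (mul u v) ≡ true
      inj      : ∀ {u v} → okL u ≡ true → okL v ≡ true → φ u ≡ φ v → u ≡ v
      els      : List L
      els-ok   : allᵇ okL els ≡ true
      complete : ∀ {u} → okL u ≡ true → BoolEq.mem E u els ≡ true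

    toLab : Lab
    toLab = record
      { L = L ; E = E ; mul = mul ; unit = unit ; okL = okL ; φ = φ ; φ-unit = φ-unit ; ok-unit = ok-unit ; hom = hom
      ; mulinj = λ ov os ou p → inj ov (closed os ou) (trans p (sym (hom os ou))) }

    open BoolEq E using (sound; rfl; mem; all-mem)

    ∈els : ∀ us {y} → allᵇ okL us ≡ true → y ∈ᶠ map φ us ≡ true → ∃ λ u → (okL u ≡ true) × (y ≡ φ u)
    ∈els (u ∷ us) {y} o p with ∧-split {okL u} o | y Fₚ.≟ φ u
    ... | ou , _ | yes q = u , ou , q
    ... | _ , ous | no _ = ∈els us ous p

    els∋ : ∀ us {u} → mem u us ≡ true → φ u ∈ᶠ map φ us ≡ true
    els∋ (v ∷ us) {u} p with ∨-split {BoolEq.eq E u v} p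
    ... | inj₁ q = ∨-inj₁ _ (⌊⌋-true (φ u Fₚ.≟ φ v) (cong φ (sound q)))
    ... | inj₂ q = ∨-inj₂ ⌊ φ u Fₚ.≟ φ v ⌋ (els∋ us q)

    in-image : ∀ {y} → y ∈ᶠ map φ els ≡ true → ∃ λ u → (okL u ≡ true) × (y ≡ φ u)
    in-image = ∈els els els-ok

    to-image : ∀ {u} → okL u ≡ true → φ u ∈ᶠ map φ els ≡ true
    to-image o = els∋ els (complete o)

    private
      mem· : ∀ {y z} → y ∈ᶠ map φ els ≡ true → z ∈ᶠ map φ els ≡ true → (y · z) ∈ᶠ map φ els ≡ true
      mem· p q with in-image p | in-image q
      ... | u , ou , refl | v , ov , refl = subst (λ t → t ∈ᶠ map φ els ≡ true) (hom ou ov) (to-image (closed ou ov))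
      memE : e ∈ᶠ map φ els ≡ true
      memE = subst (λ t → t ∈ᶠ map φ els ≡ true) φ-unit (to-image ok-unit)
      mem^ : ∀ {y} k → y ∈ᶠ map φ els ≡ true → (y ^ k) ∈ᶠ map φ els ≡ true
      mem^ zero p = memE
      mem^ (suc k) p = mem· p (mem^ k p)

    image : Sub
    image = record
      { mem = λ y → y ∈ᶠ map φ els ; e∈ = memE ; ·∈ = mem·
      -- In a finite group the inverse is a power, so closure under products suffices.
      ; inv∈ = λ {y} p → case hasOrder y of λ { (n , o) → subst (λ t → t ∈ᶠ map φ els ≡ true) (sym (pr y n o)) (mem^ (n ∸ 1) p) } }
      where
      pr : ∀ y n → HasOrder y n → inv y ≡ y ^ (n ∸ 1)
      pr y (suc n) o = inv-uniq y _ (HasOrder.pow-n o)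

  pow-inj : ∀ {a n} → HasOrder a n → ∀ {i j} → i < j + n → j < i + n → a ^ i ≡ a ^ j → i ≡ j
  pow-inj {a} {n} o {i} {j} p q r with ℕₚ.<-cmp i j
  ... | tri≈ _ s _ = s
  ... | tri< i<j _ _ = ⊥-elim (HasOrder.least o (j ∸ i) (ℕₚ.m<n⇒0<n∸m i<j)
          (ℕₚ.+-cancelˡ-< i _ _ (subst (_< i + n) (sym (ℕₚ.m+[n∸m]≡n (ℕₚ.<⇒≤ i<j))) q)) (^-∸ a (ℕₚ.<⇒≤ i<j) r))
  ... | tri> _ _ j<i = ⊥-elim (HasOrder.least o (i ∸ j) (ℕₚ.m<n⇒0<n∸m j<i)
          (ℕₚ.+-cancelˡ-< j _ _ (subst (_< j + n) (sym (ℕₚ.m+[n∸m]≡n (ℕₚ.<⇒≤ j<i))) p)) (^-∸ a (ℕₚ.<⇒≤ j<i) (sym r)))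

  module _ {a : El} {n : ℕ} (o : HasOrder a n) where
    open HasOrder o

    addMod : ℕ → ℕ → ℕ
    addMod u v = if (u + v) <ᵇ n then u + v else u + v ∸ n

    addMod-pow : ∀ u v → a ^ addMod u v ≡ a ^ u · a ^ v
    addMod-pow u v with (u + v) <ᵇ n in eq
    ... | true = ^-+ a u v
    ... | false = trans (sym (idˡ _)) (trans (cong (_· a ^ (u + v ∸ n)) (sym pow-n)) (trans (sym (^-+ a n (u + v ∸ n))) (trans (cong (a ^_) (ℕₚ.m+[n∸m]≡n (<ᵇ-false {u + v} {n} eq))) (^-+ a u v))))

    addMod-< : ∀ {u v} → u < n → v < n → addMod u v < n
    addMod-< {u} {v} p q with (u + v) <ᵇ n in eq
    ... | true = <ᵇ-sound eq
    ... | false = ℕₚ.+-cancelˡ-< n _ _ (subst (_< n + n) (sym (ℕₚ.m+[n∸m]≡n (<ᵇ-false {u + v} {n} eq))) (ℕₚ.+-mono-< p q))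

    modLab : CLab
    modLab = record
      { L = ℕ ; E = Eℕ ; mul = addMod ; unit = 0 ; okL = _<ᵇ n ; φ = a ^_ ; φ-unit = refl ; ok-unit = <ᵇ-true pos
      ; hom = λ {u} {v} _ _ → addMod-pow u v
      ; closed = λ p q → <ᵇ-true (addMod-< (<ᵇ-sound p) (<ᵇ-sound q))
      ; inj = λ p q → ord-inj o (<ᵇ-sound p) (<ᵇ-sound q)
      ; els = upto n ; els-ok = all-upto (_<ᵇ n) n (λ _ → <ᵇ-true) ; complete = λ p → mem-upto n (<ᵇ-sound p) }

    -- Labels c - w … c + w stand for the exponents -w … w; they multiply faithfully when 3w < n.
    offLab : (w c : ℕ) → w + w ≤ c → w + (w + w) < n → Lab
    offLab w c 2w≤c 3w<n = record
      { L = ℕ ; E = Eℕ ; mul = λ s u → s + u ∸ c ; unit = c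
      ; okL = λ u → (c <ᵇ suc (u + w)) ∧ (u <ᵇ suc (c + w))
      ; φ = λ u → a ^ u / a ^ c ; φ-unit = invʳ _
      ; ok-unit = cong₂ _∧_ (<ᵇ-true (s≤s (ℕₚ.m≤m+n c w))) (<ᵇ-true (s≤s (ℕₚ.m≤m+n c w)))
      ; hom = λ {u} {v} p q → hom′ {u} {v} (big {u} {v} p q)
      -- With all three labels within `w` of `c`, the exponents `v` and `s + u ∸ c` differ by at
      -- most 3w < n, so equal powers force equal labels.
      ; mulinj = λ {v} {s} {u} ov os ou p → pow-inj o (lem₁ {v} {s} {u} ov os ou) (lem₂ {v} {s} {u} ov os ou)
          (·-cancelʳ (inv (a ^ c)) (trans p (sym (hom′ {s} {u} (big {s} {u} os ou))))) }
      where
      lo : ∀ {u} → (c <ᵇ suc (u + w)) ∧ (u <ᵇ suc (c + w)) ≡ true → c ≤ u + w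
      lo {u} p = ℕₚ.≤-pred (<ᵇ-sound (proj₁ (∧-split {c <ᵇ suc (u + w)} p)))
      hi : ∀ {u} → (c <ᵇ suc (u + w)) ∧ (u <ᵇ suc (c + w)) ≡ true → u ≤ c + w
      hi {u} p = ℕₚ.≤-pred (<ᵇ-sound (proj₂ (∧-split {c <ᵇ suc (u + w)} p)))
      big : ∀ {s u} → (c <ᵇ suc (s + w)) ∧ (s <ᵇ suc (c + w)) ≡ true → (c <ᵇ suc (u + w)) ∧ (u <ᵇ suc (c + w)) ≡ true → c ≤ s + u
      big {s} {u} p q = ℕₚ.+-cancelʳ-≤ (w + w) _ _ (ℕₚ.≤-trans (ℕₚ.+-monoʳ-≤ c 2w≤c)
        (ℕₚ.≤-trans (ℕₚ.+-mono-≤ (lo {s} p) (lo {u} q)) (ℕₚ.≤-reflexive (eq s u w))))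
        where
        eq : ∀ s u w → (s + w) + (u + w) ≡ s + u + (w + w)
        eq = solve-∀
      hom′ : ∀ {s u} → c ≤ s + u → a ^ (s + u ∸ c) / a ^ c ≡ (a ^ s / a ^ c) · (a ^ u / a ^ c)
      hom′ {s} {u} p = ·-cancelˡ (a ^ c) (begin
        a ^ c · (a ^ (s + u ∸ c) / a ^ c) ≡⟨ assoc _ _ _ ⟨
        (a ^ c · a ^ (s + u ∸ c)) / a ^ c ≡⟨ cong (_/ a ^ c) (trans (sym (^-+ a c _)) (trans (cong (a ^_) (ℕₚ.m+[n∸m]≡n p)) (^-+ a s u))) ⟩
        (a ^ s · a ^ u) / a ^ c ≡⟨ grp (a ^ s ∷ a ^ u ∷ a ^ c ∷ []) (v0 ⊙ v1 ⊙ v2 ⁻) (v0 ⊙ v2 ⊙ v2 ⁻ ⊙ (v1 ⊙ v2 ⁻)) refl ⟩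
        ((a ^ s · a ^ c) / a ^ c) · (a ^ u / a ^ c) ≡⟨ cong (λ t → (t / a ^ c) · (a ^ u / a ^ c)) (^-comm a s c) ⟩
        ((a ^ c · a ^ s) / a ^ c) · (a ^ u / a ^ c) ≡⟨ grp (a ^ s ∷ a ^ u ∷ a ^ c ∷ []) (v2 ⊙ v0 ⊙ v2 ⁻ ⊙ (v1 ⊙ v2 ⁻)) (v2 ⊙ (v0 ⊙ v2 ⁻ ⊙ (v1 ⊙ v2 ⁻))) refl ⟩
        a ^ c · ((a ^ s / a ^ c) · (a ^ u / a ^ c)) ∎)
        where open ≡-Reasoning
      lem₁ : ∀ {v s u} → (c <ᵇ suc (v + w)) ∧ (v <ᵇ suc (c + w)) ≡ true → (c <ᵇ suc (s + w)) ∧ (s <ᵇ suc (c + w)) ≡ true →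
             (c <ᵇ suc (u + w)) ∧ (u <ᵇ suc (c + w)) ≡ true → v < (s + u ∸ c) + n
      lem₁ {v} {s} {u} ov os ou = ℕₚ.≤-<-trans {j = (s + u ∸ c) + (w + (w + w))} (ℕₚ.+-cancelˡ-≤ c _ _ (begin
        c + v                                ≤⟨ ℕₚ.+-monoʳ-≤ c (hi {v} ov) ⟩
        c + (c + w)                          ≤⟨ ℕₚ.+-mono-≤ (lo {s} os) (ℕₚ.+-monoˡ-≤ w (lo {u} ou)) ⟩
        (s + w) + ((u + w) + w) ≡⟨ eq s u w ⟩
        (s + u) + (w + (w + w)) ≡⟨ cong (_+ (w + (w + w))) (sym (ℕₚ.m+[n∸m]≡n (big {s} {u} os ou))) ⟩
        (c + (s + u ∸ c)) + (w + (w + w)) ≡⟨ ℕₚ.+-assoc c _ _ ⟩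
        c + ((s + u ∸ c) + (w + (w + w))) ∎)) (ℕₚ.+-monoʳ-< (s + u ∸ c) 3w<n)
        where
        open ℕₚ.≤-Reasoning
        eq : ∀ s u w → (s + w) + ((u + w) + w) ≡ (s + u) + (w + (w + w))
        eq = solve-∀
      lem₂ : ∀ {v s u} → (c <ᵇ suc (v + w)) ∧ (v <ᵇ suc (c + w)) ≡ true → (c <ᵇ suc (s + w)) ∧ (s <ᵇ suc (c + w)) ≡ true →
             (c <ᵇ suc (u + w)) ∧ (u <ᵇ suc (c + w)) ≡ true → s + u ∸ c < v + n
      lem₂ {v} {s} {u} ov os ou = ℕₚ.≤-<-trans {j = v + (w + (w + w))} (ℕₚ.+-cancelˡ-≤ c _ _ (begin
        c + (s + u ∸ c) ≡⟨ ℕₚ.m+[n∸m]≡n (big {s} {u} os ou) ⟩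
        s + u                                ≤⟨ ℕₚ.+-mono-≤ (hi {s} os) (ℕₚ.≤-trans (hi {u} ou) (ℕₚ.+-monoˡ-≤ w (lo {v} ov))) ⟩
        (c + w) + ((v + w) + w) ≡⟨ eq c v w ⟩
        c + (v + (w + (w + w))) ∎)) (ℕₚ.+-monoʳ-< v 3w<n)
        where
        open ℕₚ.≤-Reasoning
        eq : ∀ c v w → (c + w) + ((v + w) + w) ≡ c + (v + (w + (w + w)))
        eq = solve-∀

  iter : {A : Set} → (A → A) → ℕ → A → A
  iter f zero    x = x
  iter f (suc k) x = f (iter f k x)

  -- The extension of a subgroup by an element x acting on it as θ, with xʳ = t.
  module _ (Λ : CLab) (H : Sub) (φ∈ : ∀ {u} → CLab.okL Λ u ≡ true → CLab.φ Λ u ∈ H)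
           (x : El) (θ : CLab.L Λ → CLab.L Λ) (r : ℕ) (t : CLab.L Λ) (r>0 : 1 ≤ r) (okt : CLab.okL Λ t ≡ true)
           (okθ : ∀ {u} → CLab.okL Λ u ≡ true → CLab.okL Λ (θ u) ≡ true)
           (act : ∀ {u} → CLab.okL Λ u ≡ true → x · CLab.φ Λ u ≡ CLab.φ Λ (θ u) · x)
           (xr : x ^ r ≡ CLab.φ Λ t) (out : ∀ k → 1 ≤ k → k < r → x ^ k ∉ H) where
    open CLab Λ

    private
      okI : ∀ k {u} → okL u ≡ true → okL (iter θ k u) ≡ true
      okI zero o = o
      okI (suc k) o = okθ (okI k o)

      actI : ∀ k {u} → okL u ≡ true → x ^ k · φ u ≡ φ (iter θ k u) · x ^ k
      actI zero o = trans (idˡ _) (sym (idʳ _))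
      actI (suc k) {u} o = begin
        (x · x ^ k) · φ u ≡⟨ assoc _ _ _ ⟩
        x · (x ^ k · φ u) ≡⟨ cong (x ·_) (actI k o) ⟩
        x · (φ (iter θ k u) · x ^ k) ≡⟨ assoc _ _ _ ⟨
        (x · φ (iter θ k u)) · x ^ k ≡⟨ cong (_· x ^ k) (act (okI k o)) ⟩
        (φ (θ (iter θ k u)) · x) · x ^ k ≡⟨ assoc _ _ _ ⟩
        φ (θ (iter θ k u)) · (x · x ^ k) ∎
        where open ≡-Reasoning

      mulX : L × ℕ → L × ℕ → L × ℕ
      mulX (u , v) (w , z) = if (v + z) <ᵇ r then (mul u (iter θ v w) , v + z) else (mul (mul u (iter θ v w)) t , v + z ∸ r)

      φX : L × ℕ → El
      φX (u , v) = φ u · x ^ v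

      okX : L × ℕ → Bool
      okX (u , v) = okL u ∧ (v <ᵇ r)

      ok₁ : ∀ {u v} → okX (u , v) ≡ true → okL u ≡ true
      ok₁ {u} {v} p = proj₁ (∧-split {okL u} p)
      ok₂ : ∀ {u v} → okX (u , v) ≡ true → v < r
      ok₂ {u} {v} p = <ᵇ-sound (proj₂ (∧-split {okL u} p))

      homX : ∀ {p q} → okX p ≡ true → okX q ≡ true → φX (mulX p q) ≡ φX p · φX q
      homX {u , v} {w , z} op oq = trans (go ((v + z) <ᵇ r) refl) (sym (begin
        (φ u · x ^ v) · (φ w · x ^ z) ≡⟨ grp (φ u ∷ x ^ v ∷ φ w ∷ x ^ z ∷ []) (v0 ⊙ v1 ⊙ (v2 ⊙ v3)) (v0 ⊙ (v1 ⊙ v2) ⊙ v3) refl ⟩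
        (φ u · (x ^ v · φ w)) · x ^ z ≡⟨ cong (λ s → (φ u · s) · x ^ z) (actI v ow) ⟩
        (φ u · (φ w′ · x ^ v)) · x ^ z ≡⟨ grp (φ u ∷ φ w′ ∷ x ^ v ∷ x ^ z ∷ []) (v0 ⊙ (v1 ⊙ v2) ⊙ v3) (v0 ⊙ v1 ⊙ (v2 ⊙ v3)) refl ⟩
        (φ u · φ w′) · (x ^ v · x ^ z) ≡⟨ cong₂ _·_ (sym (hom ou (okI v ow))) (sym (^-+ x v z)) ⟩
        φ (mul u w′) · x ^ (v + z) ∎))
        where
        open ≡-Reasoning
        ou = ok₁ {u} {v} op
        ow = ok₁ {w} {z} oq
        w′ = iter θ v w
        go : ∀ b → ((v + z) <ᵇ r) ≡ b → φX (if b then (mul u w′ , v + z) else (mul (mul u w′) t , v + z ∸ r)) ≡ φ (mul u w′) · x ^ (v + z)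
        go true _ = refl
        go false eq = trans (cong (_· x ^ (v + z ∸ r)) (hom (closed ou (okI v ow)) okt)) (trans (assoc _ _ _) (cong (φ (mul u w′) ·_)
          (trans (cong (_· x ^ (v + z ∸ r)) (sym xr)) (trans (sym (^-+ x r (v + z ∸ r))) (cong (x ^_) (ℕₚ.m+[n∸m]≡n (<ᵇ-false {v + z} {r} eq)))))))

      closedX : ∀ {p q} → okX p ≡ true → okX q ≡ true → okX (mulX p q) ≡ true
      closedX {u , v} {w , z} op oq = go ((v + z) <ᵇ r) refl
        where
        ou = ok₁ {u} {v} op
        oc = closed ou (okI v (ok₁ {w} {z} oq))
        go : ∀ b → ((v + z) <ᵇ r) ≡ b → okX (if b then (mul u (iter θ v w) , v + z) else (mul (mul u (iter θ v w)) t , v + z ∸ r)) ≡ true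
        go true eq = cong₂ _∧_ oc eq
        go false eq = cong₂ _∧_ (closed oc okt) (<ᵇ-true (ℕₚ.+-cancelˡ-< r _ _ (subst (_< r + r) (sym (ℕₚ.m+[n∸m]≡n (<ᵇ-false {v + z} {r} eq)))
          (ℕₚ.+-mono-< (ok₂ {u} {v} op) (ok₂ {w} {z} oq)))))

      -- Otherwise the power of `x` with exponent `v′ ∸ v`, positive and below `r`, would lie in
      -- `H`.
      injX′ : ∀ {u v u′ v′} → okL u ≡ true → okL u′ ≡ true → v′ < r → v < v′ → φ u · x ^ v ≡ φ u′ · x ^ v′ → ⊥
      injX′ {u} {v} {u′} {v′} ou ou′ lt v<v′ p = false≢true (out (v′ ∸ v) (ℕₚ.m<n⇒0<n∸m v<v′) (ℕₚ.≤-<-trans (ℕₚ.m∸n≤m v′ v) lt))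
        (subst (_∈ H) (trans (cong (inv (φ u′) ·_) q) (grp (φ u′ ∷ x ^ (v′ ∸ v) ∷ []) (v0 ⁻ ⊙ (v0 ⊙ v1)) v1 refl)) (·∈ H (inv∈ H (φ∈ ou′)) (φ∈ ou)))
        where
        q : φ u ≡ φ u′ · x ^ (v′ ∸ v)
        q = ·-cancelʳ (x ^ v) (trans p (trans (cong (λ s → φ u′ · x ^ s) (sym (ℕₚ.m∸n+n≡m (ℕₚ.<⇒≤ v<v′))))
              (trans (cong (φ u′ ·_) (^-+ x (v′ ∸ v) v)) (sym (assoc _ _ _)))))

      injX : ∀ {p q} → okX p ≡ true → okX q ≡ true → φX p ≡ φX q → p ≡ q
      injX {u , v} {u′ , v′} op oq r with ℕₚ.<-cmp v v′
      ... | tri< l _ _ = ⊥-elim (injX′ (ok₁ {u} {v} op) (ok₁ {u′} {v′} oq) (ok₂ {u′} {v′} oq) l r)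
      ... | tri> _ _ l = ⊥-elim (injX′ (ok₁ {u′} {v′} oq) (ok₁ {u} {v} op) (ok₂ {u} {v} op) l (sym r))
      ... | tri≈ _ refl _ = cong (_, v) (inj (ok₁ {u} {v} op) (ok₁ {u′} {v} oq) (·-cancelʳ (x ^ v) r))

      elsX : ℕ → List (L × ℕ)
      elsX zero    = []
      elsX (suc k) = map (_, k) els ++ elsX k

      elsX-ok : ∀ k → k ≤ r → allᵇ okX (elsX k) ≡ true
      elsX-ok zero _ = refl
      elsX-ok (suc k) k<r = allᵇ-++ okX (map (_, k) els) _
        (allᵇ-map okX (_, k) els (allᵇ-cong okL (λ u → okX (u , k)) els (λ u p → cong₂ _∧_ p (<ᵇ-true k<r)) els-ok))
        (elsX-ok k (ℕₚ.<⇒≤ k<r))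

      EX : BoolEq (L × ℕ)
      EX = E× E Eℕ

      memX : ∀ {u} k us → BoolEq.mem E u us ≡ true → BoolEq.mem EX (u , k) (map (_, k) us) ≡ true
      memX {u} k (v ∷ us) p with ∨-split {BoolEq.eq E u v} p
      ... | inj₁ q = ∨-inj₁ _ (cong₂ _∧_ q (≡ᵇ-refl k))
      ... | inj₂ q = ∨-inj₂ (BoolEq.eq EX (u , k) (v , k)) (memX k us q)

      completeX : ∀ {u v} k → okL u ≡ true → v < k → BoolEq.mem EX (u , v) (elsX k) ≡ true
      completeX {u} {v} (suc k) o (s≤s v≤k) with ℕₚ.m≤n⇒m<n∨m≡n v≤k
      ... | inj₁ v<k  = BoolEq.mem-++ʳ EX (u , v) (map (_, k) els) (elsX k) (completeX k o v<k)
      ... | inj₂ refl = BoolEq.mem-++ˡ EX (u , v) (map (_, k) els) (elsX k) (memX k els (complete o))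

    extLab : CLab
    extLab = record
      { L = L × ℕ ; E = EX ; mul = mulX ; unit = unit , 0 ; okL = okX ; φ = φX
      ; φ-unit = trans (idʳ _) φ-unit ; ok-unit = cong₂ _∧_ ok-unit (<ᵇ-true r>0)
      ; hom = λ {p} {q} → homX {p} {q} ; closed = λ {p} {q} → closedX {p} {q} ; inj = λ {p} {q} → injX {p} {q}
      ; els = elsX r ; els-ok = elsX-ok r ℕₚ.≤-refl
      ; complete = λ { {u , v} p → completeX r (ok₁ {u} {v} p) (ok₂ {u} {v} p) } }

-- Tables of connection sets and of search orders

pattern [_] a = a ∷ []
pattern [_&_] a b = a ∷ b ∷ []
pattern [_&_&_] a b c = a ∷ b ∷ c ∷ []
pattern [_&_&_&_] a b c d = a ∷ b ∷ c ∷ d ∷ []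

toFin : ∀ {k} → ℕ → Fin (suc k)
toFin {k}     zero    = zero
toFin {zero}  (suc a) = zero
toFin {suc k} (suc a) = suc (toFin a)

decimals : ℕ → ℕ → List ℕ → List ℕ
decimals zero    c ds = ds
decimals (suc f) c ds = if c <ᵇ 10 then ds else decimals f (c div 10) (c % 10 ∷ ds)

-- The code 1 a b i l₁ l₂ … (in decimal) stands for the entry (10 a + b , i , label l₁ l₂ …).
entries : {A : Set} {m : ℕ} → (List ℕ → A) → List ℕ → List (ℕ × (Fin (suc m) × A))
entries {A} {m} label = map λ c → entry (decimals 9 c [])
  where
  entry : List ℕ → ℕ × (Fin (suc m) × A)
  entry (a ∷ b ∷ i ∷ ls) = 10 * a + b , toFin i , label ls
  entry ls               = 0 , zero , label ls

label₁ : List ℕ → ℕ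
label₁ (a ∷ _) = a
label₁ _       = 0

label₂ : List ℕ → ℕ × ℕ
label₂ (a ∷ ls) = a , label₁ ls
label₂ _        = 0 , 0

label₃ : List ℕ → (ℕ × ℕ) × ℕ
label₃ (a ∷ b ∷ ls) = (a , b) , label₁ ls
label₃ _            = (0 , 0) , 0

label₄ : List ℕ → ((ℕ × ℕ) × ℕ) × ℕ
label₄ (a ∷ b ∷ c ∷ ls) = ((a , b) , c) , label₁ ls
label₄ _                = ((0 , 0) , 0) , 0

-- The digits n, i, j in the names from `conn-K410` to `conn-K760` stand for the relations aⁿ = 1, x
-- a = aⁱ x, x² = aʲ, and the label (u , v) stands for aᵘ xᵛ. Each `patch` is the order in which the
-- search places vertices.
conn-K410 : List (List (List (ℕ × ℕ)))
conn-K410 =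
  ([] ∷ [ (2 , 0) & (0 , 1) & (3 , 1) ] ∷ [ (0 , 0) & (0 , 1) & (3 , 1) ] ∷ []) ∷
  ([ (2 , 0) & (0 , 1) & (1 , 1) ] ∷ [] ∷ [ (1 , 0) & (3 , 0) & (0 , 1) ] ∷ []) ∷
  ([ (0 , 0) & (0 , 1) & (1 , 1) ] ∷ [ (3 , 0) & (1 , 0) & (0 , 1) ] ∷ [] ∷ []) ∷ []

patch-K410 : List (ℕ × (Fin 3 × (ℕ × ℕ)))
patch-K410 = entries label₂ (
  100200 ∷ 101101 ∷ 102231 ∷ 102130 ∷ 102010 ∷ 104001 ∷ 106201 ∷ 101100 ∷ [])

conn-K411 : List (List (List (ℕ × ℕ)))
conn-K411 =
  ([] ∷ [ (0 , 0) & (3 , 0) & (0 , 1) ] ∷ [ (0 , 0) & (2 , 0) & (2 , 1) ] ∷ []) ∷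
  ([ (0 , 0) & (1 , 0) & (3 , 1) ] ∷ [] ∷ [ (0 , 0) & (0 , 1) & (3 , 1) ] ∷ []) ∷
  ([ (0 , 0) & (2 , 0) & (1 , 1) ] ∷ [ (0 , 0) & (3 , 1) & (0 , 1) ] ∷ [] ∷ []) ∷ []

patch-K411 : List (ℕ × (Fin 3 × (ℕ × ℕ)))
patch-K411 = entries label₂ (
  100100 ∷ 101200 ∷ 102101 ∷ 102201 ∷ 102020 ∷ 101110 ∷ 103001 ∷ 106010 ∷ [])

conn-K430 : List (List (List (ℕ × ℕ)))
conn-K430 =
  ([] ∷ [ (1 , 0) & (3 , 0) & (2 , 1) ] ∷ [ (0 , 0) & (1 , 0) & (0 , 1) ] ∷ []) ∷
  ([ (3 , 0) & (1 , 0) & (2 , 1) ] ∷ [] ∷ [ (0 , 1) & (2 , 1) & (3 , 1) ] ∷ []) ∷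
  ([ (0 , 0) & (3 , 0) & (0 , 1) ] ∷ [ (0 , 1) & (2 , 1) & (3 , 1) ] ∷ [] ∷ []) ∷ []

patch-K430 : List (ℕ × (Fin 3 × (ℕ × ℕ)))
patch-K430 = entries label₂ (
  100200 ∷ 101121 ∷ 102210 ∷ 101031 ∷ 104130 ∷ 105201 ∷ 105001 ∷ 106131 ∷ 102120 ∷ 108030 ∷ 105211 ∷ 105100 ∷ 109010 ∷ [])

conn-K432 : List (List (List (ℕ × ℕ)))
conn-K432 =
  ([] ∷ [ (0 , 0) & (1 , 0) & (0 , 1) ] ∷ [ (0 , 0) & (1 , 1) & (3 , 1) ] ∷ []) ∷
  ([ (0 , 0) & (3 , 0) & (2 , 1) ] ∷ [] ∷ [ (0 , 0) & (1 , 0) & (1 , 1) ] ∷ []) ∷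
  ([ (0 , 0) & (3 , 1) & (1 , 1) ] ∷ [ (0 , 0) & (3 , 0) & (3 , 1) ] ∷ [] ∷ []) ∷ []

patch-K432 : List (ℕ × (Fin 3 × (ℕ × ℕ)))
patch-K432 = entries label₂ (
  100100 ∷ 101200 ∷ 102211 ∷ 103101 ∷ 102011 ∷ 105110 ∷ 105210 ∷ 101010 ∷ 104201 ∷ 105001 ∷ [])

conn-K510 : List (List (List (ℕ × ℕ)))
conn-K510 =
  ([] ∷ [ (1 , 0) & (0 , 1) & (2 , 1) ] ∷ [ (0 , 0) & (1 , 0) & (0 , 1) ] ∷ []) ∷
  ([ (4 , 0) & (0 , 1) & (3 , 1) ] ∷ [] ∷ [ (1 , 0) & (3 , 1) & (4 , 1) ] ∷ []) ∷
  ([ (0 , 0) & (4 , 0) & (0 , 1) ] ∷ [ (4 , 0) & (2 , 1) & (1 , 1) ] ∷ [] ∷ []) ∷ []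

patch-K510 : List (ℕ × (Fin 3 × (ℕ × ℕ)))
patch-K510 = entries label₂ (
  100200 ∷ 101121 ∷ 102210 ∷ 101011 ∷ 104110 ∷ 105201 ∷ 105001 ∷ 104100 ∷ 102120 ∷ 105211 ∷ 107010 ∷ [])

conn-K540 : List (List (List (ℕ × ℕ)))
conn-K540 =
  ([] ∷ [ (0 , 0) & (4 , 0) & (2 , 1) ] ∷ [ (3 , 0) & (4 , 0) & (4 , 1) ] ∷ []) ∷
  ([ (0 , 0) & (1 , 0) & (2 , 1) ] ∷ [] ∷ [ (2 , 1) & (3 , 1) & (4 , 1) ] ∷ []) ∷
  ([ (2 , 0) & (1 , 0) & (4 , 1) ] ∷ [ (2 , 1) & (3 , 1) & (4 , 1) ] ∷ [] ∷ []) ∷ []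

patch-K540 : List (ℕ × (Fin 3 × (ℕ × ℕ)))
patch-K540 = entries label₂ (
  100100 ∷ 101241 ∷ 102140 ∷ 102231 ∷ 103010 ∷ 101110 ∷ 106240 ∷ 105001 ∷ 101101 ∷ 107011 ∷ 110230 ∷ 106111 ∷ 105141 ∷ 108200 ∷ [])

conn-K610 : List (List (List (ℕ × ℕ)))
conn-K610 =
  ([] ∷ [ (0 , 0) & (3 , 0) & (0 , 1) ] ∷ [ (5 , 0) & (4 , 1) & (5 , 1) ] ∷ []) ∷
  ([ (0 , 0) & (3 , 0) & (0 , 1) ] ∷ [] ∷ [ (3 , 0) & (4 , 0) & (5 , 1) ] ∷ []) ∷
  ([ (1 , 0) & (2 , 1) & (1 , 1) ] ∷ [ (3 , 0) & (2 , 0) & (1 , 1) ] ∷ [] ∷ []) ∷ []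

patch-K610 : List (ℕ × (Fin 3 × (ℕ × ℕ)))
patch-K610 = entries label₂ (
  100100 ∷ 101251 ∷ 101001 ∷ 102240 ∷ 104250 ∷ 105101 ∷ 102110 ∷ 105010 ∷ 101201 ∷ 104011 ∷ 108111 ∷ 103200 ∷ [])

conn-K611 : List (List (List (ℕ × ℕ)))
conn-K611 =
  ([] ∷ [ (0 , 0) & (3 , 0) & (2 , 1) ] ∷ [ (4 , 0) & (0 , 1) & (1 , 1) ] ∷ []) ∷
  ([ (0 , 0) & (3 , 0) & (3 , 1) ] ∷ [] ∷ [ (0 , 0) & (4 , 0) & (5 , 1) ] ∷ []) ∷
  ([ (2 , 0) & (5 , 1) & (4 , 1) ] ∷ [ (0 , 0) & (2 , 0) & (0 , 1) ] ∷ [] ∷ []) ∷ []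

patch-K611 : List (ℕ × (Fin 3 × (ℕ × ℕ)))
patch-K611 = entries label₂ (
  100100 ∷ 101240 ∷ 101031 ∷ 103211 ∷ 101131 ∷ 101010 ∷ 104140 ∷ 104250 ∷ 102110 ∷ 102040 ∷ 103220 ∷ 107120 ∷ 111200 ∷ 110101 ∷ 109001 ∷ [])

conn-K650 : List (List (List (ℕ × ℕ)))
conn-K650 =
  ([] ∷ [ (0 , 0) & (0 , 1) & (4 , 1) ] ∷ [ (5 , 0) & (3 , 1) & (4 , 1) ] ∷ []) ∷
  ([ (0 , 0) & (0 , 1) & (4 , 1) ] ∷ [] ∷ [ (0 , 1) & (3 , 1) & (4 , 1) ] ∷ []) ∷
  ([ (1 , 0) & (3 , 1) & (4 , 1) ] ∷ [ (0 , 1) & (3 , 1) & (4 , 1) ] ∷ [] ∷ []) ∷ []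

patch-K650 : List (ℕ × (Fin 3 × (ℕ × ℕ)))
patch-K650 = entries label₂ (
  100100 ∷ 101231 ∷ 101041 ∷ 103250 ∷ 104141 ∷ 102200 ∷ 104010 ∷ 105110 ∷ 108101 ∷ 108001 ∷ [])

conn-K653 : List (List (List (ℕ × ℕ)))
conn-K653 =
  ([] ∷ [ (0 , 0) & (1 , 1) & (2 , 1) ] ∷ [ (5 , 0) & (4 , 1) & (5 , 1) ] ∷ []) ∷
  ([ (0 , 0) & (4 , 1) & (5 , 1) ] ∷ [] ∷ [ (4 , 0) & (5 , 0) & (3 , 1) ] ∷ []) ∷
  ([ (1 , 0) & (1 , 1) & (2 , 1) ] ∷ [ (2 , 0) & (1 , 0) & (0 , 1) ] ∷ [] ∷ []) ∷ []

patch-K653 : List (ℕ × (Fin 3 × (ℕ × ℕ)))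
patch-K653 = entries label₂ (
  100100 ∷ 101250 ∷ 102111 ∷ 103251 ∷ 101010 ∷ 103110 ∷ 101200 ∷ 103101 ∷ 108241 ∷ 105001 ∷ [])

conn-K710 : List (List (List (ℕ × ℕ)))
conn-K710 =
  ([] ∷ [ (4 , 0) & (6 , 0) & (0 , 1) ] ∷ [ (0 , 0) & (2 , 0) & (1 , 1) ] ∷ []) ∷
  ([ (3 , 0) & (1 , 0) & (0 , 1) ] ∷ [] ∷ [ (1 , 0) & (2 , 0) & (3 , 1) ] ∷ []) ∷
  ([ (0 , 0) & (5 , 0) & (6 , 1) ] ∷ [ (6 , 0) & (5 , 0) & (4 , 1) ] ∷ [] ∷ []) ∷ []

patch-K710 : List (ℕ × (Fin 3 × (ℕ × ℕ)))
patch-K710 = entries label₂ (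
  100200 ∷ 101160 ∷ 101061 ∷ 103211 ∷ 103150 ∷ 105101 ∷ 102011 ∷ 107220 ∷ 101110 ∷ 107020 ∷ 104230 ∷ 106010 ∷ 110221 ∷ 105100 ∷ 112210 ∷ 102001 ∷ [])

conn-K760 : List (List (List (ℕ × ℕ)))
conn-K760 =
  ([] ∷ [ (0 , 0) & (5 , 0) & (0 , 1) ] ∷ [ (0 , 0) & (5 , 0) & (6 , 0) ] ∷ []) ∷
  ([ (0 , 0) & (2 , 0) & (0 , 1) ] ∷ [] ∷ [ (0 , 0) & (4 , 1) & (5 , 1) ] ∷ []) ∷
  ([ (0 , 0) & (2 , 0) & (1 , 0) ] ∷ [ (0 , 0) & (4 , 1) & (5 , 1) ] ∷ [] ∷ []) ∷ []

patch-K760 : List (ℕ × (Fin 3 × (ℕ × ℕ)))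
patch-K760 = entries label₂ (
  100100 ∷ 101200 ∷ 101020 ∷ 101151 ∷ 104260 ∷ 103010 ∷ 103210 ∷ 101110 ∷ 101030 ∷ 107141 ∷ 109241 ∷ 103061 ∷ 111251 ∷ 108160 ∷ 113001 ∷ [])

conn-C33 : List (List (List (ℕ × ℕ)))
conn-C33 =
  ([] ∷ [ (0 , 0) & (1 , 1) & (1 , 2) ] ∷ [ (0 , 0) & (2 , 0) & (2 , 2) ] ∷ []) ∷
  ([ (0 , 0) & (2 , 2) & (2 , 1) ] ∷ [] ∷ [ (0 , 0) & (1 , 0) & (2 , 1) ] ∷ []) ∷
  ([ (0 , 0) & (1 , 0) & (1 , 1) ] ∷ [ (0 , 0) & (2 , 0) & (1 , 2) ] ∷ [] ∷ []) ∷ []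

patch-C33 : List (ℕ × (Fin 3 × (ℕ × ℕ)))
patch-C33 = entries label₂ (
  100100 ∷ 101200 ∷ 102112 ∷ 103222 ∷ 103022 ∷ 101101 ∷ 103001 ∷ 107220 ∷ 101110 ∷ 103201 ∷ 108010 ∷ [])

conn-A4 : List (List (List ((ℕ × ℕ) × ℕ)))
conn-A4 =
  ([] ∷ [ ((0 , 0) , 0) & ((1 , 0) , 0) & ((1 , 1) , 1) ] ∷ [ ((0 , 0) , 1) & ((0 , 0) , 2) & ((1 , 0) , 2) ] ∷ []) ∷
  ([ ((0 , 0) , 0) & ((1 , 0) , 0) & ((0 , 1) , 2) ] ∷ [] ∷ [ ((0 , 0) , 0) & ((0 , 0) , 1) & ((0 , 1) , 2) ] ∷ []) ∷
  ([ ((0 , 0) , 2) & ((0 , 0) , 1) & ((0 , 1) , 1) ] ∷ [ ((0 , 0) , 0) & ((0 , 0) , 2) & ((1 , 1) , 1) ] ∷ [] ∷ []) ∷ []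

patch-A4 : List (ℕ × (Fin 3 × ((ℕ × ℕ) × ℕ)))
patch-A4 = entries label₃ (
  1001000 ∷ 1012001 ∷ 1010012 ∷ 1011112 ∷ 1032000 ∷ 1010001 ∷ 1022100 ∷ 1071100 ∷ 1070100 ∷ [])

conn-C2222 : List (List (List (((ℕ × ℕ) × ℕ) × ℕ)))
conn-C2222 =
  ([] ∷ [ (((0 , 0) , 1) , 0) & (((1 , 0) , 0) , 1) & (((1 , 1) , 0) , 1) & (((0 , 1) , 1) , 1) ] ∷ [ (((0 , 0) , 0) , 0) & (((1 , 0) , 0) , 0) & (((0 , 0) , 1) , 0) & (((1 , 0) , 1) , 1) ] ∷ []) ∷
  ([ (((0 , 0) , 1) , 0) & (((1 , 0) , 0) , 1) & (((1 , 1) , 0) , 1) & (((0 , 1) , 1) , 1) ] ∷ [] ∷ [ (((1 , 0) , 0) , 0) & (((1 , 1) , 0) , 0) & (((0 , 0) , 1) , 0) & (((1 , 1) , 1) , 0) ] ∷ []) ∷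
  ([ (((0 , 0) , 0) , 0) & (((1 , 0) , 0) , 0) & (((0 , 0) , 1) , 0) & (((1 , 0) , 1) , 1) ] ∷ [ (((1 , 0) , 0) , 0) & (((1 , 1) , 0) , 0) & (((0 , 0) , 1) , 0) & (((1 , 1) , 1) , 0) ] ∷ [] ∷ []) ∷ []

patch-C2222 : List (ℕ × (Fin 3 × (((ℕ × ℕ) × ℕ) × ℕ)))
patch-C2222 = entries label₄ (
  10020000 ∷ 10110010 ∷ 10101011 ∷ 10211100 ∷ 10420010 ∷ 10400010 ∷ 10110000 ∷ 10521110 ∷ 10600101 ∷ 10811000 ∷ 10821010 ∷ 10601010 ∷ 11221000 ∷
  11010110 ∷ 11000001 ∷ 11401000 ∷ 11220100 ∷ 11211010 ∷ 11601111 ∷ 11621001 ∷ 12010111 ∷ 11701110 ∷ 12021100 ∷ 10900100 ∷ [])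

conn-C6 : List (List (List (ℕ)))
conn-C6 =
  ([] ∷ [ 1 & 2 ] ∷ [ 3 & 5 ] ∷ []) ∷
  ([ 5 & 4 ] ∷ [] ∷ [ 2 & 5 ] ∷ []) ∷
  ([ 3 & 1 ] ∷ [ 4 & 1 ] ∷ [] ∷ []) ∷ []

patch-C6 : List (ℕ × (Fin 3 × (ℕ)))
patch-C6 = entries label₁ (
  10011 ∷ 10123 ∷ 10120 ∷ 10114 ∷ 10103 ∷ 10201 ∷ 10612 ∷ 10124 ∷ 10705 ∷ 10422 ∷ 10110 ∷ [])

conn-C7 : List (List (List (ℕ)))
conn-C7 =
  ([] ∷ [ 0 & 4 & 6 ] ∷ [ 0 & 3 & 4 ] ∷ []) ∷
  ([ 0 & 3 & 1 ] ∷ [] ∷ [ 1 & 2 & 4 ] ∷ []) ∷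
  ([ 0 & 4 & 3 ] ∷ [ 6 & 5 & 3 ] ∷ [] ∷ []) ∷ []

patch-C7 : List (ℕ × (Fin 3 × (ℕ)))
patch-C7 = entries label₁ (
  10010 ∷ 10124 ∷ 10101 ∷ 10221 ∷ 10204 ∷ 10514 ∷ 10620 ∷ [])

conn-C222 : List (List (List ((ℕ × ℕ) × ℕ)))
conn-C222 =
  ([] ∷ [ ((1 , 0) , 0) & ((0 , 1) , 0) & ((1 , 1) , 0) & ((1 , 1) , 1) ] ∷ [ ((0 , 0) , 0) & ((0 , 1) , 0) & ((0 , 0) , 1) & ((1 , 1) , 1) ] ∷ []) ∷
  ([ ((1 , 0) , 0) & ((0 , 1) , 0) & ((1 , 1) , 0) & ((1 , 1) , 1) ] ∷ [] ∷ [ ((1 , 0) , 0) & ((0 , 1) , 0) & ((1 , 0) , 1) & ((0 , 1) , 1) ] ∷ []) ∷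
  ([ ((0 , 0) , 0) & ((0 , 1) , 0) & ((0 , 0) , 1) & ((1 , 1) , 1) ] ∷ [ ((1 , 0) , 0) & ((0 , 1) , 0) & ((1 , 0) , 1) & ((0 , 1) , 1) ] ∷ [] ∷ []) ∷ []

patch-C222 : List (ℕ × (Fin 3 × ((ℕ × ℕ) × ℕ)))
patch-C222 = entries label₃ (
  1002000 ∷ 1011100 ∷ 1010010 ∷ 1031010 ∷ 1042001 ∷ 1030110 ∷ 1062111 ∷ 1061101 ∷ 1062110 ∷ 1080001 ∷ 1091011 ∷ 1100111 ∷ 1091000 ∷ 1090100 ∷ [])

-- In the tables `conn-Z3` to `conn-Z9` exponents are shifted in order to stay natural numbers:
-- exponent 0 is the label 6 for 3, 4, 5 and 7 parts and the label 4 for 6, 8 and 9 parts.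
conn-Z3 : List (List (List ℕ))
conn-Z3 =
  ([] ∷ [ 6 & 4 & 5 ] ∷ [ 6 & 9 & 7 ] ∷ []) ∷
  ([ 6 & 8 & 7 ] ∷ [] ∷ [ 6 & 5 & 8 ] ∷ []) ∷
  ([ 6 & 3 & 5 ] ∷ [ 6 & 7 & 4 ] ∷ [] ∷ []) ∷ []

patch-Z3 : List (ℕ × (Fin 3 × ℕ))
patch-Z3 = entries label₁ (
  10016 ∷ 10126 ∷ 10214 ∷ 10105 ∷ 10415 ∷ 10425 ∷ 10507 ∷ [])

conn-Z4 : List (List (List ℕ))
conn-Z4 =
  ([] ∷ [ 6 ] ∷ [ 6 & 7 ] ∷ [ 9 & 7 ] ∷ []) ∷
  ([ 6 ] ∷ [] ∷ [ 7 & 8 ] ∷ [ 8 & 9 ] ∷ []) ∷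
  ([ 6 & 5 ] ∷ [ 5 & 4 ] ∷ [] ∷ [ 7 ] ∷ []) ∷
  ([ 3 & 5 ] ∷ [ 4 & 3 ] ∷ [ 5 ] ∷ [] ∷ []) ∷ []

patch-Z4 : List (ℕ × (Fin 4 × ℕ))
patch-Z4 = entries label₁ (
  10016 ∷ 10127 ∷ 10138 ∷ 10107 ∷ 10215 ∷ 10526 ∷ 10305 ∷ 10737 ∷ 10214 ∷ 10236 ∷ 10325 ∷ 10304 ∷ [])

conn-Z5 : List (List (List ℕ))
conn-Z5 =
  ([] ∷ [ 8 ] ∷ [ 5 ] ∷ [ 5 ] ∷ [ 6 & 4 & 5 ] ∷ []) ∷
  ([ 4 ] ∷ [] ∷ [ 5 & 6 ] ∷ [ 3 & 4 & 5 ] ∷ [] ∷ []) ∷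
  ([ 7 ] ∷ [ 7 & 6 ] ∷ [] ∷ [ 5 ] ∷ [ 5 & 7 ] ∷ []) ∷
  ([ 7 ] ∷ [ 9 & 8 & 7 ] ∷ [ 7 ] ∷ [] ∷ [ 6 ] ∷ []) ∷
  ([ 6 & 8 & 7 ] ∷ [] ∷ [ 7 & 5 ] ∷ [ 6 ] ∷ [] ∷ []) ∷ []

patch-Z5 : List (ℕ × (Fin 5 × ℕ))
patch-Z5 = entries label₁ (
  10046 ∷ 10125 ∷ 10244 ∷ 10134 ∷ 10216 ∷ 10205 ∷ 10415 ∷ 10317 ∷ 10835 ∷ 10426 ∷ 11045 ∷ 11007 ∷ 11136 ∷ [])

conn-Z6 : List (List (List ℕ))
conn-Z6 =
  ([] ∷ [ 4 ] ∷ [ 4 ] ∷ [ 5 ] ∷ [ 5 ] ∷ [ 4 ] ∷ []) ∷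
  ([ 4 ] ∷ [] ∷ [ 5 ] ∷ [ 5 ] ∷ [ 5 ] ∷ [ 4 ] ∷ []) ∷
  ([ 4 ] ∷ [ 3 ] ∷ [] ∷ [ 5 ] ∷ [ 4 ] ∷ [ 4 ] ∷ []) ∷
  ([ 3 ] ∷ [ 3 ] ∷ [ 3 ] ∷ [] ∷ [ 5 ] ∷ [ 5 ] ∷ []) ∷
  ([ 3 ] ∷ [ 3 ] ∷ [ 4 ] ∷ [ 3 ] ∷ [] ∷ [ 4 ] ∷ []) ∷
  ([ 4 ] ∷ [ 4 ] ∷ [ 4 ] ∷ [ 3 ] ∷ [ 4 ] ∷ [] ∷ []) ∷ []

patch-Z6 : List (ℕ × (Fin 6 × ℕ))
patch-Z6 = entries label₁ (
  10014 ∷ 10154 ∷ 10224 ∷ 10335 ∷ 10244 ∷ 10213 ∷ 10103 ∷ 10134 ∷ 10845 ∷ 10825 ∷ 10255 ∷ 10105 ∷ [])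

conn-Z7 : List (List (List ℕ))
conn-Z7 =
  ([] ∷ [] ∷ [ 7 ] ∷ [ 8 ] ∷ [] ∷ [ 7 & 8 ] ∷ [ 6 & 7 ] ∷ []) ∷
  ([] ∷ [] ∷ [ 5 ] ∷ [ 5 & 7 ] ∷ [ 6 & 7 ] ∷ [ 6 ] ∷ [] ∷ []) ∷
  ([ 5 ] ∷ [ 7 ] ∷ [] ∷ [] ∷ [ 8 & 7 ] ∷ [ 7 ] ∷ [ 6 ] ∷ []) ∷
  ([ 4 ] ∷ [ 7 & 5 ] ∷ [] ∷ [] ∷ [ 6 ] ∷ [ 7 ] ∷ [ 4 ] ∷ []) ∷
  ([] ∷ [ 6 & 5 ] ∷ [ 4 & 5 ] ∷ [ 6 ] ∷ [] ∷ [] ∷ [ 5 ] ∷ []) ∷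
  ([ 5 & 4 ] ∷ [ 6 ] ∷ [ 5 ] ∷ [ 5 ] ∷ [] ∷ [] ∷ [ 5 ] ∷ []) ∷
  ([ 6 & 5 ] ∷ [] ∷ [ 6 ] ∷ [ 8 ] ∷ [ 7 ] ∷ [ 7 ] ∷ [] ∷ []) ∷ []

patch-Z7 : List (ℕ × (Fin 7 × ℕ))
patch-Z7 = entries label₁ (
  10066 ∷ 10157 ∷ 10126 ∷ 10205 ∷ 10217 ∷ 10447 ∷ 10638 ∷ 10448 ∷ 10636 ∷ 10927 ∷ 11067 ∷ 11158 ∷ 10837 ∷ 10518 ∷ 10816 ∷ 10646 ∷ 11025 ∷ 11365 ∷
  11456 ∷ 11004 ∷ 10907 ∷ [])

-- Modulo 3 different shifted labels become equal, so order 3 has a search list of its own, written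
-- in residues.
patch-Z7-3 : List (ℕ × (Fin 7 × ℕ))
patch-Z7-3 = entries label₁ (
  10060 ∷ 10132 ∷ 10251 ∷ 10220 ∷ 10302 ∷ 10311 ∷ 10541 ∷ 10542 ∷ 10610 ∷ 10750 ∷ 10322 ∷ 10631 ∷ 10762 ∷ 10440 ∷ 11130 ∷ 10501 ∷ [])

conn-Z8 : List (List (List ℕ))
conn-Z8 =
  ([] ∷ [ 4 ] ∷ [] ∷ [] ∷ [ 4 ] ∷ [ 4 ] ∷ [ 5 ] ∷ [ 4 ] ∷ []) ∷
  ([ 4 ] ∷ [] ∷ [ 5 ] ∷ [ 5 ] ∷ [ 5 ] ∷ [ 4 ] ∷ [] ∷ [] ∷ []) ∷
  ([] ∷ [ 3 ] ∷ [] ∷ [ 4 ] ∷ [ 4 ] ∷ [ 5 ] ∷ [] ∷ [ 5 ] ∷ []) ∷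
  ([] ∷ [ 3 ] ∷ [ 4 ] ∷ [] ∷ [] ∷ [ 5 ] ∷ [ 5 ] ∷ [ 5 ] ∷ []) ∷
  ([ 4 ] ∷ [ 3 ] ∷ [ 4 ] ∷ [] ∷ [] ∷ [] ∷ [ 5 ] ∷ [ 4 ] ∷ []) ∷
  ([ 4 ] ∷ [ 4 ] ∷ [ 3 ] ∷ [ 3 ] ∷ [] ∷ [] ∷ [ 5 ] ∷ [] ∷ []) ∷
  ([ 3 ] ∷ [] ∷ [] ∷ [ 3 ] ∷ [ 3 ] ∷ [ 3 ] ∷ [] ∷ [ 4 ] ∷ []) ∷
  ([ 4 ] ∷ [] ∷ [ 3 ] ∷ [ 3 ] ∷ [ 4 ] ∷ [] ∷ [ 4 ] ∷ [] ∷ []) ∷ []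

patch-Z8 : List (ℕ × (Fin 8 × ℕ))
patch-Z8 = entries label₁ (
  10014 ∷ 10154 ∷ 10265 ∷ 10344 ∷ 10474 ∷ 10323 ∷ 10433 ∷ 10264 ∷ 10243 ∷ 10312 ∷ 10203 ∷ 10713 ∷ 10453 ∷ 10924 ∷ 11134 ∷ 11275 ∷ 11545 ∷ 10105 ∷ [])

conn-Z9 : List (List (List ℕ))
conn-Z9 =
  ([] ∷ [ 5 ] ∷ [ 5 ] ∷ [ 4 ] ∷ [ 5 ] ∷ [] ∷ [ 4 ] ∷ [] ∷ [ 5 ] ∷ []) ∷
  ([ 3 ] ∷ [] ∷ [ 4 ] ∷ [ 3 ] ∷ [ 4 ] ∷ [ 4 ] ∷ [ 3 ] ∷ [] ∷ [] ∷ []) ∷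
  ([ 3 ] ∷ [ 4 ] ∷ [] ∷ [ 4 ] ∷ [ 5 ] ∷ [] ∷ [] ∷ [ 4 ] ∷ [ 5 ] ∷ []) ∷
  ([ 4 ] ∷ [ 5 ] ∷ [ 4 ] ∷ [] ∷ [] ∷ [ 5 ] ∷ [ 4 ] ∷ [ 4 ] ∷ [] ∷ []) ∷
  ([ 3 ] ∷ [ 4 ] ∷ [ 3 ] ∷ [] ∷ [] ∷ [ 5 ] ∷ [] ∷ [ 4 ] ∷ [ 4 ] ∷ []) ∷
  ([] ∷ [ 4 ] ∷ [] ∷ [ 3 ] ∷ [ 3 ] ∷ [] ∷ [ 4 ] ∷ [ 3 ] ∷ [ 5 ] ∷ []) ∷
  ([ 4 ] ∷ [ 5 ] ∷ [] ∷ [ 4 ] ∷ [] ∷ [ 4 ] ∷ [] ∷ [ 4 ] ∷ [ 5 ] ∷ []) ∷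
  ([] ∷ [] ∷ [ 4 ] ∷ [ 4 ] ∷ [ 4 ] ∷ [ 5 ] ∷ [ 4 ] ∷ [] ∷ [ 5 ] ∷ []) ∷
  ([ 3 ] ∷ [] ∷ [ 3 ] ∷ [] ∷ [ 4 ] ∷ [ 3 ] ∷ [ 3 ] ∷ [ 3 ] ∷ [] ∷ []) ∷ []

patch-Z9 : List (ℕ × (Fin 9 × ℕ))
patch-Z9 = entries label₁ (
  10034 ∷ 10164 ∷ 10215 ∷ 10274 ∷ 10355 ∷ 10585 ∷ 10524 ∷ 10745 ∷ 10444 ∷ 10214 ∷ 10854 ∷ 10403 ∷ 10233 ∷ 10363 ∷ 10584 ∷ 10473 ∷ 10723 ∷ 11725 ∷
  10743 ∷ 10213 ∷ 10653 ∷ 10402 ∷ 10232 ∷ 10362 ∷ 10583 ∷ 10472 ∷ 10722 ∷ 11975 ∷ 12386 ∷ 12465 ∷ 11235 ∷ 10205 ∷ [])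

patch-Z9-2 : List (ℕ × (Fin 9 × ℕ))
patch-Z9-2 = entries label₁ (
  10030 ∷ 10160 ∷ 10211 ∷ 10270 ∷ 10351 ∷ 10581 ∷ 10520 ∷ 10741 ∷ 10650 ∷ 10210 ∷ 10640 ∷ 10401 ∷ 10780 ∷ [])

patch-Z9-3 : List (ℕ × (Fin 9 × ℕ))
patch-Z9-3 = entries label₁ (
  10030 ∷ 10160 ∷ 10211 ∷ 10270 ∷ 10351 ∷ 10581 ∷ 10520 ∷ 10741 ∷ 10440 ∷ 10210 ∷ 10850 ∷ 10402 ∷ 10232 ∷ 10362 ∷ 10580 ∷ 10472 ∷ 10722 ∷ 10952 ∷
  10112 ∷ 10842 ∷ 10301 ∷ [])

-- The first digit after `T` is the number of parts. The rest names the subgroup carrying the base: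
-- 2 and 3 are cyclic orders, `V` is the Klein four-group, `S` the dihedral group of order 6 and `N`
-- the elementary abelian group of order 9.
conn-T53 : List (List (List (ℕ)))
conn-T53 =
  ([] ∷ [ 0 & 2 ] ∷ [ 1 ] ∷ [ 1 ] ∷ [ 0 & 2 ] ∷ []) ∷
  ([ 0 & 1 ] ∷ [] ∷ [ 1 & 2 ] ∷ [ 1 & 2 ] ∷ [] ∷ []) ∷
  ([ 2 ] ∷ [ 2 & 1 ] ∷ [] ∷ [ 1 ] ∷ [ 2 & 1 ] ∷ []) ∷
  ([ 2 ] ∷ [ 2 & 1 ] ∷ [ 2 ] ∷ [] ∷ [ 2 & 0 ] ∷ []) ∷
  ([ 0 & 1 ] ∷ [] ∷ [ 1 & 2 ] ∷ [ 1 & 0 ] ∷ [] ∷ []) ∷ []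

patch-T53 : List (ℕ × (Fin 5 × (ℕ)))
patch-T53 = entries label₁ (
  10010 ∷ 10121 ∷ 10240 ∷ 10331 ∷ 10412 ∷ 10120 ∷ 10642 ∷ 10430 ∷ 10302 ∷ 10311 ∷ 10922 ∷ 11001 ∷ [])

conn-T62 : List (List (List (ℕ)))
conn-T62 =
  ([] ∷ [] ∷ [ 0 & 1 ] ∷ [] ∷ [ 1 ] ∷ [ 1 & 0 ] ∷ []) ∷
  ([] ∷ [] ∷ [ 0 ] ∷ [ 1 & 0 ] ∷ [ 0 ] ∷ [ 0 ] ∷ []) ∷
  ([ 0 & 1 ] ∷ [ 0 ] ∷ [] ∷ [] ∷ [ 0 ] ∷ [ 1 ] ∷ []) ∷
  ([] ∷ [ 1 & 0 ] ∷ [] ∷ [] ∷ [ 1 & 0 ] ∷ [ 1 ] ∷ []) ∷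
  ([ 1 ] ∷ [ 0 ] ∷ [ 0 ] ∷ [ 1 & 0 ] ∷ [] ∷ [] ∷ []) ∷
  ([ 1 & 0 ] ∷ [ 0 ] ∷ [ 1 ] ∷ [ 1 ] ∷ [] ∷ [] ∷ []) ∷ []

patch-T62 : List (ℕ × (Fin 6 × (ℕ)))
patch-T62 = entries label₁ (
  10020 ∷ 10151 ∷ 10101 ∷ 10240 ∷ 10310 ∷ 10330 ∷ 10650 ∷ 10721 ∷ [])

conn-T72 : List (List (List (ℕ)))
conn-T72 =
  ([] ∷ [ 1 & 0 ] ∷ [ 1 ] ∷ [ 0 ] ∷ [ 0 ] ∷ [] ∷ [ 1 ] ∷ []) ∷
  ([ 1 & 0 ] ∷ [] ∷ [ 0 & 1 ] ∷ [] ∷ [ 0 ] ∷ [ 1 ] ∷ [] ∷ []) ∷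
  ([ 1 ] ∷ [ 0 & 1 ] ∷ [] ∷ [ 0 ] ∷ [ 1 ] ∷ [] ∷ [ 0 ] ∷ []) ∷
  ([ 0 ] ∷ [] ∷ [ 0 ] ∷ [] ∷ [ 1 ] ∷ [ 1 ] ∷ [ 0 & 1 ] ∷ []) ∷
  ([ 0 ] ∷ [ 0 ] ∷ [ 1 ] ∷ [ 1 ] ∷ [] ∷ [ 1 & 0 ] ∷ [] ∷ []) ∷
  ([] ∷ [ 1 ] ∷ [] ∷ [ 1 ] ∷ [ 1 & 0 ] ∷ [] ∷ [ 0 & 1 ] ∷ []) ∷
  ([ 1 ] ∷ [] ∷ [ 0 ] ∷ [ 0 & 1 ] ∷ [] ∷ [ 0 & 1 ] ∷ [] ∷ []) ∷ []

patch-T72 : List (ℕ × (Fin 7 × (ℕ)))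
patch-T72 = entries label₁ (
  10010 ∷ 10140 ∷ 10221 ∷ 10311 ∷ 10320 ∷ 10401 ∷ 10431 ∷ 10550 ∷ 10360 ∷ 10541 ∷ 11030 ∷ [])

conn-T82 : List (List (List (ℕ)))
conn-T82 =
  ([] ∷ [ 1 ] ∷ [] ∷ [] ∷ [] ∷ [ 1 ] ∷ [ 0 & 1 ] ∷ [ 1 & 0 ] ∷ []) ∷
  ([ 1 ] ∷ [] ∷ [ 0 & 1 ] ∷ [] ∷ [ 1 ] ∷ [ 0 ] ∷ [ 1 ] ∷ [] ∷ []) ∷
  ([] ∷ [ 0 & 1 ] ∷ [] ∷ [ 1 ] ∷ [ 1 ] ∷ [ 0 & 1 ] ∷ [] ∷ [] ∷ []) ∷
  ([] ∷ [] ∷ [ 1 ] ∷ [] ∷ [ 1 ] ∷ [ 0 ] ∷ [ 0 ] ∷ [ 1 & 0 ] ∷ []) ∷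
  ([] ∷ [ 1 ] ∷ [ 1 ] ∷ [ 1 ] ∷ [] ∷ [ 0 ] ∷ [ 0 ] ∷ [ 1 ] ∷ []) ∷
  ([ 1 ] ∷ [ 0 ] ∷ [ 0 & 1 ] ∷ [ 0 ] ∷ [ 0 ] ∷ [] ∷ [] ∷ [] ∷ []) ∷
  ([ 0 & 1 ] ∷ [ 1 ] ∷ [] ∷ [ 0 ] ∷ [ 0 ] ∷ [] ∷ [] ∷ [ 1 ] ∷ []) ∷
  ([ 1 & 0 ] ∷ [] ∷ [] ∷ [ 1 & 0 ] ∷ [ 1 ] ∷ [] ∷ [ 1 ] ∷ [] ∷ []) ∷ []

patch-T82 : List (ℕ × (Fin 8 × (ℕ)))
patch-T82 = entries label₁ (
  10060 ∷ 10111 ∷ 10140 ∷ 10371 ∷ 10330 ∷ 10321 ∷ 10350 ∷ 10601 ∷ 10210 ∷ 10720 ∷ 11051 ∷ 10831 ∷ 11270 ∷ [])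

conn-T4V : List (List (List (ℕ × ℕ)))
conn-T4V =
  ([] ∷ [ (0 , 0) & (1 , 1) ] ∷ [ (1 , 0) & (0 , 1) ] ∷ [ (0 , 0) & (0 , 1) ] ∷ []) ∷
  ([ (0 , 0) & (1 , 1) ] ∷ [] ∷ [ (0 , 0) & (0 , 1) ] ∷ [ (0 , 0) & (1 , 0) ] ∷ []) ∷
  ([ (1 , 0) & (0 , 1) ] ∷ [ (0 , 0) & (0 , 1) ] ∷ [] ∷ [ (0 , 0) & (0 , 1) ] ∷ []) ∷
  ([ (0 , 0) & (0 , 1) ] ∷ [ (0 , 0) & (1 , 0) ] ∷ [ (0 , 0) & (0 , 1) ] ∷ [] ∷ []) ∷ []

patch-T4V : List (ℕ × (Fin 4 × (ℕ × ℕ)))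
patch-T4V = entries label₂ (
  100100 ∷ 101300 ∷ 102201 ∷ 102200 ∷ 104301 ∷ 103001 ∷ 103101 ∷ 103010 ∷ [])

conn-T4S : List (List (List (ℕ × ℕ)))
conn-T4S =
  ([] ∷ [ (0 , 0) & (2 , 1) ] ∷ [ (0 , 1) & (2 , 1) ] ∷ [ (0 , 0) & (0 , 1) ] ∷ []) ∷
  ([ (0 , 0) & (2 , 1) ] ∷ [] ∷ [ (0 , 0) & (1 , 1) ] ∷ [ (0 , 0) & (1 , 0) ] ∷ []) ∷
  ([ (0 , 1) & (2 , 1) ] ∷ [ (0 , 0) & (1 , 1) ] ∷ [] ∷ [ (0 , 1) & (1 , 1) ] ∷ []) ∷
  ([ (0 , 0) & (0 , 1) ] ∷ [ (0 , 0) & (2 , 0) ] ∷ [ (0 , 1) & (1 , 1) ] ∷ [] ∷ []) ∷ []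

patch-T4S : List (ℕ × (Fin 4 × (ℕ × ℕ)))
patch-T4S = entries label₂ (
  100100 ∷ 101300 ∷ 102201 ∷ 102310 ∷ 101110 ∷ 101010 ∷ 105211 ∷ 107221 ∷ 103320 ∷ 106020 ∷ 108120 ∷ 109001 ∷ 109101 ∷ 113301 ∷ 113200 ∷ [])

conn-T4N : List (List (List (ℕ × ℕ)))
conn-T4N =
  ([] ∷ [ (2 , 0) & (2 , 2) ] ∷ [ (2 , 0) & (0 , 2) ] ∷ [ (0 , 0) & (0 , 1) ] ∷ []) ∷
  ([ (1 , 0) & (1 , 1) ] ∷ [] ∷ [ (0 , 1) & (1 , 2) ] ∷ [ (1 , 0) & (2 , 0) ] ∷ []) ∷
  ([ (1 , 0) & (0 , 1) ] ∷ [ (0 , 2) & (2 , 1) ] ∷ [] ∷ [ (0 , 2) & (2 , 2) ] ∷ []) ∷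
  ([ (0 , 0) & (0 , 2) ] ∷ [ (2 , 0) & (1 , 0) ] ∷ [ (0 , 1) & (1 , 1) ] ∷ [] ∷ []) ∷ []

patch-T4N : List (ℕ × (Fin 4 × (ℕ × ℕ)))
patch-T4N = entries label₂ (
  100300 ∷ 101120 ∷ 102202 ∷ 103301 ∷ 102001 ∷ 101121 ∷ 101200 ∷ 105221 ∷ 106310 ∷ 102010 ∷ 101100 ∷ [])

conn-T5V : List (List (List (ℕ × ℕ)))
conn-T5V =
  ([] ∷ [ (0 , 0) & (0 , 1) ] ∷ [ (1 , 0) ] ∷ [ (1 , 1) ] ∷ [ (0 , 0) & (1 , 1) ] ∷ []) ∷
  ([ (0 , 0) & (0 , 1) ] ∷ [] ∷ [ (0 , 1) ] ∷ [ (1 , 0) & (1 , 1) & (0 , 1) ] ∷ [] ∷ []) ∷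
  ([ (1 , 0) ] ∷ [ (0 , 1) ] ∷ [] ∷ [ (0 , 0) ] ∷ [ (1 , 0) & (0 , 1) & (1 , 1) ] ∷ []) ∷
  ([ (1 , 1) ] ∷ [ (1 , 0) & (1 , 1) & (0 , 1) ] ∷ [ (0 , 0) ] ∷ [] ∷ [ (1 , 1) ] ∷ []) ∷
  ([ (0 , 0) & (1 , 1) ] ∷ [] ∷ [ (1 , 0) & (0 , 1) & (1 , 1) ] ∷ [ (1 , 1) ] ∷ [] ∷ []) ∷ []

patch-T5V : List (ℕ × (Fin 5 × (ℕ × ℕ)))
patch-T5V = entries label₂ (
  100100 ∷ 101311 ∷ 102400 ∷ 103210 ∷ 103310 ∷ 105101 ∷ 105001 ∷ 103401 ∷ 106211 ∷ 103200 ∷ 103410 ∷ 103010 ∷ 110110 ∷ 112301 ∷ 113201 ∷ 111111 ∷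
  110300 ∷ [])

-- Verified base graphs with three parts over small subgroups

find-ok : {A : Set} (P f : A → Bool) (xs : List A) → allᵇ P xs ≡ true → anyᵇ f xs ≡ true → ∃ λ x → (P x ≡ true) × (f x ≡ true)
find-ok P f (x ∷ xs) o p with f x in eq
... | true  = x , proj₁ (∧-split o) , eq
... | false = find-ok P f xs (proj₂ (∧-split {P x} o)) p

not-true : ∀ {b} → not b ≡ true → b ≡ false
not-true {false} _ = refl

look : {A : Set} → List A → A → ℕ → A
look []       d _       = d
look (x ∷ _)  d zero    = x
look (_ ∷ xs) d (suc k) = look xs d k

table : {A : Set} {m : ℕ} → List (List (List A)) → Fin m → Fin m → List A
table t i j = look (look t [] (toℕ i)) [] (toℕ j)

module Table3 (G : FinGroup) where
  open Grp G
  open Labels G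
  open LabelKinds G
  open Core G 3
  open M3 G

  -- The conditions of `Sym3` and `Star` become Boolean tests over the labels of the subgroup; the
  -- table is sparse, and its complement is the good graph.
  module Tab (Λ : CLab) (conn : Fin 3 → Fin 3 → List (CLab.L Λ)) (gens : List (CLab.L Λ))
             (patch : List (ℕ × (Fin 3 × CLab.L Λ))) (k : ℕ) where
    open CLab Λ
    open BoolEq E using (eq; mem; sound; rfl; neq)
    module B = Base 2 toLab conn

    nadj : B.Code → B.Code → Bool
    nadj c d = not (BoolEq.mem B.EC d (B.nb c))

    sizeCk in3Ck out3Ck diffCk : Fin 3 → Fin 3 → Bool
    sizeCk i j = eqF i j ∨ (length (conn i j) ≡ᵇ k)
    in3Ck i j = eqF i j ∨ anyᵇ (λ a → mem a (conn i j) ∧ anyᵇ (λ b → (mem b (conn i j) ∧ not (eq a b)) ∧ anyᵇ (λ c → (mem c (conn i j) ∧ (not (eq a c) ∧ not (eq b c)))) els) els) els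
    out3Ck i j = eqF i j ∨ anyᵇ (λ a → nadj (i , unit) (j , a) ∧ anyᵇ (λ b → (nadj (i , unit) (j , b) ∧ not (eq a b)) ∧ anyᵇ (λ c → (nadj (i , unit) (j , c) ∧ (not (eq a c) ∧ not (eq b c)))) els) els) els

    both : Fin 3 → Fin 3 → Fin 3 → L → L → Bool
    both i j l u z = nadj (i , unit) (l , z) ∧ nadj (j , u) (l , z)

    diff1 : Fin 3 → Fin 3 → Fin 3 → L → Bool
    diff1 i j l u = anyᵇ (λ z → both i j l u z ∧ (not (nadj (i , unit) (j , u)) ∨ anyᵇ (λ z′ → both i j l u z′ ∧ not (eq z z′)) els)) els

    diffCk i j with i Fₚ.≟ j
    ... | yes _ = true
    ... | no p  = allᵇ (diff1 i j (proj₁ (fin3-third i j p))) els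

    pairs : Fin 3 → Fin 3 → Fin 3 → L → L → L → Bool
    pairs i j l u z₁ z₂ = nadj (i , unit) (l , z₂) ∧ (nadj (i , u) (l , z₂) ∧ nadj (j , z₁) (l , z₂))

    same1 : Fin 3 → Fin 3 → Fin 3 → L → Bool
    same1 i j l u = eq u unit ∨ anyᵇ (λ z₁ → (nadj (i , unit) (j , z₁) ∧ nadj (i , u) (j , z₁)) ∧ anyᵇ (pairs i j l u z₁) els) els

    sameCk : Fin 3 → Bool
    sameCk i = allᵇ (same1 i (proj₁ (fin3-others i)) (proj₁ (proj₂ (fin3-others i)))) els

    starCk : Bool
    starCk = allF sameCk ∧ (allF (λ i → allF (diffCk i)) ∧ (allF (λ i → allF (sizeCk i)) ∧ (allF (λ i → allF (in3Ck i)) ∧ allF (λ i → allF (out3Ck i)))))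

    module _ (wf : B.wellformed ≡ true) (rc : B.rigidCheck wf gens patch ≡ true) (sc : starCk ≡ true)
             (gok : allᵇ okL gens ≡ true)
             (K : Sub) (least : ∀ P → (∀ {g} → mem g gens ≡ true → φ g ∈ P) → K ⊑ P) (φ∈ : ∀ {u} → okL u ≡ true → φ u ∈ K) where
      S : Conn
      S = B.S

      private
        c₁ = ∧-split {allF sameCk} sc
        c₂ = ∧-split {allF (λ i → allF (diffCk i))} (proj₂ c₁)
        c₃ = ∧-split {allF (λ i → allF (sizeCk i))} (proj₂ c₂)
        c₄ = ∧-split {allF (λ i → allF (in3Ck i))} (proj₂ c₃)

        at : (f : Fin 3 → Fin 3 → Bool) → allF (λ i → allF (f i)) ≡ true → ∀ i j → f i j ≡ true
        at f p i j = allF-elim (f i) (allF-elim (λ i → allF (f i)) p i) j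

        skip : ∀ {i j : Fin 3} {b} → i ≢ j → eqF i j ∨ b ≡ true → b ≡ true
        skip {i} {j} p q with ∨-split {eqF i j} q
        ... | inj₁ r = ⊥-elim (p (eqF-sound r))
        ... | inj₂ r = r

      label : ∀ {y} → y ∈ K → ∃ λ u → (okL u ≡ true) × (y ≡ φ u)
      label p = in-image (least image (λ {g} q → to-image (BoolEq.all-mem E okL gens gok q)) p)

      nadj-S : ∀ {i u j v} → okL u ≡ true → okL v ≡ true → nadj (i , u) (j , v) ≡ true → S i j (φ v / φ u) ≡ false
      nadj-S {i} {u} {j} {v} ou ov p = trans (B.adj-ok wf {i , u} {j , v} ou ov) (not-true p)

      nadj-unit : ∀ {i j v} → okL v ≡ true → nadj (i , unit) (j , v) ≡ true → S i j (φ v) ≡ false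
      nadj-unit {i} {j} {v} ov p = trans (cong (S i j) (sym (trans (cong (φ v /_) φ-unit) (trans (cong (φ v ·_) inv-e) (idʳ _))))) (nadj-S {i} {unit} {j} {v} ok-unit ov p)

      lift3 : (f g : L → Bool) (Q : El → Set) → (∀ {u} → okL u ≡ true → f u ≡ true → Q (φ u)) →
              anyᵇ (λ a → f a ∧ anyᵇ (λ b → (f b ∧ not (eq a b)) ∧ anyᵇ (λ c → (f c ∧ (not (eq a c) ∧ not (eq b c)))) els) els) els ≡ true → Three Q
      lift3 f _ Q h p with find-ok okL _ els els-ok p
      ... | a , oa , q with ∧-split {f a} q
      ... | fa , q′ with find-ok okL _ els els-ok q′
      ... | b , ob , r with ∧-split {f b ∧ not (eq a b)} r
      ... | fb′ , r′ with ∧-split {f b} fb′ | find-ok okL _ els els-ok r′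
      ... | fb , a≠b | c , oc , s with ∧-split {f c} s
      ... | fc , s′ with ∧-split {not (eq a c)} s′
      ... | a≠c , b≠c = three (λ t → neq (not-true a≠b) (inj oa ob t)) (λ t → neq (not-true a≠c) (inj oa oc t)) (λ t → neq (not-true b≠c) (inj ob oc t)) (h oa fa) (h ob fb) (h oc fc)

      sym3 : Sym3 K S
      sym3 = record
        { isC = B.isC wf
        ; supp = λ {i} {j} p → case B.S-find wf {i} {j} p of λ { (s , os , _ , q) → subst (_∈ K) (sym q) (φ∈ os) }
        ; rigid = B.base-rigid wf gens patch rc K least
        ; size = k
        ; sz = λ i j p → trans (B.S-cnt wf i j) (≡ᵇ-sound _ k (skip {i} {j} p (at sizeCk (proj₁ c₃) i j)))
        ; in3 = λ i j p → lift3 (λ a → mem a (conn i j)) (λ _ → true) (λ x → S i j x ≡ true) (λ _ q → B.∈φ wf (conn i j) q) (skip {i} {j} p (at in3Ck (proj₁ c₄) i j))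
        ; out3 = λ i j p → lift3 (λ a → nadj (i , unit) (j , a)) (λ _ → true) (λ x → x ∈ K × S i j x ≡ false)
            (λ {u} o q → φ∈ o , nadj-unit {i} {j} {u} o q) (skip {i} {j} p (at out3Ck (proj₂ c₄) i j)) }

      star : Star K S
      star = record { same = same ; diff = diff }
        where
        same : ∀ i y → y ∈ K → y ≢ e → ∃ λ j → ∃ λ l → i ≢ j × i ≢ l × j ≢ l × ∃ λ z₁ → ∃ λ z₂ →
             z₁ ∈ K × z₂ ∈ K × S i j z₁ ≡ false × S i j (z₁ / y) ≡ false ×
             S i l z₂ ≡ false × S i l (z₂ / y) ≡ false × S j l (z₂ / z₁) ≡ false
        same i y y∈ y≢e with label y∈
        ... | u , ou , refl with ∨-split {eq u unit} (BoolEq.all-mem E (same1 i j l) els (allF-elim sameCk (proj₁ c₁) i) (complete ou))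
          where
          j = proj₁ (fin3-others i)
          l = proj₁ (proj₂ (fin3-others i))
        ... | inj₁ q = ⊥-elim (y≢e (trans (cong φ (sound q)) φ-unit))
        ... | inj₂ q with fin3-others i
        ... | j , l , i≢j , i≢l , j≢l with find-ok okL _ els els-ok q
        ... | z₁ , o₁ , r with ∧-split {nadj (i , unit) (j , z₁) ∧ nadj (i , u) (j , z₁)} r
        ... | r₁ , r₂ with ∧-split {nadj (i , unit) (j , z₁)} r₁ | find-ok okL (pairs i j l u z₁) els els-ok r₂
        ... | a , b | z₂ , o₂ , s with ∧-split {nadj (i , unit) (l , z₂)} s
        ... | c , s′ with ∧-split {nadj (i , u) (l , z₂)} s′
        ... | d , f = j , l , i≢j , i≢l , j≢l , φ z₁ , φ z₂ , φ∈ o₁ , φ∈ o₂ , nadj-unit {i} {j} {z₁} o₁ a , nadj-S {i} {u} {j} {z₁} ou o₁ b ,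
              nadj-unit {i} {l} {z₂} o₂ c , nadj-S {i} {u} {l} {z₂} ou o₂ d , nadj-S {j} {z₁} {l} {z₂} o₁ o₂ f
        diff : ∀ i j y → i ≢ j → y ∈ K → ∃ λ l → i ≢ l × j ≢ l ×
             (∃ λ z → z ∈ K × S i l z ≡ false × S j l (z / y) ≡ false) ×
             (S i j y ≡ false → Two λ z → z ∈ K × S i l z ≡ false × S j l (z / y) ≡ false)
        diff i j y i≢j y∈ with i Fₚ.≟ j | at diffCk (proj₁ c₂) i j | label y∈
        ... | yes p | _ | _ = ⊥-elim (i≢j p)
        ... | no p | ck | u , ou , refl with fin3-third i j p
        ... | l , i≢l , j≢l with find-ok okL _ els els-ok (BoolEq.all-mem E (diff1 i j l) els ck (complete ou))
        ... | z , oz , q with ∧-split {both i j l u z} q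
        ... | q₁ , q₂ = l , i≢l , j≢l , (φ z , mk oz q₁) , tw
          where
          mk : ∀ {z} → okL z ≡ true → both i j l u z ≡ true → φ z ∈ K × S i l (φ z) ≡ false × S j l (φ z / φ u) ≡ false
          mk {z} o b = φ∈ o , nadj-unit {i} {l} {z} o (proj₁ (∧-split b)) , nadj-S {j} {u} {l} {z} ou o (proj₂ (∧-split {nadj (i , unit) (l , z)} b))
          tw : S i j (φ u) ≡ false → Two λ z → z ∈ K × S i l z ≡ false × S j l (z / φ u) ≡ false
          tw nf with ∨-split {not (nadj (i , unit) (j , u))} q₂
          ... | inj₁ r = ⊥-elim (false≢true nf (trans (cong (S i j) (sym (trans (cong (φ u /_) φ-unit) (trans (cong (φ u ·_) inv-e) (idʳ _)))))
                  (trans (B.adj-ok wf {i , unit} {j , u} ok-unit ou) (notnot r))))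
            where
            notnot : ∀ {b} → not (not b) ≡ true → b ≡ true
            notnot {true} _ = refl
          ... | inj₂ r with find-ok okL _ els els-ok r
          ... | z′ , oz′ , s with ∧-split {both i j l u z′} s
          ... | b′ , z≠ = two (λ t → neq (not-true z≠) (inj oz oz′ t)) (mk oz q₁) (mk oz′ b′)

      good : Good K
      good = Reset.good K S sym3 star

module SmallGroups (G : FinGroup) where
  open Grp G
  open Labels G
  open LabelKinds G
  open Core G 3
  open M3 G
  open Table3 G

  conj-pow : ∀ {x a b} → x · a ≡ b · x → ∀ k → x · a ^ k ≡ b ^ k · x
  conj-pow p zero = trans (idʳ _) (sym (idˡ _))
  conj-pow {x} {a} {b} p (suc k) = begin
    x · (a · a ^ k) ≡⟨ assoc _ _ _ ⟨
    (x · a) · a ^ k ≡⟨ cong (_· a ^ k) p ⟩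
    (b · x) · a ^ k ≡⟨ assoc _ _ _ ⟩
    b · (x · a ^ k) ≡⟨ cong (b ·_) (conj-pow p k) ⟩
    b · (b ^ k · x) ≡⟨ assoc _ _ _ ⟨
    (b · b ^ k) · x ∎
    where open ≡-Reasoning

  ^∈gen : ∀ a k → a ^ k ∈ gen a
  ^∈gen a = ^∈ (gen a) (gen-∋ a)

  -- ⟨a⟩ has index 2 in the subgroup generated, and `x` acts on exponents by u ↦ i u, which `θ`
  -- computes by repeated addition modulo `n`.
  module Cyclic2 (a x : El) (n : ℕ) (o : HasOrder a n) (x∉ : x ∉ gen a) (i j : ℕ) (act : x · a ≡ a ^ i · x) (sq : x · x ≡ a ^ j) (j<n : j < n) where
    θ : ℕ → ℕ
    θ u = iter (addMod o u) i 0

    private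
      θ-pow : ∀ k u → a ^ iter (addMod o u) k 0 ≡ (a ^ u) ^ k
      θ-pow zero u = refl
      θ-pow (suc k) u = trans (addMod-pow o u (iter (addMod o u) k 0)) (cong (a ^ u ·_) (θ-pow k u))
      θ-ok : ∀ k {u} → u < n → iter (addMod o u) k 0 < n
      θ-ok zero _ = HasOrder.pos o
      θ-ok (suc k) p = addMod-< o p (θ-ok k p)

    K : Sub
    K = adjoin (gen a) x

    Λ : CLab
    Λ = extLab (modLab o) (gen a) (λ {u} _ → ^∈gen a u) x θ 2 j (s≤s z≤n) (<ᵇ-true j<n)
      (λ p → <ᵇ-true (θ-ok i (<ᵇ-sound p)))
      (λ {u} _ → trans (conj-pow act u) (cong (_· x) (trans (sym (^-* a u i)) (trans (cong (a ^_) (ℕₚ.*-comm u i)) (trans (^-* a i u) (sym (θ-pow i u)))))))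
      (trans (cong (x ·_) (^1 x)) sq)
      (λ { (suc zero) _ _ → subst (_∉ gen a) (sym (^1 x)) x∉ ; (suc (suc k)) _ (s≤s (s≤s ())) })

    gens : List (ℕ × ℕ)
    gens = (1 , 0) ∷ (0 , 1) ∷ []

    least : ∀ P → (∀ {g} → BoolEq.mem (CLab.E Λ) g gens ≡ true → CLab.φ Λ g ∈ P) → K ⊑ P
    least P h = adjoin-least (gen a) x P (gen-least a P (subst (_∈ P) (trans (idʳ _) (^1 a)) (h {1 , 0} refl)))
      (subst (_∈ P) (trans (idˡ _) (^1 x)) (h {0 , 1} refl))

    φ∈K : ∀ {u} → CLab.okL Λ u ≡ true → CLab.φ Λ u ∈ K
    φ∈K {u , v} _ = ·∈ K (adjoin-⊒ (gen a) x (^∈gen a u)) (^∈ K (adjoin-∋ (gen a) x) v)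

  -- In order, the subgroups are C₄ × C₂, C₈, the dihedral and the quaternion group of order 8, C₁₀,
  -- D₁₀, C₆ × C₂, C₁₂, D₁₂, the dicyclic group of order 12, C₁₄ and D₁₄, dihedral groups being
  -- indexed by their order.
  module _ (a x : El) (x∉ : x ∉ gen a) where
    good-K410 : HasOrder a 4 → x · a ≡ a ^ 1 · x → x · x ≡ a ^ 0 → Good (adjoin (gen a) x)
    good-K410 o p q = Tab.good Λ (table conn-K410) gens patch-K410 3 refl refl refl refl K least (λ {u} → φ∈K {u})
      where open Cyclic2 a x 4 o x∉ 1 0 p q (s≤s z≤n)

    good-K411 : HasOrder a 4 → x · a ≡ a ^ 1 · x → x · x ≡ a ^ 1 → Good (adjoin (gen a) x)
    good-K411 o p q = Tab.good Λ (table conn-K411) gens patch-K411 3 refl refl refl refl K least (λ {u} → φ∈K {u})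
      where open Cyclic2 a x 4 o x∉ 1 1 p q (s≤s (s≤s z≤n))

    good-K430 : HasOrder a 4 → x · a ≡ a ^ 3 · x → x · x ≡ a ^ 0 → Good (adjoin (gen a) x)
    good-K430 o p q = Tab.good Λ (table conn-K430) gens patch-K430 3 refl refl refl refl K least (λ {u} → φ∈K {u})
      where open Cyclic2 a x 4 o x∉ 3 0 p q (s≤s z≤n)

    good-K432 : HasOrder a 4 → x · a ≡ a ^ 3 · x → x · x ≡ a ^ 2 → Good (adjoin (gen a) x)
    good-K432 o p q = Tab.good Λ (table conn-K432) gens patch-K432 3 refl refl refl refl K least (λ {u} → φ∈K {u})
      where open Cyclic2 a x 4 o x∉ 3 2 p q (s≤s (s≤s (s≤s z≤n)))

    good-K510 : HasOrder a 5 → x · a ≡ a ^ 1 · x → x · x ≡ a ^ 0 → Good (adjoin (gen a) x)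
    good-K510 o p q = Tab.good Λ (table conn-K510) gens patch-K510 3 refl refl refl refl K least (λ {u} → φ∈K {u})
      where open Cyclic2 a x 5 o x∉ 1 0 p q (s≤s z≤n)

    good-K540 : HasOrder a 5 → x · a ≡ a ^ 4 · x → x · x ≡ a ^ 0 → Good (adjoin (gen a) x)
    good-K540 o p q = Tab.good Λ (table conn-K540) gens patch-K540 3 refl refl refl refl K least (λ {u} → φ∈K {u})
      where open Cyclic2 a x 5 o x∉ 4 0 p q (s≤s z≤n)

    good-K610 : HasOrder a 6 → x · a ≡ a ^ 1 · x → x · x ≡ a ^ 0 → Good (adjoin (gen a) x)
    good-K610 o p q = Tab.good Λ (table conn-K610) gens patch-K610 3 refl refl refl refl K least (λ {u} → φ∈K {u})
      where open Cyclic2 a x 6 o x∉ 1 0 p q (s≤s z≤n)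

    good-K611 : HasOrder a 6 → x · a ≡ a ^ 1 · x → x · x ≡ a ^ 1 → Good (adjoin (gen a) x)
    good-K611 o p q = Tab.good Λ (table conn-K611) gens patch-K611 3 refl refl refl refl K least (λ {u} → φ∈K {u})
      where open Cyclic2 a x 6 o x∉ 1 1 p q (s≤s (s≤s z≤n))

    good-K650 : HasOrder a 6 → x · a ≡ a ^ 5 · x → x · x ≡ a ^ 0 → Good (adjoin (gen a) x)
    good-K650 o p q = Tab.good Λ (table conn-K650) gens patch-K650 3 refl refl refl refl K least (λ {u} → φ∈K {u})
      where open Cyclic2 a x 6 o x∉ 5 0 p q (s≤s z≤n)

    good-K653 : HasOrder a 6 → x · a ≡ a ^ 5 · x → x · x ≡ a ^ 3 → Good (adjoin (gen a) x)
    good-K653 o p q = Tab.good Λ (table conn-K653) gens patch-K653 3 refl refl refl refl K least (λ {u} → φ∈K {u})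
      where open Cyclic2 a x 6 o x∉ 5 3 p q (s≤s (s≤s (s≤s (s≤s z≤n))))

    good-K710 : HasOrder a 7 → x · a ≡ a ^ 1 · x → x · x ≡ a ^ 0 → Good (adjoin (gen a) x)
    good-K710 o p q = Tab.good Λ (table conn-K710) gens patch-K710 3 refl refl refl refl K least (λ {u} → φ∈K {u})
      where open Cyclic2 a x 7 o x∉ 1 0 p q (s≤s z≤n)

    good-K760 : HasOrder a 7 → x · a ≡ a ^ 6 · x → x · x ≡ a ^ 0 → Good (adjoin (gen a) x)
    good-K760 o p q = Tab.good Λ (table conn-K760) gens patch-K760 3 refl refl refl refl K least (λ {u} → φ∈K {u})
      where open Cyclic2 a x 7 o x∉ 6 0 p q (s≤s z≤n)

  comm-pow : ∀ {x y} → x · y ≡ y · x → ∀ k → x · y ^ k ≡ y ^ k · x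
  comm-pow = conj-pow

  -- The case of `extLab` with trivial action. `comm′` hands commutation on to the extended labels,
  -- so that the extension can be iterated.
  module Comm (Λ : CLab) (H : Sub) (φ∈ : ∀ {u} → CLab.okL Λ u ≡ true → CLab.φ Λ u ∈ H) (x : El) (r : ℕ) (1≤r : 1 ≤ r)
              (comm : ∀ {u} → CLab.okL Λ u ≡ true → x · CLab.φ Λ u ≡ CLab.φ Λ u · x) (xr : x ^ r ≡ e)
              (out : ∀ k → 1 ≤ k → k < r → x ^ k ∉ H) where
    Λ′ : CLab
    Λ′ = extLab Λ H φ∈ x id r (CLab.unit Λ) 1≤r (CLab.ok-unit Λ) id comm (trans xr (sym (CLab.φ-unit Λ))) out

    φ∈′ : ∀ {u} → CLab.okL Λ′ u ≡ true → CLab.φ Λ′ u ∈ adjoin H x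
    φ∈′ {u , v} p = ·∈ (adjoin H x) (adjoin-⊒ H x (φ∈ (proj₁ (∧-split {CLab.okL Λ u} p)))) (^∈ (adjoin H x) (adjoin-∋ H x) v)

    comm′ : ∀ {y} → (∀ {u} → CLab.okL Λ u ≡ true → y · CLab.φ Λ u ≡ CLab.φ Λ u · y) → y · x ≡ x · y →
            ∀ {u} → CLab.okL Λ′ u ≡ true → y · CLab.φ Λ′ u ≡ CLab.φ Λ′ u · y
    comm′ {y} f q {u , v} p = begin
      y · (CLab.φ Λ u · x ^ v) ≡⟨ assoc _ _ _ ⟨
      (y · CLab.φ Λ u) · x ^ v ≡⟨ cong (_· x ^ v) (f (proj₁ (∧-split {CLab.okL Λ u} p))) ⟩
      (CLab.φ Λ u · y) · x ^ v ≡⟨ assoc _ _ _ ⟩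
      CLab.φ Λ u · (y · x ^ v) ≡⟨ cong (CLab.φ Λ u ·_) (comm-pow q v) ⟩
      CLab.φ Λ u · (x ^ v · y) ≡⟨ assoc _ _ _ ⟨
      (CLab.φ Λ u · x ^ v) · y ∎
      where open ≡-Reasoning

  out2 : ∀ {H x} → x ∉ H → ∀ k → 1 ≤ k → k < 2 → x ^ k ∉ H
  out2 {H} {x} p (suc zero) _ _ = subst (_∉ H) (sym (^1 x)) p
  out2 p (suc (suc k)) _ (s≤s (s≤s ()))

  out3′ : ∀ {H x} → x ^ 3 ≡ e → x ∉ H → ∀ k → 1 ≤ k → k < 3 → x ^ k ∉ H
  out3′ {H} {x} q p (suc zero) _ _ = subst (_∉ H) (sym (^1 x)) p
  out3′ {H} {x} q p (suc (suc zero)) _ _ = ≢true λ r → false≢true p (subst (_∈ H)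
    (trans (grp (x ∷ []) (v0 ⊙ (v0 ⊙ ε) ⊙ (v0 ⊙ (v0 ⊙ ε))) (v0 ⊙ (v0 ⊙ (v0 ⊙ (v0 ⊙ ε)))) refl) (trans (cong (x ·_) q) (idʳ x))) (·∈ H r r))
  out3′ q p (suc (suc (suc k))) _ (s≤s (s≤s (s≤s ())))

  x^2 : ∀ {x} → x · x ≡ e → x ^ 2 ≡ e
  x^2 {x} p = trans (cong (x ·_) (^1 x)) p

  ord2 : ∀ {x} → x · x ≡ e → x ≢ e → HasOrder x 2
  ord2 {x} p q = record { pos = s≤s z≤n ; pow-n = x^2 p ; least = λ { (suc zero) _ _ r → q (trans (sym (^1 x)) r) ; (suc (suc k)) _ (s≤s (s≤s ())) } }

  good-C33 : ∀ a b → HasOrder a 3 → b ^ 3 ≡ e → b ∉ gen a → b · a ≡ a · b → Good (adjoin (gen a) b)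
  good-C33 a b o b3 b∉ ba = Tab.good Λ′ (table conn-C33) ((1 , 0) ∷ (0 , 1) ∷ []) patch-C33 3 refl refl refl refl (adjoin (gen a) b)
    (λ P h → adjoin-least (gen a) b P (gen-least a P (subst (_∈ P) (trans (idʳ _) (^1 a)) (h {1 , 0} refl))) (subst (_∈ P) (trans (idˡ _) (^1 b)) (h {0 , 1} refl)))
    (λ {u} → φ∈′ {u})
    where open Comm (modLab o) (gen a) (λ {u} _ → ^∈gen a u) b 3 (s≤s z≤n) (λ {u} _ → comm-pow ba u) b3 (out3′ {gen a} b3 b∉)

  -- ⟨a, b⟩ is a Klein four-group on which conjugation by `c` sends a to b and b to a b; on
  -- exponents this is (u , v) ↦ (v , u + v), the map `θ`.
  good-A4 : ∀ a b c → a · a ≡ e → a ≢ e → b · b ≡ e → b ∉ gen a → c ^ 3 ≡ e → c ∉ adjoin (gen a) b →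
            b · a ≡ a · b → c · a ≡ b · c → c · b ≡ (a · b) · c → Good (adjoin (adjoin (gen a) b) c)
  good-A4 a b c aa a≢e bb b∉ c3 c∉ ba ca cb = Tab.good Λ₃ (table conn-A4) (((1 , 0) , 0) ∷ ((0 , 0) , 1) ∷ []) patch-A4 3 refl refl refl refl K least (λ {u} → φ∈K {u})
    where
    V K : Sub
    V = adjoin (gen a) b
    K = adjoin V c
    o = ord2 aa a≢e
    open Comm (modLab o) (gen a) (λ {u} _ → ^∈gen a u) b 2 (s≤s z≤n) (λ {u} _ → comm-pow ba u) (x^2 bb) (out2 {gen a} b∉)
    θ : ℕ × ℕ → ℕ × ℕ
    θ (u , v) = v , addMod o u v
    okθ : ∀ {u} → CLab.okL Λ′ u ≡ true → CLab.okL Λ′ (θ u) ≡ true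
    okθ {u , v} p = cong₂ _∧_ (proj₂ (∧-split {u <ᵇ 2} p)) (<ᵇ-true (addMod-< o (<ᵇ-sound {u} (proj₁ (∧-split {u <ᵇ 2} p))) (<ᵇ-sound {v} (proj₂ (∧-split {u <ᵇ 2} p)))))
    act : ∀ {u} → CLab.okL Λ′ u ≡ true → c · CLab.φ Λ′ u ≡ CLab.φ Λ′ (θ u) · c
    act {0 , 0} _ = grp (c ∷ []) (v0 ⊙ (ε ⊙ ε)) (ε ⊙ ε ⊙ v0) refl
    act {1 , 0} _ = trans (grp (c ∷ a ∷ []) (v0 ⊙ (v1 ⊙ ε ⊙ ε)) (v0 ⊙ v1) refl) (trans ca (grp (b ∷ c ∷ []) (v0 ⊙ v1) (ε ⊙ (v0 ⊙ ε) ⊙ v1) refl))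
    act {0 , 1} _ = trans (grp (c ∷ b ∷ []) (v0 ⊙ (ε ⊙ (v1 ⊙ ε))) (v0 ⊙ v1) refl) (trans cb (grp (a ∷ b ∷ c ∷ []) (v0 ⊙ v1 ⊙ v2) (v0 ⊙ ε ⊙ (v1 ⊙ ε) ⊙ v2) refl))
    act {1 , 1} _ = begin
      c · ((a · e) · (b · e)) ≡⟨ grp (c ∷ a ∷ b ∷ []) (v0 ⊙ (v1 ⊙ ε ⊙ (v2 ⊙ ε))) (v0 ⊙ v1 ⊙ v2) refl ⟩
      (c · a) · b ≡⟨ cong (_· b) ca ⟩
      (b · c) · b ≡⟨ assoc _ _ _ ⟩
      b · (c · b) ≡⟨ cong (b ·_) cb ⟩
      b · ((a · b) · c) ≡⟨ grp (a ∷ b ∷ c ∷ []) (v1 ⊙ (v0 ⊙ v1 ⊙ v2)) (v1 ⊙ v0 ⊙ v1 ⊙ v2) refl ⟩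
      ((b · a) · b) · c ≡⟨ cong (λ t → (t · b) · c) ba ⟩
      ((a · b) · b) · c ≡⟨ cong (_· c) (trans (assoc a b b) (cong (a ·_) bb)) ⟩
      (a · e) · c ≡⟨ grp (a ∷ c ∷ []) (v0 ⊙ ε ⊙ v1) (v0 ⊙ ε ⊙ ε ⊙ v1) refl ⟩
      ((a · e) · e) · c ∎
      where open ≡-Reasoning
    act {0 , suc (suc v)} ()
    act {1 , suc (suc v)} ()
    act {suc (suc u) , v} ()
    Λ₃ : CLab
    Λ₃ = extLab Λ′ V (λ {u} → φ∈′ {u}) c θ 3 (0 , 0) (s≤s z≤n) refl (λ {u} → okθ {u}) (λ {u} → act {u}) (trans c3 (sym (idˡ e))) (out3′ {V} c3 c∉)
    least : ∀ P → (∀ {g} → BoolEq.mem (CLab.E Λ₃) g (((1 , 0) , 0) ∷ ((0 , 0) , 1) ∷ []) ≡ true → CLab.φ Λ₃ g ∈ P) → K ⊑ P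
    least P h = adjoin-least V c P (adjoin-least (gen a) b P (gen-least a P a∈) (subst (_∈ P) (trans (cong (_/ c) ca) (·-/ b c)) (/∈ P (·∈ P c∈ a∈) c∈))) c∈
      where
      a∈ : a ∈ P
      a∈ = subst (_∈ P) (trans (idʳ _) (trans (idʳ _) (^1 a))) (h {(1 , 0) , 0} refl)
      c∈ : c ∈ P
      c∈ = subst (_∈ P) (trans (cong (_· c ^ 1) (idˡ e)) (trans (idˡ _) (^1 c))) (h {(0 , 0) , 1} refl)
    φ∈K : ∀ {u} → CLab.okL Λ₃ u ≡ true → CLab.φ Λ₃ u ∈ K
    φ∈K {u , v} p = ·∈ K (adjoin-⊒ V c (φ∈′ {u} (proj₁ (∧-split {CLab.okL Λ′ u} p)))) (^∈ K (adjoin-∋ V c) v)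

  module Elementary (ex2 : ∀ x → x · x ≡ e) where
    commute : ∀ x y → x · y ≡ y · x
    commute x y = trans (sym (inv-uniq (x · y) (x · y) (ex2 (x · y)))) (trans (inv-· x y) (cong₂ _·_ (inv-uniq y y (ex2 y)) (inv-uniq x x (ex2 x))))

    module Rank3 (a b c : El) (a≢e : a ≢ e) (b∉ : b ∉ gen a) (c∉ : c ∉ adjoin (gen a) b) where
      module C₂ = Comm (modLab (ord2 (ex2 a) a≢e)) (gen a) (λ {u} _ → ^∈gen a u) b 2 (s≤s z≤n) (λ {u} _ → comm-pow (commute b a) u) (x^2 (ex2 b)) (out2 {gen a} b∉)
      V : Sub
      V = adjoin (gen a) b

      cm : ∀ y {u} → CLab.okL C₂.Λ′ u ≡ true → y · CLab.φ C₂.Λ′ u ≡ CLab.φ C₂.Λ′ u · y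
      cm y {u} = C₂.comm′ {y} (λ {v} _ → comm-pow (commute y a) v) (commute y b) {u}

      module C₃ = Comm C₂.Λ′ V (λ {u} → C₂.φ∈′ {u}) c 2 (s≤s z≤n) (λ {u} → cm c {u}) (x^2 (ex2 c)) (out2 {V} c∉)
      W : Sub
      W = adjoin V c

      module B₃ = Base 2 (CLab.toLab C₃.Λ′) (table conn-C222)

      least₃ : ∀ P → (∀ {g} → BoolEq.mem (CLab.E C₃.Λ′) g (((1 , 0) , 0) ∷ ((0 , 1) , 0) ∷ ((0 , 0) , 1) ∷ []) ≡ true → CLab.φ C₃.Λ′ g ∈ P) → W ⊑ P
      least₃ P h = adjoin-least V c P (adjoin-least (gen a) b P (gen-least a P (subst (_∈ P) (trans (idʳ _) (trans (idʳ _) (^1 a))) (h {(1 , 0) , 0} refl)))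
        (subst (_∈ P) (trans (idʳ _) (trans (idˡ _) (^1 b))) (h {(0 , 1) , 0} refl))) (subst (_∈ P) (trans (cong (_· c ^ 1) (idˡ e)) (trans (idˡ _) (^1 c))) (h {(0 , 0) , 1} refl))

      rigid₃ : Rigid W B₃.S
      rigid₃ = B₃.base-rigid refl (((1 , 0) , 0) ∷ ((0 , 1) , 0) ∷ ((0 , 0) , 1) ∷ []) patch-C222 refl W least₃

      module _ (d : El) (d∉ : d ∉ W) where
        module C₄ = Comm C₃.Λ′ W (λ {u} → C₃.φ∈′ {u}) d 2 (s≤s z≤n) (λ {u} → C₃.comm′ {d} (λ {v} → cm d {v}) (commute d c) {u}) (x^2 (ex2 d)) (out2 {W} d∉)

        good-C2222 : Good (adjoin W d)
        good-C2222 = Tab.good C₄.Λ′ (table conn-C2222) ((((1 , 0) , 0) , 0) ∷ (((0 , 1) , 0) , 0) ∷ (((0 , 0) , 1) , 0) ∷ (((0 , 0) , 0) , 1) ∷ []) patch-C2222 4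
          refl refl refl refl (adjoin W d)
          (λ P h → adjoin-least W d P (adjoin-least V c P (adjoin-least (gen a) b P
            (gen-least a P (subst (_∈ P) (trans (idʳ _) (trans (idʳ _) (trans (idʳ _) (^1 a)))) (h {((1 , 0) , 0) , 0} refl)))
            (subst (_∈ P) (trans (idʳ _) (trans (idʳ _) (trans (idˡ _) (^1 b)))) (h {((0 , 1) , 0) , 0} refl)))
            (subst (_∈ P) (trans (idʳ _) (trans (cong (_· c ^ 1) (idˡ e)) (trans (idˡ _) (^1 c)))) (h {((0 , 0) , 1) , 0} refl)))
            (subst (_∈ P) (trans (cong (λ t → (t · e) · d ^ 1) (idˡ e)) (trans (cong (_· d ^ 1) (idˡ e)) (trans (idˡ _) (^1 d)))) (h {((0 , 0) , 0) , 1} refl)))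
          (λ {u} → C₄.φ∈′ {u})

-- Three parts over a cyclic group of order at least eight

∈ᶠ-++ : ∀ {k} {y : Fin k} xs ys → y ∈ᶠ (xs ++ ys) ≡ false → (y ∈ᶠ xs ≡ false) × (y ∈ᶠ ys ≡ false)
∈ᶠ-++ [] ys p = refl , p
∈ᶠ-++ {y = y} (x ∷ xs) ys p with y Fₚ.≟ x
... | no _ = ∈ᶠ-++ xs ys p

-- The residue modulo `n` of the exponent u - c that the shifted label `u` stands for.
norm : ℕ → ℕ → ℕ → ℕ
norm c n u = if u <ᵇ c then n ∸ (c ∸ u) else u ∸ c

module CyclicBase (G : FinGroup) where
  open Grp G
  open Labels G
  open LabelKinds G

  gen-least₁ : ∀ {a} P → a ^ 1 ∈ P → gen a ⊑ P
  gen-least₁ {a} P p = gen-least a P (subst (_∈ P) (^1 a) p)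

  module _ {a : El} {n : ℕ} (o : HasOrder a n) where
    -- By the pigeonhole principle the `n` powers of `a` do not all fit into a shorter list.
    avoidList : ∀ xs → length xs < n → ∃ λ y → y ∈ gen a × y ∈ᶠ xs ≡ false
    avoidList xs lt with Fₚ.any? (λ (k : Fin n) → (a ^ toℕ k) ∈ᶠ xs Bₚ.≟ false)
    ... | yes (k , p) = a ^ toℕ k , ^∈ (gen a) (gen-∋ a) (toℕ k) , p
    ... | no q = ⊥-elim (clash (Fₚ.pigeonhole lt idx))
      where
      find : ∀ ys {y} → y ∈ᶠ ys ≡ true → ∃ λ (i : Fin (length ys)) → L.lookup ys i ≡ y
      find (z ∷ ys) {y} p with y Fₚ.≟ z
      ... | yes r = zero , sym r
      ... | no _ with find ys p
      ... | i , r = suc i , r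
      mm : ∀ (k : Fin n) → (a ^ toℕ k) ∈ᶠ xs ≡ true
      mm k with (a ^ toℕ k) ∈ᶠ xs in eq
      ... | true = refl
      ... | false = ⊥-elim (q (k , eq))
      idx : Fin n → Fin (length xs)
      idx k = proj₁ (find xs (mm k))
      clash : (∃ λ i → ∃ λ j → i F.< j × idx i ≡ idx j) → ⊥
      clash (i , j , i<j , p) = ℕₚ.<⇒≢ i<j (ord-inj o (Fₚ.toℕ<n i) (Fₚ.toℕ<n j)
        (trans (sym (proj₂ (find xs (mm i)))) (trans (cong (L.lookup xs) p) (proj₂ (find xs (mm j))))))

  shift-∉ : ∀ xs {z y} → z ∈ᶠ map (_· y) xs ≡ false → (z / y) ∈ᶠ xs ≡ false
  shift-∉ [] p = refl
  shift-∉ (x ∷ xs) {z} {y} p with (z / y) Fₚ.≟ x | z Fₚ.≟ (x · y)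
  ... | yes r | no s = ⊥-elim (s (/-≡ r))
  ... | no _ | no _ = shift-∉ xs p

  module Z3 where
    open Core G 3
    open M3 G
    open Table3 G

    -- Orders 8 and 9 are too small for the window of `offLab`, which needs 9 < n, so the table is
    -- reduced to residues.
    good-8 : ∀ {a} → HasOrder a 8 → Good (gen a)
    good-8 {a} o = Tab.good (modLab o) (λ i j → map (norm 6 8) (table conn-Z3 i j)) (1 ∷ []) (map (λ { (k , i , u) → k , i , norm 6 8 u }) patch-Z3) 3
      refl refl refl refl (gen a) (λ P h → gen-least₁ P (h {1} refl)) (λ {u} _ → ^∈ (gen a) (gen-∋ a) u)

    good-9 : ∀ {a} → HasOrder a 9 → Good (gen a)
    good-9 {a} o = Tab.good (modLab o) (λ i j → map (norm 6 9) (table conn-Z3 i j)) (1 ∷ []) (map (λ { (k , i , u) → k , i , norm 6 9 u }) patch-Z3) 3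
      refl refl refl refl (gen a) (λ P h → gen-least₁ P (h {1} refl)) (λ {u} _ → ^∈ (gen a) (gen-∋ a) u)

    -- Since `n` is unknown, the witnesses for `Star` are found by counting instead of evaluation:
    -- each has to avoid at most nine values, three translates of three-element sets, while `a` has
    -- at least ten powers.
    module Big {a : El} {n : ℕ} (o : HasOrder a n) (10≤n : 10 ≤ n) where
      Λ : Lab
      Λ = offLab o 3 6 ℕₚ.≤-refl 10≤n
      module B = Base 2 Λ (table conn-Z3)
      S : Conn
      S = B.S

      K : Sub
      K = gen a

      wf : B.wellformed ≡ true
      wf = refl

      φ∈ : ∀ u → Lab.φ Λ u ∈ K
      φ∈ u = /∈ K (^∈ K (gen-∋ a) u) (^∈ K (gen-∋ a) 6)

      φ7 : Lab.φ Λ 7 ≡ a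
      φ7 = ·-/ a (a ^ 6)

      len3 : ∀ (i j : Fin 3) → length (map (Lab.φ Λ) (table conn-Z3 i j)) ≡ 3 ⊎ i ≡ j
      len3 = λ { 0F 0F → inj₂ refl ; 0F 1F → inj₁ refl ; 0F 2F → inj₁ refl ; 1F 0F → inj₁ refl ; 1F 1F → inj₂ refl
               ; 1F 2F → inj₁ refl ; 2F 0F → inj₁ refl ; 2F 1F → inj₁ refl ; 2F 2F → inj₂ refl }

      N : Fin 3 → Fin 3 → List El
      N i j = map (Lab.φ Λ) (table conn-Z3 i j)

      size3 : ∀ {i j} → i ≢ j → length (N i j) ≡ 3
      size3 {i} {j} p with len3 i j
      ... | inj₁ q = q
      ... | inj₂ q = ⊥-elim (p q)

      short : ∀ (xs ys : List El) {k l} → length xs ≡ k → length ys ≡ l → length (xs ++ ys) ≡ k + l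
      short xs ys p q = trans (Lₚ.length-++ xs) (cong₂ _+_ p q)

      pick : ∀ (xs : List El) {k} → length xs ≡ k → k < 10 → ∃ λ y → y ∈ K × y ∈ᶠ xs ≡ false
      pick xs refl lt = avoidList o xs (ℕₚ.<-≤-trans lt 10≤n)

      single : ∀ {y : El} {c ys} → y ∈ᶠ (c ∷ ys) ≡ false → y ≢ c × y ∈ᶠ ys ≡ false
      single {y} {c} p with y Fₚ.≟ c
      ... | no q = q , p

      in3 : ∀ i j → i ≢ j → Three (λ x → S i j x ≡ true)
      in3 i j p = go (table conn-Z3 i j) (B.conn-ok wf i j) (B.conn-distinct wf i j) (trans (sym (Lₚ.length-map (Lab.φ Λ) (table conn-Z3 i j))) (size3 {i} {j} p))
        where
        open Lab Λ
        dis : ∀ {s t ss} → okL s ≡ true → okL t ≡ true → mem t (s ∷ ss) ≡ true → ∀ {u} → not (mem u (s ∷ ss)) ≡ true → u ≢ t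
        dis {s} {t} {ss} _ _ q {u} r refl = false≢true (not-true r) q
        go : ∀ ss → allᵇ okL ss ≡ true → B.distinct ss ≡ true → length ss ≡ 3 → Three (λ x → x ∈ᶠ map φ ss ≡ true)
        go (s₁ ∷ s₂ ∷ s₃ ∷ []) ok d refl with ∧-split {okL s₁} ok | ∧-split {not (mem s₁ (s₂ ∷ s₃ ∷ []))} d
        ... | o₁ , ok′ | d₁ , d′ with ∧-split {okL s₂} ok′ | ∧-split {not (mem s₂ (s₃ ∷ []))} d′
        ... | o₂ , ok″ | d₂ , _ with ∧-split {okL s₃} ok″
        ... | o₃ , _ = three {a = φ s₁} {b = φ s₂} {c = φ s₃} (λ q → dis {s₂} {s₂} {s₃ ∷ []} o₂ o₂ (∨-inj₁ _ (rfl s₂)) {s₁} d₁ (injL {s₁} {s₂} o₁ o₂ q))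
                (λ q → dis {s₂} {s₃} {s₃ ∷ []} o₂ o₃ (∨-inj₂ (eq s₃ s₂) (∨-inj₁ _ (rfl s₃))) {s₁} d₁ (injL {s₁} {s₃} o₁ o₃ q))
                (λ q → dis {s₃} {s₃} {[]} o₃ o₃ (∨-inj₁ _ (rfl s₃)) {s₂} d₂ (injL {s₂} {s₃} o₂ o₃ q))
                (B.∈φ wf (s₁ ∷ s₂ ∷ s₃ ∷ []) {s₁} (∨-inj₁ _ (rfl s₁)))
                (B.∈φ wf (s₁ ∷ s₂ ∷ s₃ ∷ []) {s₂} (∨-inj₂ (eq s₂ s₁) (∨-inj₁ _ (rfl s₂))))
                (B.∈φ wf (s₁ ∷ s₂ ∷ s₃ ∷ []) {s₃} (∨-inj₂ (eq s₃ s₁) (∨-inj₂ (eq s₃ s₂) (∨-inj₁ _ (rfl s₃)))))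

      out3 : ∀ i j → i ≢ j → Three (λ x → x ∈ K × S i j x ≡ false)
      out3 i j p with pick (N i j) (size3 {i} {j} p) (ℕₚ.m≤m+n 4 6)
      ... | y₁ , k₁ , q₁ with pick (y₁ ∷ N i j) (cong ℕ.suc (size3 {i} {j} p)) (ℕₚ.m≤m+n 5 5)
      ... | y₂ , k₂ , r₂ with pick (y₂ ∷ y₁ ∷ N i j) (cong (λ t → ℕ.suc (ℕ.suc t)) (size3 {i} {j} p)) (ℕₚ.m≤m+n 6 4)
      ... | y₃ , k₃ , r₃ with single {y₂} {y₁} {N i j} r₂ | single {y₃} {y₂} {y₁ ∷ N i j} r₃
      ... | d₁₂ , q₂ | d₂₃ , r₃′ with single {y₃} {y₁} {N i j} r₃′
      ... | d₁₃ , q₃ = three (≢-sym d₁₂) (≢-sym d₁₃) (≢-sym d₂₃) (k₁ , q₁) (k₂ , q₂) (k₃ , q₃)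

      shifted : ∀ {i j} y → i ≢ j → length (map (_· y) (N i j)) ≡ 3
      shifted {i} {j} y p = trans (Lₚ.length-map (_· y) (N i j)) (size3 {i} {j} p)

      star : Star K S
      star = record { same = same ; diff = diff }
        where
        same : ∀ i y → y ∈ K → y ≢ e → ∃ λ j → ∃ λ l → i ≢ j × i ≢ l × j ≢ l × ∃ λ z₁ → ∃ λ z₂ →
             z₁ ∈ K × z₂ ∈ K × S i j z₁ ≡ false × S i j (z₁ / y) ≡ false ×
             S i l z₂ ≡ false × S i l (z₂ / y) ≡ false × S j l (z₂ / z₁) ≡ false
        same i y _ _ with fin3-others i
        ... | j , l , i≢j , i≢l , j≢l with pick (N i j ++ map (_· y) (N i j)) (short (N i j) (map (_· y) (N i j)) (size3 {i} {j} i≢j) (shifted {i} {j} y i≢j)) (ℕₚ.m≤m+n 7 3)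
        ... | z₁ , k₁ , p with pick (N i l ++ (map (_· y) (N i l) ++ map (_· z₁) (N j l)))
                (short (N i l) (map (_· y) (N i l) ++ map (_· z₁) (N j l)) (size3 {i} {l} i≢l) (short (map (_· y) (N i l)) (map (_· z₁) (N j l)) (shifted {i} {l} y i≢l) (shifted {j} {l} z₁ j≢l))) ℕₚ.≤-refl
        ... | z₂ , k₂ , q with ∈ᶠ-++ (N i j) (map (_· y) (N i j)) p | ∈ᶠ-++ (N i l) (map (_· y) (N i l) ++ map (_· z₁) (N j l)) q
        ... | a₁ , a₂ | b₁ , q′ with ∈ᶠ-++ (map (_· y) (N i l)) (map (_· z₁) (N j l)) q′
        ... | b₂ , b₃ = j , l , i≢j , i≢l , j≢l , z₁ , z₂ , k₁ , k₂ , a₁ , shift-∉ (N i j) a₂ , b₁ , shift-∉ (N i l) b₂ , shift-∉ (N j l) b₃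
        diff : ∀ i j y → i ≢ j → y ∈ K → ∃ λ l → i ≢ l × j ≢ l ×
             (∃ λ z → z ∈ K × S i l z ≡ false × S j l (z / y) ≡ false) ×
             (S i j y ≡ false → Two λ z → z ∈ K × S i l z ≡ false × S j l (z / y) ≡ false)
        diff i j y i≢j _ with fin3-third i j i≢j
        ... | l , i≢l , j≢l with pick (N i l ++ map (_· y) (N j l)) (short (N i l) (map (_· y) (N j l)) (size3 {i} {l} i≢l) (shifted {j} {l} y j≢l)) (ℕₚ.m≤m+n 7 3)
        ... | z , k , p with pick (z ∷ N i l ++ map (_· y) (N j l)) (cong ℕ.suc (short (N i l) (map (_· y) (N j l)) (size3 {i} {l} i≢l) (shifted {j} {l} y j≢l))) (ℕₚ.m≤m+n 8 2)
        ... | z′ , k′ , p′ with single {z′} {z} {N i l ++ map (_· y) (N j l)} p′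
        ... | d , p″ with ∈ᶠ-++ (N i l) (map (_· y) (N j l)) p | ∈ᶠ-++ (N i l) (map (_· y) (N j l)) p″
        ... | a₁ , a₂ | b₁ , b₂ = l , i≢l , j≢l , (z , k , a₁ , shift-∉ (N j l) a₂) ,
              λ _ → two (≢-sym d) (k , a₁ , shift-∉ (N j l) a₂) (k′ , b₁ , shift-∉ (N j l) b₂)

      sym3 : Sym3 K S
      sym3 = record
        { isC = B.isC wf
        ; supp = λ {i} {j} p → case B.S-find wf {i} {j} p of λ { (s , _ , _ , q) → subst (_∈ K) (sym q) (φ∈ s) }
        ; rigid = B.base-rigid wf (7 ∷ []) patch-Z3 refl K (λ P h → gen-least a P (subst (_∈ P) φ7 (h {7} refl)))
        ; size = 3
        ; sz = λ i j p → trans (B.S-cnt wf i j) (trans (sym (Lₚ.length-map (Lab.φ Λ) (table conn-Z3 i j))) (size3 {i} {j} p))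
        ; in3 = in3
        ; out3 = out3 }

      good : Good K
      good = Reset.good K S sym3 star

    good-cyclic : ∀ {a n} → HasOrder a n → 8 ≤ n → Good (gen a)
    good-cyclic {a} {n} o p with n ℕₚ.≟ 8 | n ℕₚ.≟ 9
    ... | yes refl | _ = good-8 o
    ... | no _ | yes refl = good-9 o
    ... | no q | no r = Big.good o (ℕₚ.≤∧≢⇒< (ℕₚ.≤∧≢⇒< p (≢-sym q)) (≢-sym r))

-- Groups in which every element has order at most three

cnt-pos : ∀ {k} (f : Fin k → Bool) x → f x ≡ true → 1 ≤ cnt f
cnt-pos {suc k} f zero p rewrite p = s≤s z≤n
cnt-pos {suc k} f (suc x) p = ℕₚ.≤-trans (cnt-pos (f ∘ suc) x p) (ℕₚ.m≤n+m _ (b2n (f zero)))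

cnt-≤ : ∀ {k} (f : Fin k → Bool) → cnt f ≤ k
cnt-≤ {zero} f = z≤n
cnt-≤ {suc k} f with f zero
... | true  = s≤s (cnt-≤ (f ∘ suc))
... | false = ℕₚ.m≤n⇒m≤1+n (cnt-≤ (f ∘ suc))

module Analysis (G : FinGroup) where
  open Grp G
  open Labels G
  open LabelKinds G
  open SmallGroups G

  All : Sub → Set
  All K = ∀ x → x ∈ K

  missing : ∀ K → All K ⊎ (∃ λ x → x ∉ K)
  missing K with Fₚ.any? (λ x → Sub.mem K x Bₚ.≟ false)
  ... | yes p = inj₂ p
  ... | no q  = inj₁ λ x → case ∈? x K of λ { (inj₁ r) → r ; (inj₂ r) → ⊥-elim (q (x , r)) }

  -- Adjoining an element outside enlarges the subgroup strictly, so the fuel `order` suffices to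
  -- reach all of `G`.
  grow : ∀ {P : Sub → Set} → (∀ H g → g ∉ H → P H → P (adjoin H g)) → ∀ H → P H → ∃ λ K → P K × All K
  grow {P} step H₀ p₀ = go order H₀ (ℕₚ.m≤n+m order _) p₀
    where
    bigger : ∀ H g → g ∉ H → cnt (Sub.mem H) < cnt (Sub.mem (adjoin H g))
    bigger H g g∉ = subst (cnt (Sub.mem H) <_) (cnt-∖ (Sub.mem (adjoin H g)) (Sub.mem H) (λ x → adjoin-⊒ H g))
      (ℕₚ.+-monoˡ-≤ (cnt (Sub.mem H)) (cnt-pos (λ x → Sub.mem (adjoin H g) x ∧ not (Sub.mem H x)) g (cong₂ _∧_ (adjoin-∋ H g) (cong not g∉))))
    go : ∀ fuel H → order ≤ cnt (Sub.mem H) + fuel → P H → ∃ λ K → P K × All K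
    go fuel H le p with missing H
    ... | inj₁ all = H , p , all
    go zero H le p | inj₂ (g , g∉) = ⊥-elim (ℕₚ.<⇒≱ (ℕₚ.<-≤-trans (bigger H g g∉) (cnt-≤ _)) (subst (order ≤_) (ℕₚ.+-identityʳ _) le))
    go (suc f) H le p | inj₂ (g , g∉) = go f (adjoin H g) (ℕₚ.≤-trans le (subst (_≤ cnt (Sub.mem (adjoin H g)) + f) (sym (ℕₚ.+-suc _ f))
      (ℕₚ.+-monoˡ-≤ f (bigger H g g∉)))) (step H g g∉ p)

  anyF : ∀ {k} → (Fin k → Bool) → Bool
  anyF {zero}  f = false
  anyF {suc k} f = f zero ∨ anyF (f ∘ suc)

  anyF-find : ∀ {k} (f : Fin k → Bool) → anyF f ≡ true → ∃ λ i → f i ≡ true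
  anyF-find {suc k} f p with ∨-split {f zero} p
  ... | inj₁ q = zero , q
  ... | inj₂ q with anyF-find (f ∘ suc) q
  ... | i , r = suc i , r

  -- The labelling goes from the table to `G`, where it can be evaluated; the isomorphism asked for
  -- is its inverse.
  module Iso (Λ : CLab) (T : FinTable) (lab : Fin (FinTable.size T) → CLab.L Λ) where
    open CLab Λ
    open FinTable T
    open BoolEq E using (eq; sound; rfl; all-mem)

    homCk : Fin size → Fin size → Bool
    homCk i j = eq (lab (op i j)) (mul (lab i) (lab j))
    injCk : Fin size → Fin size → Bool
    injCk i j = not (eq (lab i) (lab j)) ∨ eqF i j
    surCk : L → Bool
    surCk u = anyF (λ i → eq u (lab i))

    isoCk : Bool
    isoCk = allF (λ i → allF (homCk i)) ∧ (allF (λ i → allF (injCk i)) ∧ (allᵇ surCk els ∧ allF (λ i → okL (lab i))))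

    iso : isoCk ≡ true → All image → G ≅ T
    iso ck all = f , (f-inj , f-sur) , f-hom
      where
      c₁ = ∧-split {allF (λ i → allF (homCk i))} ck
      c₂ = ∧-split {allF (λ i → allF (injCk i))} (proj₂ c₁)
      c₃ = ∧-split {allᵇ surCk els} (proj₂ c₂)
      ψ : Fin size → El
      ψ i = φ (lab i)
      okl : ∀ i → okL (lab i) ≡ true
      okl = allF-elim (λ i → okL (lab i)) (proj₂ c₃)
      ψ-hom : ∀ i j → ψ (op i j) ≡ ψ i · ψ j
      ψ-hom i j = trans (cong φ (sound (allF-elim (homCk i) (allF-elim (λ i → allF (homCk i)) (proj₁ c₁) i) j))) (hom (okl i) (okl j))
      ψ-inj : ∀ {i j} → ψ i ≡ ψ j → i ≡ j
      ψ-inj {i} {j} p with ∨-split {not (eq (lab i) (lab j))} (allF-elim (injCk i) (allF-elim (λ i → allF (injCk i)) (proj₁ c₂) i) j)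
      ... | inj₁ q = ⊥-elim (false≢true (not-true q) (subst (λ t → eq (lab i) t ≡ true) (inj (okl i) (okl j) p) (rfl (lab i))))
      ... | inj₂ q = eqF-sound q
      pre : ∀ y → ∃ λ i → ψ i ≡ y
      pre y with in-image (all y)
      ... | u , ou , refl with anyF-find (λ i → eq u (lab i)) (all-mem surCk els (proj₁ c₃) (complete ou))
      ... | i , q = i , cong φ (sym (sound q))
      f : El → Fin size
      f y = proj₁ (pre y)
      ψf : ∀ y → ψ (f y) ≡ y
      ψf y = proj₂ (pre y)
      f-inj : ∀ {x y} → f x ≡ f y → x ≡ y
      f-inj {x} {y} p = trans (sym (ψf x)) (trans (cong ψ p) (ψf y))
      f-sur : ∀ i → ∃ λ x → ∀ {z} → z ≡ x → f z ≡ i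
      f-sur i = ψ i , λ { refl → ψ-inj (ψf (ψ i)) }
      f-hom : ∀ x y → f (x · y) ≡ op (f x) (f y)
      f-hom x y = ψ-inj (trans (ψf (x · y)) (sym (trans (ψ-hom (f x) (f y)) (cong₂ _·_ (ψf x) (ψf y)))))

  gen-image : ∀ {a n} (o : HasOrder a n) → gen a ⊑ CLab.image (modLab o)
  gen-image {a} {n} o = gen-least a (CLab.image (modLab o)) (a∈ n o)
    where
    a∈ : ∀ n (o : HasOrder a n) → a ∈ CLab.image (modLab o)
    a∈ zero o = ⊥-elim (ℕₚ.<⇒≱ (HasOrder.pos o) z≤n)
    a∈ (suc zero) o = subst (_∈ CLab.image (modLab o)) (trans (sym (HasOrder.pow-n o)) (^1 a)) (e∈ (CLab.image (modLab o)))
    a∈ (suc (suc n)) o = subst (_∈ CLab.image (modLab o)) (^1 a) (CLab.to-image (modLab o) {1} refl)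

  gen-pow : ∀ {a n} → HasOrder a n → ∀ {y} → y ∈ gen a → ∃ λ k → k < n × y ≡ a ^ k
  gen-pow o p with CLab.in-image (modLab o) (gen-image o p)
  ... | k , ok , q = k , <ᵇ-sound ok , q

  all-image : ∀ {a n} (o : HasOrder a n) → All (gen a) → All (CLab.image (modLab o))
  all-image o f x = gen-image o (f x)

  iso-1 : (∀ x → x ≡ e) → G ≅ Cyc 1
  iso-1 f = Iso.iso (modLab o) (Cyc 1) toℕ refl λ x → subst (_∈ CLab.image (modLab o)) (sym (f x)) (e∈ (CLab.image (modLab o)))
    where
    o : HasOrder e 1
    o = record { pos = s≤s z≤n ; pow-n = idˡ e ; least = λ { (suc k) _ (s≤s ()) } }
  iso-2 : ∀ {a} → HasOrder a 2 → All (gen a) → G ≅ Cyc 2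
  iso-2 o f = Iso.iso (modLab o) (Cyc 2) toℕ refl (all-image o f)
  iso-3 : ∀ {a} → HasOrder a 3 → All (gen a) → G ≅ Cyc 3
  iso-3 o f = Iso.iso (modLab o) (Cyc 3) toℕ refl (all-image o f)
  iso-4 : ∀ {a} → HasOrder a 4 → All (gen a) → G ≅ Cyc 4
  iso-4 o f = Iso.iso (modLab o) (Cyc 4) toℕ refl (all-image o f)
  iso-5 : ∀ {a} → HasOrder a 5 → All (gen a) → G ≅ Cyc 5
  iso-5 o f = Iso.iso (modLab o) (Cyc 5) toℕ refl (all-image o f)

  ord3 : ∀ {x} → x ^ 3 ≡ e → x ≢ e → HasOrder x 3
  ord3 {x} p q = record { pos = s≤s z≤n ; pow-n = p ; least = λ
    { (suc zero) _ _ r → q (trans (sym (^1 x)) r)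
    ; (suc (suc zero)) _ _ r → q (trans (sym (^1 x)) (·-cancelˡ (x ^ 2) (trans (grp (x ∷ []) (v0 ⊙ (v0 ⊙ ε) ⊙ (v0 ⊙ ε)) (v0 ⊙ (v0 ⊙ (v0 ⊙ ε))) refl)
        (trans p (sym (trans (idʳ _) r))))))
    ; (suc (suc (suc k))) _ (s≤s (s≤s (s≤s ()))) } }

  iso-V : ∀ {a b} → a · a ≡ e → a ≢ e → b · b ≡ e → b ∉ gen a → b · a ≡ a · b → All (adjoin (gen a) b) → G ≅ C2²
  iso-V {a} {b} aa a≢e bb b∉ ba all = Iso.iso Λ′ C2² (λ i → table2 (toℕ i)) refl λ x → V⊑ (all x)
    where
    open Comm (modLab (ord2 aa a≢e)) (gen a) (λ {u} _ → ^∈gen a u) b 2 (s≤s z≤n) (λ {u} _ → comm-pow ba u) (x^2 bb) (out2 {gen a} b∉)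
    table2 : ℕ → ℕ × ℕ
    table2 0 = 0 , 0
    table2 1 = 1 , 0
    table2 2 = 0 , 1
    table2 _ = 1 , 1
    V⊑ : adjoin (gen a) b ⊑ CLab.image Λ′
    V⊑ = adjoin-least (gen a) b (CLab.image Λ′) (gen-least a (CLab.image Λ′) (subst (_∈ CLab.image Λ′) (trans (idʳ _) (^1 a)) (CLab.to-image Λ′ {1 , 0} refl)))
      (subst (_∈ CLab.image Λ′) (trans (idˡ _) (^1 b)) (CLab.to-image Λ′ {0 , 1} refl))

  iso-D6 : ∀ {c t} → HasOrder c 3 → t ∉ gen c → t · c ≡ c ^ 2 · t → t · t ≡ e → All (adjoin (gen c) t) → G ≅ D6
  iso-D6 {c} {t} o t∉ tc tt′ all = Iso.iso Λ D6 (λ i → tab (toℕ i)) refl λ x → least (CLab.image Λ)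
      (λ {g} p → CLab.to-image Λ {g} (BoolEq.all-mem (CLab.E Λ) (CLab.okL Λ) gens {g} refl p)) (all x)
    where
    open Cyclic2 c t 3 o t∉ 2 0 tc tt′ (s≤s z≤n)
    tab : ℕ → ℕ × ℕ
    tab 0 = 0 , 0
    tab 1 = 1 , 0
    tab 2 = 2 , 0
    tab 3 = 0 , 1
    tab 4 = 1 , 1
    tab _ = 2 , 1

  -- `c33` and `a4` record only a subgroup, because a graph over it can be enlarged to `G`. The
  -- other constructors describe all of `G`, which is needed to recognise the exceptions.
  data Small : Set where
    trivialG : (∀ x → x ≡ e) → Small
    exp2     : (∀ x → x · x ≡ e) → ∀ a → a ≢ e → Small
    c3       : ∀ c → HasOrder c 3 → All (gen c) → Small
    c33      : ∀ a b → HasOrder a 3 → b ^ 3 ≡ e → b ∉ gen a → b · a ≡ a · b → Small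
    a4       : ∀ a b c → a · a ≡ e → a ≢ e → b · b ≡ e → b ∉ gen a → c ^ 3 ≡ e → c ∉ adjoin (gen a) b →
               b · a ≡ a · b → c · a ≡ b · c → c · b ≡ (a · b) · c → Small
    s3       : ∀ c t → HasOrder c 3 → t ∉ gen c → t · c ≡ c ^ 2 · t → t · t ≡ e → All (adjoin (gen c) t) → Small

  module Small3 (le3 : ∀ x → (x ≡ e) ⊎ (x ≢ e × x · x ≡ e) ⊎ (x ≢ e × x ^ 3 ≡ e)) where
    cube : ∀ {x} → x ^ 3 ≡ e → x · x ≡ inv x
    cube {x} p = sym (inv-uniq x (x · x) (trans (grp (x ∷ []) (v0 ⊙ (v0 ⊙ v0)) (v0 ⊙ (v0 ⊙ (v0 ⊙ ε))) refl) p))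

    involution : ∀ {x} → x · x ≡ e → inv x ≡ x
    involution {x} p = inv-uniq x x p

    not3∧2 : ∀ {x} → x ^ 3 ≡ e → x · x ≡ e → x ≡ e
    not3∧2 {x} p q = trans (sym (trans (cong (x ·_) (trans (cong (x ·_) (^1 x)) q)) (idʳ x))) p

    not-gen : ∀ {c t} → HasOrder c 3 → t · t ≡ e → t ≢ e → t ∉ gen c
    not-gen {c} {t} o tt′ t≢e = ≢true λ p → t≢e (case gen-pow o p of λ { (k , _ , refl) → not3∧2 (pw k) tt′ })
      where
      pw : ∀ k → (c ^ k) ^ 3 ≡ e
      pw k = trans (sym (^-* c 3 k)) (trans (cong (c ^_) (ℕₚ.*-comm 3 k)) (trans (^-* c k 3) (trans (cong (_^ k) (HasOrder.pow-n o)) (e^ k))))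

    -- These are the relations of the triangle presentation (2, 3, 3) of A₄: `t` and its conjugate
    -- `b` generate a Klein four-group normalised by `c`.
    mk-a4 : ∀ c t → c ≢ e → c ^ 3 ≡ e → t ≢ e → t · t ≡ e → (c · t) ^ 3 ≡ e → Small
    mk-a4 c t c≢e c3′ t≢e tt′ ct3 = a4 t b c tt′ t≢e bb b∉ c3′ c∉ ba ca cb
      where
      b = c · (t · inv c)
      ca : c · t ≡ b · c
      ca = grp (c ∷ t ∷ []) (v0 ⊙ v1) (v0 ⊙ (v1 ⊙ v0 ⁻) ⊙ v0) refl
      bb : b · b ≡ e
      bb = trans (grp (c ∷ t ∷ []) (v0 ⊙ (v1 ⊙ v0 ⁻) ⊙ (v0 ⊙ (v1 ⊙ v0 ⁻))) (v0 ⊙ ((v1 ⊙ v1) ⊙ v0 ⁻)) refl)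
             (trans (cong (λ s → c · (s · inv c)) tt′) (grp (c ∷ []) (v0 ⊙ (ε ⊙ v0 ⁻)) ε refl))
      -- (ct)³ = 1 says t c t = c⁻¹ t c⁻¹
      key : t · (c · t) ≡ inv c · (t · inv c)
      key = trans (sym (inv-uniq _ _ (trans (grp (c ∷ t ∷ []) (v0 ⊙ (v1 ⁻ ⊙ v0) ⊙ (v1 ⊙ (v0 ⊙ v1))) (v0 ⊙ v1 ⁻ ⊙ v0 ⊙ v1 ⊙ v0 ⊙ v1) refl)
            (trans (cong (λ s → ((((c · s) · c) · t) · c) · t) (involution tt′)) (trans (grp (c ∷ t ∷ []) (v0 ⊙ v1 ⊙ v0 ⊙ v1 ⊙ v0 ⊙ v1) (v0 ⊙ v1 ⊙ (v0 ⊙ v1 ⊙ (v0 ⊙ v1 ⊙ ε))) refl) ct3)))))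
            (trans (grp (c ∷ t ∷ []) ((v0 ⊙ (v1 ⁻ ⊙ v0)) ⁻) (v0 ⁻ ⊙ (v1 ⊙ v0 ⁻)) refl) refl)
      cb : c · b ≡ (t · b) · c
      cb = begin
        c · (c · (t · inv c)) ≡⟨ grp (c ∷ t ∷ []) (v0 ⊙ (v0 ⊙ (v1 ⊙ v0 ⁻))) (v0 ⊙ v0 ⊙ (v1 ⊙ v0 ⁻)) refl ⟩
        (c · c) · (t · inv c) ≡⟨ cong (_· (t · inv c)) (cube c3′) ⟩
        inv c · (t · inv c) ≡⟨ key ⟨
        t · (c · t) ≡⟨ grp (c ∷ t ∷ []) (v1 ⊙ (v0 ⊙ v1)) (v1 ⊙ (v0 ⊙ (v1 ⊙ v0 ⁻)) ⊙ v0) refl ⟩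
        (t · (c · (t · inv c))) · c ∎
        where open ≡-Reasoning
      ba : b · t ≡ t · b
      ba = begin
        b · t ≡⟨ cong₂ _·_ (involution bb) (involution tt′) ⟨
        inv b · inv t ≡⟨ inv-· t b ⟨
        inv (t · b) ≡⟨ involution tbtb ⟩
        t · b ∎
        where
        open ≡-Reasoning
        tb : t · b ≡ c · (b · inv c)
        tb = trans (grp (t ∷ b ∷ c ∷ []) (v0 ⊙ v1) (v0 ⊙ v1 ⊙ v2 ⊙ v2 ⁻) refl) (trans (cong (_· inv c) (sym cb)) (assoc _ _ _))
        tbtb : (t · b) · (t · b) ≡ e
        tbtb = trans (cong₂ _·_ tb tb) (trans (grp (c ∷ b ∷ []) (v0 ⊙ (v1 ⊙ v0 ⁻) ⊙ (v0 ⊙ (v1 ⊙ v0 ⁻))) (v0 ⊙ ((v1 ⊙ v1) ⊙ v0 ⁻)) refl)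
             (trans (cong (λ s → c · (s · inv c)) bb) (grp (c ∷ []) (v0 ⊙ (ε ⊙ v0 ⁻)) ε refl)))
      b≢t : b ≢ t
      b≢t p = t≢e (trans (sym (trans (cong (t ·_) tt′) (idʳ t))) (trans t3 ct3))
        where
        tc : t · c ≡ c · t
        tc = trans (cong (_· c) (sym p)) (sym ca)
        t3 : t · (t · t) ≡ (c · t) ^ 3
        t3 = sym (begin
          (c · t) · ((c · t) · ((c · t) · e)) ≡⟨ grp (c ∷ t ∷ []) (v0 ⊙ v1 ⊙ (v0 ⊙ v1 ⊙ (v0 ⊙ v1 ⊙ ε))) (v0 ⊙ (v1 ⊙ v0) ⊙ v1 ⊙ (v0 ⊙ v1)) refl ⟩
          ((c · (t · c)) · t) · (c · t) ≡⟨ cong (λ s → ((c · s) · t) · (c · t)) tc ⟩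
          ((c · (c · t)) · t) · (c · t) ≡⟨ cong (((c · (c · t)) · t) ·_) (sym tc) ⟩
          ((c · (c · t)) · t) · (t · c) ≡⟨ grp (c ∷ t ∷ []) (v0 ⊙ (v0 ⊙ v1) ⊙ v1 ⊙ (v1 ⊙ v0)) (v0 ⊙ (v0 ⊙ ((v1 ⊙ v1) ⊙ (v1 ⊙ v0)))) refl ⟩
          c · (c · ((t · t) · (t · c))) ≡⟨ cong (λ s → c · (c · (s · (t · c)))) tt′ ⟩
          c · (c · (e · (t · c))) ≡⟨ cong (λ s → c · (c · (e · s))) tc ⟩
          c · (c · (e · (c · t))) ≡⟨ grp (c ∷ t ∷ []) (v0 ⊙ (v0 ⊙ (ε ⊙ (v0 ⊙ v1)))) (v0 ⊙ (v0 ⊙ (v0 ⊙ ε)) ⊙ v1) refl ⟩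
          c ^ 3 · t ≡⟨ cong (_· t) c3′ ⟩
          e · t ≡⟨ idˡ t ⟩
          t ≡⟨ idʳ t ⟨
          t · e ≡⟨ cong (t ·_) tt′ ⟨
          t · (t · t) ∎)
          where open ≡-Reasoning
      b≢e : b ≢ e
      b≢e p = t≢e (trans (grp (c ∷ t ∷ []) v1 (v0 ⁻ ⊙ (v0 ⊙ (v1 ⊙ v0 ⁻)) ⊙ v0) refl) (trans (cong (λ s → (inv c · s) · c) p) (grp (c ∷ []) (v0 ⁻ ⊙ ε ⊙ v0) ε refl)))
      b∉ : b ∉ gen t
      b∉ = ≢true λ p → case gen-pow (ord2 tt′ t≢e) p of λ
        { (zero , _ , q) → b≢e q ; (suc zero , _ , q) → b≢t (trans q (^1 t)) ; (suc (suc k) , s≤s (s≤s ()) , _) }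
      Cent : Sub
      Cent = fromDec {λ y → y · t ≡ t · y} (λ y → y · t Fₚ.≟ t · y) (trans (idˡ t) (sym (idʳ t)))
        (λ {x} {y} p q → trans (assoc x y t) (trans (cong (x ·_) q) (trans (sym (assoc x t y)) (trans (cong (_· y) p) (assoc t x y)))))
        (λ {x} p → ·-cancelˡ x (trans (grp (x ∷ t ∷ []) (v0 ⊙ (v0 ⁻ ⊙ v1)) (v1 ⊙ v0 ⊙ v0 ⁻) refl) (trans (cong (_· inv x) (sym p)) (assoc _ _ _))))
      -- ⟨t, b⟩ centralises `t`; if `c` did too, its conjugate `b` of `t` would equal `t`.
      c∉ : c ∉ adjoin (gen t) b
      c∉ = ≢true λ p → b≢t (·-cancelʳ c (trans (sym ca) (⌊⌋-sound (c · t Fₚ.≟ t · c)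
        (adjoin-least (gen t) b Cent (gen-least t Cent (⌊⌋-true (t · t Fₚ.≟ t · t) refl)) (⌊⌋-true (b · t Fₚ.≟ t · b) ba) p))))

    -- In a group of exponent 3 every element commutes with its conjugates.
    exp3 : (∀ x → x ^ 3 ≡ e) → ∀ c → c ≢ e → Small
    exp3 f c c≢e with missing (gen c)
    ... | inj₁ all = c3 c (ord3 (f c) c≢e) all
    ... | inj₂ (b , b∉) with ∈? (b · (c · inv b)) (gen c)
    ... | inj₂ q = c33 c (b · (c · inv b)) (ord3 (f c) c≢e) (f _) q (sym (begin
        c · (b · (c · inv b)) ≡⟨ cong (λ s → c · (b · (c · s))) (cube (f b)) ⟨
        c · (b · (c · (b · b))) ≡⟨ grp (b ∷ c ∷ []) (v1 ⊙ (v0 ⊙ (v1 ⊙ (v0 ⊙ v0)))) (v1 ⊙ (v0 ⊙ v1 ⊙ v0) ⊙ v0) refl ⟩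
        (c · ((b · c) · b)) · b ≡⟨ cong (λ s → (c · s) · b) (w b) ⟩
        (c · ((inv c · inv b) · inv c)) · b ≡⟨ grp (b ∷ c ∷ []) (v1 ⊙ (v1 ⁻ ⊙ v0 ⁻ ⊙ v1 ⁻) ⊙ v0) (v0 ⁻ ⊙ v1 ⁻ ⊙ v0) refl ⟩
        (inv b · inv c) · b ≡⟨ cong (λ s → (s · inv c) · b) (cube (f b)) ⟨
        ((b · b) · inv c) · b ≡⟨ grp (b ∷ c ∷ []) (v0 ⊙ v0 ⊙ v1 ⁻ ⊙ v0) (v0 ⊙ (v0 ⁻ ⊙ v1 ⊙ v0 ⁻) ⁻) refl ⟩
        b · inv ((inv b · c) · inv b) ≡⟨ cong (λ s → b · inv s) (w (inv b)) ⟩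
        b · inv ((inv c · inv (inv b)) · inv c) ≡⟨ grp (b ∷ c ∷ []) (v0 ⊙ (v1 ⁻ ⊙ v0 ⁻ ⁻ ⊙ v1 ⁻) ⁻) (v0 ⊙ (v1 ⊙ v0 ⁻) ⊙ v1) refl ⟩
        (b · (c · inv b)) · c ∎))
      where
      open ≡-Reasoning
      w : ∀ y → (y · c) · y ≡ (inv c · inv y) · inv c
      w y = trans (sym (inv-uniq _ _ (trans (grp (y ∷ c ∷ []) (v1 ⊙ v0 ⊙ v1 ⊙ (v0 ⊙ v1 ⊙ v0)) (v1 ⊙ v0 ⊙ (v1 ⊙ v0 ⊙ (v1 ⊙ v0 ⊙ ε))) refl) (f (c · y)))))
        (grp (y ∷ c ∷ []) ((v1 ⊙ v0 ⊙ v1) ⁻) (v1 ⁻ ⊙ v0 ⁻ ⊙ v1 ⁻) refl)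
    ... | inj₁ q with gen-pow (ord3 (f c) c≢e) q
    ... | zero , _ , r = ⊥-elim (c≢e (trans (grp (b ∷ c ∷ []) v1 (v0 ⁻ ⊙ (v0 ⊙ (v1 ⊙ v0 ⁻)) ⊙ v0) refl) (trans (cong (λ s → (inv b · s) · b) r) (grp (b ∷ []) (v0 ⁻ ⊙ ε ⊙ v0) ε refl))))
    ... | suc zero , _ , r = c33 c b (ord3 (f c) c≢e) (f b) b∉ (trans (grp (b ∷ c ∷ []) (v0 ⊙ v1) (v0 ⊙ (v1 ⊙ v0 ⁻) ⊙ v0) refl) (cong (_· b) (trans r (^1 c))))
    ... | suc (suc zero) , _ , r = ⊥-elim (c≢e (not3∧2 (f c) (trans (sym (cong (c ·_) inv-c)) (invʳ c))))
      where
      -- conjugation by b inverts c, hence so does conjugation by b³ = 1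
      bc : b · c ≡ inv c · b
      bc = trans (grp (b ∷ c ∷ []) (v0 ⊙ v1) (v0 ⊙ (v1 ⊙ v0 ⁻) ⊙ v0) refl) (cong (_· b) (trans r (trans (cong (c ·_) (^1 c)) (cube (f c)))))
      bc⁻ : b · inv c ≡ c · b
      bc⁻ = trans (grp (b ∷ c ∷ []) (v0 ⊙ v1 ⁻) (v1 ⊙ (v1 ⁻ ⊙ v0) ⊙ v1 ⁻) refl) (trans (cong (λ s → (c · s) · inv c) (sym bc)) (grp (b ∷ c ∷ []) (v1 ⊙ (v0 ⊙ v1) ⊙ v1 ⁻) (v1 ⊙ v0) refl))
      inv-c : inv c ≡ c
      inv-c = sym (begin
        c ≡⟨ idˡ c ⟨
        e · c ≡⟨ cong (_· c) (f b) ⟨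
        b ^ 3 · c ≡⟨ grp (b ∷ c ∷ []) (v0 ⊙ (v0 ⊙ (v0 ⊙ ε)) ⊙ v1) (v0 ⊙ (v0 ⊙ (v0 ⊙ v1))) refl ⟩
        b · (b · (b · c)) ≡⟨ cong (λ s → b · (b · s)) bc ⟩
        b · (b · (inv c · b)) ≡⟨ grp (b ∷ c ∷ []) (v0 ⊙ (v0 ⊙ (v1 ⁻ ⊙ v0))) (v0 ⊙ (v0 ⊙ v1 ⁻) ⊙ v0) refl ⟩
        (b · (b · inv c)) · b ≡⟨ cong (λ s → (b · s) · b) bc⁻ ⟩
        (b · (c · b)) · b ≡⟨ grp (b ∷ c ∷ []) (v0 ⊙ (v1 ⊙ v0) ⊙ v0) (v0 ⊙ v1 ⊙ (v0 ⊙ v0)) refl ⟩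
        (b · c) · (b · b) ≡⟨ cong (_· (b · b)) bc ⟩
        (inv c · b) · (b · b) ≡⟨ grp (b ∷ c ∷ []) (v1 ⁻ ⊙ v0 ⊙ (v0 ⊙ v0)) (v1 ⁻ ⊙ (v0 ⊙ (v0 ⊙ (v0 ⊙ ε)))) refl ⟩
        inv c · b ^ 3 ≡⟨ cong (inv c ·_) (f b) ⟩
        inv c · e ≡⟨ idʳ _ ⟩
        inv c ∎)
        where open ≡-Reasoning
    ... | suc (suc (suc k)) , s≤s (s≤s (s≤s ())) , _

    is3 is2 : El → Set
    is3 c = c ≢ e × c ^ 3 ≡ e
    is2 t = t ≢ e × t · t ≡ e
    is3? : ∀ c → Dec (is3 c)
    is3? c = ¬? (c Fₚ.≟ e) ×-dec (c ^ 3 Fₚ.≟ e)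
    is2? : ∀ t → Dec (is2 t)
    is2? t = ¬? (t Fₚ.≟ e) ×-dec (t · t Fₚ.≟ e)

    -- From here on every involution inverts every element of order 3.
    inverting : (∀ c t → is3 c → is2 t → (c · t) ^ 3 ≢ e) → ∀ c t → is3 c → is2 t → Small
    inverting none c t (c≢e , c3′) (t≢e , tt′) with Fₚ.any? (λ d → is3? d ×-dec (Sub.mem (gen c) d Bₚ.≟ false))
    ... | yes (d , (d≢e , d3) , d∉) = c33 c d (ord3 c3′ c≢e) d3 d∉ (dc (le3 (c · d)))
      where
      invt : ∀ c → is3 c → (t · c) · t ≡ inv c
      invt c (c≢e , cc3) with le3 (c · t)
      ... | inj₁ q = ⊥-elim (false≢true (not-gen (ord3 cc3 c≢e) tt′ t≢e) (subst (_∈ gen c) (inv-uniq c t q) (inv∈ (gen c) (gen-∋ c))))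
      ... | inj₂ (inj₂ (_ , q)) = ⊥-elim (none c t (c≢e , cc3) (t≢e , tt′) q)
      ... | inj₂ (inj₁ (_ , q)) = sym (inv-uniq c _ (trans (grp (c ∷ t ∷ []) (v0 ⊙ (v1 ⊙ v0 ⊙ v1)) (v0 ⊙ v1 ⊙ (v0 ⊙ v1)) refl) q))
      -- If c d were an involution, then c⁻¹ (c d) = d would have order 3 against `none`. If c d has
      -- order 3 it is inverted by `t`, as are c and d, and comparing the two forms of (c d)⁻¹ shows
      -- that c and d commute.
      dc : (c · d ≡ e) ⊎ (c · d ≢ e × (c · d) · (c · d) ≡ e) ⊎ (c · d ≢ e × (c · d) ^ 3 ≡ e) → d · c ≡ c · d
      dc (inj₁ q) = ⊥-elim (false≢true d∉ (subst (_∈ gen c) (inv-uniq c d q) (inv∈ (gen c) (gen-∋ c))))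
      dc (inj₂ (inj₁ (n , q))) = ⊥-elim (none (inv c) (c · d) ((λ r → c≢e (inv-injective (trans r (sym inv-e)))) ,
         trans (grp (c ∷ []) (v0 ⁻ ⊙ (v0 ⁻ ⊙ (v0 ⁻ ⊙ ε))) ((v0 ⊙ (v0 ⊙ (v0 ⊙ ε))) ⁻) refl) (trans (cong inv c3′) inv-e)) (n , q)
         (trans (cong (_^ 3) (grp (c ∷ d ∷ []) (v0 ⁻ ⊙ (v0 ⊙ v1)) v1 refl)) d3))
      dc (inj₂ (inj₂ (n , q))) = inv-injective (begin
        inv (d · c) ≡⟨ inv-· d c ⟩
        inv c · inv d ≡⟨ cong₂ _·_ (invt c (c≢e , c3′)) (invt d (d≢e , d3)) ⟨
        ((t · c) · t) · ((t · d) · t) ≡⟨ grp (c ∷ d ∷ t ∷ []) (v2 ⊙ v0 ⊙ v2 ⊙ (v2 ⊙ v1 ⊙ v2)) (v2 ⊙ (v0 ⊙ ((v2 ⊙ v2) ⊙ v1)) ⊙ v2) refl ⟩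
        (t · (c · ((t · t) · d))) · t ≡⟨ cong (λ s → (t · (c · (s · d))) · t) tt′ ⟩
        (t · (c · (e · d))) · t ≡⟨ cong (λ s → (t · (c · s)) · t) (idˡ d) ⟩
        (t · (c · d)) · t ≡⟨ invt (c · d) (n , q) ⟩
        inv (c · d) ∎)
        where open ≡-Reasoning
    ... | no none′ = s3 c t (ord3 c3′ c≢e) (not-gen (ord3 c3′ c≢e) tt′ t≢e) tc tt′ all
      where
      K = adjoin (gen c) t
      invs : ∀ s → is2 s → (s · c) · s ≡ inv c
      invs s (s≢e , ss) with le3 (c · s)
      ... | inj₁ q = ⊥-elim (false≢true (not-gen (ord3 c3′ c≢e) ss s≢e) (subst (_∈ gen c) (inv-uniq c s q) (inv∈ (gen c) (gen-∋ c))))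
      ... | inj₂ (inj₂ (_ , q)) = ⊥-elim (none c s (c≢e , c3′) (s≢e , ss) q)
      ... | inj₂ (inj₁ (_ , q)) = sym (inv-uniq c _ (trans (grp (c ∷ s ∷ []) (v0 ⊙ (v1 ⊙ v0 ⊙ v1)) (v0 ⊙ v1 ⊙ (v0 ⊙ v1)) refl) q))
      tc : t · c ≡ c ^ 2 · t
      tc = begin
        t · c ≡⟨ idʳ _ ⟨
        (t · c) · e ≡⟨ cong ((t · c) ·_) tt′ ⟨
        (t · c) · (t · t) ≡⟨ assoc _ _ _ ⟨
        ((t · c) · t) · t ≡⟨ cong (_· t) (invs t (t≢e , tt′)) ⟩
        inv c · t ≡⟨ cong (_· t) (trans (cong (c ·_) (^1 c)) (cube c3′)) ⟨
        c ^ 2 · t ∎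
        where open ≡-Reasoning
      ing : ∀ y → is3 y → y ∈ gen c
      ing y p = case ∈? y (gen c) of λ { (inj₁ q) → q ; (inj₂ q) → ⊥-elim (none′ (y , p , q)) }
      all : All K
      all y with le3 y
      ... | inj₁ refl = e∈ K
      ... | inj₂ (inj₂ p) = adjoin-⊒ (gen c) t (ing y p)
      ... | inj₂ (inj₁ (y≢e , yy)) with le3 (y · t)
      ... | inj₁ q = inv∈⁻ K (subst (_∈ K) (sym (inv-uniq y t q)) (adjoin-∋ (gen c) t))
      ... | inj₂ (inj₂ p) = subst (_∈ K) (trans (assoc y t t) (trans (cong (y ·_) tt′) (idʳ y))) (·∈ K (adjoin-⊒ (gen c) t (ing (y · t) p)) (adjoin-∋ (gen c) t))
      -- If y t were an involution it would invert `c`; but y and t both invert `c`, so y t fixes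
      -- it, and `c` would equal its inverse.
      ... | inj₂ (inj₁ (n , q)) = ⊥-elim (c≢e (not3∧2 c3′ (trans (sym (cong (c ·_) (trans (sym (invs (y · t) (n , q))) fixes))) (invʳ c))))
        where
        open ≡-Reasoning
        fixes : ((y · t) · c) · (y · t) ≡ c
        fixes = begin
          ((y · t) · c) · (y · t) ≡⟨ cong (((y · t) · c) ·_) (trans (sym (involution q)) (trans (inv-· y t) (cong₂ _·_ (involution tt′) (involution yy)))) ⟩
          ((y · t) · c) · (t · y) ≡⟨ grp (y ∷ t ∷ c ∷ []) (v0 ⊙ v1 ⊙ v2 ⊙ (v1 ⊙ v0)) (v0 ⊙ (v1 ⊙ v2 ⊙ v1) ⊙ v0) refl ⟩
          (y · ((t · c) · t)) · y ≡⟨ cong (λ s → (y · s) · y) (invs t (t≢e , tt′)) ⟩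
          (y · inv c) · y ≡⟨ cong₂ (λ p q → (p · inv c) · q) (sym (involution yy)) (sym (involution yy)) ⟩
          (inv y · inv c) · inv y ≡⟨ grp (y ∷ c ∷ []) (v0 ⁻ ⊙ v1 ⁻ ⊙ v0 ⁻) ((v0 ⊙ v1 ⊙ v0) ⁻) refl ⟩
          inv ((y · c) · y) ≡⟨ cong inv (invs y (y≢e , yy)) ⟩
          inv (inv c) ≡⟨ inv-inv c ⟩
          c ∎

    small : Small
    small with Fₚ.any? is3?
    ... | no none with Fₚ.any? is2?
    ... | no none₂ = trivialG λ x → case le3 x of λ { (inj₁ p) → p ; (inj₂ (inj₁ p)) → ⊥-elim (none₂ (x , p)) ; (inj₂ (inj₂ p)) → ⊥-elim (none (x , p)) }
    ... | yes (a , a≢e , _) = exp2 (λ x → case le3 x of λ { (inj₁ refl) → idˡ e ; (inj₂ (inj₁ p)) → proj₂ p ; (inj₂ (inj₂ p)) → ⊥-elim (none (x , p)) }) a a≢e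
    small | yes (c , cc) with Fₚ.any? is2?
    ... | no none₂ = exp3 (λ x → case le3 x of λ { (inj₁ refl) → trans (cong (e ·_) (trans (cong (e ·_) (idˡ e)) (idˡ e))) (idˡ e) ; (inj₂ (inj₁ p)) → ⊥-elim (none₂ (x , p)) ; (inj₂ (inj₂ p)) → proj₂ p }) c (proj₁ cc)
    ... | yes (t , tt′) with Fₚ.any? (λ c → Fₚ.any? λ t → is3? c ×-dec (is2? t ×-dec ((c · t) ^ 3 Fₚ.≟ e)))
    ... | yes (c′ , t′ , (p , q) , (r , s) , u) = mk-a4 c′ t′ p q r s u
    ... | no none = inverting (λ c t p q r → none (c , t , p , q , r)) c t cc tt′

-- Irredundant generating sequences

module Chains (G : FinGroup) where
  open Grp G
  open Analysis G

  -- An irredundant sequence of generators g 1 , … , g r of K over H, with g 0 = e.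
  record Chain (H K : Sub) : Set where
    field
      r     : ℕ
      g     : ℕ → El
      Ks    : ℕ → Sub
      g0    : g 0 ≡ e
      H⊑    : H ⊑ Ks 0
      fresh : ∀ i → i < r → g (suc i) ∉ Ks i
      mono  : ∀ i → i < r → Ks i ⊑ Ks (suc i)
      memb  : ∀ i → i < r → g (suc i) ∈ Ks (suc i)
      top   : Ks r ⊑ K
      least : ∀ P → H ⊑ P → (∀ i → i < r → g (suc i) ∈ P) → K ⊑ P

  chain : ∀ H → ∃ λ K → Chain H K × All K
  chain H = grow {Chain H} step H (record
    { r = 0 ; g = λ _ → e ; Ks = λ _ → H ; g0 = refl ; H⊑ = id ; fresh = λ _ () ; mono = λ _ () ; memb = λ _ () ; top = id ; least = λ P h _ → h })
    where
    step : ∀ K x → x ∉ K → Chain H K → Chain H (adjoin K x)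
    step K x x∉ c = record
      { r = suc r ; g = g′ ; Ks = Ks′ ; g0 = g0 ; H⊑ = H⊑
      ; fresh = λ i i<r → split i i<r (λ l → trans (cong₂ (λ k y → Sub.mem k y) (K-old (ℕₚ.<⇒≤ l)) (g-old l)) (fresh i l)) λ { refl → trans (cong₂ (λ k y → Sub.mem k y) (K-old ℕₚ.≤-refl) g-new)
          (≢true λ q → false≢true x∉ (top q)) }
      ; mono = λ i i<r → split i i<r (λ l {y} p → trans (cong (λ k → Sub.mem k y) (K-old l)) (mono i l (trans (cong (λ k → Sub.mem k y) (sym (K-old (ℕₚ.<⇒≤ l)))) p)))
          λ { refl {y} p → trans (cong (λ k → Sub.mem k y) K-new) (adjoin-⊒ K x (top (trans (cong (λ k → Sub.mem k y) (sym (K-old ℕₚ.≤-refl))) p))) }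
      ; memb = λ i i<r → split i i<r (λ l → trans (cong₂ (λ k y → Sub.mem k y) (K-old l) (g-old l)) (memb i l)) λ { refl → trans (cong₂ (λ k y → Sub.mem k y) K-new g-new) (adjoin-∋ K x) }
      ; top = λ {y} p → trans (cong (λ k → Sub.mem k y) (sym K-new)) p
      ; least = λ P h f → adjoin-least K x P (least P h (λ i l → subst (_∈ P) (g-old l) (f i (ℕₚ.m≤n⇒m≤1+n l)))) (subst (_∈ P) g-new (f r ℕₚ.≤-refl)) }
      where
      open Chain c
      g′ : ℕ → El
      g′ k = if k ≡ᵇ suc r then x else g k
      Ks′ : ℕ → Sub
      Ks′ k = if k ≡ᵇ suc r then adjoin K x else Ks k
      ne : ∀ {k} → k ≤ r → (k ≡ᵇ suc r) ≡ false
      ne {k} l = ≢true λ p → ℕₚ.<⇒≢ (s≤s l) (≡ᵇ-sound k (suc r) p)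
      g-old : ∀ {i} → i < r → g′ (suc i) ≡ g (suc i)
      g-old {i} l = cong (λ b → if b then x else g (suc i)) (ne l)
      g-new : g′ (suc r) ≡ x
      g-new = cong (λ b → if b then x else g (suc r)) (≡ᵇ-refl r)
      K-old : ∀ {i} → i ≤ r → Ks′ i ≡ Ks i
      K-old {i} l = cong (λ b → if b then adjoin K x else Ks i) (ne l)
      K-new : Ks′ (suc r) ≡ adjoin K x
      K-new = cong (λ b → if b then adjoin K x else Ks (suc r)) (≡ᵇ-refl r)
      split : ∀ {A : Set} i → i < suc r → (i < r → A) → (i ≡ r → A) → A
      split i (s≤s l) f h with ℕₚ.m≤n⇒m<n∨m≡n l
      ... | inj₁ q = f q
      ... | inj₂ q = h q

  module ChainFacts {H K : Sub} (c : Chain H K) where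
    open Chain c

    K-up : ∀ {i j} → i ≤ j → j ≤ r → Ks i ⊑ Ks j
    K-up {j = zero} z≤n _ p = p
    K-up {i} {suc j} i≤j j<r p with ℕₚ.m≤n⇒m<n∨m≡n i≤j
    ... | inj₂ refl = p
    ... | inj₁ (s≤s l) = mono j j<r (K-up l (ℕₚ.<⇒≤ j<r) p)

    H⊑Ks : ∀ {j} → j ≤ r → H ⊑ Ks j
    H⊑Ks l p = K-up z≤n l (H⊑ p)

    g∈ : ∀ {i j} → i ≤ j → j ≤ r → g i ∈ Ks j
    g∈ {zero} {j} _ l = subst (_∈ Ks j) (sym g0) (e∈ (Ks j))
    g∈ {suc i} l m = K-up l m (memb i (ℕₚ.≤-trans l m))

    xs ys : ℕ → List El
    xs zero    = []
    xs (suc k) = g (suc k) ∷ xs k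
    ys zero    = []
    ys (suc k) = g (suc k) / g k ∷ ys k

    X Y : El → Bool
    X x = x ∈ᶠ xs r
    Y x = x ∈ᶠ ys r

    xs-find : ∀ k {x} → x ∈ᶠ xs k ≡ true → ∃ λ i → i < k × x ≡ g (suc i)
    xs-find (suc k) {x} p with x Fₚ.≟ g (suc k)
    ... | yes q = k , ℕₚ.≤-refl , q
    ... | no _ with xs-find k p
    ... | i , l , q = i , ℕₚ.m≤n⇒m≤1+n l , q

    ys-find : ∀ k {x} → x ∈ᶠ ys k ≡ true → ∃ λ i → i < k × x ≡ g (suc i) / g i
    ys-find (suc k) {x} p with x Fₚ.≟ (g (suc k) / g k)
    ... | yes q = k , ℕₚ.≤-refl , q
    ... | no _ with ys-find k p
    ... | i , l , q = i , ℕₚ.m≤n⇒m≤1+n l , q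

    xs-mem : ∀ k {i} → i < k → g (suc i) ∈ᶠ xs k ≡ true
    xs-mem (suc k) {i} (s≤s l) with ℕₚ.m≤n⇒m<n∨m≡n l
    ... | inj₁ q = ∨-inj₂ ⌊ g (suc i) Fₚ.≟ g (suc k) ⌋ (xs-mem k q)
    ... | inj₂ refl = ∨-inj₁ _ (⌊⌋-true (g (suc i) Fₚ.≟ g (suc i)) refl)

    ys-mem : ∀ k {i} → i < k → (g (suc i) / g i) ∈ᶠ ys k ≡ true
    ys-mem (suc k) {i} (s≤s l) with ℕₚ.m≤n⇒m<n∨m≡n l
    ... | inj₁ q = ∨-inj₂ ⌊ (g (suc i) / g i) Fₚ.≟ (g (suc k) / g k) ⌋ (ys-mem k q)
    ... | inj₂ refl = ∨-inj₁ _ (⌊⌋-true ((g (suc i) / g i) Fₚ.≟ (g (suc i) / g i)) refl)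

    -- g (suc i) cannot be expressed through elements of K_i.
    escape : ∀ {i u v w} → i < r → u ∈ Ks i → v ∈ Ks i → w ∈ Ks i → u · (g (suc i) · v) ≢ w
    escape {i} {u} {v} {w} l u∈ v∈ w∈ p = false≢true (fresh i l) (subst (_∈ Ks i)
      (trans (cong (λ t → inv u · (t · inv v)) (sym p)) (grp (u ∷ g (suc i) ∷ v ∷ []) (v0 ⁻ ⊙ (v0 ⊙ (v1 ⊙ v2) ⊙ v2 ⁻)) v1 refl))
      (·∈ (Ks i) (inv∈ (Ks i) u∈) (·∈ (Ks i) w∈ (inv∈ (Ks i) v∈))))

    escape⁻ : ∀ {i u v w} → i < r → u ∈ Ks i → v ∈ Ks i → w ∈ Ks i → u · (inv (g (suc i)) · v) ≢ w
    escape⁻ {i} {u} {v} {w} l u∈ v∈ w∈ p = escape l (inv∈ (Ks i) v∈) (inv∈ (Ks i) u∈) (inv∈ (Ks i) w∈)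
      (trans (grp (u ∷ g (suc i) ∷ v ∷ []) (v2 ⁻ ⊙ (v1 ⊙ v0 ⁻)) ((v0 ⊙ (v1 ⁻ ⊙ v2)) ⁻) refl) (cong inv p))

    X∉ : ∀ {x} → X x ≡ true → x ∉ H
    X∉ {x} p with xs-find r p
    ... | i , l , refl = ≢true λ q → false≢true (fresh i l) (H⊑Ks (ℕₚ.<⇒≤ l) q)

    Y∉ : ∀ {x} → Y x ≡ true → x ∉ H
    Y∉ {x} p with ys-find r p
    ... | i , l , refl = ≢true λ q → escape l (e∈ (Ks i)) (inv∈ (Ks i) (g∈ ℕₚ.≤-refl (ℕₚ.<⇒≤ l))) (H⊑Ks (ℕₚ.<⇒≤ l) q) (idˡ _)

    private
      Kh : ∀ {i} → i < r → H ⊑ Ks i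
      Kh l = H⊑Ks (ℕₚ.<⇒≤ l)
      Kg : ∀ {i j} → i ≤ j → j < r → g i ∈ Ks j
      Kg l m = g∈ l (ℕₚ.<⇒≤ m)
      Ke : ∀ {i} → e ∈ Ks i
      Ke {i} = e∈ (Ks i)
      Ki : ∀ {i x} → x ∈ Ks i → inv x ∈ Ks i
      Ki {i} = inv∈ (Ks i)
      Km : ∀ {i x y} → x ∈ Ks i → y ∈ Ks i → x · y ∈ Ks i
      Km {i} = ·∈ (Ks i)

    -- The generator with the larger index would lie in the subgroup of the earlier ones. This lemma
    -- and its variants exclude triangles made of two new edges and a base edge, provided the base
    -- avoids `e` there.
    XX-out : ∀ {x z} → X x ≡ true → X z ≡ true → z / x ∈ H → z / x ≡ e
    XX-out p q h with xs-find r p | xs-find r q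
    ... | i , l , refl | j , m , refl with ℕₚ.<-cmp i j
    ... | tri≈ _ refl _ = invʳ _
    ... | tri< i<j _ _ = ⊥-elim (escape m Ke (Ki (Kg i<j m)) (Kh m h) (idˡ _))
    ... | tri> _ _ j<i = ⊥-elim (escape⁻ l (Kg j<i l) Ke (Kh l h) (cong (g (suc j) ·_) (idʳ _)))

    XX-in : ∀ {x z} → X x ≡ true → X z ≡ true → inv z · x ∈ H → inv z · x ≡ e
    XX-in p q h with xs-find r p | xs-find r q
    ... | i , l , refl | j , m , refl with ℕₚ.<-cmp i j
    ... | tri≈ _ refl _ = invˡ _
    ... | tri< i<j _ _ = ⊥-elim (escape⁻ m Ke (Kg i<j m) (Kh m h) (idˡ _))
    ... | tri> _ _ j<i = ⊥-elim (escape l (Ki (Kg j<i l)) Ke (Kh l h) (cong (inv (g (suc j)) ·_) (idʳ _)))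

    YY-out : ∀ {x z} → Y x ≡ true → Y z ≡ true → z / x ∈ H → z / x ≡ e
    YY-out p q h with ys-find r p | ys-find r q
    ... | i , l , refl | j , m , refl with ℕₚ.<-cmp i j
    ... | tri≈ _ refl _ = invʳ _
    ... | tri< i<j _ _ = ⊥-elim (escape m Ke (Km (Ki (Kg ℕₚ.≤-refl m)) (Ki (Km (Kg i<j m) (Ki (Kg (ℕₚ.<⇒≤ i<j) m))))) (Kh m h)
            (grp (g (suc j) ∷ g j ∷ g (suc i) ∷ g i ∷ []) (ε ⊙ (v0 ⊙ (v1 ⁻ ⊙ (v2 ⊙ v3 ⁻) ⁻))) (v0 ⊙ v1 ⁻ ⊙ (v2 ⊙ v3 ⁻) ⁻) refl))
    ... | tri> _ _ j<i = ⊥-elim (escape⁻ l (Km (Km (Kg j<i l) (Ki (Kg (ℕₚ.<⇒≤ j<i) l))) (Kg ℕₚ.≤-refl l)) Ke (Kh l h)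
            (grp (g (suc j) ∷ g j ∷ g (suc i) ∷ g i ∷ []) (v0 ⊙ v1 ⁻ ⊙ v3 ⊙ (v2 ⁻ ⊙ ε)) (v0 ⊙ v1 ⁻ ⊙ (v2 ⊙ v3 ⁻) ⁻) refl))

    YY-in : ∀ {x z} → Y x ≡ true → Y z ≡ true → inv z · x ∈ H → inv z · x ≡ e
    YY-in p q h with ys-find r p | ys-find r q
    ... | i , l , refl | j , m , refl with ℕₚ.<-cmp i j
    ... | tri≈ _ refl _ = invˡ _
    ... | tri< i<j _ _ = ⊥-elim (escape⁻ m (Kg ℕₚ.≤-refl m) (Km (Kg i<j m) (Ki (Kg (ℕₚ.<⇒≤ i<j) m))) (Kh m h)
            (grp (g (suc j) ∷ g j ∷ g (suc i) ∷ g i ∷ []) (v1 ⊙ (v0 ⁻ ⊙ (v2 ⊙ v3 ⁻))) ((v0 ⊙ v1 ⁻) ⁻ ⊙ (v2 ⊙ v3 ⁻)) refl))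
    ... | tri> _ _ j<i = ⊥-elim (escape l (Ki (Km (Kg j<i l) (Ki (Kg (ℕₚ.<⇒≤ j<i) l)))) (Ki (Kg ℕₚ.≤-refl l)) (Kh l h) refl)

    YX-in : ∀ {x y} → X x ≡ true → Y y ≡ true → inv y · x ∈ H → inv y · x ≡ e
    YX-in p q h with xs-find r p | ys-find r q
    ... | i , l , refl | j , m , refl with ℕₚ.<-cmp i j
    ... | tri< i<j _ _ = ⊥-elim (escape⁻ m (Kg ℕₚ.≤-refl m) (Kg i<j m) (Kh m h)
            (grp (g (suc j) ∷ g j ∷ g (suc i) ∷ []) (v1 ⊙ (v0 ⁻ ⊙ v2)) ((v0 ⊙ v1 ⁻) ⁻ ⊙ v2) refl))
    ... | tri> _ _ j<i = ⊥-elim (escape l (Ki (Km (Kg j<i l) (Ki (Kg (ℕₚ.<⇒≤ j<i) l)))) Ke (Kh l h) (cong (inv (g (suc j) / g j) ·_) (idʳ _)))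
    -- For equal indices the quotient is g i itself, which lies in `H` only for i = 0, where it is
    -- `e`.
    ... | tri≈ _ refl _ = trans eq (first i l (subst (_∈ H) eq h))
      where
      eq : inv (g (suc i) / g i) · g (suc i) ≡ g i
      eq = grp (g (suc i) ∷ g i ∷ []) ((v0 ⊙ v1 ⁻) ⁻ ⊙ v0) v1 refl
      first : ∀ i → i < r → g i ∈ H → g i ≡ e
      first zero _ _ = g0
      first (suc i) l q = ⊥-elim (false≢true (fresh i (ℕₚ.<⇒≤ l)) (Kh (ℕₚ.<⇒≤ l) q))

    X-cnt : cnt X ≡ r
    X-cnt = trans (cnt-list (xs r) (go r ℕₚ.≤-refl)) (len r)
      where
      len : ∀ k → length (xs k) ≡ k
      len zero = refl
      len (suc k) = cong suc (len k)
      go : ∀ k → k ≤ r → Distinct (xs k)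
      go zero _ = tt
      go (suc k) l = ≢true (λ p → case xs-find k p of λ { (i , m , q) → false≢true (fresh k l) (subst (_∈ Ks k) (sym q) (Kg m l)) }) , go k (ℕₚ.<⇒≤ l)

    Y-cnt : cnt Y ≡ r
    Y-cnt = trans (cnt-list (ys r) (go r ℕₚ.≤-refl)) (len r)
      where
      len : ∀ k → length (ys k) ≡ k
      len zero = refl
      len (suc k) = cong suc (len k)
      go : ∀ k → k ≤ r → Distinct (ys k)
      go zero _ = tt
      go (suc k) l = ≢true (λ p → case ys-find k p of λ { (i , m , q) → escape l Ke (Ki (Kg ℕₚ.≤-refl l)) (Km (Kg m l) (Ki (Kg (ℕₚ.<⇒≤ m) l))) (trans (idˡ _) q) }) , go k (ℕₚ.<⇒≤ l)

    -- Suppose j < l. If i ≠ l, the generator with the larger of the two indices would be expressed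
    -- by earlier ones; if i = l, the equation says g i = g j with j < i. Each contradicts
    -- irredundance.
    label : ∀ {l i j} → l < r → i < r → j < r → g (suc l) ≡ (g (suc i) / g i) · g j → l ≤ j
    label {l} {i} {j} l<r i<r j<r p with l ℕₚ.≤? j
    ... | yes q = q
    ... | no q with ℕₚ.<-cmp i l
    ... | tri< i<l _ _ = ⊥-elim (false≢true (fresh l l<r) (subst (_∈ Ks l) (sym p) (Km (Km (Kg i<l l<r) (Ki (Kg (ℕₚ.<⇒≤ i<l) l<r))) (Kg (ℕₚ.<⇒≤ (ℕₚ.≰⇒> q)) l<r))))
    ... | tri> _ _ l<i = ⊥-elim (escape i<r Ke (Km (Ki (Kg ℕₚ.≤-refl i<r)) (Kg (ℕₚ.≤-trans (ℕₚ.<⇒≤ (ℕₚ.≰⇒> q)) (ℕₚ.<⇒≤ l<i)) i<r)) (Kg l<i i<r)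
            (trans (grp (g (suc i) ∷ g i ∷ g j ∷ []) (ε ⊙ (v0 ⊙ (v1 ⁻ ⊙ v2))) (v0 ⊙ v1 ⁻ ⊙ v2) refl) (sym p)))
    ... | tri≈ _ refl _ = ⊥-elim (same (ℕₚ.≰⇒> q) i<r (sym (·-cancelˡ (g (suc i) · inv (g i)) (trans (sym p) (grp (g (suc i) ∷ g i ∷ []) v0 (v0 ⊙ v1 ⁻ ⊙ v1) refl)))))
      where
      same : ∀ {i} → j < i → i < r → g i ≡ g j → ⊥
      same {suc i} (s≤s j≤i) i<r eq = false≢true (fresh i (ℕₚ.<⇒≤ i<r)) (subst (_∈ Ks i) (sym eq) (Kg j≤i (ℕₚ.<⇒≤ i<r)))

-- Adding all generators at once

module OneShot (G : FinGroup) (m : ℕ) where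
  open Grp G
  open Chains G
  open Analysis G
  open Core G m

  -- Base edges are recognised by lying in triangles; automorphisms then act blockwise by translations, and the
  -- edges X : p₀ → p₁ and Y : q₀ → q₁ force them to commute with the generators one after the other.
  module Shoot (i₀ : Fin m) (H K : Sub) (ch : Chain H K) (all : All K) (S′ B : Conn) (isB : IsConn B)
               (B⊆ : ∀ i j x → B i j x ≡ true → S′ i j x ≡ true)
               (in-tri : ∀ i j x → B i j x ≡ true → ∃ λ l → ∃ λ z → S′ i l z ≡ true × S′ j l (z / x) ≡ true)
               (no-tri : ∀ i j x → S′ i j x ≡ true → B i j x ≡ false → ∀ l z → S′ i l z ≡ true → S′ j l (z / x) ≡ true → ⊥)
               (rig : Rigid H B) (p₀ p₁ q₀ q₁ : Fin m)
               (X-in : ∀ x → ChainFacts.X ch x ≡ true → S′ p₀ p₁ x ≡ true × B p₀ p₁ x ≡ false)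
               (X-out : ∀ x → S′ p₀ p₁ x ≡ true → B p₀ p₁ x ≡ false → ChainFacts.X ch x ≡ true)
               (Y-in : ∀ x → ChainFacts.Y ch x ≡ true → S′ q₀ q₁ x ≡ true × B q₀ q₁ x ≡ false)
               (Y-out : ∀ x → S′ q₀ q₁ x ≡ true → B q₀ q₁ x ≡ false → ChainFacts.Y ch x ≡ true) where
    open Chain ch
    open ChainFacts ch hiding (label)
    open Glue G m i₀

    -- A base edge lies in a triangle, hence so does its image, and by `no-tri` an edge outside the
    -- base does not.
    base-edge : (σ : Auto S′) → ∀ u v → adjC B u v ≡ true → adjC B (to σ u) (to σ v) ≡ true
    base-edge σ u@(i , x) v@(j , y) p with in-tri i j (y / x) p | adjC B (to σ u) (to σ v) in eq
    ... | _ | true = refl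
    ... | l , z , a , b | false = ⊥-elim (no-tri _ _ _ (trans (pres σ u v) (B⊆ i j _ p)) eq (proj₁ (to σ w)) (proj₂ (to σ w) / proj₂ (to σ u))
          (trans (pres σ u w) (trans (cong (S′ i l) (·-/ z x)) a))
          (trans (cong (S′ _ _) (grp (proj₂ (to σ u) ∷ proj₂ (to σ v) ∷ proj₂ (to σ w) ∷ []) (v2 ⊙ v0 ⁻ ⊙ (v1 ⊙ v0 ⁻) ⁻) (v2 ⊙ v1 ⁻) refl))
            (trans (pres σ v w) (trans (cong (S′ j l) (grp (z ∷ x ∷ y ∷ []) (v0 ⊙ v1 ⊙ v2 ⁻) (v0 ⊙ (v2 ⊙ v1 ⁻) ⁻) refl)) b))))
      where w = l , z · x

    baseAuto : Auto S′ → Auto B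
    baseAuto = preserved {S′} {B} base-edge

    rigid : Rigid full S′
    rigid σ with blockwise {H} rig (baseAuto σ)
    ... | z , val , H⊑z = glue σ z val {full} (λ {x} _ → least (Equiv z) H⊑z (λ i l → ∈Equiv z (g (suc i)) λ c → fix (suc i) l c) (all x))
      where
      move : ∀ p q x c → S′ p q x ≡ true → B p q x ≡ false → S′ p q (z (x · c) / z c) ≡ true × B p q (z (x · c) / z c) ≡ false
      move p q x c s b = trans (sym (cong₂ (adjC S′) (val p c) (val q (x · c)))) (trans (pres σ (p , c) (q , x · c)) (trans (cong (S′ p q) (·-/ x c)) s)) ,
        trans (sym (cong₂ (adjC B) (val p c) (val q (x · c)))) (trans (pres (baseAuto σ) (p , c) (q , x · c)) (trans (cong (B p q) (·-/ x c)) b))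
      z-inj : ∀ {x y} → z x ≡ z y → x ≡ y
      z-inj {x} {y} p = cong proj₂ (to-inj σ {i₀ , x} {i₀ , y} (trans (val i₀ x) (trans (cong (i₀ ,_) p) (sym (val i₀ y)))))
      -- Through `X` the element z (g (k+1) c) is g (l+1) z c for some l; through `Y` and the case k
      -- it is also g (i+1) (g i)⁻¹ g k z c. `label` gives l ≤ k, and for l < k the fixed generator
      -- g (l+1) would share its image with g (k+1), against injectivity of `z`.
      fixes : ∀ k → k ≤ r → ∀ i → i ≤ k → ∀ c → z (g i · c) ≡ g i · z c
      fixes zero _ zero _ c = trans (cong (λ t → z (t · c)) g0) (trans (cong z (idˡ c)) (sym (trans (cong (_· z c) g0) (idˡ _))))
      fixes (suc k) k<r i i≤ c with ℕₚ.m≤n⇒m<n∨m≡n i≤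
      ... | inj₁ (s≤s i≤k) = fixes k (ℕₚ.<⇒≤ k<r) i i≤k c
      ... | inj₂ refl = next (xs-find r (X-out _ (proj₁ mx) (proj₂ mx))) (ys-find r (Y-out _ (proj₁ my) (proj₂ my)))
        where
        X∋ = X-in (g (suc k)) (xs-mem r k<r)
        Y∋ = Y-in (g (suc k) / g k) (ys-mem r k<r)
        mx = move p₀ p₁ (g (suc k)) c (proj₁ X∋) (proj₂ X∋)
        my = move q₀ q₁ (g (suc k) / g k) (g k · c) (proj₁ Y∋) (proj₂ Y∋)
        step : (g (suc k) / g k) · (g k · c) ≡ g (suc k) · c
        step = grp (g (suc k) ∷ g k ∷ c ∷ []) (v0 ⊙ v1 ⁻ ⊙ (v1 ⊙ v2)) (v0 ⊙ v2) refl
        next : (∃ λ l → l < r × z (g (suc k) · c) / z c ≡ g (suc l)) →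
               (∃ λ i → i < r × z ((g (suc k) / g k) · (g k · c)) / z (g k · c) ≡ g (suc i) / g i) → z (g (suc k) · c) ≡ g (suc k) · z c
        next (l , l<r , p) (i , i<r , q) with ℕₚ.m≤n⇒m<n∨m≡n (ChainFacts.label ch {l} {i} {k} l<r i<r k<r (·-cancelʳ (z c) (begin
            g (suc l) · z c ≡⟨ /-≡ p ⟨
            z (g (suc k) · c) ≡⟨ cong z step ⟨
            z ((g (suc k) / g k) · (g k · c)) ≡⟨ /-≡ q ⟩
            (g (suc i) / g i) · z (g k · c) ≡⟨ cong ((g (suc i) / g i) ·_) (fixes k (ℕₚ.<⇒≤ k<r) k ℕₚ.≤-refl c) ⟩
            (g (suc i) / g i) · (g k · z c) ≡⟨ assoc _ _ _ ⟨
            ((g (suc i) / g i) · g k) · z c ∎)))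
          where open ≡-Reasoning
        ... | inj₂ refl = /-≡ p
        ... | inj₁ l<k = ⊥-elim (false≢true (fresh k k<r) (subst (_∈ Ks k) (sym (·-cancelʳ c (z-inj (trans (/-≡ p) (sym (fixes k (ℕₚ.<⇒≤ k<r) (suc l) l<k c)))))) (g∈ l<k (ℕₚ.<⇒≤ k<r))))
      fix : ∀ k → k ≤ r → ∀ c → z (g k · c) ≡ g k · z c
      fix k l c = fixes k l k ℕₚ.≤-refl c

  module Arcs (H K : Sub) (ch : Chain H K) (arc : Fin m → Fin m → Bool) (kind : Fin m → Fin m → Bool)
              (anti : ∀ i j → arc i j ≡ true → arc j i ≡ false) where
    open Chain ch using (r)
    open ChainFacts ch

    set : Fin m → Fin m → El → Bool
    set i j x = if kind i j then X x else Y x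

    -- The new edges: along every arc i → j a set of size r, X or Y according to its kind.
    N : Conn
    N i j x = (arc i j ∧ set i j x) ∨ (arc j i ∧ set j i (inv x))

    N-split : ∀ {i j x} → N i j x ≡ true → (arc i j ≡ true × set i j x ≡ true) ⊎ (arc j i ≡ true × set j i (inv x) ≡ true)
    N-split {i} {j} {x} p with ∨-split {arc i j ∧ set i j x} p
    ... | inj₁ q = inj₁ (∧-split {arc i j} q)
    ... | inj₂ q = inj₂ (∧-split {arc j i} q)

    set∉ : ∀ {i j x} → set i j x ≡ true → x ∉ H
    set∉ {i} {j} p with kind i j
    ... | true  = X∉ p
    ... | false = Y∉ p

    N∉ : ∀ {i j x} → N i j x ≡ true → x ∉ H
    N∉ {i} {j} {x} p with N-split {i} {j} p
    ... | inj₁ (_ , q) = set∉ {i} {j} q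
    ... | inj₂ (_ , q) = ≢true λ s → false≢true (set∉ {j} {i} q) (inv∈ H s)

    set-cnt : ∀ i j → cnt (set i j) ≡ r
    set-cnt i j with kind i j
    ... | true  = X-cnt
    ... | false = Y-cnt

    irr-arc : ∀ i → arc i i ≡ false
    irr-arc i with arc i i in eq
    ... | false = refl
    ... | true  = trans (sym eq) (anti i i eq)

    isN : IsConn N
    isN = record
      { symC = λ i j x → trans (cong (λ t → (arc j i ∧ set j i (inv x)) ∨ (arc i j ∧ set i j t)) (inv-inv x)) (Bₚ.∨-comm (arc j i ∧ set j i (inv x)) _)
      ; irrC = λ i x → cong₂ _∨_ (cong (_∧ set i i x) (irr-arc i)) (cong (_∧ set i i (inv x)) (irr-arc i)) }

    N-cnt : ∀ i j → cnt (N i j) ≡ (b2n (arc i j) + b2n (arc j i)) * r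
    N-cnt i j with arc i j in a | arc j i in b
    ... | true | true = ⊥-elim (false≢true (anti i j a) b)
    ... | true | false = trans (cnt-cong (λ x → Bₚ.∨-identityʳ (set i j x))) (trans (set-cnt i j) (sym (ℕₚ.+-identityʳ r)))
    ... | false | true = trans (cnt-bij (set j i) inv inv inv-inv inv-inv) (trans (set-cnt j i) (sym (ℕₚ.+-identityʳ r)))
    ... | false | false = cnt-false {order}

sum-* : ∀ {k} (f : Fin k → ℕ) r → sum (λ j → f j * r) ≡ sum f * r
sum-* {zero} f r = refl
sum-* {suc k} f r = trans (cong (f zero * r +_) (sum-* (f ∘ suc) r)) (sym (ℕₚ.*-distribʳ-+ r (f zero) (sum (f ∘ suc))))

anyᶠ : ∀ {k} → (Fin k → Bool) → Bool
anyᶠ {zero}  f = false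
anyᶠ {suc k} f = f zero ∨ anyᶠ (f ∘ suc)

anyᶠ-find : ∀ {k} (f : Fin k → Bool) → anyᶠ f ≡ true → ∃ λ i → f i ≡ true
anyᶠ-find {suc k} f p with ∨-split {f zero} p
... | inj₁ q = zero , q
... | inj₂ q with anyᶠ-find (f ∘ suc) q
... | i , r = suc i , r

-- A finite base with arcs for the generators

module Builder (G : FinGroup) where
  open Grp G
  open Labels G
  open Analysis G
  open Chains G

  -- `d` is the valency of the base and `ρ` the number of arcs meeting each part; every arc
  -- contributes `r`, so the final valency is d + ρ r.
  module Build (m′ : ℕ) (Λ : Lab) (conn : Fin (suc m′) → Fin (suc m′) → List (Lab.L Λ)) (gens : List (Lab.L Λ))
               (patch : List (ℕ × (Fin (suc m′) × Lab.L Λ))) (arc kind : Fin (suc m′) → Fin (suc m′) → Bool)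
               (d ρ : ℕ) (p₀ p₁ q₀ q₁ : Fin (suc m′)) where
    open Lab Λ
    module B = Base m′ Λ conn
    open Core G (suc m′)

    lam : Fin (suc m′) → Fin (suc m′) → Bool
    lam i j = arc i j ∨ arc j i

    antiCk triCk : Fin (suc m′) → Fin (suc m′) → Bool
    antiCk i j = not (arc i j ∧ arc j i)
    triCk i j = allᵇ (λ s → anyᶠ λ l → anyᵇ (λ t → BoolEq.mem B.EC (l , t) (B.nb (j , s))) (conn i l)) (conn i j)

    -- Controls triangles with two new edges meeting in part i. No new edges may join j and l; base
    -- edges may do so only if `e` is not among them and the two arcs both enter i, or both leave it
    -- with the same kind, for then the quotient of the new elements could only be `e`.
    cfgCk : Fin (suc m′) → Fin (suc m′) → Fin (suc m′) → Bool
    cfgCk i j l = (eqF j l ∨ not (lam i j ∧ lam i l)) ∨ (not (lam j l) ∧ (B.empty (conn j l) ∨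
      (not (mem unit (conn j l)) ∧ ((arc j i ∧ arc l i) ∨ (arc i j ∧ (arc i l ∧ eqB (kind i j) (kind i l)))))))

    degCk lamCk : Fin (suc m′) → Bool
    degCk i = sum (λ j → length (conn i j)) ≡ᵇ d
    lamCk i = sum (λ j → b2n (arc i j) + b2n (arc j i)) ≡ᵇ ρ

    checks : Bool
    checks = allF (λ i → allF (antiCk i)) ∧ (allF (λ i → allF (triCk i)) ∧ (allF (λ i → allF (λ j → allF (cfgCk i j))) ∧
      (allF degCk ∧ (allF lamCk ∧ ((arc p₀ p₁ ∧ kind p₀ p₁) ∧ (arc q₀ q₁ ∧ not (kind q₀ q₁)))))))

    module _ (wf : B.wellformed ≡ true) (rc : B.rigidCheck wf gens patch ≡ true) (ck : checks ≡ true)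
             (H : Sub) (least : ∀ P → (∀ {g} → mem g gens ≡ true → φ g ∈ P) → H ⊑ P) (φ∈ : ∀ {u} → okL u ≡ true → φ u ∈ H) where
      private
        k₁ = ∧-split {allF (λ i → allF (antiCk i))} ck
        k₂ = ∧-split {allF (λ i → allF (triCk i))} (proj₂ k₁)
        k₃ = ∧-split {allF (λ i → allF (λ j → allF (cfgCk i j)))} (proj₂ k₂)
        k₄ = ∧-split {allF degCk} (proj₂ k₃)
        k₅ = ∧-split {allF lamCk} (proj₂ k₄)
        k₆ = ∧-split {arc p₀ p₁ ∧ kind p₀ p₁} (proj₂ k₅)
        k₇ = ∧-split {arc p₀ p₁} (proj₁ k₆)
        k₈ = ∧-split {arc q₀ q₁} (proj₂ k₆)

      S : Conn
      S = B.S

      open IsConn (B.isC wf) using (symC; irrC)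

      supp : ∀ {i j x} → S i j x ≡ true → x ∈ H
      supp {i} {j} p with B.S-find wf {i} {j} p
      ... | s , os , _ , refl = φ∈ os

      anti : ∀ i j → arc i j ≡ true → arc j i ≡ false
      anti i j p = ≢true λ q → false≢true (not-true (allF-elim (antiCk i) (allF-elim (λ i → allF (antiCk i)) (proj₁ k₁) i) j)) (cong₂ _∧_ p q)

      C : ∃ λ K → Chain H K × All K
      C = chain H
      K = proj₁ C
      ch = proj₁ (proj₂ C)
      all = proj₂ (proj₂ C)
      open ChainFacts ch
      open OneShot G (suc m′)
      open Arcs H K ch arc kind anti

      S′ : Conn
      S′ i j x = S i j x ∨ N i j x

      lam-N : ∀ {i j x} → N i j x ≡ true → lam i j ≡ true
      lam-N {i} {j} {x} p with N-split {i} {j} p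
      ... | inj₁ (q , _) = ∨-inj₁ _ q
      ... | inj₂ (q , _) = ∨-inj₂ (arc i j) q

      -- Arcs of different kinds into one part are harmless by `YX-in`. For arcs out of one part the
      -- quotient g (i+1) (g i)⁻¹ (g (i+1))⁻¹ can lie in `H` without being `e`, which is why `out-e`
      -- asks for equal kinds.
      in-e : ∀ {i j k l x z} → set i j x ≡ true → set k l z ≡ true → inv z · x ∈ H → inv z · x ≡ e
      in-e {i} {j} {k} {l} {x} {z} p q h with kind i j | kind k l
      ... | true  | true  = XX-in p q h
      ... | false | false = YY-in p q h
      ... | true  | false = YX-in p q h
      ... | false | true  = inv-injective (trans (grp (x ∷ z ∷ []) ((v1 ⁻ ⊙ v0) ⁻) (v0 ⁻ ⊙ v1) refl) (trans (YX-in q p (subst (_∈ H) (grp (x ∷ z ∷ []) ((v1 ⁻ ⊙ v0) ⁻) (v0 ⁻ ⊙ v1) refl) (inv∈ H h))) (sym inv-e)))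

      out-e : ∀ {i j k l x z} → eqB (kind i j) (kind k l) ≡ true → set i j x ≡ true → set k l z ≡ true → z / x ∈ H → z / x ≡ e
      out-e {i} {j} {k} {l} s p q h with kind i j | kind k l
      ... | true  | true  = XX-out p q h
      ... | false | false = YY-out p q h

      into : ∀ {i j x} → arc j i ≡ true → N i j x ≡ true → set j i (inv x) ≡ true
      into {i} {j} a p with N-split {i} {j} p
      ... | inj₁ (q , _) = ⊥-elim (false≢true (anti j i a) q)
      ... | inj₂ (_ , q) = q
      outof : ∀ {i j x} → arc i j ≡ true → N i j x ≡ true → set i j x ≡ true
      outof {i} {j} a p with N-split {i} {j} p
      ... | inj₁ (_ , q) = q
      ... | inj₂ (q , _) = ⊥-elim (false≢true (anti i j a) q)

      cfg : ∀ i j l → cfgCk i j l ≡ true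
      cfg i j l = allF-elim (cfgCk i j) (allF-elim (λ j → allF (cfgCk i j)) (allF-elim (λ i → allF (λ j → allF (cfgCk i j))) (proj₁ k₃) i) j) l

      NT3 : ∀ {i j l x z} → N i j x ≡ true → N i l z ≡ true → N j l (z / x) ≡ true → ⊥
      NT3 {i} {j} {l} {x} {z} p q s with ∨-split {eqF j l ∨ not (lam i j ∧ lam i l)} (cfg i j l)
      ... | inj₂ t = false≢true (not-true (proj₁ (∧-split {not (lam j l)} t))) (lam-N {j} {l} s)
      ... | inj₁ t with ∨-split {eqF j l} t
      ... | inj₁ u = false≢true (IsConn.irrC isN l (z / x)) (subst (λ t → N t l (z / x) ≡ true) (eqF-sound u) s)
      ... | inj₂ u = false≢true (not-true u) (cong₂ _∧_ (lam-N {i} {j} p) (lam-N {i} {l} q))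

      NT1 : ∀ {i j l x z} → N i j x ≡ true → N i l z ≡ true → S j l (z / x) ≡ true → ⊥
      NT1 {i} {j} {l} {x} {z} p q s with ∨-split {eqF j l ∨ not (lam i j ∧ lam i l)} (cfg i j l)
      ... | inj₁ t with ∨-split {eqF j l} t
      ... | inj₁ u = false≢true (irrC l (z / x)) (subst (λ t → S t l (z / x) ≡ true) (eqF-sound u) s)
      ... | inj₂ u = false≢true (not-true u) (cong₂ _∧_ (lam-N {i} {j} p) (lam-N {i} {l} q))
      NT1 {i} {j} {l} {x} {z} p q s | inj₂ t with ∨-split {B.empty (conn j l)} (proj₂ (∧-split {not (lam j l)} t))
      ... | inj₁ em = false≢true (none (conn j l) em) s
        where
        none : ∀ ss → B.empty ss ≡ true → (z / x) ∈ᶠ map φ ss ≡ false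
        none [] _ = refl
      ... | inj₂ u with ∧-split {not (mem unit (conn j l))} u
      ... | nu , v = contra (zx (∨-split {arc j i ∧ arc l i} v))
        where
        zx : (arc j i ∧ arc l i ≡ true) ⊎ (arc i j ∧ (arc i l ∧ eqB (kind i j) (kind i l)) ≡ true) → z / x ≡ e
        zx (inj₁ a) = trans zeq (in-e {j} {i} {l} {i} (into {i} {j} (proj₁ (∧-split a)) p) (into {i} {l} (proj₂ (∧-split {arc j i} a)) q) (subst (_∈ H) zeq (supp {j} {l} s)))
          where
          zeq : z / x ≡ inv (inv z) · inv x
          zeq = cong (_· inv x) (sym (inv-inv z))
        zx (inj₂ a) with ∧-split {arc i j} a
        ... | a₁ , a₂ with ∧-split {arc i l} a₂
        ... | a₃ , a₄ = out-e {i} {j} {i} {l} a₄ (outof {i} {j} a₁ p) (outof {i} {l} a₃ q) (supp {j} {l} s)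
        contra : z / x ≡ e → ⊥
        contra eq with B.S-find wf {j} {l} (subst (λ t → S j l t ≡ true) eq s)
        ... | t , ot , mt , e≡ = false≢true (not-true nu) (subst (λ t → mem t (conn j l) ≡ true) (injL ot ok-unit (trans (sym e≡) (sym φ-unit))) mt)

      -- With two base edges the third element would lie in `H`, so a triangle on a new edge
      -- contains a second one. The cases differ only in the part where the two new edges meet.
      no-tri : ∀ i j x → S′ i j x ≡ true → S i j x ≡ false → ∀ l z → S′ i l z ≡ true → S′ j l (z / x) ≡ true → ⊥
      no-tri i j x p b l z q s with ∨-split {S i j x} p
      ... | inj₁ p′ = false≢true b p′
      ... | inj₂ p′ with ∨-split {S i l z} q | ∨-split {S j l (z / x)} s
      ... | inj₁ q′ | inj₁ s′ = false≢true (N∉ {i} {j} p′) (subst (_∈ H) (grp (z ∷ x ∷ []) ((v0 ⊙ v1 ⁻) ⁻ ⊙ v0) v1 refl) (·∈ H (inv∈ H (supp {j} {l} s′)) (supp {i} {l} q′)))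
      ... | inj₂ q′ | inj₁ s′ = NT1 {i} {j} {l} p′ q′ s′
      ... | inj₂ q′ | inj₂ s′ = NT3 {i} {j} {l} p′ q′ s′
      ... | inj₁ q′ | inj₂ s′ = NT1 {j} {i} {l} {inv x} {z / x} (trans (IsConn.symC isN i j x) p′) s′
              (subst (λ t → S i l t ≡ true) (grp (z ∷ x ∷ []) v0 (v0 ⊙ v1 ⁻ ⊙ v1 ⁻ ⁻) refl) q′)

      in-tri : ∀ i j x → S i j x ≡ true → ∃ λ l → ∃ λ z → S′ i l z ≡ true × S′ j l (z / x) ≡ true
      in-tri i j x p with B.S-find wf {i} {j} p
      ... | s , os , ms , refl with anyᶠ-find _ (all-mem (λ s → anyᶠ λ l → anyᵇ (λ t → BoolEq.mem B.EC (l , t) (B.nb (j , s))) (conn i l)) (conn i j)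
              (allF-elim (triCk i) (allF-elim (λ i → allF (triCk i)) (proj₁ k₂) i) j) ms)
      ... | l , q = go (conn i l) (B.conn-ok wf i l) q refl
        where
        go : ∀ ts → allᵇ okL ts ≡ true → anyᵇ (λ t → BoolEq.mem B.EC (l , t) (B.nb (j , s))) ts ≡ true → ts ≡ conn i l →
             ∃ λ l → ∃ λ z → S′ i l z ≡ true × S′ j l (z / φ s) ≡ true
        go ts ok f eq with find-mem ts ok f
          where
          find-mem : ∀ ts → allᵇ okL ts ≡ true → anyᵇ (λ t → BoolEq.mem B.EC (l , t) (B.nb (j , s))) ts ≡ true → ∃ λ t → (okL t ≡ true) × (mem t ts ≡ true) × (BoolEq.mem B.EC (l , t) (B.nb (j , s)) ≡ true)
          find-mem (t ∷ ts) ok f with ∧-split {okL t} ok | ∨-split {BoolEq.mem B.EC (l , t) (B.nb (j , s))} f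
          ... | ot , _ | inj₁ u = t , ot , ∨-inj₁ _ (rfl t) , u
          ... | _ , ok′ | inj₂ u with find-mem ts ok′ u
          ... | t′ , ot , mt , w = t′ , ot , ∨-inj₂ (eq′ t′ t) mt , w
            where eq′ = BoolEq.eq E
        go ts ok f refl | t , ot , mt , w = l , φ t , ∨-inj₁ _ (B.∈φ wf (conn i l) mt) , ∨-inj₁ _ (trans (B.adj-ok wf {j , s} {l , t} os ot) w)

      S′-N : ∀ {i j x} → S′ i j x ≡ true → S i j x ≡ false → N i j x ≡ true
      S′-N {i} {j} {x} p q with ∨-split {S i j x} p
      ... | inj₁ t = ⊥-elim (false≢true q t)
      ... | inj₂ t = t

      N-S : ∀ {i j x} → N i j x ≡ true → S i j x ≡ false
      N-S {i} {j} p = ≢true λ q → false≢true (N∉ {i} {j} p) (supp {i} {j} q)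

      set-X : ∀ {i j x} → kind i j ≡ true → set i j x ≡ X x
      set-X {i} {j} {x} p = cong (λ b → if b then X x else Y x) p
      set-Y : ∀ {i j x} → kind i j ≡ false → set i j x ≡ Y x
      set-Y {i} {j} {x} p = cong (λ b → if b then X x else Y x) p

      X-in : ∀ x → X x ≡ true → S′ p₀ p₁ x ≡ true × S p₀ p₁ x ≡ false
      X-in x p = ∨-inj₂ (S p₀ p₁ x) n , N-S {p₀} {p₁} n
        where n = ∨-inj₁ _ (cong₂ _∧_ (proj₁ k₇) (trans (set-X {p₀} {p₁} (proj₂ k₇)) p))
      Y-in : ∀ x → Y x ≡ true → S′ q₀ q₁ x ≡ true × S q₀ q₁ x ≡ false
      Y-in x p = ∨-inj₂ (S q₀ q₁ x) n , N-S {q₀} {q₁} n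
        where n = ∨-inj₁ _ (cong₂ _∧_ (proj₁ k₈) (trans (set-Y {q₀} {q₁} (not-true (proj₂ k₈))) p))

      rigid′ : Rigid full S′
      rigid′ = Shoot.rigid zero H K ch all S′ S (B.isC wf) (λ i j x → ∨-inj₁ (N i j x)) in-tri no-tri (B.base-rigid wf gens patch rc H least) p₀ p₁ q₀ q₁
        X-in (λ x p q → trans (sym (set-X {p₀} {p₁} (proj₂ k₇))) (outof {p₀} {p₁} (proj₁ k₇) (S′-N {p₀} {p₁} p q)))
        Y-in (λ x p q → trans (sym (set-Y {q₀} {q₁} (not-true (proj₂ k₈)))) (outof {q₀} {q₁} (proj₁ k₈) (S′-N {q₀} {q₁} p q)))

      isC′ : IsConn S′
      isC′ = record { symC = λ i j x → cong₂ _∨_ (symC i j x) (IsConn.symC isN i j x) ; irrC = λ i x → cong₂ _∨_ (irrC i x) (IsConn.irrC isN i x) }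

      hgr : HGR (suc m′) G
      hgr = toHGR isC′ rigid′ (d + ρ * Chain.r ch) degs zero
        where
        open ≡-Reasoning
        degs : ∀ i → deg S′ i ≡ d + ρ * Chain.r ch
        degs i = begin
          sum (λ j → cnt (S′ i j)) ≡⟨ sum-cong-≗ (λ j → cnt-∨ (S i j) (N i j) (λ x p q → false≢true (N∉ {i} {j} q) (supp {i} {j} p))) ⟩
          sum (λ j → cnt (S i j) + cnt (N i j)) ≡⟨ ∑-distrib-+ (λ j → cnt (S i j)) (λ j → cnt (N i j)) ⟩
          sum (λ j → cnt (S i j)) + sum (λ j → cnt (N i j)) ≡⟨ cong₂ _+_ (sum-cong-≗ (λ j → B.S-cnt wf i j)) (sum-cong-≗ (λ j → N-cnt i j)) ⟩
          sum (λ j → length (conn i j)) + sum (λ j → (b2n (arc i j) + b2n (arc j i)) * Chain.r ch)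
            ≡⟨ cong₂ _+_ (≡ᵇ-sound (sum (λ j → length (conn i j))) d (allF-elim degCk (proj₁ k₄) i)) (sum-* (λ j → b2n (arc i j) + b2n (arc j i)) (Chain.r ch)) ⟩
          d + sum (λ j → b2n (arc i j) + b2n (arc j i)) * Chain.r ch ≡⟨ cong (λ t → d + t * Chain.r ch) (≡ᵇ-sound (sum (λ j → b2n (arc i j) + b2n (arc j i))) ρ (allF-elim lamCk (proj₁ k₅) i)) ⟩
          d + ρ * Chain.r ch ∎

pairIn : {m : ℕ} → List (ℕ × ℕ) → Fin m → Fin m → Bool
pairIn ps i j = anyᵇ (λ p → (toℕ i ≡ᵇ proj₁ p) ∧ (toℕ j ≡ᵇ proj₂ p)) ps

-- Graphs with four to nine parts

module Middle (G : FinGroup) where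
  open Grp G
  open Labels G
  open LabelKinds G
  open SmallGroups G
  open Analysis G
  open Builder G
  open CyclicBase G

  -- The arcs are a perfect matching for even m (ρ = 1) and a cycle through all parts for odd m (ρ =
  -- 2), with directions alternating except at part 0. For odd m both arcs leaving part 2 are of
  -- kind `Y`, as arcs leaving a part must agree in kind.
  module Fam (m′ c : ℕ) (conn : List (List (List ℕ))) (arcs yarcs : List (ℕ × ℕ)) (d ρ : ℕ) (p₀ p₁ q₀ q₁ : Fin (suc m′)) where
    arc kind : Fin (suc m′) → Fin (suc m′) → Bool
    arc = pairIn arcs
    kind i j = not (pairIn yarcs i j)

    module Mod {a : El} {n : ℕ} (o : HasOrder a n) (patch : List (ℕ × (Fin (suc m′) × ℕ))) where
      module W = Build m′ (CLab.toLab (modLab o)) (λ i j → map (norm c n) (table conn i j)) (1 ∷ []) patch arc kind d ρ p₀ p₁ q₀ q₁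

      hgr : (wf : W.B.wellformed ≡ true) → W.B.rigidCheck wf (1 ∷ []) patch ≡ true → W.checks ≡ true → HGR (suc m′) G
      hgr wf rc ck = W.hgr wf rc ck (gen a) (λ P h → gen-least₁ P (h {1} refl)) (λ {u} _ → ^∈gen a u)

    normed : ℕ → List (ℕ × (Fin (suc m′) × ℕ)) → List (ℕ × (Fin (suc m′) × ℕ))
    normed n = map (λ { (k , i , u) → k , i , norm c n u })

    module Big {a : El} {n : ℕ} (o : HasOrder a n) (w : ℕ) (2w≤c : w + w ≤ c) (3w<n : w + (w + w) < n) (patch : List (ℕ × (Fin (suc m′) × ℕ))) where
      module W = Build m′ (offLab o w c 2w≤c 3w<n) (table conn) (suc c ∷ []) patch arc kind d ρ p₀ p₁ q₀ q₁

      hgr : (wf : W.B.wellformed ≡ true) → W.B.rigidCheck wf (suc c ∷ []) patch ≡ true → W.checks ≡ true → HGR (suc m′) G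
      hgr wf rc ck = W.hgr wf rc ck (gen a) (λ P h → gen-least a P (subst (_∈ P) (·-/ a (a ^ c)) (h {suc c} (∨-inj₁ _ (≡ᵇ-refl (suc c))))))
        (λ {u} _ → /∈ (gen a) (^∈gen a u) (^∈gen a c))

  module F4 = Fam 3 6 conn-Z4 ((0 , 1) ∷ (2 , 3) ∷ []) ((2 , 3) ∷ []) 5 1 0F 1F 2F 3F

  -- From order 10 on a window of three exponents on either side of 0 is faithful and one evaluation
  -- covers all orders; the smaller orders are evaluated one by one.
  cyclic-4 : ∀ {a n} → HasOrder a n → 4 ≤ n → HGR 4 G
  cyclic-4 {n = 0} o ()
  cyclic-4 {n = 1} o (s≤s ())
  cyclic-4 {n = 2} o (s≤s (s≤s ()))
  cyclic-4 {n = 3} o (s≤s (s≤s (s≤s ())))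
  cyclic-4 {n = 4} o _ = F4.Mod.hgr o (F4.normed 4 patch-Z4) refl refl refl
  cyclic-4 {n = 5} o _ = F4.Mod.hgr o (F4.normed 5 patch-Z4) refl refl refl
  cyclic-4 {n = 6} o _ = F4.Mod.hgr o (F4.normed 6 patch-Z4) refl refl refl
  cyclic-4 {n = 7} o _ = F4.Mod.hgr o (F4.normed 7 patch-Z4) refl refl refl
  cyclic-4 {n = 8} o _ = F4.Mod.hgr o (F4.normed 8 patch-Z4) refl refl refl
  cyclic-4 {n = 9} o _ = F4.Mod.hgr o (F4.normed 9 patch-Z4) refl refl refl
  cyclic-4 {n = suc (suc (suc (suc (suc (suc (suc (suc (suc (suc n)))))))))} o _ = F4.Big.hgr o 3 ℕₚ.≤-refl (ℕₚ.m≤m+n 10 n) patch-Z4 refl refl refl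

  module F5 = Fam 4 6 conn-Z5 ((0 , 1) ∷ (2 , 1) ∷ (2 , 3) ∷ (4 , 3) ∷ (4 , 0) ∷ []) ((2 , 1) ∷ (2 , 3) ∷ []) 6 2 0F 1F 2F 1F

  cyclic-5 : ∀ {a n} → HasOrder a n → 4 ≤ n → HGR 5 G
  cyclic-5 {n = 0} o ()
  cyclic-5 {n = 1} o (s≤s ())
  cyclic-5 {n = 2} o (s≤s (s≤s ()))
  cyclic-5 {n = 3} o (s≤s (s≤s (s≤s ())))
  cyclic-5 {n = 4} o _ = F5.Mod.hgr o (F5.normed 4 patch-Z5) refl refl refl
  cyclic-5 {n = 5} o _ = F5.Mod.hgr o (F5.normed 5 patch-Z5) refl refl refl
  cyclic-5 {n = 6} o _ = F5.Mod.hgr o (F5.normed 6 patch-Z5) refl refl refl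
  cyclic-5 {n = 7} o _ = F5.Mod.hgr o (F5.normed 7 patch-Z5) refl refl refl
  cyclic-5 {n = 8} o _ = F5.Mod.hgr o (F5.normed 8 patch-Z5) refl refl refl
  cyclic-5 {n = 9} o _ = F5.Mod.hgr o (F5.normed 9 patch-Z5) refl refl refl
  cyclic-5 {n = suc (suc (suc (suc (suc (suc (suc (suc (suc (suc n)))))))))} o _ = F5.Big.hgr o 3 ℕₚ.≤-refl (ℕₚ.m≤m+n 10 n) patch-Z5 refl refl refl

  module F6 = Fam 5 4 conn-Z6 ((0 , 1) ∷ (2 , 3) ∷ (4 , 5) ∷ []) ((2 , 3) ∷ []) 5 1 0F 1F 2F 3F

  -- Here exponents stay within 2 of 0, so the uniform case already begins at order 7.
  cyclic-6 : ∀ {a n} → HasOrder a n → 3 ≤ n → HGR 6 G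
  cyclic-6 {n = 0} o ()
  cyclic-6 {n = 1} o (s≤s ())
  cyclic-6 {n = 2} o (s≤s (s≤s ()))
  cyclic-6 {n = 3} o _ = F6.Mod.hgr o (F6.normed 3 patch-Z6) refl refl refl
  cyclic-6 {n = 4} o _ = F6.Mod.hgr o (F6.normed 4 patch-Z6) refl refl refl
  cyclic-6 {n = 5} o _ = F6.Mod.hgr o (F6.normed 5 patch-Z6) refl refl refl
  cyclic-6 {n = 6} o _ = F6.Mod.hgr o (F6.normed 6 patch-Z6) refl refl refl
  cyclic-6 {n = suc (suc (suc (suc (suc (suc (suc n))))))} o _ = F6.Big.hgr o 2 ℕₚ.≤-refl (ℕₚ.m≤m+n 7 n) patch-Z6 refl refl refl

  module F7 = Fam 6 6 conn-Z7 ((0 , 1) ∷ (2 , 1) ∷ (2 , 3) ∷ (4 , 3) ∷ (4 , 5) ∷ (6 , 5) ∷ (6 , 0) ∷ []) ((2 , 1) ∷ (2 , 3) ∷ []) 6 2 0F 1F 2F 1F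

  cyclic-7 : ∀ {a n} → HasOrder a n → 3 ≤ n → HGR 7 G
  cyclic-7 {n = 0} o ()
  cyclic-7 {n = 1} o (s≤s ())
  cyclic-7 {n = 2} o (s≤s (s≤s ()))
  cyclic-7 {n = 3} o _ = F7.Mod.hgr o patch-Z7-3 refl refl refl
  cyclic-7 {n = 4} o _ = F7.Mod.hgr o (F7.normed 4 patch-Z7) refl refl refl
  cyclic-7 {n = 5} o _ = F7.Mod.hgr o (F7.normed 5 patch-Z7) refl refl refl
  cyclic-7 {n = 6} o _ = F7.Mod.hgr o (F7.normed 6 patch-Z7) refl refl refl
  cyclic-7 {n = 7} o _ = F7.Mod.hgr o (F7.normed 7 patch-Z7) refl refl refl
  cyclic-7 {n = 8} o _ = F7.Mod.hgr o (F7.normed 8 patch-Z7) refl refl refl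
  cyclic-7 {n = 9} o _ = F7.Mod.hgr o (F7.normed 9 patch-Z7) refl refl refl
  cyclic-7 {n = suc (suc (suc (suc (suc (suc (suc (suc (suc (suc n)))))))))} o _ = F7.Big.hgr o 3 ℕₚ.≤-refl (ℕₚ.m≤m+n 10 n) patch-Z7 refl refl refl

  module F8 = Fam 7 4 conn-Z8 ((0 , 1) ∷ (2 , 3) ∷ (4 , 5) ∷ (6 , 7) ∷ []) ((2 , 3) ∷ []) 5 1 0F 1F 2F 3F

  cyclic-8 : ∀ {a n} → HasOrder a n → 3 ≤ n → HGR 8 G
  cyclic-8 {n = 0} o ()
  cyclic-8 {n = 1} o (s≤s ())
  cyclic-8 {n = 2} o (s≤s (s≤s ()))
  cyclic-8 {n = 3} o _ = F8.Mod.hgr o (F8.normed 3 patch-Z8) refl refl refl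
  cyclic-8 {n = 4} o _ = F8.Mod.hgr o (F8.normed 4 patch-Z8) refl refl refl
  cyclic-8 {n = 5} o _ = F8.Mod.hgr o (F8.normed 5 patch-Z8) refl refl refl
  cyclic-8 {n = 6} o _ = F8.Mod.hgr o (F8.normed 6 patch-Z8) refl refl refl
  cyclic-8 {n = suc (suc (suc (suc (suc (suc (suc n))))))} o _ = F8.Big.hgr o 2 ℕₚ.≤-refl (ℕₚ.m≤m+n 7 n) patch-Z8 refl refl refl

  module F9 = Fam 8 4 conn-Z9 ((0 , 1) ∷ (2 , 1) ∷ (2 , 3) ∷ (4 , 3) ∷ (4 , 5) ∷ (6 , 5) ∷ (6 , 7) ∷ (8 , 7) ∷ (8 , 0) ∷ []) ((2 , 1) ∷ (2 , 3) ∷ []) 6 2 0F 1F 2F 1F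

  cyclic-9 : ∀ {a n} → HasOrder a n → 2 ≤ n → HGR 9 G
  cyclic-9 {n = 0} o ()
  cyclic-9 {n = 1} o (s≤s ())
  cyclic-9 {n = 2} o _ = F9.Mod.hgr o patch-Z9-2 refl refl refl
  cyclic-9 {n = 3} o _ = F9.Mod.hgr o patch-Z9-3 refl refl refl
  cyclic-9 {n = 4} o _ = F9.Mod.hgr o (F9.normed 4 patch-Z9) refl refl refl
  cyclic-9 {n = 5} o _ = F9.Mod.hgr o (F9.normed 5 patch-Z9) refl refl refl
  cyclic-9 {n = 6} o _ = F9.Mod.hgr o (F9.normed 6 patch-Z9) refl refl refl
  cyclic-9 {n = suc (suc (suc (suc (suc (suc (suc n))))))} o _ = F9.Big.hgr o 2 ℕₚ.≤-refl (ℕₚ.m≤m+n 7 n) patch-Z9 refl refl refl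

  hgr-T53 : ∀ {a} → HasOrder a 3 → HGR 5 G
  hgr-T53 {a} o
    = Build.hgr 4 (CLab.toLab (modLab o)) (table conn-T53) (1 ∷ []) patch-T53 (pairIn ((0 , 1) ∷ (2 , 1) ∷ (2 , 3) ∷ (4 , 3) ∷ (4 , 0) ∷ [])) (λ i j → not (pairIn ((2 , 1) ∷ (2 , 3) ∷ []) i j)) 6 2 0F 1F 2F 1F refl refl refl
      (gen a) (λ P h → gen-least₁ P (h {1} refl)) (λ {u} _ → ^∈gen a u)

  hgr-T62 : ∀ {a} → HasOrder a 2 → HGR 6 G
  hgr-T62 {a} o
    = Build.hgr 5 (CLab.toLab (modLab o)) (table conn-T62) (1 ∷ []) patch-T62 (pairIn ((0 , 1) ∷ (2 , 3) ∷ (4 , 5) ∷ [])) (λ i j → not (pairIn ((2 , 3) ∷ []) i j)) 5 1 0F 1F 2F 3F refl refl refl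
      (gen a) (λ P h → gen-least₁ P (h {1} refl)) (λ {u} _ → ^∈gen a u)

  hgr-T72 : ∀ {a} → HasOrder a 2 → HGR 7 G
  hgr-T72 {a} o
    = Build.hgr 6 (CLab.toLab (modLab o)) (table conn-T72) (1 ∷ []) patch-T72 (pairIn ((0 , 1) ∷ (2 , 1) ∷ (2 , 3) ∷ (4 , 3) ∷ (4 , 5) ∷ (6 , 5) ∷ (6 , 0) ∷ [])) (λ i j → not (pairIn ((2 , 1) ∷ (2 , 3) ∷ []) i j)) 6 2 0F 1F 2F 1F refl refl refl
      (gen a) (λ P h → gen-least₁ P (h {1} refl)) (λ {u} _ → ^∈gen a u)

  hgr-T82 : ∀ {a} → HasOrder a 2 → HGR 8 G
  hgr-T82 {a} o
    = Build.hgr 7 (CLab.toLab (modLab o)) (table conn-T82) (1 ∷ []) patch-T82 (pairIn ((0 , 1) ∷ (2 , 3) ∷ (4 , 5) ∷ (6 , 7) ∷ [])) (λ i j → not (pairIn ((2 , 3) ∷ []) i j)) 6 1 0F 1F 2F 3F refl refl refl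
      (gen a) (λ P h → gen-least₁ P (h {1} refl)) (λ {u} _ → ^∈gen a u)

  hgr-T4V : ∀ {a b} → a · a ≡ e → a ≢ e → b · b ≡ e → b ∉ gen a → b · a ≡ a · b → HGR 4 G
  hgr-T4V {a} {b} aa a≢e bb b∉ ba
    = Build.hgr 3 (CLab.toLab Λ′) (table conn-T4V) ((1 , 0) ∷ (0 , 1) ∷ []) patch-T4V (pairIn ((0 , 1) ∷ (2 , 3) ∷ [])) (λ i j → not (pairIn ((2 , 3) ∷ []) i j)) 6 1 0F 1F 2F 3F refl refl refl
      (adjoin (gen a) b) (λ P h → adjoin-least (gen a) b P (gen-least a P (subst (_∈ P) (trans (idʳ _) (^1 a)) (h {1 , 0} refl))) (subst (_∈ P) (trans (idˡ _) (^1 b)) (h {0 , 1} refl))) (λ {u} → φ∈′ {u})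
    where open Comm (modLab (ord2 aa a≢e)) (gen a) (λ {u} _ → ^∈gen a u) b 2 (s≤s z≤n) (λ {u} _ → comm-pow ba u) (x^2 bb) (out2 {gen a} b∉)

  hgr-T5V : ∀ {a b} → a · a ≡ e → a ≢ e → b · b ≡ e → b ∉ gen a → b · a ≡ a · b → HGR 5 G
  hgr-T5V {a} {b} aa a≢e bb b∉ ba
    = Build.hgr 4 (CLab.toLab Λ′) (table conn-T5V) ((1 , 0) ∷ (0 , 1) ∷ []) patch-T5V (pairIn ((0 , 1) ∷ (2 , 1) ∷ (2 , 3) ∷ (4 , 3) ∷ (4 , 0) ∷ [])) (λ i j → not (pairIn ((2 , 1) ∷ (2 , 3) ∷ []) i j)) 6 2 0F 1F 2F 1F refl refl refl
      (adjoin (gen a) b) (λ P h → adjoin-least (gen a) b P (gen-least a P (subst (_∈ P) (trans (idʳ _) (^1 a)) (h {1 , 0} refl))) (subst (_∈ P) (trans (idˡ _) (^1 b)) (h {0 , 1} refl))) (λ {u} → φ∈′ {u})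
    where open Comm (modLab (ord2 aa a≢e)) (gen a) (λ {u} _ → ^∈gen a u) b 2 (s≤s z≤n) (λ {u} _ → comm-pow ba u) (x^2 bb) (out2 {gen a} b∉)

  hgr-T4N : ∀ {a b} → HasOrder a 3 → b ^ 3 ≡ e → b ∉ gen a → b · a ≡ a · b → HGR 4 G
  hgr-T4N {a} {b} o b3 b∉ ba
    = Build.hgr 3 (CLab.toLab Λ′) (table conn-T4N) ((1 , 0) ∷ (0 , 1) ∷ []) patch-T4N (pairIn ((0 , 1) ∷ (2 , 3) ∷ [])) (λ i j → not (pairIn ((2 , 3) ∷ []) i j)) 6 1 0F 1F 2F 3F refl refl refl
      (adjoin (gen a) b) (λ P h → adjoin-least (gen a) b P (gen-least a P (subst (_∈ P) (trans (idʳ _) (^1 a)) (h {1 , 0} refl))) (subst (_∈ P) (trans (idˡ _) (^1 b)) (h {0 , 1} refl))) (λ {u} → φ∈′ {u})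
    where open Comm (modLab o) (gen a) (λ {u} _ → ^∈gen a u) b 3 (s≤s z≤n) (λ {u} _ → comm-pow ba u) b3 (out3′ {gen a} b3 b∉)

  hgr-T4S : ∀ {c t} → HasOrder c 3 → t ∉ gen c → t · c ≡ c ^ 2 · t → t · t ≡ e → HGR 4 G
  hgr-T4S {c} {t} o t∉ tc tt′
    = Build.hgr 3 (CLab.toLab Λ) (table conn-T4S) gens patch-T4S (pairIn ((0 , 1) ∷ (2 , 3) ∷ [])) (λ i j → not (pairIn ((2 , 3) ∷ []) i j)) 6 1 0F 1F 2F 3F refl refl refl
      K least (λ {u} → φ∈K {u})
    where open Cyclic2 c t 3 o t∉ 2 0 tc tt′ (s≤s z≤n)

-- From an m-HGR back to connection sets

-- The converse of toHGR: an m-HGR is given by connection sets.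
module FromHGR (G : FinGroup) (m : ℕ) (h : HGR m G) where
  open Grp G
  open Core G m
  open HGR h hiding (sym)

  rep : Fin m → Fin N
  rep i = proj₁ (part-onto i)

  -- The inverse turns the left action into right translation: `act g` becomes multiplication by g⁻¹
  -- from the right.
  vert : Vx → Fin N
  vert (i , x) = act (inv x) (rep i)

  S : Conn
  S i j x = adj (rep i) (vert (j , x))

  adj-vert : ∀ u v → adj (vert u) (vert v) ≡ adjC S u v
  adj-vert (i , x) (j , y) = trans (cong (adj (vert (i , x))) (trans (cong (λ t → act t (rep j)) (grp (x ∷ y ∷ []) (v1 ⁻) (v0 ⁻ ⊙ (v1 ⊙ v0 ⁻) ⁻) refl)) (act-· (inv x) (inv (y / x)) (rep j))))
    (act-aut (inv x) (rep i) (act (inv (y / x)) (rep j)))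

  part-vert : ∀ i x → part (vert (i , x)) ≡ i
  part-vert i x = trans (sym (proj₂ (part-orbits (rep i) (vert (i , x))) (inv x , refl))) (proj₂ (part-onto i))

  same-act : ∀ {g k v} → act g v ≡ act k v → g ≡ k
  same-act {g} {k} {v} p = sym (trans (grp (g ∷ k ∷ []) v1 (v0 ⊙ (v0 ⁻ ⊙ v1)) refl) (trans (cong (g ·_) (semiregular (inv g · k) v
    (trans (act-· (inv g) k v) (trans (cong (act (inv g)) (sym p)) (trans (sym (act-· (inv g) g v)) (trans (cong (λ t → act t v) (invˡ g)) (act-e v))))))) (idʳ g)))

  vert-inj : ∀ {u v} → vert u ≡ vert v → u ≡ v
  vert-inj {i , x} {j , y} p with trans (sym (part-vert i x)) (trans (cong part p) (part-vert j y))
  ... | refl = cong (i ,_) (inv-injective (same-act p))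

  coord : Fin N → Vx
  coord w = part w , inv (proj₁ (proj₁ (part-orbits (rep (part w)) w) (proj₂ (part-onto (part w)))))

  vert-coord : ∀ w → vert (coord w) ≡ w
  vert-coord w = trans (cong (λ t → act t (rep (part w))) (inv-inv _)) (proj₂ (proj₁ (part-orbits (rep (part w)) w) (proj₂ (part-onto (part w)))))

  coord-vert : ∀ u → coord (vert u) ≡ u
  coord-vert u = vert-inj (vert-coord (vert u))

  isC : IsConn S
  isC = record
    { symC = λ i j x → trans (cong (S j i) (sym (idˡ (inv x)))) (trans (sym (adj-vert (j , x) (i , e))) (trans (sym′ (vert (j , x)) (vert (i , e))) (trans (adj-vert (i , e) (j , x)) (cong (S i j) (trans (cong (x ·_) inv-e) (idʳ x))))))
    ; irrC = λ i x → independent _ _ (trans (proj₂ (part-onto i)) (sym (part-vert i x))) }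
    where sym′ = Graph.sym Γ

  regular′ : ∃ λ k → ∀ i → deg S i ≡ k
  regular′ = proj₁ regular , λ i → begin
    sum (λ j → cnt (S i j)) ≡⟨ sum-cong-≗ {m} {λ j → cnt (S i j)} {λ j → sum (λ y → at i (combine j y))} (λ j → sum-cong-≗ {order} {λ y → b2n (S i j y)} {λ y → at i (combine j y)} (λ y → cong (λ t → b2n (adj (rep i) (vert t))) (sym (Fₚ.remQuot-combine j y)))) ⟩
    sum {m} (λ j → sum {order} (λ y → at i (combine j y))) ≡⟨ sum-combine m (at i) ⟨
    sum (at i) ≡⟨ sum-permute (λ u → b2n (adj (rep i) u)) bij ⟨
    sum (λ u → b2n (adj (rep i) u)) ≡⟨ sumL-allFin (λ u → b2n (adj (rep i) u)) ⟨
    degree Γ (rep i) ≡⟨ proj₂ regular (rep i) ⟩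
    proj₁ regular ∎
    where
    open ≡-Reasoning
    at : Fin m → Fin (m * order) → ℕ
    at i c = b2n (adj (rep i) (vert (remQuot {m} order c)))
    bij = permutation (λ c → vert (remQuot {m} order c)) (λ w → combine (proj₁ (coord w)) (proj₂ (coord w)))
      (λ w → trans (cong vert (Fₚ.remQuot-combine (proj₁ (coord w)) (proj₂ (coord w)))) (vert-coord w))
      (λ c → trans (cong (λ t → combine (proj₁ t) (proj₂ t)) (coord-vert (remQuot {m} order c))) (Fₚ.combine-remQuot {m} order c))

  rigid : Rigid full S
  rigid σ with onto-Aut (permutation (λ w → vert (to σ (coord w))) (λ w → vert (from σ (coord w)))
      (λ w → trans (cong (λ t → vert (to σ t)) (coord-vert _)) (trans (cong vert (to-from σ _)) (vert-coord w)))
      (λ w → trans (cong (λ t → vert (from σ t)) (coord-vert _)) (trans (cong vert (from-to σ _)) (vert-coord w))))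
      (λ u v → trans (adj-vert _ _) (trans (pres σ _ _) (trans (sym (adj-vert _ _)) (cong₂ adj (vert-coord u) (vert-coord v)))))
  ... | g , p = inv g , λ i x _ → vert-inj (begin
      vert (to σ (i , x)) ≡⟨ cong (λ t → vert (to σ t)) (coord-vert (i , x)) ⟨
      vert (to σ (coord (vert (i , x)))) ≡⟨ p (vert (i , x)) ⟩
      act g (vert (i , x)) ≡⟨ act-· g (inv x) (rep i) ⟨
      act (g · inv x) (rep i) ≡⟨ cong (λ t → act t (rep i)) (grp (g ∷ x ∷ []) (v0 ⊙ v1 ⁻) ((v1 ⊙ v0 ⁻) ⁻) refl) ⟩
      vert (i , x · inv g) ∎)
    where open ≡-Reasoning

record Hom (K G : FinGroup) : Set where
  private
    module K = FinGroup K
    module G = FinGroup G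
  field
    φ   : Fin K.order → Fin G.order
    ψ   : Fin G.order → Fin K.order
    φψ  : ∀ x → φ (ψ x) ≡ x
    φ-· : ∀ x y → φ (K._·_ x y) ≡ G._·_ (φ x) (φ y)
    φ-inj : ∀ {x y} → φ x ≡ φ y → x ≡ y

-- The exhaustive search runs over one concrete group, so an m-HGR of an isomorphic `G` is pulled
-- back to it.
transport : ∀ {m K G} → Hom K G → HGR m G → HGR m K
transport {m} {K} {G} hom h = record
  { Γ = Γ ; regular = regular ; act = act ∘ φ
  ; act-e = λ v → trans (cong (λ t → act t v) φ-e) (act-e v)
  ; act-· = λ x y v → trans (cong (λ t → act t v) (φ-· x y)) (act-· (φ x) (φ y) v)
  ; act-aut = act-aut ∘ φ
  ; faithful = λ x p → to-e (faithful (φ x) p)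
  ; onto-Aut = λ σ a → ψ (proj₁ (onto-Aut σ a)) , λ v → trans (proj₂ (onto-Aut σ a) v) (cong (λ t → act t v) (sym (φψ _)))
  ; semiregular = λ x v p → to-e (semiregular (φ x) v p)
  ; part = part ; part-onto = part-onto
  ; part-orbits = λ u v → (λ p → ψ (proj₁ (proj₁ (part-orbits u v) p)) , trans (cong (λ t → act t u) (φψ _)) (proj₂ (proj₁ (part-orbits u v) p))) ,
      λ { (g , p) → proj₂ (part-orbits u v) (φ g , p) }
  ; independent = independent }
  where
  open HGR h hiding (sym)
  open Hom hom
  open Grp G using (·-cancelˡ)
  φ-e : φ (FinGroup.e K) ≡ FinGroup.e G
  φ-e = ·-cancelˡ (φ (FinGroup.e K)) (trans (sym (φ-· _ _)) (trans (cong φ (FinGroup.idˡ K _)) (sym (FinGroup.idʳ G _))))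
  to-e : ∀ {x} → φ x ≡ FinGroup.e G → x ≡ FinGroup.e K
  to-e p = φ-inj (trans p (sym φ-e))

module Twist (G : FinGroup) (m : ℕ) where
  open Grp G
  open Core G m

  record Rep (S : Conn) : Set where
    field
      isC   : IsConn S
      d     : ℕ
      deg-d : ∀ i → deg S i ≡ d
      rigid : Rigid full S

  -- Renumbering the parts by π and choosing other base points.
  module _ (π π⁻ : Fin m → Fin m) (ππ⁻ : ∀ i → π (π⁻ i) ≡ i) (π⁻π : ∀ i → π⁻ (π i) ≡ i) (c : Fin m → El) where
    twist : Conn → Conn
    twist S i j x = S (π i) (π j) ((c j · x) / c i)

    move back : Vx → Vx
    move (i , x) = π i , c i · x
    back (i , x) = π⁻ i , inv (c (π⁻ i)) · x

    move-back : ∀ v → move (back v) ≡ v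
    move-back (i , x) = cong₂ _,_ (ππ⁻ i) (grp (c (π⁻ i) ∷ x ∷ []) (v0 ⊙ (v0 ⁻ ⊙ v1)) v1 refl)

    back-move : ∀ v → back (move v) ≡ v
    back-move (i , x) = cong₂ _,_ (π⁻π i) (trans (cong (λ t → inv (c t) · (c i · x)) (π⁻π i)) (grp (c i ∷ x ∷ []) (v0 ⁻ ⊙ (v0 ⊙ v1)) v1 refl))

    adj-move : ∀ S u v → adjC S (move u) (move v) ≡ adjC (twist S) u v
    adj-move S (i , x) (j , y) = cong (S (π i) (π j)) (grp (c i ∷ x ∷ c j ∷ y ∷ []) (v2 ⊙ v3 ⊙ (v0 ⊙ v1) ⁻) (v2 ⊙ (v3 ⊙ v1 ⁻) ⊙ v0 ⁻) refl)

    cnt-twist : ∀ S i j → cnt (twist S i j) ≡ cnt (S (π i) (π j))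
    cnt-twist S i j = cnt-bij (S (π i) (π j)) (λ x → (c j · x) / c i) (λ x → inv (c j) · (x · c i))
      (λ x → grp (c i ∷ c j ∷ x ∷ []) (v1 ⊙ (v1 ⁻ ⊙ (v2 ⊙ v0)) ⊙ v0 ⁻) v2 refl) (λ x → grp (c i ∷ c j ∷ x ∷ []) (v1 ⁻ ⊙ (v1 ⊙ v2 ⊙ v0 ⁻ ⊙ v0)) v2 refl)

    twisted : ∀ {S} → Rep S → Rep (twist S)
    twisted {S} r = record
      { isC = record
        { symC = λ i j x → trans (cong (S (π j) (π i)) (grp (c i ∷ c j ∷ x ∷ []) (v0 ⊙ v2 ⁻ ⊙ v1 ⁻) ((v1 ⊙ v2 ⊙ v0 ⁻) ⁻) refl)) (IsConn.symC isC (π i) (π j) _)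
        ; irrC = λ i x → IsConn.irrC isC (π i) _ }
      ; d = d
      ; deg-d = λ i → trans (sum-cong-≗ (λ j → cnt-twist S i j)) (trans (sum-bij (λ j → cnt (S (π i) j)) π π⁻ ππ⁻ π⁻π) (deg-d (π i)))
      ; rigid = rig }
      where
      open Rep r
      rig : Rigid full (twist S)
      rig σ with rigid (record
        { to = move ∘ to σ ∘ back ; from = move ∘ from σ ∘ back
        ; to-from = λ v → trans (cong (move ∘ to σ) (back-move _)) (trans (cong move (to-from σ _)) (move-back v))
        ; from-to = λ v → trans (cong (move ∘ from σ) (back-move _)) (trans (cong move (from-to σ _)) (move-back v))
        ; pres = λ u v → trans (adj-move S _ _) (trans (pres σ _ _) (trans (sym (adj-move S _ _)) (cong₂ (adjC S) (move-back u) (move-back v)))) })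
      ... | g , p = g , λ i x _ → trans (sym (back-move _)) (trans (cong back (trans (cong (move ∘ to σ) (sym (back-move (i , x)))) (trans (p (π i) (c i · x) refl)
              (cong (π i ,_) (assoc (c i) x g))))) (back-move (i , x · g)))



hgr-rep : ∀ {m G} → HGR m G → ∃ (Twist.Rep G m)
hgr-rep {m} {G} h = S , record { isC = isC ; d = proj₁ regular′ ; deg-d = proj₂ regular′ ; rigid = rigid }
  where open FromHGR G m h

-- Normal forms of systems of connection sets

seg : {A : Set} → (ℕ → A) → ℕ → ℕ → List A
seg f a zero    = []
seg f a (suc l) = f a ∷ seg f (suc a) l

seg-snoc : {A : Set} (f : ℕ → A) → ∀ a l → seg f a (suc l) ≡ seg f a l ++ f (a + l) ∷ []
seg-snoc f a zero    = cong (λ t → f t ∷ []) (sym (ℕₚ.+-identityʳ a))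
seg-snoc f a (suc l) = cong (f a ∷_) (trans (seg-snoc f (suc a) l) (cong (λ t → seg f (suc a) l ++ f t ∷ []) (sym (ℕₚ.+-suc a l))))

seg-cong : {A : Set} {f g : ℕ → A} → ∀ a l → (∀ b → b < a + l → f b ≡ g b) → seg f a l ≡ seg g a l
seg-cong a zero    h = refl
seg-cong a (suc l) h = cong₂ _∷_ (h a (ℕₚ.m<m+n a (s≤s z≤n))) (seg-cong (suc a) l λ b p → h b (subst (b <_) (sym (ℕₚ.+-suc a l)) p))

seg-map : {A B : Set} (g : A → B) (f : ℕ → A) → ∀ a l → map g (seg f a l) ≡ seg (g ∘ f) a l
seg-map g f a zero    = refl
seg-map g f a (suc l) = cong (g (f a) ∷_) (seg-map g f (suc a) l)

look-seg : {A : Set} (f : ℕ → A) (z : A) → ∀ a {l b} → b < l → look (seg f a l) z b ≡ f (a + b)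
look-seg f z a {suc l} {zero}  _       = cong f (sym (ℕₚ.+-identityʳ a))
look-seg f z a {suc l} {suc b} (s≤s p) = trans (look-seg f z (suc a) p) (cong f (sym (ℕₚ.+-suc a b)))

-- p ∷ ps bounds c ∷ cs lexicographically; only as many entries as both lists have are compared.
Lex : List ℕ → List ℕ → Set
Lex (p ∷ ps) (c ∷ cs) = (c < p) ⊎ (c ≡ p × Lex ps cs)
Lex _        _        = ⊤

lex-total : ∀ ps cs → Lex ps cs ⊎ Lex cs ps
lex-total [] cs = inj₁ tt
lex-total (p ∷ ps) [] = inj₁ tt
lex-total (p ∷ ps) (c ∷ cs) with ℕₚ.<-cmp p c
... | tri< l _ _ = inj₂ (inj₁ l)
... | tri> _ _ l = inj₁ (inj₁ l)
... | tri≈ _ e _ with lex-total ps cs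
... | inj₁ q = inj₁ (inj₂ (sym e , q))
... | inj₂ q = inj₂ (inj₂ (e , q))

lex-trans : ∀ {f g h : ℕ → ℕ} a l → Lex (seg f a l) (seg g a l) → Lex (seg g a l) (seg h a l) → Lex (seg f a l) (seg h a l)
lex-trans a zero _ _ = tt
lex-trans a (suc l) (inj₁ p) (inj₁ q) = inj₁ (ℕₚ.<-trans q p)
lex-trans a (suc l) (inj₁ p) (inj₂ (e , _)) = inj₁ (subst (_< _) (sym e) p)
lex-trans a (suc l) (inj₂ (e , _)) (inj₁ q) = inj₁ (subst (_ <_) e q)
lex-trans a (suc l) (inj₂ (e , p)) (inj₂ (e′ , q)) = inj₂ (trans e′ e , lex-trans (suc a) l p q)

-- Surplus entries are never compared, so the bounded list may be prolonged; a row of the search has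
-- one entry more than its predecessor.
lex-longer : ∀ {f g : ℕ → ℕ} a l → Lex (seg f a l) (seg g a l) → Lex (seg f a l) (seg g a (suc l))
lex-longer a zero _ = tt
lex-longer a (suc l) (inj₁ p) = inj₁ p
lex-longer a (suc l) (inj₂ (e , p)) = inj₂ (e , lex-longer (suc a) l p)

toFin-toℕ : ∀ {k} (i : Fin (suc k)) → toFin (toℕ i) ≡ i
toFin-toℕ {zero}  zero    = refl
toFin-toℕ {suc k} zero    = refl
toFin-toℕ {suc k} (suc i) = cong suc (toFin-toℕ i)

toℕ-toFin : ∀ {k a} → a < suc k → toℕ (toFin {k} a) ≡ a
toℕ-toFin {k} {zero} _ = refl
toℕ-toFin {suc k} {suc a} (s≤s p) = cong suc (toℕ-toFin p)

upsum : (ℕ → ℕ) → ℕ → ℕ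
upsum h zero    = 0
upsum h (suc k) = upsum h k + h k

upsum-front : ∀ h k → upsum h (suc k) ≡ h 0 + upsum (h ∘ suc) k
upsum-front h zero    = ℕₚ.+-comm 0 (h 0)
upsum-front h (suc k) = trans (cong (_+ h (suc k)) (upsum-front h k)) (ℕₚ.+-assoc (h 0) (upsum (h ∘ suc) k) (h (suc k)))

sum-upsum : ∀ k (h : ℕ → ℕ) → sum {k} (h ∘ toℕ) ≡ upsum h k
sum-upsum zero h = refl
sum-upsum (suc k) h = trans (cong (h 0 +_) (sum-upsum k (h ∘ suc))) (sym (upsum-front h k))

upsum-mono : ∀ h {a b} → a ≤ b → upsum h a ≤ upsum h b
upsum-mono h {a} {b} p = subst (λ t → upsum h a ≤ upsum h t) (ℕₚ.m+[n∸m]≡n p) (go (b ∸ a))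
  where
  go : ∀ c → upsum h a ≤ upsum h (a + c)
  go zero = ℕₚ.≤-reflexive (cong (upsum h) (sym (ℕₚ.+-identityʳ a)))
  go (suc c) = ℕₚ.≤-trans (go c) (ℕₚ.≤-trans (ℕₚ.m≤m+n _ (h (a + c))) (ℕₚ.≤-reflexive (cong (upsum h) (sym (ℕₚ.+-suc a c)))))

-- Bounds what the parts still to come can add to a valency, which justifies pruning from below.
upsum-room : ∀ h n → (∀ k → h k ≤ n) → ∀ {a b} → a ≤ b → upsum h b ≤ upsum h a + (b ∸ a) * n
upsum-room h n p {a} {b} q = subst (λ t → upsum h t ≤ upsum h a + (b ∸ a) * n) (ℕₚ.m+[n∸m]≡n q) (go (b ∸ a))
  where
  go : ∀ c → upsum h (a + c) ≤ upsum h a + c * n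
  go zero = ℕₚ.≤-reflexive (trans (cong (upsum h) (ℕₚ.+-identityʳ a)) (sym (ℕₚ.+-identityʳ _)))
  go (suc c) = ℕₚ.≤-trans (ℕₚ.≤-reflexive (cong (upsum h) (ℕₚ.+-suc a c))) (ℕₚ.≤-trans (ℕₚ.+-mono-≤ (go c) (p (a + c)))
    (ℕₚ.≤-reflexive (trans (ℕₚ.+-assoc (upsum h a) (c * n) n) (cong (upsum h a +_) (ℕₚ.+-comm (c * n) n)))))

eqL : List Bool → List Bool → Bool
eqL [] [] = true
eqL (a ∷ as) (b ∷ bs) = eqB a b ∧ eqL as bs
eqL _ _ = false

eqL-sound : ∀ {as bs} → eqL as bs ≡ true → as ≡ bs
eqL-sound {[]} {[]} _ = refl
eqL-sound {a ∷ as} {b ∷ bs} p = cong₂ _∷_ (eqB-sound a b (proj₁ (∧-split {eqB a b} p))) (eqL-sound (proj₂ (∧-split {eqB a b} p)))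
  where
  eqB-sound : ∀ a b → eqB a b ≡ true → a ≡ b
  eqB-sound true  true  _ = refl
  eqB-sound false false _ = refl

eqL-refl : ∀ as → eqL as as ≡ true
eqL-refl [] = refl
eqL-refl (a ∷ as) = cong₂ _∧_ (eqB-refl {a} refl) (eqL-refl as)

EL : BoolEq (List Bool)
EL = record { eq = eqL ; sound = eqL-sound ; rfl = eqL-refl }

open BoolEq EL public using () renaming (mem to memL)

weight : List Bool → ℕ
weight [] = 0
weight (b ∷ bs) = b2n b + weight bs

bits : ∀ {k} → (Fin k → Bool) → List Bool
bits {zero}  f = []
bits {suc k} f = f zero ∷ bits (f ∘ suc)

bits-cong : ∀ {k} {f g : Fin k → Bool} → (∀ x → f x ≡ g x) → bits f ≡ bits g
bits-cong {zero}  h = refl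
bits-cong {suc k} h = cong₂ _∷_ (h zero) (bits-cong (h ∘ suc))

size-bits : ∀ {k} (f : Fin k → Bool) → weight (bits f) ≡ cnt f
size-bits {zero}  f = refl
size-bits {suc k} f = cong (b2n (f zero) +_) (size-bits (f ∘ suc))

look-bits : ∀ {k} (f : Fin k → Bool) x → look (bits f) false (toℕ x) ≡ f x
look-bits {suc k} f zero    = refl
look-bits {suc k} f (suc x) = look-bits (f ∘ suc) x

subsets : ℕ → List (List Bool)
subsets zero    = [] ∷ []
subsets (suc k) = map (true ∷_) (subsets k) ++ map (false ∷_) (subsets k)

mem-cons : ∀ b s ss → memL s ss ≡ true → memL (b ∷ s) (map (b ∷_) ss) ≡ true
mem-cons b s (t ∷ ss) p with ∨-split {eqL s t} p
... | inj₁ q = ∨-inj₁ _ (cong₂ _∧_ (eqB-refl {b} refl) q)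
... | inj₂ q = ∨-inj₂ (eqL (b ∷ s) (b ∷ t)) (mem-cons b s ss q)

mem-subsets : ∀ {k} (f : Fin k → Bool) → memL (bits f) (subsets k) ≡ true
mem-subsets {zero}  f = refl
mem-subsets {suc k} f with f zero
... | true  = BoolEq.mem-++ˡ EL (true ∷ bits (f ∘ suc)) (map (true ∷_) (subsets k)) _ (mem-cons true (bits (f ∘ suc)) (subsets k) (mem-subsets (f ∘ suc)))
... | false = BoolEq.mem-++ʳ EL (false ∷ bits (f ∘ suc)) (map (true ∷_) (subsets k)) _ (mem-cons false (bits (f ∘ suc)) (subsets k) (mem-subsets (f ∘ suc)))

keep : (List Bool → Bool) → List (List Bool) → List (List Bool)
keep f [] = []
keep f (s ∷ ss) = if f s then s ∷ keep f ss else keep f ss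

mem-keep : ∀ f s ss → memL s ss ≡ true → f s ≡ true → memL s (keep f ss) ≡ true
mem-keep f s (t ∷ ss) p q with ∨-split {eqL s t} p
... | inj₁ r with refl ← eqL-sound {s} {t} r rewrite q = ∨-inj₁ _ (eqL-refl s)
... | inj₂ r with f t
... | true  = ∨-inj₂ (eqL s t) (mem-keep f s ss r q)
... | false = mem-keep f s ss r q

anyᵇ-map : {A B : Set} (f : B → Bool) (g : A → B) → ∀ xs → anyᵇ f (map g xs) ≡ true → anyᵇ (f ∘ g) xs ≡ true
anyᵇ-map f g (x ∷ xs) p with ∨-split {f (g x)} p
... | inj₁ q = ∨-inj₁ _ q
... | inj₂ q = ∨-inj₂ (f (g x)) (anyᵇ-map f g xs q)

∨-right : ∀ {a b} → a ≡ false → a ∨ b ≡ true → b ≡ true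
∨-right refl p = p

-- The parts can be ordered so that each is the largest of those remaining in its sizes towards the earlier ones.
module Sort {m′ : ℕ} (w : Fin (suc m′) → Fin (suc m′) → ℕ) where
  key : (Fin (suc m′) → Fin (suc m′)) → ℕ → Fin (suc m′) → List ℕ
  key π k x = seg (λ a → w (π (toFin a)) x) 0 k

  record Ord (k : ℕ) : Set where
    field
      π π⁻ : Fin (suc m′) → Fin (suc m′)
      ππ⁻  : ∀ i → π (π⁻ i) ≡ i
      π⁻π  : ∀ i → π⁻ (π i) ≡ i
      top  : ∀ b → b < k → ∀ l → b < toℕ l → Lex (key π b (π (toFin b))) (key π b (π l))

  best : ∀ π k (y : Fin (suc m′)) → k ≤ toℕ y → (xs : List (Fin (suc m′))) →
         ∃ λ z → k ≤ toℕ z × Lex (key π k (π z)) (key π k (π y)) × Allₗ (λ x → k ≤ toℕ x → Lex (key π k (π z)) (key π k (π x))) xs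
  best π k y p [] = y , p , lex-self 0 k , []
    where
    lex-self : ∀ {f : ℕ → ℕ} a l → Lex (seg f a l) (seg f a l)
    lex-self a zero    = tt
    lex-self a (suc l) = inj₂ (refl , lex-self (suc a) l)
  best π k y p (x ∷ xs) with k ℕₚ.≤? toℕ x
  ... | no n = let (z , q , r , all) = best π k y p xs in z , q , r , (λ t → ⊥-elim (n t)) ∷ all
  ... | yes t with lex-total (key π k (π y)) (key π k (π x))
  ... | inj₁ u = let (z , q , r , all) = best π k y p xs in z , q , r , (λ _ → lex-trans 0 k r u) ∷ all
  ... | inj₂ u = let (z , q , r , all) = best π k x t xs in z , q , lex-trans 0 k r u , (λ _ → r) ∷ all

  swap : Fin (suc m′) → Fin (suc m′) → Fin (suc m′) → Fin (suc m′)
  swap i j x = if ⌊ x Fₚ.≟ i ⌋ then j else (if ⌊ x Fₚ.≟ j ⌋ then i else x)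

  swap-swap : ∀ i j x → swap i j (swap i j x) ≡ x
  swap-swap i j x with x Fₚ.≟ i
  swap-swap i j x | yes refl with j Fₚ.≟ i
  ... | yes refl = refl
  ... | no _ with j Fₚ.≟ j
  ... | yes _ = refl
  ... | no n = ⊥-elim (n refl)
  swap-swap i j x | no n with x Fₚ.≟ j
  ... | yes refl with i Fₚ.≟ i
  ... | yes _ = refl
  ... | no n′ = ⊥-elim (n′ refl)
  swap-swap i j x | no n | no n′ with x Fₚ.≟ i
  ... | yes q = ⊥-elim (n q)
  ... | no _ with x Fₚ.≟ j
  ... | yes q = ⊥-elim (n′ q)
  ... | no _ = refl

  swap-≥ : ∀ i j x {b} → b ≤ toℕ i → b ≤ toℕ j → b ≤ toℕ x → b ≤ toℕ (swap i j x)
  swap-≥ i j x p q r with x Fₚ.≟ i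
  ... | yes _ = q
  ... | no _ with x Fₚ.≟ j
  ... | yes _ = p
  ... | no _ = r

  swap-< : ∀ i j x → toℕ x < toℕ i → toℕ x < toℕ j → swap i j x ≡ x
  swap-< i j x p q with x Fₚ.≟ i
  ... | yes refl = ⊥-elim (ℕₚ.<-irrefl refl p)
  ... | no _ with x Fₚ.≟ j
  ... | yes refl = ⊥-elim (ℕₚ.<-irrefl refl q)
  ... | no _ = refl

  swap-fst : ∀ i j → swap i j i ≡ j
  swap-fst i j with i Fₚ.≟ i
  ... | yes _ = refl
  ... | no n = ⊥-elim (n refl)

  -- Selection sort. The key of a part involves only its sizes towards the parts placed before, so
  -- bringing the best one to position k disturbs no earlier comparison.
  arrange : ∀ k → k ≤ suc m′ → Ord k
  arrange zero _ = record { π = id ; π⁻ = id ; ππ⁻ = λ _ → refl ; π⁻π = λ _ → refl ; top = λ _ () }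
  arrange (suc k) k<m = extend (arrange k (ℕₚ.<⇒≤ k<m))
    where
    at-k : toℕ (toFin {m′} k) ≡ k
    at-k = toℕ-toFin k<m
    extend : Ord k → Ord (suc k)
    extend o with best (Ord.π o) k (toFin k) (ℕₚ.≤-reflexive (sym at-k)) (allFin (suc m′))
    ... | z , k≤z , _ , max = record
      { π = π ∘ s ; π⁻ = s ∘ π⁻
      ; ππ⁻ = λ i → trans (cong π (swap-swap (toFin k) z (π⁻ i))) (ππ⁻ i)
      ; π⁻π = λ i → trans (cong s (π⁻π (s i))) (swap-swap (toFin k) z i)
      ; top = top′ }
      where
      open Ord o
      s = swap (toFin k) z
      k≤ : k ≤ toℕ (toFin {m′} k)
      k≤ = ℕₚ.≤-reflexive (sym at-k)
      fixes : ∀ a → a < k → s (toFin a) ≡ toFin a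
      fixes a p = swap-< (toFin k) z (toFin a) (lt k≤) (lt k≤z)
        where
        lt : ∀ {c} → k ≤ c → toℕ (toFin {m′} a) < c
        lt q = subst (_< _) (sym (toℕ-toFin (ℕₚ.<-trans p k<m))) (ℕₚ.<-≤-trans p q)
      key≡ : ∀ b → b ≤ k → ∀ x → key (π ∘ s) b x ≡ key π b x
      key≡ b p x = seg-cong 0 b λ a a<b → cong (λ t → w (π t) x) (fixes a (ℕₚ.<-≤-trans a<b p))
      top′ : ∀ b → b < suc k → ∀ l → b < toℕ l → Lex (key (π ∘ s) b (π (s (toFin b)))) (key (π ∘ s) b (π (s l)))
      top′ b (s≤s b≤k) l b<l rewrite key≡ b b≤k (π (s (toFin b))) | key≡ b b≤k (π (s l)) with ℕₚ.m≤n⇒m<n∨m≡n b≤k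
      ... | inj₁ b<k = subst (λ t → Lex (key π b (π t)) (key π b (π (s l)))) (sym (fixes b b<k)) (top b b<k (s l) (swap-≥ (toFin k) z l (ℕₚ.<-≤-trans b<k k≤) (ℕₚ.<-≤-trans b<k k≤z) b<l))
      ... | inj₂ refl = subst (λ t → Lex (key π k (π t)) (key π k (π (s l)))) (sym (swap-fst (toFin k) z)) (All.lookup max (∈-allFin (s l)) (swap-≥ (toFin k) z l k≤ k≤z (ℕₚ.<⇒≤ b<l)))

  abstract
    order : Ord (suc m′)
    order = arrange (suc m′) ℕₚ.≤-refl

-- Exhaustive search: every normal form has an unwanted automorphism

module Candidates (K : FinGroup) (m : ℕ) (i₀ : Fin m) (n′ : ℕ) where
  open Grp K
  open Core K m

  Eqn : Set
  Eqn = (ℕ × ℕ × ℕ) × (ℕ × ℕ × ℕ)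

  -- Only the sets S i j with i < j are stored; the triple is the address of the bit, reached
  -- through the inverse for i > j. The address (0 , 0 , 0) is never filled and reads as `false`,
  -- the value inside a part.
  canon : Fin m → Fin m → El → ℕ × ℕ × ℕ
  canon i j x = if toℕ i <ᵇ toℕ j then (toℕ i , toℕ j , toℕ x) else (if toℕ j <ᵇ toℕ i then (toℕ j , toℕ i , toℕ (inv x)) else (0 , 0 , 0))

  -- A candidate is a permutation of the vertices, the vertex (i , x) having the number i n + x with n = 1 + n′.
  perm : List ℕ → Vx → Vx
  perm c (i , x) = look (allFin m) i₀ (k div suc n′) , look (allFin order) e (k % suc n′)
    where k = look c 0 (toℕ i * suc n′ + toℕ x)

  eqV : Vx → Vx → Bool
  eqV (i , x) (j , y) = eqF i j ∧ eqF x y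

  eqV-sound : ∀ {u v} → eqV u v ≡ true → u ≡ v
  eqV-sound {i , x} {j , y} p = cong₂ _,_ (eqF-sound (proj₁ (∧-split {eqF i j} p))) (eqF-sound (proj₂ (∧-split {eqF i j} p)))

  eqV-refl : ∀ u → eqV u u ≡ true
  eqV-refl (i , x) = cong₂ _∧_ (eqF-refl i) (eqF-refl x)

  allV anyV : (Vx → Bool) → Bool
  allV f = allF λ i → allF λ x → f (i , x)
  anyV f = anyᶠ λ i → anyᶠ λ x → f (i , x)

  allV-elim : ∀ f → allV f ≡ true → ∀ v → f v ≡ true
  allV-elim f p (i , x) = allF-elim (λ x → f (i , x)) (allF-elim (λ i → allF λ x → f (i , x)) p i) x

  vertices : List Vx
  vertices = concatMap (λ i → map (i ,_) (allFin order)) (allFin m)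

  find : (Vx → Bool) → List Vx → Vx
  find f [] = i₀ , e
  find f (v ∷ vs) = if f v then v else find f vs

  perm⁻ : List ℕ → Vx → Vx
  perm⁻ c v = find (λ u → eqV (perm c u) v) vertices

  quotient : Vx → Vx → El
  quotient (_ , x) (_ , y) = y / x

  -- The image of an edge depends only on its two parts and its quotient.
  uniform : List ℕ → Vx → Vx → Bool
  uniform c (i , x) (j , y) = (eqF (proj₁ (perm c (i , x))) (proj₁ (perm c (i , e))) ∧ eqF (proj₁ (perm c (j , y))) (proj₁ (perm c (j , y / x)))) ∧
    eqF (quotient (perm c (i , x)) (perm c (j , y))) (quotient (perm c (i , e)) (perm c (j , y / x)))

  inverse moved : List ℕ → Vx → Bool
  inverse c v = eqV (perm c (perm⁻ c v)) v ∧ eqV (perm⁻ c (perm c v)) v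
  moved c v = not (eqV (perm c v) v)

  -- A right translation that keeps the group coordinate of (i₀ , e) is the identity. So a valid
  -- candidate, which also moves some vertex, is no translation.
  valid : List ℕ → Bool
  valid c = allV (inverse c) ∧ (allV (λ u → allV (uniform c u)) ∧ (eqF (proj₂ (perm c (i₀ , e))) e ∧ anyV (moved c)))

  eqn : List ℕ → Fin m → Fin m → El → Eqn
  eqn c i j x = canon i j x , canon (proj₁ (perm c (i , e))) (proj₁ (perm c (j , x))) (quotient (perm c (i , e)) (perm c (j , x)))

  -- By uniformity these finitely many equations between bits of `S` say that the candidate is an
  -- automorphism.
  eqns : List ℕ → List Eqn
  eqns c = concatMap (λ i → concatMap (λ j → if toℕ i <ᵇ toℕ j then map (eqn c i j) (allFin order) else []) (allFin m)) (allFin m)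

  module Instances (c : List ℕ) where
    all-concat : {A B : Set} (f : B → Bool) (g : A → List B) → ∀ xs → allᵇ f (concatMap g xs) ≡ true → allᵇ (λ x → allᵇ f (g x)) xs ≡ true
    all-concat f g [] _ = refl
    all-concat f g (y ∷ ys) p = cong₂ _∧_ (proj₁ (allᵇ-++⁻ (g y) p)) (all-concat f g ys (proj₂ (allᵇ-++⁻ (g y) p)))
      where
      allᵇ-++⁻ : ∀ xs {ys} → allᵇ f (xs ++ ys) ≡ true → (allᵇ f xs ≡ true) × (allᵇ f ys ≡ true)
      allᵇ-++⁻ [] p = refl , p
      allᵇ-++⁻ (x ∷ xs) p with ∧-split {f x} p
      ... | q , r = cong₂ _∧_ q (proj₁ (allᵇ-++⁻ xs r)) , proj₂ (allᵇ-++⁻ xs r)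

    all-allFin : ∀ {k} (f : Fin k → Bool) → allᵇ f (allFin k) ≡ true → ∀ i → f i ≡ true
    all-allFin {k} f p i = tab k id p i
      where
      tab : ∀ l (g : Fin l → Fin k) → allᵇ f (L.tabulate g) ≡ true → ∀ i → f (g i) ≡ true
      tab (suc l) g p zero    = proj₁ (∧-split p)
      tab (suc l) g p (suc i) = tab l (g ∘ suc) (proj₂ (∧-split {f (g zero)} p)) i

    all-map : {A B : Set} (f : B → Bool) (g : A → B) → ∀ xs → allᵇ f (map g xs) ≡ true → allᵇ (f ∘ g) xs ≡ true
    all-map f g [] _ = refl
    all-map f g (x ∷ xs) p = cong₂ _∧_ (proj₁ (∧-split p)) (all-map f g xs (proj₂ (∧-split {f (g x)} p)))

    eq-at : (h : Eqn → Bool) → allᵇ h (eqns c) ≡ true → ∀ i j x → toℕ i < toℕ j → h (eqn c i j x) ≡ true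
    eq-at h eqs i j x p = all-allFin (h ∘ eqn c i j) (all-map h (eqn c i j) (allFin order)
      (subst (λ b → allᵇ h (if b then map (eqn c i j) (allFin order) else []) ≡ true) (<ᵇ-true p)
      (all-allFin (λ j → allᵇ h (block i j)) (all-concat h (block i) (allFin m)
      (all-allFin (λ i → allᵇ h (concatMap (block i) (allFin m))) (all-concat h (λ i → concatMap (block i) (allFin m)) (allFin m) eqs) i)) j))) x
      where
      block : Fin m → Fin m → List Eqn
      block i j = if toℕ i <ᵇ toℕ j then map (eqn c i j) (allFin order) else []

  module Found (S : Conn) (isC : IsConn S) (rigid : Rigid full S) (c : List ℕ) (ok : valid c ≡ true)
               (eqs : ∀ i j x → toℕ i < toℕ j → S i j x ≡ S (proj₁ (perm c (i , e))) (proj₁ (perm c (j , x))) (quotient (perm c (i , e)) (perm c (j , x)))) where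
    ok₁ = ∧-split {allV (inverse c)} ok
    ok₂ = ∧-split {allV (λ u → allV (uniform c u))} (proj₂ ok₁)
    ok₃ = ∧-split {eqF (proj₂ (perm c (i₀ , e))) e} (proj₂ ok₂)

    inv₁ : ∀ v → perm c (perm⁻ c v) ≡ v
    inv₁ v = eqV-sound (proj₁ (∧-split {eqV (perm c (perm⁻ c v)) v} (allV-elim (inverse c) (proj₁ ok₁) v)))
    inv₂ : ∀ v → perm⁻ c (perm c v) ≡ v
    inv₂ v = eqV-sound (proj₂ (∧-split {eqV (perm c (perm⁻ c v)) v} (allV-elim (inverse c) (proj₁ ok₁) v)))

    uni : ∀ u v → uniform c u v ≡ true
    uni u v = allV-elim (uniform c u) (allV-elim (λ u → allV (uniform c u)) (proj₁ ok₂) u) v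

    pres< : ∀ u v → toℕ (proj₁ u) < toℕ (proj₁ v) → adjC S (perm c u) (perm c v) ≡ adjC S u v
    pres< (i , x) (j , y) p = begin
      S (proj₁ (perm c (i , x))) (proj₁ (perm c (j , y))) (quotient (perm c (i , x)) (perm c (j , y)))
        ≡⟨ cong₂ (λ a b → S a b (quotient (perm c (i , x)) (perm c (j , y)))) (eqF-sound (proj₁ parts)) (eqF-sound (proj₂ parts)) ⟩
      S (proj₁ (perm c (i , e))) (proj₁ (perm c (j , y / x))) (quotient (perm c (i , x)) (perm c (j , y)))
        ≡⟨ cong (S (proj₁ (perm c (i , e))) (proj₁ (perm c (j , y / x)))) (eqF-sound (proj₂ split)) ⟩
      S (proj₁ (perm c (i , e))) (proj₁ (perm c (j , y / x))) (quotient (perm c (i , e)) (perm c (j , y / x)))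
        ≡⟨ eqs i j (y / x) p ⟨
      S i j (y / x) ∎
      where
      open ≡-Reasoning
      split = ∧-split {eqF (proj₁ (perm c (i , x))) (proj₁ (perm c (i , e))) ∧ eqF (proj₁ (perm c (j , y))) (proj₁ (perm c (j , y / x)))} (uni (i , x) (j , y))
      parts = ∧-split {eqF (proj₁ (perm c (i , x))) (proj₁ (perm c (i , e)))} (proj₁ split)

    part-e : ∀ i x → proj₁ (perm c (i , x)) ≡ proj₁ (perm c (i , e))
    part-e i x = eqF-sound (proj₁ (∧-split {eqF (proj₁ (perm c (i , x))) (proj₁ (perm c (i , e)))} (proj₁ (∧-split
      {eqF (proj₁ (perm c (i , x))) (proj₁ (perm c (i , e))) ∧ eqF (proj₁ (perm c (i , x))) (proj₁ (perm c (i , x / x)))} (uni (i , x) (i , x))))))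

    σ : Auto S
    σ = record { to = perm c ; from = perm⁻ c ; to-from = inv₁ ; from-to = inv₂ ; pres = pr }
      where
      pr : ∀ u v → adjC S (perm c u) (perm c v) ≡ adjC S u v
      pr u@(i , x) v@(j , y) with Fₚ.<-cmp i j
      ... | tri< p _ _ = pres< u v p
      ... | tri> _ _ p = trans (IsConn.adj-sym isC (perm c u) (perm c v)) (trans (pres< v u p) (IsConn.adj-sym isC v u))
      ... | tri≈ _ refl _ = trans (cong (λ t → S (proj₁ (perm c u)) t (quotient (perm c u) (perm c v))) (trans (part-e i y) (sym (part-e i x)))) (trans (IsConn.irrC isC (proj₁ (perm c u)) (quotient (perm c u) (perm c v))) (sym (IsConn.irrC isC i (y / x))))

    absurd : ⊥
    absurd with rigid σ
    ... | g , p with anyᶠ-find (λ i → anyᶠ λ x → moved c (i , x)) (proj₂ ok₃)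
    ... | i , q with anyᶠ-find (λ x → moved c (i , x)) q
    ... | x , r = false≢true (not-true r) (subst (λ t → eqV t (i , x) ≡ true) (sym (trans (p i x refl) (cong (i ,_) (trans (cong (x ·_) g≡e) (idʳ x))))) (eqV-refl (i , x)))
      where
      g≡e : g ≡ e
      g≡e = trans (sym (idˡ g)) (trans (cong proj₂ (sym (p i₀ e refl))) (eqF-sound (proj₁ ok₃)))

module Refute (K : FinGroup) (m″ n′ : ℕ) where
  open Grp K
  m : ℕ
  m = suc (suc m″)
  open Core K m
  open Twist K m using (Rep; twist; twisted; cnt-twist)

  open Candidates K m zero n′

  Row : Set
  Row = List (List Bool)

  val : List Row → ℕ × ℕ × ℕ → Bool
  val rows (a , b , c) = look (look (look rows [] b) [] a) false c

  holds : List Row → Eqn → Bool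
  holds rows (p , q) = eqB (val rows p) (val rows q)

  leaf : List (List Eqn) → List Row → Bool
  leaf Es rows = anyᵇ (allᵇ (holds rows)) Es

  -- Row k holds S 0 k, ..., S (k-1) k. The list `ds` holds the valencies so far of the earlier
  -- parts and `tot` that of part k; `pr` holds the sizes of the previous row as long as they still
  -- bind the current one. `nd` and `acc` collect the new valencies and entries.
  module Search (Es : List (List Eqn)) (all first base : List (List Bool)) (d : ℕ) where
    -- The count `b` includes the parts already decided, the part itself among them, so at most (m ∸
    -- b) * order can still be added towards the valency `d`.
    bad : ℕ → ℕ → Bool
    bad b x = (d <ᵇ x) ∨ (x + (m ∸ b) * order <ᵇ d)

    -- Base points are free: those of parts 0 and 1 bring S 0 1 into the list `base`, those of the
    -- later parts put `e` into S 0 k unless it is empty.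
    options : ℕ → ℕ → List (List Bool)
    options k (suc i)       = all
    options (suc zero) zero = base
    options k zero          = first

    over : List ℕ → ℕ → Bool
    over []      c = false
    over (p ∷ _) c = p <ᵇ c

    rest : List ℕ → ℕ → List ℕ
    rest []       c = []
    rest (p ∷ ps) c = if c ≡ᵇ p then ps else []

    mutual
      go : ℕ → ℕ → List ℕ → List ℕ → List Row → Bool
      go zero    k ds pr rows = leaf Es rows
      go (suc r) k ds pr rows = row r k 0 0 ds pr [] [] rows

      row : ℕ → ℕ → ℕ → ℕ → List ℕ → List ℕ → List ℕ → Row → List Row → Bool
      row r k i tot []       pr nd acc rows = bad (suc k) tot ∨ go r (suc k) (nd ++ tot ∷ []) (map weight acc) (rows ++ acc ∷ [])
      row r k i tot (x ∷ ds) pr nd acc rows = allᵇ (λ s → entry r k i tot x ds pr nd acc rows s (weight s)) (options k i)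

      entry : ℕ → ℕ → ℕ → ℕ → ℕ → List ℕ → List ℕ → List ℕ → Row → List Row → List Bool → ℕ → Bool
      entry r k i tot x ds pr nd acc rows s c = bad (suc k) (x + c) ∨ (bad (suc i) (tot + c) ∨ (over pr c ∨
        row r k (suc i) (tot + c) ds (rest pr c) (nd ++ (x + c) ∷ []) (acc ++ s ∷ []) rows))

  based : List Bool → Bool
  based s = look s false (toℕ e) ∨ (weight s ≡ᵇ 0)

  shift : (El → Bool) → El → El → El → Bool
  shift X a b x = X ((b · x) / a)

  normal : List (List Bool) → List Bool → Bool
  normal base s = anyᶠ λ a → anyᶠ λ b → memL (bits (shift (λ y → look s false (toℕ y)) a b)) base

  explore : List (List Eqn) → Row → Row → Row → ℕ → Bool
  explore Es all first base d = Search.go Es all first base d m 0 [] [] []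

  -- Every normalised system of connection sets satisfies the equations of one of the candidates.
  check : List (List ℕ) → Row → Bool
  check cs base = allᵇ valid cs ∧ (allᵇ (normal base) (subsets order) ∧
    allᵇ (explore (map eqns cs) (subsets order) (keep based (subsets order)) base) (upto (suc (m * order))))

  module Sound (S : Conn) (rep : Rep S) (base : List (List Bool))
               (sorted : ∀ k → suc k < m → Lex (seg (λ a → cnt (S (toFin a) (toFin k))) 0 k) (seg (λ a → cnt (S (toFin a) (toFin (suc k)))) 0 (suc k)))
               (S01 : memL (bits (S zero (suc zero))) base ≡ true)
               (S0 : ∀ k → 1 < toℕ k → based (bits (S zero k)) ≡ true) where
    open Rep rep

    X : ℕ → ℕ → List Bool
    X a b = bits (S (toFin a) (toFin b))

    R : ℕ → Row
    R k = seg (λ a → X a k) 0 k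

    w : ℕ → ℕ → ℕ
    w a b = weight (X a b)

    w-cnt : ∀ a b → w a b ≡ cnt (S (toFin a) (toFin b))
    w-cnt a b = size-bits (S (toFin a) (toFin b))

    w-sym : ∀ a b → w a b ≡ w b a
    w-sym a b = trans (w-cnt a b) (trans (cnt-cong (λ x → sym (IsConn.symC isC (toFin a) (toFin b) x)))
      (trans (cnt-bij (S (toFin b) (toFin a)) inv inv inv-inv inv-inv) (sym (w-cnt b a))))

    w-irr : ∀ a → w a a ≡ 0
    w-irr a = trans (w-cnt a a) (trans (cnt-cong (IsConn.irrC isC (toFin a))) (cnt-false {order}))

    -- The valency of part `a` towards the first `b` parts; these are the numbers the search keeps
    -- in `ds`, `tot` and `nd`.
    P : ℕ → ℕ → ℕ
    P a b = upsum (w a) b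

    P-d : ∀ a → P a m ≡ d
    P-d a = trans (sym (sum-upsum m (w a))) (trans (sum-cong-≗ (λ j → trans (w-cnt a (toℕ j)) (cong (λ t → cnt (S (toFin a) t)) (toFin-toℕ j)))) (deg-d (toFin a)))

    val-R : ∀ {i j x} → toℕ i < toℕ j → val (seg R 0 m) (toℕ i , toℕ j , toℕ x) ≡ S i j x
    val-R {i} {j} {x} p = trans (cong (λ t → look (look t [] (toℕ i)) false (toℕ x)) (look-seg R [] 0 (Fₚ.toℕ<n j)))
      (trans (cong (λ t → look t false (toℕ x)) (look-seg (λ a → X a (toℕ j)) [] 0 p))
      (trans (look-bits _ x) (cong₂ (λ a b → S a b x) (toFin-toℕ i) (toFin-toℕ j))))

    val-canon : ∀ i j x → val (seg R 0 m) (canon i j x) ≡ S i j x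
    val-canon i j x with toℕ i <ᵇ toℕ j in p
    ... | true = val-R {i} {j} {x} (<ᵇ-sound p)
    ... | false with toℕ j <ᵇ toℕ i in q
    ... | true = trans (val-R {j} {i} {inv x} (<ᵇ-sound q)) (IsConn.symC isC i j x)
    ... | false with refl ← Fₚ.toℕ-injective {i = i} {j = j} (ℕₚ.≤-antisym (<ᵇ-false q) (<ᵇ-false p)) = sym (IsConn.irrC isC i x)


    eqB-sound : ∀ {a b} → eqB a b ≡ true → a ≡ b
    eqB-sound {true}  {true}  _ = refl
    eqB-sound {false} {false} _ = refl

    module _ (c : List ℕ) (ok : valid c ≡ true) (eqs : allᵇ (holds (seg R 0 m)) (eqns c) ≡ true) where
      absurd : ⊥
      absurd = Found.absurd S isC rigid c ok λ i j x p →
        trans (sym (val-canon i j x)) (trans (eqB-sound (Instances.eq-at c (holds (seg R 0 m)) eqs i j x p)) (val-canon _ _ _))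

    module Run (cs : List (List ℕ)) (ok : allᵇ valid cs ≡ true) where
      open Search (map eqns cs) (subsets order) (keep based (subsets order)) base d

      found : leaf (map eqns cs) (seg R 0 m) ≡ true → ⊥
      found p with find-ok valid _ cs ok (anyᵇ-map (allᵇ (holds (seg R 0 m))) eqns cs p)
      ... | c , v , q = absurd c v q

      not-bad : ∀ a b → b ≤ m → bad b (P a b) ≡ false
      not-bad a b b≤m = cong₂ _∨_ (≢true λ p → ℕₚ.<⇒≱ (<ᵇ-sound p) (subst (P a b ≤_) (P-d a) (upsum-mono (w a) b≤m)))
        (≢true λ p → ℕₚ.<⇒≱ (<ᵇ-sound p) (subst (_≤ P a b + (m ∸ b) * order) (P-d a) (upsum-room (w a) order (λ k → subst (_≤ order) (sym (w-cnt a k)) (cnt-≤ _)) b≤m)))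

      option : ∀ i k → i < k → k < m → memL (X i k) (options k i) ≡ true
      option (suc i) k _ _ = mem-subsets (S (toFin (suc i)) (toFin k))
      option zero (suc zero) _ _ = S01
      option zero (suc (suc k)) _ p = mem-keep based (X 0 (2 + k)) (subsets order) (mem-subsets (S zero (toFin (2 + k)))) (S0 (toFin (2 + k)) (subst (1 <_) (sym (toℕ-toFin p)) (s≤s (s≤s z≤n))))

      not-over : ∀ pr c cs → Lex pr (c ∷ cs) → over pr c ≡ false
      not-over [] c cs _ = refl
      not-over (p ∷ pr) c cs (inj₁ q) = ≢true λ r → ℕₚ.<-asym q (<ᵇ-sound r)
      not-over (p ∷ pr) c cs (inj₂ (q , _)) = ≢true λ r → ℕₚ.<-irrefl (sym q) (<ᵇ-sound r)

      lex-rest : ∀ pr c cs → Lex pr (c ∷ cs) → Lex (rest pr c) cs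
      lex-rest [] c cs _ = tt
      lex-rest (p ∷ pr) c cs l with c ≡ᵇ p in eq
      ... | false = tt
      lex-rest (p ∷ pr) c cs (inj₁ q) | true = ⊥-elim (ℕₚ.<-irrefl (≡ᵇ-sound c p eq) q)
      lex-rest (p ∷ pr) c cs (inj₂ (_ , q)) | true = q

      prev : ℕ → List ℕ
      prev zero    = []
      prev (suc k) = seg (λ a → w a k) 0 k

      lex-prev : ∀ k → k < m → Lex (prev k) (seg (λ a → w a k) 0 k)
      lex-prev zero _ = tt
      lex-prev (suc k) p = subst₂ Lex (seg-cong 0 k λ a _ → sym (w-cnt a k)) (seg-cong 0 (suc k) λ a _ → sym (w-cnt a (suc k))) (sorted k p)

      mutual
        -- Follows the branch that writes down the given `S`. Neither the valency bounds nor the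
        -- ordering can prune it, so it reaches a leaf, and the equations satisfied there contradict
        -- rigidity.
        go-ok : ∀ r k → r + k ≡ m → go r k (seg (λ a → P a k) 0 k) (prev k) (seg R 0 k) ≡ true → ⊥
        go-ok zero k refl p = found p
        go-ok (suc r) k rk p = row-ok k 0 r k (prev k) refl (trans (ℕₚ.+-suc r k) rk) p (lex-prev k (ℕₚ.m+n≤o⇒n≤o r (ℕₚ.≤-reflexive (trans (ℕₚ.+-suc r k) rk))))

        row-ok : ∀ l i r k pr → i + l ≡ k → r + suc k ≡ m →
                 row r k i (P k i) (seg (λ a → P a k) i l) pr (seg (λ a → P a (suc k)) 0 i) (seg (λ a → X a k) 0 i) (seg R 0 k) ≡ true →
                 Lex pr (seg (λ a → w a k) i l) → ⊥
        row-ok zero i r k pr il rk p _ with refl ← trans (sym (ℕₚ.+-identityʳ i)) il =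
          go-ok r (suc i) rk (subst₃ (λ a b c → go r (suc i) a b c ≡ true)
            (trans (cong (λ t → seg (λ a → P a (suc i)) 0 i ++ t ∷ []) full-P) (sym (seg-snoc (λ a → P a (suc i)) 0 i)))
            (seg-map weight (λ a → X a i) 0 i) (sym (seg-snoc R 0 i)) (∨-right (trans (cong (bad (suc i)) full-P) (not-bad i (suc i) i<m)) p))
          where
          i<m : suc i ≤ m
          i<m = ℕₚ.m+n≤o⇒n≤o r (ℕₚ.≤-reflexive rk)
          -- The diagonal set is empty, so a completed row already counts the part itself.
          full-P : P i i ≡ P i (suc i)
          full-P = sym (trans (cong (P i i +_) (w-irr i)) (ℕₚ.+-identityʳ _))
          subst₃ : {A B C : Set} (Q : A → B → C → Set) → ∀ {a a′ b b′ c c′} → a ≡ a′ → b ≡ b′ → c ≡ c′ → Q a b c → Q a′ b′ c′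
          subst₃ Q refl refl refl q = q
        row-ok (suc l) i r k pr il rk p lex = row-ok l (suc i) r k (rest pr (w i k)) (trans (sym (ℕₚ.+-suc i l)) il) rk
          (subst₃ (λ a b c → row r k (suc i) a (seg (λ a → P a k) (suc i) l) (rest pr (w i k)) b c (seg R 0 k) ≡ true)
            (cong (P k i +_) (w-sym i k)) (sym (seg-snoc (λ a → P a (suc k)) 0 i)) (sym (seg-snoc (λ a → X a k) 0 i))
            (∨-right (not-over pr (w i k) _ lex) (∨-right (trans (cong (λ t → bad (suc i) (P k i + t)) (w-sym i k)) (not-bad k (suc i) i<m)) (∨-right (not-bad i (suc k) k<m) step))))
          (lex-rest pr (w i k) _ lex)
          where
          k<m : suc k ≤ m
          k<m = ℕₚ.m+n≤o⇒n≤o r (ℕₚ.≤-reflexive rk)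
          i<k : i < k
          i<k = subst (i <_) il (ℕₚ.m<m+n i (s≤s z≤n))
          i<m : suc i ≤ m
          i<m = ℕₚ.≤-trans i<k (ℕₚ.<⇒≤ k<m)
          step : entry r k i (P k i) (P i k) (seg (λ a → P a k) (suc i) l) pr (seg (λ a → P a (suc k)) 0 i) (seg (λ a → X a k) 0 i) (seg R 0 k) (X i k) (w i k) ≡ true
          step = BoolEq.all-mem EL (λ s → entry r k i (P k i) (P i k) (seg (λ a → P a k) (suc i) l) pr (seg (λ a → P a (suc k)) 0 i) (seg (λ a → X a k) 0 i) (seg R 0 k) s (weight s))
            (options k i) p (option i k i<k k<m)
          subst₃ : {A B C : Set} (Q : A → B → C → Set) → ∀ {a a′ b b′ c c′} → a ≡ a′ → b ≡ b′ → c ≡ c′ → Q a b c → Q a′ b′ c′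
          subst₃ Q refl refl refl q = q

      impossible : go m 0 [] [] [] ≡ true → ⊥
      impossible = go-ok m 0 (ℕₚ.+-identityʳ m)

      d≤ : d < suc (m * order)
      d≤ = s≤s (subst (_≤ m * order) (P-d 0) (upsum-room (w 0) order (λ k → subst (_≤ order) (sym (w-cnt 0 k)) (cnt-≤ _)) {0} {m} z≤n))

  record Normal (base : List (List Bool)) : Set where
    field
      S   : Conn
      rep : Rep S
      sorted : ∀ k → suc k < m → Lex (seg (λ a → cnt (S (toFin a) (toFin k))) 0 k) (seg (λ a → cnt (S (toFin a) (toFin (suc k)))) 0 (suc k))
      S01 : memL (bits (S zero (suc zero))) base ≡ true
      S0  : ∀ k → 1 < toℕ k → based (bits (S zero k)) ≡ true

  refute-normal : ∀ cs base → allᵇ valid cs ≡ true →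
                  (∀ d → d < suc (m * order) → explore (map eqns cs) (subsets order) (keep based (subsets order)) base d ≡ true) → Normal base → ⊥
  refute-normal cs base v h n = impossible (h (Rep.d rep) d≤)
    where
    open Normal n
    open Sound S rep base sorted S01 S0
    open Run cs v

  -- The parts are ordered first and the base points chosen afterwards; shifting base points leaves
  -- all sizes unchanged, so the order survives.
  normalise : ∀ base → allᵇ (normal base) (subsets order) ≡ true → ∀ {S} → Rep S → Normal base
  normalise base ck {S} rep = record { S = S₂ ; rep = rep₂ ; sorted = sorted₂ ; S01 = S01 ; S0 = S0 }
    where
    module O = Sort.Ord (Sort.order (λ i j → cnt (S i j)))
    S₁ : Conn
    S₁ = twist O.π O.π⁻ O.ππ⁻ O.π⁻π (λ _ → e) S
    rep₁ : Rep S₁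
    rep₁ = twisted O.π O.π⁻ O.ππ⁻ O.π⁻π (λ _ → e) rep
    same : El → Bool
    same = S₁ zero (suc zero)
    nf = all-nf (BoolEq.all-mem EL (normal base) (subsets order) {bits same} ck (mem-subsets same))
      where
      all-nf : normal base (bits same) ≡ true → ∃ λ a → ∃ λ b → memL (bits (shift (λ y → look (bits same) false (toℕ y)) a b)) base ≡ true
      all-nf p with anyᶠ-find _ p
      ... | a , q with anyᶠ-find _ q
      ... | b , r = a , b , r
    a = proj₁ nf
    b = proj₁ (proj₂ nf)
    pick : ∀ k → (∃ λ y → S₁ zero k ((y · e) / a) ≡ true) ⊎ (∀ y → S₁ zero k y ≡ false)
    pick k with Fₚ.any? (λ y → S₁ zero k y Bₚ.≟ true)
    ... | yes (y , p) = inj₁ (y · a , trans (cong (S₁ zero k) (grp (y ∷ a ∷ []) (v0 ⊙ v1 ⊙ ε ⊙ v1 ⁻) v0 refl)) p)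
    ... | no n = inj₂ λ y → ≢true λ p → n (y , p)
    c : Fin m → El
    c zero = a
    c (suc zero) = b
    c k@(suc (suc _)) with pick k
    ... | inj₁ (y , _) = y
    ... | inj₂ _ = e
    S₂ : Conn
    S₂ = twist id id (λ _ → refl) (λ _ → refl) c S₁
    rep₂ : Rep S₂
    rep₂ = twisted id id (λ _ → refl) (λ _ → refl) c rep₁
    cnt₂ : ∀ i j → cnt (S₂ i j) ≡ cnt (S (O.π i) (O.π j))
    cnt₂ i j = trans (cnt-twist id id (λ _ → refl) (λ _ → refl) c S₁ i j) (cnt-twist O.π O.π⁻ O.ππ⁻ O.π⁻π (λ _ → e) S i j)
    sorted₂ : ∀ k → suc k < m → Lex (seg (λ a → cnt (S₂ (toFin a) (toFin k))) 0 k) (seg (λ a → cnt (S₂ (toFin a) (toFin (suc k)))) 0 (suc k))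
    sorted₂ k p = subst₂ Lex (seg-cong 0 k λ x _ → sym (cnt₂ (toFin x) (toFin k))) (seg-cong 0 (suc k) λ x _ → sym (cnt₂ (toFin x) (toFin (suc k))))
      (lex-longer 0 k (O.top k (ℕₚ.<⇒≤ p) (toFin (suc k)) (subst (k <_) (sym (toℕ-toFin p)) ℕₚ.≤-refl)))
    S01 : memL (bits (S₂ zero (suc zero))) base ≡ true
    S01 = subst (λ t → memL t base ≡ true) (bits-cong λ x → look-bits same ((b · x) / a)) (proj₂ (proj₂ nf))
    empty-based : ∀ (f : El → Bool) → (∀ x → f x ≡ false) → based (bits f) ≡ true
    empty-based f z = ∨-inj₂ (look (bits f) false (toℕ e)) (cong (_≡ᵇ 0) (trans (size-bits f) (trans (cnt-cong z) (cnt-false {order}))))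
    S0 : ∀ k → 1 < toℕ k → based (bits (S₂ zero k)) ≡ true
    S0 (suc zero) (s≤s ())
    S0 k@(suc (suc _)) _ with pick k
    ... | inj₁ (y , p) = ∨-inj₁ _ (trans (look-bits _ e) p)
    ... | inj₂ z = empty-based _ (λ x → z _)

  refute : ∀ cs base → check cs base ≡ true → ∀ {S} → Rep S → ⊥
  refute cs base ck rep = refute-normal cs base (proj₁ ck₁) (λ d p → BoolEq.all-mem Eℕ (explore (map eqns cs) (subsets order) (keep based (subsets order)) base)
      (upto (suc (m * order))) (proj₂ ck₂) (mem-upto (suc (m * order)) p)) (normalise base (proj₁ ck₂) rep)
    where
    ck₁ = ∧-split {allᵇ valid cs} ck
    ck₂ = ∧-split {allᵇ (normal base) (subsets order)} (proj₂ ck₁)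

-- Data and evaluation for the exceptional groups

table-C1 : List (List ℕ)
table-C1 = ((0 ∷ []) ∷ [])

inverses-C1 : List ℕ
inverses-C1 = (0 ∷ [])

-- Subsets as bit lists, enough of them to reach every subset by the shifts of `normal`.
base-C1 : List (List Bool)
base-C1 = map (map (_≡ᵇ 1)) ((1 ∷ []) ∷ (0 ∷ []) ∷ [])

-- Each number encodes a permutation of the vertices in the base given by their number, the lowest
-- digit being the image of vertex 0. Here 15 has the base 3 digits 0, 2, 1 and exchanges the last
-- two parts.
codes-C1-3 : List ℕ
codes-C1-3 =
  15 ∷ []

codes-C1-4 : List ℕ
codes-C1-4 =
  177 ∷ []

codes-C1-5 : List ℕ
codes-C1-5 =
  2410 ∷ []

codes-C1-6 : List ℕ
codes-C1-6 =
  1865 ∷ 38130 ∷ []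

codes-C1-7 : List ℕ
codes-C1-7 =
  699825 ∷ 697725 ∷ 364677 ∷ []

codes-C1-8 : List ℕ
codes-C1-8 =
  14599816 ∷ 342391 ∷ 14570696 ∷ 16201857 ∷ 14596176 ∷ 5135809 ∷ 16205448 ∷ 12293344 ∷ 4364262 ∷ 14571144 ∷ 16201864 ∷ 11789904 ∷ 11788952 ∷ 16196376 ∷
  2722748 ∷ 571823 ∷ 14599368 ∷ 14571088 ∷ 14570136 ∷ 12296984 ∷ 16192736 ∷ 6971265 ∷ 12293666 ∷ 15819083 ∷ 12292259 ∷ []

codes-C1-9 : List ℕ
codes-C1-9 =
  343103292 ∷ 342624996 ∷ 377115516 ∷ 380894652 ∷ 381071804 ∷ 377062372 ∷ 342625068 ∷ 381361212 ∷ 286882740 ∷ 355807972 ∷ 148442316 ∷ 380888820 ∷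
  361011412 ∷ 208911164 ∷ 381366972 ∷ 248132196 ∷ 286882804 ∷ 360060148 ∷ 129946660 ∷ 248138100 ∷ 286887988 ∷ 364795732 ∷ 356286196 ∷ 282005660 ∷
  15502724 ∷ 11250548 ∷ 343102644 ∷ 380894004 ∷ 380881692 ∷ 377115444 ∷ 342616500 ∷ 381347388 ∷ 286868340 ∷ 341936884 ∷ 365268772 ∷ 381366884 ∷
  121232668 ∷ 55982740 ∷ 54507244 ∷ 365150372 ∷ 186888732 ∷ 130511212 ∷ 20302460 ∷ 12836852 ∷ 10415852 ∷ 8242388 ∷ 6117596 ∷ 381354084 ∷ 286875684 ∷
  343097388 ∷ 381365604 ∷ 342610596 ∷ 341314596 ∷ 341458660 ∷ 341936732 ∷ 189604892 ∷ 151335308 ∷ 377061428 ∷ 370307252 ∷ 75735884 ∷ 78873500 ∷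
  78395276 ∷ 341874444 ∷ 122592972 ∷ 110980020 ∷ 120375372 ∷ 267584052 ∷ 75733860 ∷ 70577076 ∷ 55651044 ∷ 56070948 ∷ 110955964 ∷ 120287164 ∷ 101274844 ∷
  137236180 ∷ 135287644 ∷ 92771068 ∷ 75645652 ∷ 60707956 ∷ 68440540 ∷ 58759420 ∷ 55626988 ∷ 204658988 ∷ 161577356 ∷ 341215844 ∷ 281710580 ∷ 121740764 ∷
  276892628 ∷ 153487644 ∷ 186711900 ∷ 110444892 ∷ 339736308 ∷ 225299508 ∷ 225281292 ∷ 139014348 ∷ 175547284 ∷ 132459748 ∷ 87994636 ∷ 173897332 ∷
  131370388 ∷ 132407188 ∷ 216265444 ∷ 216253132 ∷ 46506148 ∷ 45508876 ∷ 17615204 ∷ 19890260 ∷ 15194204 ∷ 10369196 ∷ 7068860 ∷ 6526484 ∷ []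

table-C2 : List (List ℕ)
table-C2 = ((0 ∷ 1 ∷ []) ∷ (1 ∷ 0 ∷ []) ∷ [])

inverses-C2 : List ℕ
inverses-C2 = (0 ∷ 1 ∷ [])

base-C2 : List (List Bool)
base-C2 = map (map (_≡ᵇ 1)) ((1 ∷ 1 ∷ []) ∷ (1 ∷ 0 ∷ []) ∷ (0 ∷ 0 ∷ []) ∷ [])

codes-C2-3 : List ℕ
codes-C2-3 =
  27150 ∷ []

codes-C2-4 : List ℕ
codes-C2-4 =
  6852524 ∷ 5017068 ∷ 11789960 ∷ 16362248 ∷ []

codes-C2-5 : List ℕ
codes-C2-5 =
  7698325410 ∷ 8967452310 ∷ 9854763210 ∷ 5476983210 ∷ 3210459876 ∷ 2310548976 ∷ 3276549810 ∷ 8954762310 ∷ 9876325410 ∷ 6789325410 ∷ 7698234510 ∷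
  5432987610 ∷ 3254769810 ∷ 3210549876 ∷ 2310458976 ∷ 7698543210 ∷ 9832547610 ∷ []

table-C3 : List (List ℕ)
table-C3 = ((0 ∷ 1 ∷ 2 ∷ []) ∷ (1 ∷ 2 ∷ 0 ∷ []) ∷ (2 ∷ 0 ∷ 1 ∷ []) ∷ [])

inverses-C3 : List ℕ
inverses-C3 = (0 ∷ 2 ∷ 1 ∷ [])

base-C3 : List (List Bool)
base-C3 = map (map (_≡ᵇ 1)) ((1 ∷ 1 ∷ 1 ∷ []) ∷ (1 ∷ 1 ∷ 0 ∷ []) ∷ (1 ∷ 0 ∷ 0 ∷ []) ∷ (0 ∷ 0 ∷ 0 ∷ []) ∷ [])

codes-C3-3 : List ℕ
codes-C3-3 =
  198166356 ∷ 232225236 ∷ []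

codes-C3-4 : List ℕ
codes-C3-4 =
  3297604023318 ∷ 3921937654998 ∷ 2502997582998 ∷ 5732078344872 ∷ 5732077322367 ∷ 4937011306623 ∷ 868753062573 ∷ 869114575725 ∷ 868292954925 ∷
  8159522698536 ∷ 6356772049023 ∷ 869698805613 ∷ 4937012329128 ∷ 8159884211688 ∷ 8784217634280 ∷ 8785260892287 ∷ 8161288773759 ∷ 7366682599551 ∷
  7363509312918 ∷ 870158856237 ∷ 870519685101 ∷ 7365278037480 ∷ 870519951213 ∷ 5732078135784 ∷ 8784801050751 ∷ 870520160301 ∷ 869699014701 ∷
  869698539501 ∷ []

table-C4 : List (List ℕ)
table-C4 = ((0 ∷ 1 ∷ 2 ∷ 3 ∷ []) ∷ (1 ∷ 2 ∷ 3 ∷ 0 ∷ []) ∷ (2 ∷ 3 ∷ 0 ∷ 1 ∷ []) ∷ (3 ∷ 0 ∷ 1 ∷ 2 ∷ []) ∷ [])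

inverses-C4 : List ℕ
inverses-C4 = (0 ∷ 3 ∷ 2 ∷ 1 ∷ [])

base-C4 : List (List Bool)
base-C4 = map (map (_≡ᵇ 1)) ((1 ∷ 1 ∷ 1 ∷ 1 ∷ []) ∷ (1 ∷ 1 ∷ 1 ∷ 0 ∷ []) ∷ (1 ∷ 1 ∷ 0 ∷ 0 ∷ []) ∷ (1 ∷ 0 ∷ 1 ∷ 0 ∷ []) ∷ (1 ∷ 0 ∷ 0 ∷ 0 ∷ []) ∷ (0 ∷ 0 ∷ 0 ∷ 0 ∷ []) ∷ [])

codes-C4-3 : List ℕ
codes-C4-3 =
  4124739679236 ∷ 4914654146820 ∷ 8842336571244 ∷ 5477527330308 ∷ 7366488975736 ∷ 8156365351288 ∷ 7366683409668 ∷ 8719405825284 ∷ 8719211391352 ∷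
  6557693405560 ∷ []

table-C5 : List (List ℕ)
table-C5 = ((0 ∷ 1 ∷ 2 ∷ 3 ∷ 4 ∷ []) ∷ (1 ∷ 2 ∷ 3 ∷ 4 ∷ 0 ∷ []) ∷ (2 ∷ 3 ∷ 4 ∷ 0 ∷ 1 ∷ []) ∷ (3 ∷ 4 ∷ 0 ∷ 1 ∷ 2 ∷ []) ∷ (4 ∷ 0 ∷ 1 ∷ 2 ∷ 3 ∷ []) ∷ [])

inverses-C5 : List ℕ
inverses-C5 = (0 ∷ 4 ∷ 3 ∷ 2 ∷ 1 ∷ [])

base-C5 : List (List Bool)
base-C5 = map (map (_≡ᵇ 1)) ((1 ∷ 1 ∷ 1 ∷ 1 ∷ 1 ∷ []) ∷ (1 ∷ 1 ∷ 1 ∷ 1 ∷ 0 ∷ []) ∷ (1 ∷ 1 ∷ 1 ∷ 0 ∷ 0 ∷ []) ∷ (1 ∷ 1 ∷ 0 ∷ 1 ∷ 0 ∷ []) ∷ (1 ∷ 1 ∷ 0 ∷ 0 ∷ 0 ∷ []) ∷ (1 ∷ 0 ∷ 1 ∷ 0 ∷ 0 ∷ []) ∷ (1 ∷ 0 ∷ 0 ∷ 0 ∷ 0 ∷ []) ∷ (0 ∷ 0 ∷ 0 ∷ 0 ∷ 0 ∷ []) ∷ [])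

codes-C5-3 : List ℕ
codes-C5-3 =
  189900079408604985 ∷ 221134965599504985 ∷ 251764368082904985 ∷ 273311514953804985 ∷ 346290136705735565 ∷ 377524981764329315 ∷ 408154343912766815 ∷
  429701462408860565 ∷ 315014926119798065 ∷ 33509404273397395 ∷ 33509445405703645 ∷ 33509485740666145 ∷ 33509514115472395 ∷ 33509363087934895 ∷ []

table-V : List (List ℕ)
table-V = ((0 ∷ 1 ∷ 2 ∷ 3 ∷ []) ∷ (1 ∷ 0 ∷ 3 ∷ 2 ∷ []) ∷ (2 ∷ 3 ∷ 0 ∷ 1 ∷ []) ∷ (3 ∷ 2 ∷ 1 ∷ 0 ∷ []) ∷ [])

inverses-V : List ℕ
inverses-V = (0 ∷ 1 ∷ 2 ∷ 3 ∷ [])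

base-V : List (List Bool)
base-V = map (map (_≡ᵇ 1)) ((1 ∷ 1 ∷ 1 ∷ 1 ∷ []) ∷ (1 ∷ 1 ∷ 1 ∷ 0 ∷ []) ∷ (1 ∷ 1 ∷ 0 ∷ 0 ∷ []) ∷ (1 ∷ 0 ∷ 1 ∷ 0 ∷ []) ∷ (1 ∷ 0 ∷ 0 ∷ 1 ∷ []) ∷ (1 ∷ 0 ∷ 0 ∷ 0 ∷ []) ∷ (0 ∷ 0 ∷ 0 ∷ 0 ∷ []) ∷ [])

codes-V-3 : List ℕ
codes-V-3 =
  5600508029292 ∷ 8842257325792 ∷ 2358289707092 ∷ 4919384175420 ∷ 4124739679236 ∷ 5543747708136 ∷ 8156436520672 ∷ 2358256633172 ∷ 8156592862572 ∷
  8842380593772 ∷ []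

table-D : List (List ℕ)
table-D = ((0 ∷ 1 ∷ 2 ∷ 3 ∷ 4 ∷ 5 ∷ []) ∷ (1 ∷ 2 ∷ 0 ∷ 4 ∷ 5 ∷ 3 ∷ []) ∷ (2 ∷ 0 ∷ 1 ∷ 5 ∷ 3 ∷ 4 ∷ []) ∷ (3 ∷ 5 ∷ 4 ∷ 0 ∷ 2 ∷ 1 ∷ []) ∷ (4 ∷ 3 ∷ 5 ∷ 1 ∷ 0 ∷ 2 ∷ []) ∷ (5 ∷ 4 ∷ 3 ∷ 2 ∷ 1 ∷ 0 ∷ []) ∷ [])

inverses-D : List ℕ
inverses-D = (0 ∷ 2 ∷ 1 ∷ 3 ∷ 4 ∷ 5 ∷ [])

base-D : List (List Bool)
base-D = map (map (_≡ᵇ 1)) ((1 ∷ 1 ∷ 1 ∷ 1 ∷ 1 ∷ 1 ∷ []) ∷ (1 ∷ 1 ∷ 1 ∷ 1 ∷ 1 ∷ 0 ∷ []) ∷ (1 ∷ 1 ∷ 1 ∷ 1 ∷ 0 ∷ 0 ∷ []) ∷ (1 ∷ 1 ∷ 1 ∷ 0 ∷ 0 ∷ 0 ∷ []) ∷ (1 ∷ 1 ∷ 0 ∷ 1 ∷ 1 ∷ 0 ∷ []) ∷ (1 ∷ 1 ∷ 0 ∷ 1 ∷ 0 ∷ 0 ∷ []) ∷ (1 ∷ 1 ∷ 0 ∷ 0 ∷ 0 ∷ 0 ∷ []) ∷ (1 ∷ 0 ∷ 0 ∷ 1 ∷ 0 ∷ 0 ∷ []) ∷ (1 ∷ 0 ∷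 0 ∷ 0 ∷ 0 ∷ 0 ∷ []) ∷ (0 ∷ 0 ∷ 0 ∷ 0 ∷ 0 ∷ 0 ∷ []) ∷ [])

codes-D-3 : List ℕ
codes-D-3 =
  25323294595151399068242 ∷ 32153717907830259008196 ∷ 27910474282735622554308 ∷ 30204666416607190586052 ∷ 20964610638353731425264 ∷
  39095548308936208710762 ∷ 25208247710886050088792 ∷ 34851183714232970292330 ∷ 23258468515398228000144 ∷ 37145434846504991059050 ∷
  34851911418497723958834 ∷ 37145041581161142761010 ∷ 39210261127102169502930 ∷ 39095214041992813147698 ∷ 39210261209762179526802 ∷
  30204332092349526245676 ∷ 32154445554780743897388 ∷ 27910080960077505478956 ∷ 25208582035165110100944 ∷ 20964944962632796791192 ∷
  14138554628434981388976 ∷ 16088333766587141011416 ∷ 32154111230490116060748 ∷ 27910808606995026871884 ∷ 30203938769658445674060 ∷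
  11321280030140908731084 ∷ 11436326774379360015942 ∷ 7077643207123183661604 ∷ 34851576969460494484170 ∷ 37145769103332062515914 ∷
  39094820594555130938058 ∷ 11436326706925637134662 ∷ 11435933451719500980510 ∷ 11435599184766275884710 ∷ 23258802839677287714864 ∷
  9371501016746915200260 ∷ 21078929932994437768530 ∷ 18382191576210868881744 ∷ 11435933509023942207966 ∷ 11435599060008111775974 ∷
  9371500891957527869892 ∷ 11321280154899072839820 ∷ 7077643082366754176292 ∷ 7077643149818742434148 ∷ 11435933384267512722654 ∷
  9371500959411250751172 ∷ 36915675469705341371076 ∷ 32269158050685992557674 ∷ 11436326831715024465030 ∷ 11435599127428876812198 ∷
  11321280097561673767308 ∷ 16317365496457701383442 ∷ 25207854388204797364464 ∷ 20964217315672484352144 ∷ 23258075192716980629592 ∷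
  18381463861829794777368 ∷ 16087606052206061553264 ∷ 11436327039164421819270 ∷ 11435933649031180837086 ∷ 11435599267445944974054 ∷
  9371500816042890134148 ∷ 11321279829425319508812 ∷ 7077642938976999870372 ∷ []

digits : (b : ℕ) → .{{ℕ.NonZero b}} → ℕ → ℕ → List ℕ
digits b zero    c = []
digits b (suc k) c = c % b ∷ digits b k (c div b)

-- The search evaluates products constantly, so the group is given by lookup tables; `sameCk`
-- identifies it with the operation that defines the exceptional group.
module Excluded (n′ : ℕ) (op : Fin (suc n′) → Fin (suc n′) → Fin (suc n′)) (table : List (List ℕ)) (inverses : List ℕ) where
  El : Set
  El = Fin (suc n′)

  mul : El → El → El
  mul x y = toFin (look (look table [] (toℕ x)) 0 (toℕ y))

  neg : El → El
  neg x = toFin (look inverses 0 (toℕ x))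

  assocCk : El → El → El → Bool
  assocCk x y z = eqF (mul (mul x y) z) (mul x (mul y z))
  unitCk : El → Bool
  unitCk x = (eqF (mul zero x) x ∧ eqF (mul x zero) x) ∧ (eqF (mul (neg x) x) zero ∧ eqF (mul x (neg x)) zero)
  sameCk : El → El → Bool
  sameCk x y = eqF (op x y) (mul x y)

  module _ (as : (allF λ x → allF λ y → allF (assocCk x y)) ≡ true) (un : allF unitCk ≡ true) (sa : (allF λ x → allF (sameCk x)) ≡ true) where
    private
      at : ∀ x → unitCk x ≡ true
      at = allF-elim unitCk un
      left : ∀ x → (eqF (mul zero x) x ≡ true) × (eqF (mul x zero) x ≡ true)
      left x = ∧-split {eqF (mul zero x) x} (proj₁ (∧-split {eqF (mul zero x) x ∧ eqF (mul x zero) x} (at x)))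
      right : ∀ x → (eqF (mul (neg x) x) zero ≡ true) × (eqF (mul x (neg x)) zero ≡ true)
      right x = ∧-split {eqF (mul (neg x) x) zero} (proj₂ (∧-split {eqF (mul zero x) x ∧ eqF (mul x zero) x} (at x)))

    group : FinGroup
    group = record
      { order = suc n′ ; _·_ = mul ; e = zero ; inv = neg
      ; assoc = λ x y z → eqF-sound (allF-elim (assocCk x y) (allF-elim (λ y → allF (assocCk x y)) (allF-elim (λ x → allF λ y → allF (assocCk x y)) as x) y) z)
      ; idˡ = λ x → eqF-sound (proj₁ (left x)) ; idʳ = λ x → eqF-sound (proj₂ (left x))
      ; invˡ = λ x → eqF-sound (proj₁ (right x)) ; invʳ = λ x → eqF-sound (proj₂ (right x)) }

    hom : ∀ {G} → G ≅ record { size = suc n′ ; op = op } → Hom group G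
    hom {G} (f , (inj , surj) , f-op) = record
      { φ = φ ; ψ = f ; φψ = λ x → inj (fφ (f x))
      ; φ-· = λ x y → inj (trans (fφ _) (trans (sym (eqF-sound (allF-elim (sameCk x) (allF-elim (λ x → allF (sameCk x)) sa x) y)))
          (trans (sym (cong₂ op (fφ x) (fφ y))) (sym (f-op (φ x) (φ y))))))
      ; φ-inj = λ {x} {y} p → trans (sym (fφ x)) (trans (cong f p) (fφ y)) }
      where
      φ : El → Fin (FinGroup.order G)
      φ x = proj₁ (surj x)
      fφ : ∀ x → f (φ x) ≡ x
      fφ x = proj₂ (surj x) refl

    excluded : ∀ m″ codes base → Refute.check group m″ n′ (map (digits (suc (suc m″) * suc n′) (suc (suc m″) * suc n′)) codes) base ≡ true →
           ∀ {G} → G ≅ record { size = suc n′ ; op = op } → HGR (suc (suc m″)) G → ⊥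
    excluded m″ codes base ck {G} iso h = Refute.refute group m″ n′ (map (digits (suc (suc m″) * suc n′) (suc (suc m″) * suc n′)) codes) base ck (proj₂ (hgr-rep (transport {K = group} {G} (hom iso) h)))

module E1 = Excluded 0 (FinTable.op (Cyc 1)) table-C1 inverses-C1
module E2 = Excluded 1 (FinTable.op (Cyc 2)) table-C2 inverses-C2
module E3 = Excluded 2 (FinTable.op (Cyc 3)) table-C3 inverses-C3
module E4 = Excluded 3 (FinTable.op (Cyc 4)) table-C4 inverses-C4
module E5 = Excluded 4 (FinTable.op (Cyc 5)) table-C5 inverses-C5
module EV = Excluded 3 (FinTable.op C2²) table-V inverses-V
module ED = Excluded 5 (FinTable.op D6) table-D inverses-D

none-C1-3 : ∀ {G} → G ≅ Cyc 1 → HGR 3 G → ⊥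
none-C1-3 {G} = E1.excluded refl refl refl 1 codes-C1-3 base-C1 refl {G}

none-C1-4 : ∀ {G} → G ≅ Cyc 1 → HGR 4 G → ⊥
none-C1-4 {G} = E1.excluded refl refl refl 2 codes-C1-4 base-C1 refl {G}

none-C1-5 : ∀ {G} → G ≅ Cyc 1 → HGR 5 G → ⊥
none-C1-5 {G} = E1.excluded refl refl refl 3 codes-C1-5 base-C1 refl {G}

none-C1-6 : ∀ {G} → G ≅ Cyc 1 → HGR 6 G → ⊥
none-C1-6 {G} = E1.excluded refl refl refl 4 codes-C1-6 base-C1 refl {G}

none-C1-7 : ∀ {G} → G ≅ Cyc 1 → HGR 7 G → ⊥
none-C1-7 {G} = E1.excluded refl refl refl 5 codes-C1-7 base-C1 refl {G}

none-C1-8 : ∀ {G} → G ≅ Cyc 1 → HGR 8 G → ⊥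
none-C1-8 {G} = E1.excluded refl refl refl 6 codes-C1-8 base-C1 refl {G}

none-C1-9 : ∀ {G} → G ≅ Cyc 1 → HGR 9 G → ⊥
none-C1-9 {G} = E1.excluded refl refl refl 7 codes-C1-9 base-C1 refl {G}

none-C2-3 : ∀ {G} → G ≅ Cyc 2 → HGR 3 G → ⊥
none-C2-3 {G} = E2.excluded refl refl refl 1 codes-C2-3 base-C2 refl {G}

none-C2-4 : ∀ {G} → G ≅ Cyc 2 → HGR 4 G → ⊥
none-C2-4 {G} = E2.excluded refl refl refl 2 codes-C2-4 base-C2 refl {G}

none-C2-5 : ∀ {G} → G ≅ Cyc 2 → HGR 5 G → ⊥
none-C2-5 {G} = E2.excluded refl refl refl 3 codes-C2-5 base-C2 refl {G}

none-C3-3 : ∀ {G} → G ≅ Cyc 3 → HGR 3 G → ⊥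
none-C3-3 {G} = E3.excluded refl refl refl 1 codes-C3-3 base-C3 refl {G}

none-C3-4 : ∀ {G} → G ≅ Cyc 3 → HGR 4 G → ⊥
none-C3-4 {G} = E3.excluded refl refl refl 2 codes-C3-4 base-C3 refl {G}

none-C4-3 : ∀ {G} → G ≅ Cyc 4 → HGR 3 G → ⊥
none-C4-3 {G} = E4.excluded refl refl refl 1 codes-C4-3 base-C4 refl {G}

none-C5-3 : ∀ {G} → G ≅ Cyc 5 → HGR 3 G → ⊥
none-C5-3 {G} = E5.excluded refl refl refl 1 codes-C5-3 base-C5 refl {G}

none-V-3 : ∀ {G} → G ≅ C2² → HGR 3 G → ⊥
none-V-3 {G} = EV.excluded refl refl refl 1 codes-V-3 base-V refl {G}

none-D-3 : ∀ {G} → G ≅ D6 → HGR 3 G → ⊥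
none-D-3 {G} = ED.excluded refl refl refl 1 codes-D-3 base-D refl {G}

-- Ten or more parts

-- The m parts without their group elements: base edges B, further edges D in no triangle, and arcs for the new edges.
record Skeleton (m′ : ℕ) : Set₁ where
  field
    B D arc kind : Fin (suc m′) → Fin (suc m′) → Bool
  F : Fin (suc m′) → Fin (suc m′) → Bool
  F i j = B i j ∨ D i j
  lam : Fin (suc m′) → Fin (suc m′) → Bool
  lam i j = arc i j ∨ arc j i
  field
    B-sym : ∀ {i j} → B i j ≡ true → B j i ≡ true
    D-sym : ∀ {i j} → D i j ≡ true → D j i ≡ true
    B-irr : ∀ i → B i i ≡ false
    D-irr : ∀ i → D i i ≡ false
    anti  : ∀ i j → arc i j ≡ true → arc j i ≡ false
    B-tri : ∀ {i j} → B i j ≡ true → ∃ λ l → B i l ≡ true × B j l ≡ true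
    D-tri : ∀ {i j l} → D i j ≡ true → F i l ≡ true → F j l ≡ true → ⊥
    two-new   : ∀ {i j l} → lam i j ≡ true → lam i l ≡ true → F j l ≡ true → ⊥
    three-new : ∀ {i j l} → lam i j ≡ true → lam i l ≡ true → lam j l ≡ true → ⊥
    d ρ   : ℕ
    deg-F : ∀ i → cnt (F i) ≡ d
    deg-lam : ∀ i → sum (λ j → b2n (arc i j) + b2n (arc j i)) ≡ ρ
    p₀ p₁ q₀ q₁ : Fin (suc m′)
    -- An edge of `D` along one of these two arcs would add `e` to the elements outside the base,
    -- and `X` or `Y` could not be read off.
    X-arc : arc p₀ p₁ ≡ true × kind p₀ p₁ ≡ true × D p₀ p₁ ≡ false
    Y-arc : arc q₀ q₁ ≡ true × kind q₀ q₁ ≡ false × D q₀ q₁ ≡ false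
    connected  : (P : Fin (suc m′) → Set) → (∀ {i j} → B i j ≡ true → P i → P j) → P zero → ∀ i → P i
    asymmetric : (q q⁻ : Fin (suc m′) → Fin (suc m′)) → (∀ i → q (q⁻ i) ≡ i) → (∀ i → q⁻ (q i) ≡ i) →
                 (∀ i j → B (q i) (q j) ≡ B i j) → ∀ i → q i ≡ i

cnt-∧-const : ∀ {k} b (f : Fin k → Bool) → cnt (λ x → b ∧ f x) ≡ b2n b * cnt f
cnt-∧-const {k} false f = cnt-false {k}
cnt-∧-const true  f = sym (ℕₚ.+-identityʳ _)

module Inflate (G : FinGroup) {m′ : ℕ} (sk : Skeleton m′) where
  open Skeleton sk
  open Grp G
  open Analysis G
  open Chains G
  open Core G (suc m′)
  open OneShot G (suc m′)

  C = chain trivial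
  ch = proj₁ (proj₂ C)
  open ChainFacts ch
  open Arcs trivial (proj₁ C) ch arc kind anti

  at-e : (Fin (suc m′) → Fin (suc m′) → Bool) → Conn
  at-e E i j x = E i j ∧ ⌊ x Fₚ.≟ e ⌋

  at-e-split : ∀ {E i j x} → at-e E i j x ≡ true → (E i j ≡ true) × (x ≡ e)
  at-e-split {E} {i} {j} {x} p = proj₁ (∧-split {E i j} p) , ⌊⌋-sound (x Fₚ.≟ e) (proj₂ (∧-split {E i j} p))

  at-e-in : ∀ {E i j x} → E i j ≡ true → x ≡ e → at-e E i j x ≡ true
  at-e-in {x = x} p q = cong₂ _∧_ p (⌊⌋-true (x Fₚ.≟ e) q)

  at-e-conn : ∀ {E} → (∀ {i j} → E i j ≡ true → E j i ≡ true) → (∀ i → E i i ≡ false) → IsConn (at-e E)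
  at-e-conn {E} s r = record
    { symC = λ i j x → bool-ext (λ p → at-e-in {E} (s (proj₁ (at-e-split {E} p))) (inv-injective (trans (proj₂ (at-e-split {E} {j} {i} p)) (sym inv-e))))
        (λ p → at-e-in {E} (s (proj₁ (at-e-split {E} p))) (trans (cong inv (proj₂ (at-e-split {E} {i} {j} p))) inv-e))
    ; irrC = λ i x → cong (_∧ ⌊ x Fₚ.≟ e ⌋) (r i) }

  S Bc S′ : Conn
  S = at-e F
  Bc = at-e B
  S′ i j x = S i j x ∨ N i j x

  F-sym : ∀ {i j} → F i j ≡ true → F j i ≡ true
  F-sym {i} {j} p with ∨-split {B i j} p
  ... | inj₁ q = ∨-inj₁ _ (B-sym q)
  ... | inj₂ q = ∨-inj₂ (B j i) (D-sym q)

  lam-sym : ∀ {i j} → lam i j ≡ true → lam j i ≡ true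
  lam-sym {i} {j} p = trans (Bₚ.∨-comm (arc j i) (arc i j)) p

  isS : IsConn S
  isS = at-e-conn {F} F-sym (λ i → cong₂ _∨_ (B-irr i) (D-irr i))
  isB : IsConn Bc
  isB = at-e-conn {B} B-sym B-irr

  lam-N : ∀ {i j x} → N i j x ≡ true → lam i j ≡ true
  lam-N {i} {j} {x} p with N-split {i} {j} p
  ... | inj₁ (q , _) = ∨-inj₁ _ q
  ... | inj₂ (q , _) = ∨-inj₂ (arc i j) q

  N≢e : ∀ {i j x} → N i j x ≡ true → x ≢ e
  N≢e {i} {j} {x} p q = false≢true (N∉ {i} {j} p) (⌊⌋-true (x Fₚ.≟ e) q)

  -- Edges of `F` carry only `e` and new edges never do, so no triangle has exactly one new edge.
  -- The remaining numbers 0, 2 and 3 are excluded by `D-tri`, `two-new` and `three-new`.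
  no-tri : ∀ i j x → S′ i j x ≡ true → Bc i j x ≡ false → ∀ l z → S′ i l z ≡ true → S′ j l (z / x) ≡ true → ⊥
  no-tri i j x p b l z q s with ∨-split {S i j x} p | ∨-split {S i l z} q | ∨-split {S j l (z / x)} s
  ... | inj₁ p′ | inj₁ q′ | inj₁ s′ = D-tri D! (proj₁ (at-e-split {F} q′)) (proj₁ (at-e-split {F} s′))
    where
    D! : D i j ≡ true
    D! with ∨-split {B i j} (proj₁ (at-e-split {F} p′))
    ... | inj₁ t = ⊥-elim (false≢true b (at-e-in {B} t (proj₂ (at-e-split {F} {i} {j} p′))))
    ... | inj₂ t = t
  ... | inj₁ p′ | inj₂ q′ | inj₂ s′ = two-new (lam-sym {i} (lam-N {i} {l} q′)) (lam-sym {j} (lam-N {j} {l} s′)) (proj₁ (at-e-split {F} p′))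
  ... | inj₁ p′ | inj₁ q′ | inj₂ s′ = N≢e {j} {l} s′ (trans (cong₂ _/_ (proj₂ (at-e-split {F} {i} {l} q′)) (proj₂ (at-e-split {F} {i} {j} p′))) (/-self e))
  ... | inj₁ p′ | inj₂ q′ | inj₁ s′ = N≢e {i} {l} q′ (trans (/-e (proj₂ (at-e-split {F} {j} {l} s′))) (proj₂ (at-e-split {F} {i} {j} p′)))
  ... | inj₂ p′ | inj₁ q′ | inj₁ s′ = N≢e {i} {j} p′ (trans (sym (/-e (proj₂ (at-e-split {F} {j} {l} s′)))) (proj₂ (at-e-split {F} {i} {l} q′)))
  ... | inj₂ p′ | inj₂ q′ | inj₁ s′ = two-new (lam-N {i} {j} p′) (lam-N {i} {l} q′) (proj₁ (at-e-split {F} s′))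
  ... | inj₂ p′ | inj₁ q′ | inj₂ s′ = two-new (lam-sym {i} (lam-N {i} {j} p′)) (lam-N {j} {l} s′) (proj₁ (at-e-split {F} q′))
  ... | inj₂ p′ | inj₂ q′ | inj₂ s′ = three-new (lam-N {i} {j} p′) (lam-N {i} {l} q′) (lam-N {j} {l} s′)

  B⊆S : ∀ {i j x} → Bc i j x ≡ true → S′ i j x ≡ true
  B⊆S {i} {j} p = ∨-inj₁ _ (at-e-in {F} (∨-inj₁ _ (proj₁ (at-e-split {B} p))) (proj₂ (at-e-split {B} {i} {j} p)))

  in-tri : ∀ i j x → Bc i j x ≡ true → ∃ λ l → ∃ λ z → S′ i l z ≡ true × S′ j l (z / x) ≡ true
  in-tri i j x p with at-e-split {B} {i} {j} p
  ... | b , refl with B-tri b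
  ... | l , a , c = l , e , B⊆S {i} (at-e-in {B} a refl) , B⊆S {j} (at-e-in {B} c (/-self e))

  module _ (σ : Auto Bc) where
    g = proj₂ (to σ (zero , e))

    edge : ∀ {i j} → B i j ≡ true → adjC Bc (i , e) (j , e) ≡ true
    edge p = at-e-in {B} p (/-self e)

    -- Base edges join vertices with equal group coordinates, so the coordinate of the image is
    -- constant along the connected base.
    level : ∀ i → proj₂ (to σ (i , e)) ≡ g
    level = connected _ (λ {i} {j} b p → trans (/-e (proj₂ (at-e-split {B} {proj₁ (to σ (i , e))} (trans (pres σ (i , e) (j , e)) (edge b))))) p) refl

  module _ (σ : Auto Bc) where
    -- The translation by g followed by σ⁻¹ maps the level of `e` to itself, and on the parts it
    -- inverts `q`.
    τ = flip σ ∘ᴬ trAuto (g σ)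
    q q⁻ : Fin (suc m′) → Fin (suc m′)
    q i = proj₁ (to σ (i , e))
    q⁻ i = proj₁ (to τ (i , e))

    to-q : ∀ i → to σ (i , e) ≡ (q i , g σ)
    to-q i = cong (q i ,_) (level σ i)

    τq : ∀ i → to τ (q i , e) ≡ (i , e)
    τq i = trans (cong (λ t → from σ (q i , t)) (idˡ (g σ))) (trans (cong (from σ) (sym (to-q i))) (from-to σ (i , e)))

    to-q⁻ : ∀ i → to τ (i , e) ≡ (q⁻ i , e)
    to-q⁻ i = cong (q⁻ i ,_) (trans (level τ i) (trans (sym (level τ (q zero))) (cong proj₂ (τq zero))))

    q-pres : ∀ i j → B (q i) (q j) ≡ B i j
    q-pres i j = trans (sym (at-1 (q i) (q j) (g σ))) (trans (cong₂ (adjC Bc) (sym (to-q i)) (sym (to-q j))) (trans (pres σ (i , e) (j , e)) (at-1 i j e)))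
      where
      at-1 : ∀ i j x → adjC Bc (i , x) (j , x) ≡ B i j
      at-1 i j x = trans (cong (B i j ∧_) (⌊⌋-true (x / x Fₚ.≟ e) (/-self x))) (Bₚ.∧-identityʳ (B i j))

    fixed : ∀ i → q i ≡ i
    fixed = asymmetric q q⁻
      (λ i → cong proj₁ (trans (cong (to σ) (sym (to-q⁻ i))) (trans (to-from σ _) (cong (i ,_) (idˡ (g σ))))))
      (λ i → cong proj₁ (τq i)) q-pres

  rigidB : Rigid trivial Bc
  rigidB σ = g σ , λ i x p → trans (cong (λ t → to σ (i , t)) (⌊⌋-sound (x Fₚ.≟ e) p))
    (trans (to-q σ i) (cong₂ _,_ (fixed σ i) (sym (trans (cong (_· g σ) (⌊⌋-sound (x Fₚ.≟ e) p)) (idˡ (g σ))))))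

  N-B : ∀ {i j x} → N i j x ≡ true → Bc i j x ≡ false
  N-B {i} {j} p = ≢true λ t → N≢e {i} {j} p (proj₂ (at-e-split {B} {i} {j} t))

  extra : ∀ {i j x} → arc i j ≡ true → D i j ≡ false → S′ i j x ≡ true → Bc i j x ≡ false → set i j x ≡ true
  extra {i} {j} {x} a nd p b with ∨-split {S i j x} p
  ... | inj₂ t with N-split {i} {j} t
  ... | inj₁ (_ , s) = s
  ... | inj₂ (s , _) = ⊥-elim (false≢true (anti i j a) s)
  extra {i} {j} {x} a nd p b | inj₁ t = ⊥-elim (D-new (∨-split {B i j} (proj₁ (at-e-split {F} t))))
    where
    D-new : (B i j ≡ true) ⊎ (D i j ≡ true) → ⊥
    D-new (inj₁ u) = false≢true b (at-e-in {B} u (proj₂ (at-e-split {F} {i} {j} t)))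
    D-new (inj₂ u) = false≢true nd u

  rigid : Rigid full S′
  rigid = Shoot.rigid zero trivial (proj₁ C) ch (proj₂ (proj₂ C)) S′ Bc isB (λ i j x → B⊆S {i} {j}) in-tri no-tri rigidB p₀ p₁ q₀ q₁
    (λ x p → new {p₀} (proj₁ X-arc) (trans (kX x) p))
    (λ x p b → trans (sym (kX x)) (extra {p₀} (proj₁ X-arc) (proj₂ (proj₂ X-arc)) p b))
    (λ x p → new {q₀} (proj₁ Y-arc) (trans (kY x) p))
    (λ x p b → trans (sym (kY x)) (extra {q₀} (proj₁ Y-arc) (proj₂ (proj₂ Y-arc)) p b))
    where
    kX : ∀ x → set p₀ p₁ x ≡ X x
    kX x = cong (λ b → if b then X x else Y x) (proj₁ (proj₂ X-arc))
    kY : ∀ x → set q₀ q₁ x ≡ Y x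
    kY x = cong (λ b → if b then X x else Y x) (proj₁ (proj₂ Y-arc))
    new : ∀ {i j x} → arc i j ≡ true → set i j x ≡ true → S′ i j x ≡ true × Bc i j x ≡ false
    new {i} {j} {x} a s = ∨-inj₂ (S i j x) n , N-B {i} n
      where n = ∨-inj₁ _ (cong₂ _∧_ a s)

  isC′ : IsConn S′
  isC′ = record { symC = λ i j x → cong₂ _∨_ (IsConn.symC isS i j x) (IsConn.symC isN i j x) ; irrC = λ i x → cong₂ _∨_ (IsConn.irrC isS i x) (IsConn.irrC isN i x) }

  hgr : HGR (suc m′) G
  hgr = toHGR isC′ rigid (d + ρ * Chain.r ch) degs zero
    where
    open ≡-Reasoning
    degs : ∀ i → deg S′ i ≡ d + ρ * Chain.r ch
    degs i = begin
      sum (λ j → cnt (S′ i j)) ≡⟨ sum-cong-≗ (λ j → cnt-∨ (S i j) (N i j) (λ x p q → N≢e {i} {j} q (proj₂ (at-e-split {F} {i} {j} p)))) ⟩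
      sum (λ j → cnt (S i j) + cnt (N i j)) ≡⟨ ∑-distrib-+ (λ j → cnt (S i j)) (λ j → cnt (N i j)) ⟩
      sum (λ j → cnt (S i j)) + sum (λ j → cnt (N i j)) ≡⟨ cong₂ _+_ (sum-cong-≗ (λ j → one (F i j))) (sum-cong-≗ (λ j → N-cnt i j)) ⟩
      cnt (F i) + sum (λ j → (b2n (arc i j) + b2n (arc j i)) * Chain.r ch)
        ≡⟨ cong₂ _+_ (deg-F i) (sum-* (λ j → b2n (arc i j) + b2n (arc j i)) (Chain.r ch)) ⟩
      d + sum (λ j → b2n (arc i j) + b2n (arc j i)) * Chain.r ch ≡⟨ cong (λ t → d + t * Chain.r ch) (deg-lam i) ⟩
      d + ρ * Chain.r ch ∎
      where
      one : ∀ b → cnt (λ x → b ∧ ⌊ x Fₚ.≟ e ⌋) ≡ b2n b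
      one b = trans (cnt-∧-const b (λ x → ⌊ x Fₚ.≟ e ⌋)) (trans (cong (b2n b *_) (cnt-single e)) (ℕₚ.*-identityʳ (b2n b)))

cnt-listℕ : ∀ {m} (f : Fin m → Bool) (L : List ℕ) → Uniqueₗ L → (∀ j → f j ≡ true → toℕ j ∈ₗ L) →
            Allₗ (λ k → ∃ λ j → toℕ j ≡ k × f j ≡ true) L → cnt f ≡ length L
cnt-listℕ {m} f [] _ h _ = trans (cnt-cong (λ j → ≢true λ p → case h j p of λ ())) (cnt-false {m})
cnt-listℕ f (k ∷ L) (k∉ ∷ u) h ((j , jk , fj) ∷ a) = begin
  cnt f ≡⟨ cnt-∖ f (λ x → ⌊ x Fₚ.≟ j ⌋) (λ x p → trans (cong f (⌊⌋-sound (x Fₚ.≟ j) p)) fj) ⟨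
  cnt f′ + cnt (λ x → ⌊ x Fₚ.≟ j ⌋) ≡⟨ cong₂ _+_ (cnt-listℕ f′ L u h′ (All.zipWith still (k∉ , a))) (cnt-single j) ⟩
  length L + 1 ≡⟨ ℕₚ.+-comm (length L) 1 ⟩
  suc (length L) ∎
  where
  open ≡-Reasoning
  f′ : Fin _ → Bool
  f′ x = f x ∧ not ⌊ x Fₚ.≟ j ⌋
  h′ : ∀ x → f′ x ≡ true → toℕ x ∈ₗ L
  h′ x p with h x (proj₁ (∧-split p))
  ... | there q = q
  ... | here q = ⊥-elim (false≢true (not-true (proj₂ (∧-split {f x} p))) (⌊⌋-true (x Fₚ.≟ j) (Fₚ.toℕ-injective (trans q (sym jk)))))
  still : ∀ {l} → (k ≢ l) × (∃ λ x → toℕ x ≡ l × f x ≡ true) → ∃ λ x → toℕ x ≡ l × f′ x ≡ true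
  still (k≢ , x , xl , fx) = x , xl , cong₂ _∧_ fx (cong not (⌊⌋-false (x Fₚ.≟ j) λ { refl → k≢ (trans (sym jk) xl) }))

-- The base is the square of the path 0, ..., m-1 without the edge from 3 to 5, whose absence
-- destroys the reflection. To reach valency 4 the ends lack two neighbours each and the parts 1, 3,
-- 5 and 8 + t lack one each; the four edges of `D` supply exactly these and lie in no triangle.
module Frame (t : ℕ) where
  m = 10 + t

  data BArc : ℕ → ℕ → Set where
    s1 : ∀ {k} → BArc k (1 + k)
    s2 : ∀ {k} → k ≢ 3 → BArc k (2 + k)

  data DArc : ℕ → ℕ → Set where
    a1 : DArc 0 (9 + t)
    a2 : DArc 0 5
    a3 : DArc 3 (9 + t)
    a4 : DArc 1 (8 + t)

  bArc dArc : ℕ → ℕ → Bool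
  bArc k l = (l ≡ᵇ 1 + k) ∨ ((l ≡ᵇ 2 + k) ∧ not (k ≡ᵇ 3))
  dArc k l = ((k ≡ᵇ 0) ∧ (l ≡ᵇ 9 + t)) ∨ (((k ≡ᵇ 0) ∧ (l ≡ᵇ 5)) ∨ (((k ≡ᵇ 3) ∧ (l ≡ᵇ 9 + t)) ∨ ((k ≡ᵇ 1) ∧ (l ≡ᵇ 8 + t))))

  bArc-sound : ∀ {k l} → bArc k l ≡ true → BArc k l
  bArc-sound {k} {l} p with ∨-split {l ≡ᵇ 1 + k} p
  ... | inj₁ q with refl ← ≡ᵇ-sound l (1 + k) q = s1
  ... | inj₂ q with ∧-split {l ≡ᵇ 2 + k} q
  ... | q₁ , q₂ with refl ← ≡ᵇ-sound l (2 + k) q₁ = s2 λ { refl → case q₂ of λ () }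

  bArc-true : ∀ {k l} → BArc k l → bArc k l ≡ true
  bArc-true (s1 {k}) = ∨-inj₁ _ (≡ᵇ-refl k)
  bArc-true (s2 {k} n) = ∨-inj₂ (2 + k ≡ᵇ 1 + k) (cong₂ _∧_ (≡ᵇ-refl k) (cong not (≢true λ p → n (≡ᵇ-sound k 3 p))))

  both : ∀ {k l a b} → ((k ≡ᵇ a) ∧ (l ≡ᵇ b)) ≡ true → (k ≡ a) × (l ≡ b)
  both {k} {l} {a} {b} p = ≡ᵇ-sound k a (proj₁ (∧-split {k ≡ᵇ a} p)) , ≡ᵇ-sound l b (proj₂ (∧-split {k ≡ᵇ a} p))

  dArc-sound : ∀ {k l} → dArc k l ≡ true → DArc k l
  dArc-sound {k} {l} p with ∨-split {(k ≡ᵇ 0) ∧ (l ≡ᵇ 9 + t)} p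
  ... | inj₁ q with refl , refl ← both {k} {l} q = a1
  ... | inj₂ p with ∨-split {(k ≡ᵇ 0) ∧ (l ≡ᵇ 5)} p
  ... | inj₁ q with refl , refl ← both {k} {l} q = a2
  ... | inj₂ p with ∨-split {(k ≡ᵇ 3) ∧ (l ≡ᵇ 9 + t)} p
  ... | inj₁ q with refl , refl ← both {k} {l} q = a3
  ... | inj₂ q with refl , refl ← both {k} {l} q = a4

  dArc-true : ∀ {k l} → DArc k l → dArc k l ≡ true
  dArc-true a1 = ∨-inj₁ _ (≡ᵇ-refl t)
  dArc-true a2 = refl
  dArc-true a3 = ∨-inj₁ _ (≡ᵇ-refl t)
  dArc-true a4 = ≡ᵇ-refl t

  Sy : (ℕ → ℕ → Set) → ℕ → ℕ → Set
  Sy R k l = R k l ⊎ R l k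

  B D : Fin m → Fin m → Bool
  B i j = bArc (toℕ i) (toℕ j) ∨ bArc (toℕ j) (toℕ i)
  D i j = dArc (toℕ i) (toℕ j) ∨ dArc (toℕ j) (toℕ i)

  B-sound : ∀ {i j} → B i j ≡ true → Sy BArc (toℕ i) (toℕ j)
  B-sound {i} {j} p with ∨-split {bArc (toℕ i) (toℕ j)} p
  ... | inj₁ q = inj₁ (bArc-sound q)
  ... | inj₂ q = inj₂ (bArc-sound q)

  D-sound : ∀ {i j} → D i j ≡ true → Sy DArc (toℕ i) (toℕ j)
  D-sound {i} {j} p with ∨-split {dArc (toℕ i) (toℕ j)} p
  ... | inj₁ q = inj₁ (dArc-sound q)
  ... | inj₂ q = inj₂ (dArc-sound q)

  B-true : ∀ {i j} → Sy BArc (toℕ i) (toℕ j) → B i j ≡ true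
  B-true (inj₁ q) = ∨-inj₁ _ (bArc-true q)
  B-true {i} {j} (inj₂ q) = ∨-inj₂ (bArc (toℕ i) (toℕ j)) (bArc-true q)

  D-true : ∀ {i j} → Sy DArc (toℕ i) (toℕ j) → D i j ≡ true
  D-true (inj₁ q) = ∨-inj₁ _ (dArc-true q)
  D-true {i} {j} (inj₂ q) = ∨-inj₂ (dArc (toℕ i) (toℕ j)) (dArc-true q)

  data Pos : ℕ → Set where
    c0 : Pos 0
    c1 : Pos 1
    c2 : Pos 2
    c3 : Pos 3
    c4 : Pos 4
    c5 : Pos 5
    mid : ∀ {s} → s ≤ 1 + t → Pos (6 + s)
    y : Pos (8 + t)
    z : Pos (9 + t)

  pos : ∀ k → k < m → Pos k
  pos 0 _ = c0
  pos 1 _ = c1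
  pos 2 _ = c2
  pos 3 _ = c3
  pos 4 _ = c4
  pos 5 _ = c5
  pos (suc (suc (suc (suc (suc (suc s)))))) (s≤s (s≤s (s≤s (s≤s (s≤s (s≤s (s≤s p))))))) with ℕₚ.m≤n⇒m<n∨m≡n p
  ... | inj₂ refl = z
  ... | inj₁ (s≤s q) with ℕₚ.m≤n⇒m<n∨m≡n q
  ... | inj₂ refl = y
  ... | inj₁ (s≤s r) = mid r

  nbB nbD : ∀ {k} → Pos k → List ℕ
  nbB c0 = 1 ∷ 2 ∷ []
  nbB c1 = 2 ∷ 3 ∷ 0 ∷ []
  nbB c2 = 3 ∷ 4 ∷ 1 ∷ 0 ∷ []
  nbB c3 = 4 ∷ 2 ∷ 1 ∷ []
  nbB c4 = 5 ∷ 6 ∷ 3 ∷ 2 ∷ []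
  nbB c5 = 6 ∷ 7 ∷ 4 ∷ []
  nbB (mid {s} _) = 7 + s ∷ 8 + s ∷ 5 + s ∷ 4 + s ∷ []
  nbB y = 9 + t ∷ 7 + t ∷ 6 + t ∷ []
  nbB z = 8 + t ∷ 7 + t ∷ []
  nbD c0 = 9 + t ∷ 5 ∷ []
  nbD c1 = 8 + t ∷ []
  nbD c3 = 9 + t ∷ []
  nbD c5 = 0 ∷ []
  nbD y = 1 ∷ []
  nbD z = 0 ∷ 3 ∷ []
  nbD _ = []

  uniqueB : ∀ {k} (p : Pos k) → Uniqueₗ (nbB p)
  uniqueB c0 = ((λ ()) ∷ []) ∷ [] ∷ []
  uniqueB c1 = ((λ ()) ∷ (λ ()) ∷ []) ∷ ((λ ()) ∷ []) ∷ [] ∷ []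
  uniqueB c2 = ((λ ()) ∷ (λ ()) ∷ (λ ()) ∷ []) ∷ ((λ ()) ∷ (λ ()) ∷ []) ∷ ((λ ()) ∷ []) ∷ [] ∷ []
  uniqueB c3 = ((λ ()) ∷ (λ ()) ∷ []) ∷ ((λ ()) ∷ []) ∷ [] ∷ []
  uniqueB c4 = ((λ ()) ∷ (λ ()) ∷ (λ ()) ∷ []) ∷ ((λ ()) ∷ (λ ()) ∷ []) ∷ ((λ ()) ∷ []) ∷ [] ∷ []
  uniqueB c5 = ((λ ()) ∷ (λ ()) ∷ []) ∷ ((λ ()) ∷ []) ∷ [] ∷ []
  uniqueB (mid _) = ((λ ()) ∷ (λ ()) ∷ (λ ()) ∷ []) ∷ ((λ ()) ∷ (λ ()) ∷ []) ∷ ((λ ()) ∷ []) ∷ [] ∷ []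
  uniqueB y = ((λ ()) ∷ (λ ()) ∷ []) ∷ ((λ ()) ∷ []) ∷ [] ∷ []
  uniqueB z = ((λ ()) ∷ []) ∷ [] ∷ []

  uniqueD : ∀ {k} (p : Pos k) → Uniqueₗ (nbD p)
  uniqueD c0 = ((λ ()) ∷ []) ∷ [] ∷ []
  uniqueD c1 = [] ∷ []
  uniqueD c2 = []
  uniqueD c3 = [] ∷ []
  uniqueD c4 = []
  uniqueD c5 = [] ∷ []
  uniqueD (mid _) = []
  uniqueD y = [] ∷ []
  uniqueD z = ((λ ()) ∷ []) ∷ [] ∷ []

  pattern n0 = here refl
  pattern n1 = there n0
  pattern n2 = there n1
  pattern n3 = there n2

  over : ∀ {k n} → ¬ (k + n < n)
  over {k} {n} p = ℕₚ.<⇒≱ p (ℕₚ.m≤n+m n k)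

  mid-max : ∀ {s} → ¬ (2 + s ≤ s)
  mid-max {s} p = over {1} {s} p

  inB : ∀ {k l} (p : Pos k) → l < m → Sy BArc k l → l ∈ₗ nbB p
  inB c0 _ (inj₁ s1) = n0
  inB c0 _ (inj₁ (s2 _)) = n1
  inB c1 _ (inj₁ s1) = n0
  inB c1 _ (inj₁ (s2 _)) = n1
  inB c1 _ (inj₂ s1) = n2
  inB c2 _ (inj₁ s1) = n0
  inB c2 _ (inj₁ (s2 _)) = n1
  inB c2 _ (inj₂ s1) = n2
  inB c2 _ (inj₂ (s2 _)) = n3
  inB c3 _ (inj₁ s1) = n0
  inB c3 _ (inj₁ (s2 n)) = ⊥-elim (n refl)
  inB c3 _ (inj₂ s1) = n1
  inB c3 _ (inj₂ (s2 _)) = n2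
  inB c4 _ (inj₁ s1) = n0
  inB c4 _ (inj₁ (s2 _)) = n1
  inB c4 _ (inj₂ s1) = n2
  inB c4 _ (inj₂ (s2 _)) = n3
  inB c5 _ (inj₁ s1) = n0
  inB c5 _ (inj₁ (s2 _)) = n1
  inB c5 _ (inj₂ s1) = n2
  inB c5 _ (inj₂ (s2 n)) = ⊥-elim (n refl)
  inB (mid _) _ (inj₁ s1) = n0
  inB (mid _) _ (inj₁ (s2 _)) = n1
  inB (mid _) _ (inj₂ s1) = n2
  inB (mid _) _ (inj₂ (s2 _)) = n3
  inB y _ (inj₁ s1) = n0
  inB y l (inj₁ (s2 _)) = ⊥-elim (over {0} l)
  inB y _ (inj₂ s1) = n1
  inB y _ (inj₂ (s2 _)) = n2
  inB z l (inj₁ s1) = ⊥-elim (over {0} l)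
  inB z l (inj₁ (s2 _)) = ⊥-elim (over {1} l)
  inB z _ (inj₂ s1) = n0
  inB z _ (inj₂ (s2 _)) = n1

  inD : ∀ {k l} (p : Pos k) → Sy DArc k l → l ∈ₗ nbD p
  inD c0 (inj₁ a1) = n0
  inD c0 (inj₁ a2) = n1
  inD c1 (inj₁ a4) = n0
  inD c3 (inj₁ a3) = n0
  inD c5 (inj₂ a2) = n0
  inD (mid p) (inj₂ a1) = ⊥-elim (mid-max p)
  inD (mid p) (inj₂ a3) = ⊥-elim (mid-max p)
  inD (mid p) (inj₂ a4) = ⊥-elim (over {0} p)
  inD y (inj₂ a4) = n0
  inD z (inj₂ a1) = n0
  inD z (inj₂ a3) = n1

  at : ∀ k → k < m → Fin m
  at k l = fromℕ< l

  toℕ-at : ∀ {k} (l : k < m) → toℕ (at k l) ≡ k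
  toℕ-at l = Fₚ.toℕ-fromℕ< l

  lit : ∀ k {n} → k < suc k + n
  lit k = ℕₚ.m≤m+n (suc k) _

  outB : ∀ {k} (p : Pos k) → Allₗ (λ l → l < m × Sy BArc k l) (nbB p)
  outB c0 = (lit 1 , inj₁ s1) ∷ (lit 2 , inj₁ (s2 λ ())) ∷ []
  outB c1 = (lit 2 , inj₁ s1) ∷ (lit 3 , inj₁ (s2 λ ())) ∷ (lit 0 , inj₂ s1) ∷ []
  outB c2 = (lit 3 , inj₁ s1) ∷ (lit 4 , inj₁ (s2 λ ())) ∷ (lit 1 , inj₂ s1) ∷ (lit 0 , inj₂ (s2 λ ())) ∷ []
  outB c3 = (lit 4 , inj₁ s1) ∷ (lit 2 , inj₂ s1) ∷ (lit 1 , inj₂ (s2 λ ())) ∷ []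
  outB c4 = (lit 5 , inj₁ s1) ∷ (lit 6 , inj₁ (s2 λ ())) ∷ (lit 3 , inj₂ s1) ∷ (lit 2 , inj₂ (s2 λ ())) ∷ []
  outB c5 = (lit 6 , inj₁ s1) ∷ (lit 7 , inj₁ (s2 λ ())) ∷ (lit 4 , inj₂ s1) ∷ []
  outB (mid {s} p) = (up 7 (ℕₚ.m≤n⇒m≤1+n q) , inj₁ s1) ∷ (up 8 q , inj₁ (s2 λ ())) ∷ (up 5 (ℕₚ.m≤n⇒m≤1+n (ℕₚ.m≤n⇒m≤1+n (ℕₚ.m≤n⇒m≤1+n q))) , inj₂ s1) ∷
                     (up 4 (ℕₚ.m≤n⇒m≤1+n (ℕₚ.m≤n⇒m≤1+n (ℕₚ.m≤n⇒m≤1+n (ℕₚ.m≤n⇒m≤1+n q)))) , inj₂ (s2 λ ())) ∷ []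
    where
    q : suc s ≤ 2 + t
    q = s≤s p
    up : ∀ k {n} → s < n → k + s < k + n
    up k r = ℕₚ.+-monoʳ-< k r
  outB y = (ℕₚ.≤-refl , inj₁ s1) ∷ (ℕₚ.m≤n+m (8 + t) 2 , inj₂ s1) ∷ (ℕₚ.m≤n+m (7 + t) 3 , inj₂ (s2 λ ())) ∷ []
  outB z = (ℕₚ.m≤n+m (9 + t) 1 , inj₂ s1) ∷ (ℕₚ.m≤n+m (8 + t) 2 , inj₂ (s2 λ ())) ∷ []

  outD : ∀ {k} (p : Pos k) → Allₗ (λ l → l < m × Sy DArc k l) (nbD p)
  outD c0 = (ℕₚ.≤-refl , inj₁ a1) ∷ (lit 5 , inj₁ a2) ∷ []
  outD c1 = (ℕₚ.m≤n+m (9 + t) 1 , inj₁ a4) ∷ []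
  outD c2 = []
  outD c3 = (ℕₚ.≤-refl , inj₁ a3) ∷ []
  outD c4 = []
  outD c5 = (lit 0 , inj₂ a2) ∷ []
  outD (mid _) = []
  outD y = (lit 1 , inj₂ a4) ∷ []
  outD z = (lit 0 , inj₂ a1) ∷ (lit 3 , inj₂ a3) ∷ []

  posF : ∀ (i : Fin m) → Pos (toℕ i)
  posF i = pos (toℕ i) (Fₚ.toℕ<n i)

  cnt-B : ∀ i (p : Pos (toℕ i)) → cnt (B i) ≡ length (nbB p)
  cnt-B i p = cnt-listℕ (B i) (nbB p) (uniqueB p) (λ j b → inB p (Fₚ.toℕ<n j) (B-sound {i} {j} b))
    (All.map (λ { (l , b) → at _ l , toℕ-at l , B-true {i} {at _ l} (subst (Sy BArc (toℕ i)) (sym (toℕ-at l)) b) }) (outB p))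

  cnt-D : ∀ i (p : Pos (toℕ i)) → cnt (D i) ≡ length (nbD p)
  cnt-D i p = cnt-listℕ (D i) (nbD p) (uniqueD p) (λ j b → inD p (D-sound {i} {j} b))
    (All.map (λ { (l , b) → at _ l , toℕ-at l , D-true {i} {at _ l} (subst (Sy DArc (toℕ i)) (sym (toℕ-at l)) b) }) (outD p))

  disjoint : ∀ {k l} → BArc k l → DArc k l → ⊥
  disjoint () a1
  disjoint () a2
  disjoint () a3
  disjoint () a4

  ascend-B : ∀ {k l} → BArc k l → k < l
  ascend-B s1 = ℕₚ.≤-refl
  ascend-B (s2 _) = ℕₚ.n≤1+n _

  ascend-D : ∀ {k l} → DArc k l → k < l
  ascend-D a1 = s≤s z≤n
  ascend-D a2 = s≤s z≤n
  ascend-D a3 = ℕₚ.m≤m+n 4 _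
  ascend-D a4 = ℕₚ.m≤m+n 2 _

  irr : ∀ {R : ℕ → ℕ → Set} → (∀ {k l} → R k l → k < l) → ∀ {k l} → k ≡ l → Sy R k l → ⊥
  irr f p (inj₁ r) = ℕₚ.<-irrefl p (f r)
  irr f p (inj₂ r) = ℕₚ.<-irrefl (sym p) (f r)

  disj : ∀ {k l} → Sy BArc k l → Sy DArc k l → ⊥
  disj (inj₁ b) (inj₁ d) = disjoint b d
  disj (inj₂ b) (inj₂ d) = disjoint b d
  disj (inj₁ b) (inj₂ d) = ℕₚ.<-asym (ascend-B b) (ascend-D d)
  disj (inj₂ b) (inj₁ d) = ℕₚ.<-asym (ascend-B b) (ascend-D d)

  deg-4 : ∀ i → cnt (λ j → B i j ∨ D i j) ≡ 4
  deg-4 i = trans (cnt-∨ (B i) (D i) (λ j b d → disj (B-sound {i} {j} b) (D-sound {i} {j} d)))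
    (trans (cong₂ _+_ (cnt-B i (posF i)) (cnt-D i (posF i))) (total (posF i)))
    where
    total : ∀ {k} (p : Pos k) → length (nbB p) + length (nbD p) ≡ 4
    total c0 = refl
    total c1 = refl
    total c2 = refl
    total c3 = refl
    total c4 = refl
    total c5 = refl
    total (mid _) = refl
    total y = refl
    total z = refl

  -- Completing the triangle of a base edge.
  tri-arc : ∀ {k l} → BArc k l → l < m → ∃ λ h → h < m × Sy BArc k h × Sy BArc l h
  tri-arc (s2 {k} n) l<m = 1 + k , ℕₚ.<⇒≤ l<m , inj₁ s1 , inj₂ s1
  tri-arc {0} s1 _ = 2 , lit 2 , inj₁ (s2 λ ()) , inj₁ s1
  tri-arc {1} s1 _ = 0 , lit 0 , inj₂ s1 , inj₂ (s2 λ ())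
  tri-arc {2} s1 _ = 1 , lit 1 , inj₂ s1 , inj₂ (s2 λ ())
  tri-arc {3} s1 _ = 2 , lit 2 , inj₂ s1 , inj₂ (s2 λ ())
  tri-arc {4} s1 _ = 6 , lit 6 , inj₁ (s2 λ ()) , inj₁ s1
  tri-arc {suc (suc (suc (suc (suc k))))} s1 l<m = 4 + k , ℕₚ.<-trans (ℕₚ.n<1+n _) (ℕₚ.<-trans (ℕₚ.n<1+n _) l<m) , inj₂ s1 , inj₂ (s2 λ ())

  swap : ∀ {R : ℕ → ℕ → Set} {k l} → Sy R k l → Sy R l k
  swap (inj₁ r) = inj₂ r
  swap (inj₂ r) = inj₁ r

  tri : ∀ {k l} → k < m → l < m → Sy BArc k l → ∃ λ h → h < m × Sy BArc k h × Sy BArc l h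
  tri _ l<m (inj₁ b) = tri-arc b l<m
  tri k<m _ (inj₂ b) with tri-arc b k<m
  ... | h , h<m , p , q = h , h<m , q , p

  nbF : ∀ {k} → Pos k → List ℕ
  nbF p = nbB p ++ nbD p

  tri-D : ∀ {k l h} → DArc k l → (p : Pos k) (q : Pos l) → h ∈ₗ nbF p → h ∈ₗ nbF q → ⊥
  tri-D a1 c0 (mid p) _ _ = mid-max p
  tri-D a3 c3 (mid p) _ _ = mid-max p
  tri-D a4 c1 (mid p) _ _ = over {0} p
  tri-D a1 c0 z n0 (there (there (there (there ()))))
  tri-D a1 c0 z n1 (there (there (there (there ()))))
  tri-D a1 c0 z n2 (there (there (there (there ()))))
  tri-D a1 c0 z n3 (there (there (there (there ()))))
  tri-D a2 c0 c5 n0 (there (there (there (there ()))))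
  tri-D a2 c0 c5 n1 (there (there (there (there ()))))
  tri-D a2 c0 c5 n2 (there (there (there (there ()))))
  tri-D a2 c0 c5 n3 (there (there (there (there ()))))
  tri-D a3 c3 z n0 (there (there (there (there ()))))
  tri-D a3 c3 z n1 (there (there (there (there ()))))
  tri-D a3 c3 z n2 (there (there (there (there ()))))
  tri-D a3 c3 z n3 (there (there (there (there ()))))
  tri-D a4 c1 y n0 (there (there (there (there ()))))
  tri-D a4 c1 y n1 (there (there (there (there ()))))
  tri-D a4 c1 y n2 (there (there (there (there ()))))
  tri-D a4 c1 y n3 (there (there (there (there ()))))

  -- Vertex 0 is known by valency 2 and, against the other end, by `dead-end`. After that k + 2 is
  -- the only neighbour of k not yet taken, except that 1 and 5 are told from 2 and 6 by their
  -- valency.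
  module Walk (q q⁻ : Fin m → Fin m) (q-q⁻ : ∀ i → q (q⁻ i) ≡ i) (q⁻-q : ∀ i → q⁻ (q i) ≡ i)
              (pres : ∀ i j → B (q i) (q j) ≡ B i j) where
    Q : ∀ k → .(k < m) → ℕ
    Q k l = toℕ (q (fromℕ< l))

    Q< : ∀ k .(l : k < m) → Q k l < m
    Q< k l = Fₚ.toℕ<n _

    Q-inj : ∀ {k l} (p : k < m) (r : l < m) → Q k p ≡ Q l r → k ≡ l
    Q-inj p r eq = trans (sym (toℕ-at p)) (trans (cong toℕ (trans (sym (q⁻-q _)) (trans (cong q⁻ (Fₚ.toℕ-injective eq)) (q⁻-q _)))) (toℕ-at r))

    edge : ∀ {k l} (p : k < m) (r : l < m) → Sy BArc k l → Sy BArc (Q k p) (Q l r)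
    edge {k} {l} p r b = B-sound {q (at k p)} {q (at l r)} (trans (pres _ _) (B-true {at k p} {at l r} (Sy-at b)))
      where
      Sy-at : Sy BArc k l → Sy BArc (toℕ (at k p)) (toℕ (at l r))
      Sy-at b rewrite toℕ-at p | toℕ-at r = b

    valency : ∀ {k} (p : k < m) (c : Pos k) (c′ : Pos (Q k p)) → length (nbB c′) ≡ length (nbB c)
    valency {k} p c c′ = begin
      length (nbB c′) ≡⟨ cnt-B (q (at k p)) c′ ⟨
      cnt (B (q (at k p))) ≡⟨ cnt-bij (B (q (at k p))) q q⁻ q-q⁻ q⁻-q ⟨
      cnt (λ j → B (q (at k p)) (q j)) ≡⟨ cnt-cong (pres (at k p)) ⟩
      cnt (B (at k p)) ≡⟨ cnt-B (at k p) (subst Pos (sym (toℕ-at p)) c) ⟩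
      length (nbB (subst Pos (sym (toℕ-at p)) c)) ≡⟨ same (sym (toℕ-at p)) ⟩
      length (nbB c) ∎
      where
      open ≡-Reasoning
      same : ∀ {l} (e : k ≡ l) → length (nbB (subst Pos e c)) ≡ length (nbB c)
      same refl = refl

    nbr : ∀ {k l} → Sy BArc k l → (l ≡ 1 + k) ⊎ (l ≡ 2 + k) ⊎ (l < k)
    nbr (inj₁ s1) = inj₁ refl
    nbr (inj₁ (s2 _)) = inj₂ (inj₁ refl)
    nbr (inj₂ b) = inj₂ (inj₂ (ascend-B b))

    valency-2 : ∀ {k} (c : Pos k) → length (nbB c) ≡ 2 → (k ≡ 0) ⊎ (k ≡ 9 + t)
    valency-2 c0 _ = inj₁ refl
    valency-2 z _ = inj₂ refl

    -- The last vertex has no path of two edges through valency 3 to valency 3, while 0 — 1 — 3 is one.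
    dead-end : ∀ {h k l} → h ≡ 9 + t → (c : Pos k) (c′ : Pos l) → Sy BArc h k → Sy BArc k l →
               length (nbB c) ≡ 3 → length (nbB c′) ≡ 3 → ⊥
    dead-end refl y (mid _) _ _ _ ()
    dead-end refl y c4 _ _ _ ()
    dead-end refl y z _ _ _ ()
    dead-end refl y y _ (inj₁ ()) _ _
    dead-end refl y y _ (inj₂ ()) _ _
    dead-end refl y c1 _ (inj₁ ()) _ _
    dead-end refl y c1 _ (inj₂ ()) _ _
    dead-end refl y c3 _ (inj₁ ()) _ _
    dead-end refl y c3 _ (inj₂ ()) _ _
    dead-end refl y c5 _ (inj₁ ()) _ _
    dead-end refl y c5 _ (inj₂ ()) _ _
    dead-end refl c1 _ (inj₁ ()) _ _ _
    dead-end refl c1 _ (inj₂ ()) _ _ _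
    dead-end refl c3 _ (inj₁ ()) _ _ _
    dead-end refl c3 _ (inj₂ ()) _ _ _
    dead-end refl c5 _ (inj₁ ()) _ _ _
    dead-end refl c5 _ (inj₂ ()) _ _ _

    Fixed : ℕ → Set
    Fixed k = ∀ (l : k < m) → Q k l ≡ k

    new : ∀ {k j} (l : k < m) → (∀ {j} → j < k → Fixed j) → j < k → Q k l ≡ j → ⊥
    new l f j<k eq = ℕₚ.<⇒≢ j<k (sym (Q-inj l j<m (trans eq (sym (f j<k j<m)))))
      where j<m = ℕₚ.<-trans j<k l

    next : ∀ k → 2 + k ≢ 5 → (∀ {j} → j < 2 + k → Fixed j) → Fixed (2 + k)
    next k n f l with nbr (subst (λ x → Sy BArc x (Q (2 + k) l)) (f (ℕₚ.n≤1+n (suc k)) k<m) (edge k<m l (inj₁ (s2 λ { refl → n refl }))))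
      where k<m = ℕₚ.<-trans (ℕₚ.n<1+n k) (ℕₚ.<⇒≤ l)
    ... | inj₁ p = ⊥-elim (new l f ℕₚ.≤-refl p)
    ... | inj₂ (inj₁ p) = p
    ... | inj₂ (inj₂ p) = ⊥-elim (new l f (ℕₚ.<-trans p (ℕₚ.n≤1+n (suc k))) refl)

    abstract
      posQ : ∀ k (l : k < m) → Pos (Q k l)
      posQ k l = pos (Q k l) (Q< k l)

    first : (Q 0 (lit 0) ≡ 0) ⊎ (Q 0 (lit 0) ≡ 9 + t) → Q 0 (lit 0) ≡ 0
    first (inj₁ p) = p
    first (inj₂ p) = ⊥-elim (dead-end p (posQ 1 (lit 1)) (posQ 3 (lit 3)) (edge (lit 0) (lit 1) (inj₁ s1)) (edge (lit 1) (lit 3) (inj₁ (s2 λ ())))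
      (valency (lit 1) c1 (posQ 1 (lit 1))) (valency (lit 3) c3 (posQ 3 (lit 3))))

    fixed : ∀ k → (∀ {j} → j < k → Fixed j) → Fixed k
    fixed 0 _ l = first (valency-2 (posQ 0 (lit 0)) (valency (lit 0) c0 (posQ 0 (lit 0))))
    fixed 1 f l with nbr (subst (λ x → Sy BArc x (Q 1 l)) (f (s≤s z≤n) (lit 0)) (edge (lit 0) l (inj₁ s1)))
    ... | inj₁ p = p
    ... | inj₂ (inj₁ p) = ⊥-elim (case valency l c1 (subst Pos (sym p) c2) of λ q → absurd p q)
      where
      absurd : ∀ {k} (p : k ≡ 2) → length (nbB (subst Pos (sym p) c2)) ≡ 3 → ⊥
      absurd refl ()
    fixed 5 f l with nbr (subst (λ x → Sy BArc x (Q 5 l)) (f ℕₚ.≤-refl (lit 4)) (edge (lit 4) l (inj₁ s1)))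
    ... | inj₁ p = p
    ... | inj₂ (inj₂ p) = ⊥-elim (new l f (ℕₚ.m≤n⇒m≤1+n p) refl)
    ... | inj₂ (inj₁ p) = ⊥-elim (absurd p (valency l c5 (subst Pos (sym p) (mid z≤n))))
      where
      absurd : ∀ {k} (p : k ≡ 6) → length (nbB (subst Pos (sym p) (mid z≤n))) ≡ 3 → ⊥
      absurd refl ()
    fixed 2 f = next 0 (λ ()) f
    fixed 3 f = next 1 (λ ()) f
    fixed 4 f = next 2 (λ ()) f
    fixed (suc (suc (suc (suc (suc (suc k)))))) f = next (4 + k) (λ ()) f

    all-fixed : ∀ i → q i ≡ i
    all-fixed i = Fₚ.toℕ-injective (trans (cong (λ t → toℕ (q t)) (sym (Fₚ.fromℕ<-toℕ i (Fₚ.toℕ<n i)))) (<-rec Fixed fixed (toℕ i) (Fₚ.toℕ<n i)))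

  connected : (P : Fin m → Set) → (∀ {i j} → B i j ≡ true → P i → P j) → P zero → ∀ i → P i
  connected P step p₀ i = subst P (Fₚ.fromℕ<-toℕ i (Fₚ.toℕ<n i)) (go (toℕ i) (Fₚ.toℕ<n i))
    where
    go : ∀ k (l : k < m) → P (at k l)
    go zero l = p₀
    go (suc k) l = step {at k k<m} {at (suc k) l} (B-true {at k k<m} {at (suc k) l} (inj₁ arc)) (go k k<m)
      where
      k<m = ℕₚ.<-trans (ℕₚ.n<1+n k) l
      arc : BArc (toℕ (at k k<m)) (toℕ (at (suc k) l))
      arc rewrite toℕ-at k<m | toℕ-at l = s1

  -- What remains to be chosen are the arcs.
  module Wire (arc kind : Fin m → Fin m → Bool) (anti : ∀ i j → arc i j ≡ true → arc j i ≡ false)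
              (two-new : ∀ {i j l} → arc i j ∨ arc j i ≡ true → arc i l ∨ arc l i ≡ true → B j l ∨ D j l ≡ true → ⊥)
              (three-new : ∀ {i j l} → arc i j ∨ arc j i ≡ true → arc i l ∨ arc l i ≡ true → arc j l ∨ arc l j ≡ true → ⊥)
              (ρ : ℕ) (deg-lam : ∀ i → sum (λ j → b2n (arc i j) + b2n (arc j i)) ≡ ρ) (p₀ p₁ q₀ q₁ : Fin m)
              (X-arc : arc p₀ p₁ ≡ true × kind p₀ p₁ ≡ true × D p₀ p₁ ≡ false)
              (Y-arc : arc q₀ q₁ ≡ true × kind q₀ q₁ ≡ false × D q₀ q₁ ≡ false) where
    skeleton : Skeleton (9 + t)
    skeleton = record
      { B = B ; D = D ; arc = arc ; kind = kind
      ; B-sym = λ {i} {j} b → B-true {j} {i} (swap {BArc} (B-sound {i} {j} b))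
      ; D-sym = λ {i} {j} b → D-true {j} {i} (swap {DArc} (D-sound {i} {j} b))
      ; B-irr = λ i → ≢true λ b → irr {BArc} ascend-B refl (B-sound {i} {i} b)
      ; D-irr = λ i → ≢true λ b → irr {DArc} ascend-D refl (D-sound {i} {i} b)
      ; anti = anti ; B-tri = λ {i} {j} → B-tri {i} {j} ; D-tri = λ {i} {j} {l} → D-tri {i} {j} {l}
      ; two-new = λ {i} {j} {l} → two-new {i} {j} {l} ; three-new = λ {i} {j} {l} → three-new {i} {j} {l}
      ; d = 4 ; ρ = ρ ; deg-F = deg-4 ; deg-lam = deg-lam ; p₀ = p₀ ; p₁ = p₁ ; q₀ = q₀ ; q₁ = q₁ ; X-arc = X-arc ; Y-arc = Y-arc
      ; connected = connected ; asymmetric = Walk.all-fixed }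
      where
      B-tri : ∀ {i j} → B i j ≡ true → ∃ λ l → B i l ≡ true × B j l ≡ true
      B-tri {i} {j} b with tri (Fₚ.toℕ<n i) (Fₚ.toℕ<n j) (B-sound {i} {j} b)
      ... | h , h<m , p , q = at h h<m , B-true {i} {at h h<m} (subst (Sy BArc (toℕ i)) (sym (toℕ-at h<m)) p) , B-true {j} {at h h<m} (subst (Sy BArc (toℕ j)) (sym (toℕ-at h<m)) q)
      inF : ∀ i l → B i l ∨ D i l ≡ true → toℕ l ∈ₗ nbF (posF i)
      inF i l p with ∨-split {B i l} p
      ... | inj₁ b = ∈-++⁺ˡ (inB (posF i) (Fₚ.toℕ<n l) (B-sound {i} {l} b))
      ... | inj₂ b = ∈-++⁺ʳ (nbB (posF i)) (inD (posF i) (D-sound {i} {l} b))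
      D-tri : ∀ {i j l} → D i j ≡ true → B i l ∨ D i l ≡ true → B j l ∨ D j l ≡ true → ⊥
      D-tri {i} {j} {l} d p q with D-sound {i} {j} d
      ... | inj₁ a = tri-D a (posF i) (posF j) (inF i l p) (inF j l q)
      ... | inj₂ a = tri-D a (posF j) (posF i) (inF j l q) (inF i l p)

module Wire-check (t : ℕ) (arcs : List (ℕ × ℕ)) (ρ : ℕ) where
  open Frame t

  arc kind lam F : Fin m → Fin m → Bool
  arc = pairIn arcs
  kind i j = not ((toℕ i ≡ᵇ 2) ∧ (toℕ j ≡ᵇ 6))
  lam i j = arc i j ∨ arc j i
  F i j = B i j ∨ D i j

  antiCk : Fin m → Fin m → Bool
  antiCk i j = not (arc i j ∧ arc j i)
  newCk : Fin m → Fin m → Fin m → Bool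
  newCk i j l = not (lam i j ∧ (lam i l ∧ (F j l ∨ lam j l)))
  lamCk : Fin m → Bool
  lamCk i = sum (λ j → b2n (arc i j) + b2n (arc j i)) ≡ᵇ ρ

  wire : (allF λ i → allF (antiCk i)) ≡ true → (allF λ i → allF λ j → allF (newCk i j)) ≡ true → allF lamCk ≡ true →
         arc 0F 1F ≡ true × kind 0F 1F ≡ true × D 0F 1F ≡ false → arc 2F 6F ≡ true × kind 2F 6F ≡ false × D 2F 6F ≡ false → Skeleton (9 + t)
  wire a n l xa ya = Wire.skeleton arc kind (λ i j p → ≢true λ q → false≢true (not-true (allF-elim (antiCk i) (allF-elim (λ i → allF (antiCk i)) a i) j)) (cong₂ _∧_ p q))
    (λ {i} {j} {l} p q r → fails {i} {j} {l} p q (∨-inj₁ _ r)) (λ {i} {j} {l} p q r → fails {i} {j} {l} p q (∨-inj₂ (F j l) r))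
    ρ (λ i → ≡ᵇ-sound (sum (λ j → b2n (arc i j) + b2n (arc j i))) ρ (allF-elim lamCk l i)) 0F 1F 2F 6F xa ya
    where
    fails : ∀ {i j l} → lam i j ≡ true → lam i l ≡ true → F j l ∨ lam j l ≡ true → ⊥
    fails {i} {j} {l} p q r = false≢true (not-true (allF-elim (newCk i j) (allF-elim (λ j → allF (newCk i j)) (allF-elim (λ i → allF λ j → allF (newCk i j)) n i) j) l))
      (cong₂ _∧_ p (cong₂ _∧_ q r))

-- Ten and eleven parts are too few for the cyclic pattern used beyond. The arcs are a perfect
-- matching for ten parts and, eleven being odd, a cycle through all parts for eleven.
skeleton-10 : Skeleton 9
skeleton-10 = Wire-check.wire 0 ((0 , 1) ∷ (2 , 6) ∷ (3 , 4) ∷ (5 , 7) ∷ (8 , 9) ∷ []) 1 refl refl refl (refl , refl , refl) (refl , refl , refl)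

skeleton-11 : Skeleton 10
skeleton-11 = Wire-check.wire 1 ((0 , 1) ∷ (1 , 3) ∷ (3 , 4) ∷ (4 , 5) ∷ (5 , 7) ∷ (7 , 9) ∷ (9 , 2) ∷ (2 , 6) ∷ (6 , 8) ∷ (8 , 10) ∷ (10 , 0) ∷ []) 2
  refl refl refl (refl , refl , refl) (refl , refl , refl)

-- For m ≥ 12 parts the arcs are i → i + 3 modulo m.
module Turn (u : ℕ) where
  open Frame (2 + u)

  -- Since m = 12 + u, the second alternative is the wrapped one: going from k to k + 3 - m.
  Next : ℕ → ℕ → Set
  Next k l = (l ≡ 3 + k) ⊎ (k ≡ 9 + u + l)

  arc kind : Fin m → Fin m → Bool
  arc i j = (toℕ j ≡ᵇ 3 + toℕ i) ∨ (toℕ i ≡ᵇ 9 + u + toℕ j)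
  kind i j = not (toℕ i ≡ᵇ 1)

  sound : ∀ {i j} → arc i j ≡ true → Next (toℕ i) (toℕ j)
  sound {i} {j} p with ∨-split {toℕ j ≡ᵇ 3 + toℕ i} p
  ... | inj₁ q = inj₁ (≡ᵇ-sound (toℕ j) _ q)
  ... | inj₂ q = inj₂ (≡ᵇ-sound (toℕ i) _ q)

  true-arc : ∀ {i j} → Next (toℕ i) (toℕ j) → arc i j ≡ true
  true-arc {i} {j} (inj₁ p) = ∨-inj₁ _ (trans (cong (_≡ᵇ 3 + toℕ i) p) (≡ᵇ-refl (toℕ i)))
  true-arc {i} {j} (inj₂ p) = ∨-inj₂ (toℕ j ≡ᵇ 3 + toℕ i) (trans (cong (_≡ᵇ 9 + u + toℕ j) p) (≡ᵇ-refl (u + toℕ j)))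

  -- Bounds on both sides of an equation decide most cases.
  off : ∀ {k} n → k ≢ suc n + k
  off {k} n = ℕₚ.m≢1+n+m k

  wrap : ∀ {k l} → l < m → l ≡ 12 + u + k → ⊥
  wrap {k} {l} l<m refl = ℕₚ.<⇒≱ l<m (ℕₚ.m≤m+n (12 + u) k)

  out-unique : ∀ {k l h} → l < m → h < m → Next k l → Next k h → l ≡ h
  out-unique _ _ (inj₁ p) (inj₁ q) = trans p (sym q)
  out-unique l<m _ (inj₁ p) (inj₂ q) = ⊥-elim (wrap l<m (trans p (cong (3 +_) q)))
  out-unique _ h<m (inj₂ p) (inj₁ q) = ⊥-elim (wrap h<m (trans q (cong (3 +_) p)))
  out-unique _ _ (inj₂ p) (inj₂ q) = ℕₚ.+-cancelˡ-≡ (9 + u) _ _ (trans (sym p) q)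

  shift3 : ∀ k → 9 + u + (3 + k) ≡ 12 + (u + k)
  shift3 k = cong (9 +_) (trans (ℕₚ.+-suc u (2 + k)) (cong suc (trans (ℕₚ.+-suc u (1 + k)) (cong suc (ℕₚ.+-suc u k)))))

  in-unique : ∀ {k l h} → l < m → h < m → Next l k → Next h k → l ≡ h
  in-unique _ _ (inj₁ p) (inj₁ q) = ℕₚ.+-cancelˡ-≡ 3 _ _ (trans (sym p) q)
  in-unique _ h<m (inj₁ p) (inj₂ q) = ⊥-elim (wrap h<m (trans q (trans (cong (9 + u +_) p) (shift3 _))))
  in-unique l<m _ (inj₂ p) (inj₁ q) = ⊥-elim (wrap l<m (trans p (trans (cong (9 + u +_) q) (shift3 _))))
  in-unique _ _ (inj₂ p) (inj₂ q) = trans p (sym q)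

  -- The two new neighbours of a part differ by 6 modulo m. Edges of `B`, edges of `D` and arcs all
  -- join parts at cyclic distance at most 5, so for m ≥ 12 no edge joins those two.
  Far : ℕ → ℕ → Set
  Far k l = (k ≡ 6 + l) ⊎ (l ≡ 6 + (u + k))

  far : ∀ {k l h} → k < m → h < m → l < m → Next k l → Next h k → Far l h
  far _ _ _ (inj₁ p) (inj₁ q) = inj₁ (trans p (cong (3 +_) q))
  far _ _ _ (inj₁ p) (inj₂ q) = inj₂ (trans q (sym (trans (cong (λ t → 6 + (u + t)) p) (cong (λ t → t) (trans (cong (6 +_) (trans (ℕₚ.+-suc u _) (cong suc (trans (ℕₚ.+-suc u _) (cong suc (ℕₚ.+-suc u _)))))) refl)))))
  far _ _ _ (inj₂ p) (inj₁ q) = inj₂ (ℕₚ.+-cancelˡ-≡ 3 _ _ (trans (sym q) p))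
  far k<m h<m _ (inj₂ p) (inj₂ q) = ⊥-elim (ℕₚ.<⇒≱ h<m (subst (12 + u ≤_) (sym q) (ℕₚ.≤-trans (ℕₚ.≤-reflexive (cong (9 +_) (ℕₚ.+-comm 3 u))) (ℕₚ.+-monoʳ-≤ (9 + u) (subst (3 ≤_) (sym p) (ℕₚ.m≤m+n 3 _))))))

  far-B : ∀ {k l} → Far k l → Sy BArc k l → ⊥
  far-B (inj₁ ()) (inj₁ s1)
  far-B (inj₁ ()) (inj₁ (s2 _))
  far-B (inj₁ ()) (inj₂ s1)
  far-B (inj₁ ()) (inj₂ (s2 _))
  far-B (inj₂ p) (inj₁ (s1 {k})) = off (4 + u) (ℕₚ.suc-injective p)
  far-B (inj₂ p) (inj₁ (s2 {k} _)) = off (3 + u) (ℕₚ.suc-injective (ℕₚ.suc-injective p))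
  far-B (inj₂ p) (inj₂ (s1 {k})) = off (6 + u) (trans p (cong (6 +_) (ℕₚ.+-suc u k)))
  far-B (inj₂ p) (inj₂ (s2 {k} _)) = off (7 + u) (trans p (cong (6 +_) (trans (ℕₚ.+-suc u (suc k)) (cong suc (ℕₚ.+-suc u k)))))

  far-D : ∀ {k l} → Far k l → Sy DArc k l → ⊥
  far-D (inj₁ ()) (inj₁ a1)
  far-D (inj₁ ()) (inj₁ a2)
  far-D (inj₁ ()) (inj₁ a3)
  far-D (inj₁ ()) (inj₁ a4)
  far-D (inj₁ ()) (inj₂ a1)
  far-D (inj₁ ()) (inj₂ a2)
  far-D (inj₁ ()) (inj₂ a3)
  far-D (inj₁ ()) (inj₂ a4)
  far-D (inj₂ p) (inj₁ a1) rewrite ℕₚ.+-identityʳ u = off 4 (sym (ℕₚ.+-cancelˡ-≡ 6 _ _ p))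
  far-D (inj₂ ()) (inj₁ a2)
  far-D (inj₂ p) (inj₁ a3) rewrite ℕₚ.+-comm u 3 = off 1 (sym (ℕₚ.+-cancelˡ-≡ 9 _ _ p))
  far-D (inj₂ p) (inj₁ a4) rewrite ℕₚ.+-comm u 1 = off 2 (sym (ℕₚ.+-cancelˡ-≡ 7 _ _ p))
  far-D (inj₂ ()) (inj₂ a1)
  far-D (inj₂ ()) (inj₂ a2)
  far-D (inj₂ ()) (inj₂ a3)
  far-D (inj₂ ()) (inj₂ a4)

  far-N : ∀ {k l} → Far k l → Sy Next k l → ⊥
  far-N (inj₁ refl) (inj₁ (inj₁ p)) = off 8 p
  far-N {l = l} (inj₁ refl) (inj₁ (inj₂ p)) = off (2 + u) (ℕₚ.+-cancelˡ-≡ 6 _ _ p)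
  far-N (inj₁ refl) (inj₂ (inj₁ ()))
  far-N {l = l} (inj₁ refl) (inj₂ (inj₂ p)) = ℕₚ.<⇒≢ (ℕₚ.<-≤-trans (s≤s (ℕₚ.m≤n+m l (8 + u))) (ℕₚ.+-monoʳ-≤ (9 + u) (ℕₚ.m≤n+m l 6))) p
  far-N {k} (inj₂ refl) (inj₁ (inj₁ p)) = off (2 + u) (sym (ℕₚ.+-cancelˡ-≡ 3 _ _ p))
  far-N {k} (inj₂ refl) (inj₁ (inj₂ p)) = ℕₚ.<⇒≢ (ℕₚ.<-≤-trans (s≤s (ℕₚ.m≤n+m k (5 + u))) (ℕₚ.m≤n+m (6 + (u + k)) (9 + u))) p
  far-N {k} (inj₂ refl) (inj₂ (inj₁ p)) = off (8 + u) p
  far-N {k} (inj₂ refl) (inj₂ (inj₂ p)) = off 2 (ℕₚ.+-cancelˡ-≡ 6 _ _ p)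

  lam-sound : ∀ {i j} → arc i j ∨ arc j i ≡ true → Sy Next (toℕ i) (toℕ j)
  lam-sound {i} {j} p with ∨-split {arc i j} p
  ... | inj₁ q = inj₁ (sound {i} {j} q)
  ... | inj₂ q = inj₂ (sound {j} {i} q)

  meet : ∀ {k l h} → k < m → l < m → h < m → Sy Next k l → Sy Next k h → (l ≡ h) ⊎ Far l h ⊎ Far h l
  meet k l h (inj₁ p) (inj₁ q) = inj₁ (out-unique l h p q)
  meet k l h (inj₂ p) (inj₂ q) = inj₁ (in-unique l h p q)
  meet k l h (inj₁ p) (inj₂ q) = inj₂ (inj₁ (far k h l p q))
  meet k l h (inj₂ p) (inj₁ q) = inj₂ (inj₂ (far k l h q p))

  irr-N : ∀ {k} → Next k k → ⊥
  irr-N (inj₁ p) = off 2 p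
  irr-N (inj₂ p) = off (8 + u) p

  anti-N : ∀ {k l} → Next k l → Next l k → ⊥
  anti-N (inj₁ refl) (inj₁ p) = off 5 p
  anti-N {k} (inj₁ refl) (inj₂ p) = off (5 + u) (ℕₚ.+-cancelˡ-≡ 3 _ _ p)
  anti-N {l = l} (inj₂ refl) (inj₁ p) = off (5 + u) (sym (ℕₚ.+-cancelˡ-≡ 3 _ _ p))
  anti-N {l = l} (inj₂ refl) (inj₂ p) = ℕₚ.<⇒≢ (ℕₚ.<-≤-trans (s≤s (ℕₚ.m≤n+m l (8 + u))) (ℕₚ.m≤n+m (9 + u + l) (9 + u))) p

  meetF : ∀ {i j l} → arc i j ∨ arc j i ≡ true → arc i l ∨ arc l i ≡ true → (toℕ j ≡ toℕ l) ⊎ Far (toℕ j) (toℕ l) ⊎ Far (toℕ l) (toℕ j)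
  meetF {i} {j} {l} p q = meet (Fₚ.toℕ<n i) (Fₚ.toℕ<n j) (Fₚ.toℕ<n l) (lam-sound {i} {j} p) (lam-sound {i} {l} q)

  out-cnt : ∀ i → cnt (arc i) ≡ 1
  out-cnt i = cnt-listℕ (arc i) (proj₁ w ∷ []) ([] ∷ []) (λ j p → here (out-unique (Fₚ.toℕ<n j) (proj₁ (proj₂ w)) (sound {i} {j} p) (proj₂ (proj₂ w))))
    ((at _ (proj₁ (proj₂ w)) , toℕ-at (proj₁ (proj₂ w)) , true-arc {i} {at _ (proj₁ (proj₂ w))} (subst (Next (toℕ i)) (sym (toℕ-at (proj₁ (proj₂ w)))) (proj₂ (proj₂ w)))) ∷ [])
    where
    w : ∃ λ l → l < m × Next (toℕ i) l
    w with 9 + u ℕₚ.≤? toℕ i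
    ... | yes p = toℕ i ∸ (9 + u) , ℕₚ.≤-<-trans (ℕₚ.m∸n≤m (toℕ i) (9 + u)) (Fₚ.toℕ<n i) , inj₂ (sym (ℕₚ.m+[n∸m]≡n p))
    ... | no p = 3 + toℕ i , ℕₚ.+-monoʳ-< 3 (ℕₚ.≰⇒> p) , inj₁ refl

  in-cnt : ∀ i → cnt (λ j → arc j i) ≡ 1
  in-cnt i = cnt-listℕ (λ j → arc j i) (proj₁ w ∷ []) ([] ∷ []) (λ j p → here (in-unique (Fₚ.toℕ<n j) (proj₁ (proj₂ w)) (sound {j} {i} p) (proj₂ (proj₂ w))))
    ((at _ (proj₁ (proj₂ w)) , toℕ-at (proj₁ (proj₂ w)) , true-arc {at _ (proj₁ (proj₂ w))} {i} (subst (λ t → Next t (toℕ i)) (sym (toℕ-at (proj₁ (proj₂ w)))) (proj₂ (proj₂ w)))) ∷ [])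
    where
    w : ∃ λ l → l < m × Next l (toℕ i)
    w with 3 ℕₚ.≤? toℕ i
    ... | yes p = toℕ i ∸ 3 , ℕₚ.≤-<-trans (ℕₚ.m∸n≤m (toℕ i) 3) (Fₚ.toℕ<n i) , inj₁ (sym (ℕₚ.m+[n∸m]≡n p))
    ... | no p = 9 + u + toℕ i , ℕₚ.<-≤-trans (ℕₚ.+-monoʳ-< (9 + u) (ℕₚ.≰⇒> p)) (ℕₚ.≤-reflexive (cong (9 +_) (ℕₚ.+-comm u 3))) , inj₂ refl

  skeleton : Skeleton (11 + u)
  skeleton = Wire.skeleton arc kind (λ i j p → ≢true λ q → anti-N (sound {i} {j} p) (sound {j} {i} q))
    (λ {i} {j} {l} p q r → F-far {j} {l} (∨-split {B j l} r) (meetF {i} {j} {l} p q))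
    (λ {i} {j} {l} p q r → N-far {j} {l} (lam-sound {j} {l} r) (meetF {i} {j} {l} p q))
    2 (λ i → trans (∑-distrib-+ (λ j → b2n (arc i j)) (λ j → b2n (arc j i))) (cong₂ _+_ (out-cnt i) (in-cnt i)))
    0F 3F 1F 4F (refl , refl , refl) (refl , refl , refl)
    where
    F-far : ∀ {j l} → (B j l ≡ true) ⊎ (D j l ≡ true) → (toℕ j ≡ toℕ l) ⊎ Far (toℕ j) (toℕ l) ⊎ Far (toℕ l) (toℕ j) → ⊥
    F-far {j} {l} (inj₁ b) (inj₁ p) = irr {BArc} ascend-B p (B-sound {j} {l} b)
    F-far {j} {l} (inj₁ b) (inj₂ (inj₁ p)) = far-B p (B-sound {j} {l} b)
    F-far {j} {l} (inj₁ b) (inj₂ (inj₂ p)) = far-B p (swap {BArc} (B-sound {j} {l} b))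
    F-far {j} {l} (inj₂ b) (inj₁ p) = irr {DArc} ascend-D p (D-sound {j} {l} b)
    F-far {j} {l} (inj₂ b) (inj₂ (inj₁ p)) = far-D p (D-sound {j} {l} b)
    F-far {j} {l} (inj₂ b) (inj₂ (inj₂ p)) = far-D p (swap {DArc} (D-sound {j} {l} b))
    N-far : ∀ {j l} → Sy Next (toℕ j) (toℕ l) → (toℕ j ≡ toℕ l) ⊎ Far (toℕ j) (toℕ l) ⊎ Far (toℕ l) (toℕ j) → ⊥
    N-far {j} {l} (inj₁ b) (inj₁ p) = irr-N (subst (Next (toℕ j)) (sym p) b)
    N-far {j} {l} (inj₂ b) (inj₁ p) = irr-N (subst (Next (toℕ l)) p b)
    N-far b (inj₂ (inj₁ p)) = far-N p b
    N-far b (inj₂ (inj₂ p)) = far-N p (swap {Next} b)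

many-parts : (G : FinGroup) → ∀ t → HGR (10 + t) G
many-parts G 0 = Inflate.hgr G skeleton-10
many-parts G 1 = Inflate.hgr G skeleton-11
many-parts G (suc (suc u)) = Inflate.hgr G (Turn.skeleton u)

-- Three parts: adjoining one generator

record Four {A : Set} (P : A → Set) : Set where
  constructor four
  field
    {a}  : A
    Pa   : P a
    rest : Three (λ z → P z × z ≢ a)

module _ {k : ℕ} {P : Fin k → Set} where
  four-avoid1 : Four P → ∀ p → Three (λ z → P z × z ≢ p)
  four-avoid1 (four {a} Pa r) p with a Fₚ.≟ p
  ... | yes refl = r
  ... | no a≢p with avoid1 r p
  ... | two b≢c ((Pb , b≢a) , b≢p) ((Pc , c≢a) , c≢p) = three (≢-sym b≢a) (≢-sym c≢a) b≢c (Pa , a≢p) (Pb , b≢p) (Pc , c≢p)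

  four-avoid2 : Four P → ∀ p q → Two (λ z → P z × z ≢ p × z ≢ q)
  four-avoid2 f p q with avoid1 (four-avoid1 f p) q
  ... | two n ((Pa , a) , a′) ((Pb , b) , b′) = two n (Pa , a , a′) (Pb , b , b′)

  four-avoid3 : Four P → ∀ p q r → ∃ λ z → P z × z ≢ p × z ≢ q × z ≢ r
  four-avoid3 f p q r with avoid2 (four-avoid1 f p) q r
  ... | z , (Pz , a) , b , c = z , Pz , a , b , c

module Extend3 (G : FinGroup) where
  open Grp G
  open Core G 3
  open Glue G 3 0F
  open M3 G

  module Ext (H : Sub) (S : Conn) (isC : IsConn S) (supp₀ : ∀ i j x → S i j x ≡ true → x ∈ H)
             (n : Fin 3 → Fin 3 → El) (n-sym : ∀ i j → n j i ≡ inv (n i j)) (n∉ : ∀ i j → i ≢ j → n i j ∉ H) where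
    open IsConn isC

    private
      supp : ∀ {i j x} → S i j x ≡ true → x ∈ H
      supp {i} {j} {x} = supp₀ i j x

    new : Fin 3 → Fin 3 → El → Bool
    new i j x = not ⌊ i Fₚ.≟ j ⌋ ∧ ⌊ x Fₚ.≟ n i j ⌋

    new-elim : ∀ {i j x} → new i j x ≡ true → i ≢ j × x ≡ n i j
    new-elim {i} {j} {x} p with i Fₚ.≟ j
    ... | no i≢j = i≢j , ⌊⌋-sound (x Fₚ.≟ n i j) p

    new-intro : ∀ {i j} → i ≢ j → new i j (n i j) ≡ true
    new-intro {i} {j} p rewrite ⌊⌋-false (i Fₚ.≟ j) p = ⌊⌋-true (n i j Fₚ.≟ n i j) refl

    S′ : Conn
    S′ i j x = S i j x ∨ new i j x

    old : ∀ {i j x} → S i j x ≡ true → S′ i j x ≡ true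
    old {i} {j} {x} = ∨-inj₁ (new i j x)

    S′-new : ∀ {i j} → i ≢ j → S′ i j (n i j) ≡ true
    S′-new {i} {j} p = ∨-inj₂ (S i j (n i j)) (new-intro p)

    S′-split : ∀ {i j x} → S′ i j x ≡ true → (S i j x ≡ true) ⊎ (i ≢ j × x ≡ n i j)
    S′-split {i} {j} {x} p with ∨-split {S i j x} p
    ... | inj₁ q = inj₁ q
    ... | inj₂ q = inj₂ (new-elim q)

    S′-false : ∀ {i j x} → S i j x ≡ false → x ≢ n i j → S′ i j x ≡ false
    S′-false {i} {j} {x} p q = ∨-false p (≢true λ r → q (proj₂ (new-elim {i} {j} r)))

    S-∉ : ∀ {i j x} → x ∉ H → S i j x ≡ false
    S-∉ p = ≢true λ q → false≢true p (supp q)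

    S-n : ∀ {i j} → i ≢ j → S i j (n i j) ≡ false
    S-n {i} {j} p = S-∉ (n∉ i j p)

    ∈≢n : ∀ {i j x} → i ≢ j → x ∈ H → x ≢ n i j
    ∈≢n {i} {j} p q = ≢-sym (∉-∈ {H} (n∉ i j p) q)

    isC′ : IsConn S′
    isC′ = record
      { symC = λ i j x → cong₂ _∨_ (symC i j x) (bool-ext
          (λ p → case new-elim {j} {i} p of λ { (a , b) → subst (λ t → new i j t ≡ true)
             (inv-injective (trans (sym (n-sym i j)) (sym b))) (new-intro (≢-sym a)) })
          (λ p → case new-elim {i} {j} p of λ { (a , refl) → subst (λ t → new j i t ≡ true) (n-sym i j) (new-intro (≢-sym a)) }))
      ; irrC = λ i x → ∨-false (irrC i x) (≢true λ p → proj₁ (new-elim {i} {i} {x} p) refl) }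

    -- Two old edges would put `n i j` into `H`, so a triangle on a new edge has a second new edge,
    -- and this leaves two possible apexes.
    cand : ∀ {i j l z} → i ≢ j → S′ i l z ≡ true → S′ j l (z / n i j) ≡ true →
           (z ≡ n i l) ⊎ (z ≡ n j l · n i j)
    cand {i} {j} {l} {z} i≢j p q with S′-split {i} {l} p | S′-split {j} {l} q
    ... | inj₂ (_ , r) | _ = inj₁ r
    ... | inj₁ _ | inj₂ (_ , r) = inj₂ (/-≡ r)
    ... | inj₁ r | inj₁ s = ⊥-elim (false≢true (n∉ i j i≢j) (subst (_∈ H)
            (grp (z ∷ n i j ∷ []) ((v0 ⊙ v1 ⁻) ⁻ ⊙ v0) v1 refl) (·∈ H (inv∈ H (supp s)) (supp r))))

    Unique : Set
    Unique = ∀ i j l → i ≢ j → i ≢ l → j ≢ l → ∃ λ c → ∀ z → S′ i l z ≡ true → S′ j l (z / n i j) ≡ true → z ≡ c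

    module _ (tri2 : ∀ i j x → S i j x ≡ true → ∃ λ l → Two (λ z → S i l z ≡ true × S j l (z / x) ≡ true))
             (uniq : Unique) where
      -- An old edge lies in two triangles. Were its image new, the two apexes would share the third
      -- part and coincide by uniqueness.
      old-edge : (σ : Auto S′) → ∀ u v → adjC S u v ≡ true → adjC S (to σ u) (to σ v) ≡ true
      old-edge σ u@(i , x) v@(j , y) p with tri2 i j (y / x) p
      ... | l , two {z₁} {z₂} z₁≢z₂ (a , b) (c , d) = go (to σ u) (to σ v) (to σ (l , z₁ · x)) (to σ (l , z₂ · x))
          (trans (pres σ u v) (old {i} {j} p))
          (trans (pres σ _ _) (up a)) (trans (pres σ _ _) (up c)) (trans (pres σ _ _) (vp b)) (trans (pres σ _ _) (vp d))
          (λ q → z₁≢z₂ (·-cancelʳ x (cong proj₂ (to-inj σ q))))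
        where
        up : ∀ {z} → S i l z ≡ true → adjC S′ u (l , z · x) ≡ true
        up {z} r = trans (cong (S′ i l) (·-/ z x)) (old {i} {l} r)
        vp : ∀ {z} → S j l (z / (y / x)) ≡ true → adjC S′ v (l , z · x) ≡ true
        vp {z} r = trans (cong (S′ j l) (grp (z ∷ x ∷ y ∷ []) (v0 ⊙ v1 ⊙ v2 ⁻) (v0 ⊙ (v2 ⊙ v1 ⁻) ⁻) refl)) (old {j} {l} r)
        go : ∀ u v w w′ → adjC S′ u v ≡ true → adjC S′ u w ≡ true → adjC S′ u w′ ≡ true →
             adjC S′ v w ≡ true → adjC S′ v w′ ≡ true → w ≢ w′ → adjC S u v ≡ true
        go (i , x) (j , y) (l , z) (l′ , z′) uv uw uw′ vw vw′ w≢w′ with S′-split {i} {j} uv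
        ... | inj₁ r = r
        ... | inj₂ (i≢j , r) = ⊥-elim (w≢w′ (cong₂ _,_ l≡l′ (·-cancelʳ (inv x) z≡z′)))
          where
          df : ∀ {u v} → adjC S′ u v ≡ true → proj₁ u ≢ proj₁ v
          df {u} {v} = IsConn.adj-diff isC′ {u} {v}
          i≢l = df {i , x} {l , z} uw
          j≢l = df {j , y} {l , z} vw
          l≡l′ : l ≡ l′
          l≡l′ = fin3-same l l′ i j (≢-sym i≢l) (≢-sym (df {i , x} {l′ , z′} uw′)) (≢-sym j≢l) (≢-sym (df {j , y} {l′ , z′} vw′)) i≢j
          sh : ∀ t → t / y ≡ (t / x) / n i j
          sh t = trans (grp (t ∷ x ∷ y ∷ []) (v0 ⊙ v2 ⁻) (v0 ⊙ v1 ⁻ ⊙ (v2 ⊙ v1 ⁻) ⁻) refl) (cong ((t / x) /_) r)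
          U = uniq i j l i≢j i≢l j≢l
          z≡z′ : z / x ≡ z′ / x
          z≡z′ = trans (proj₂ U (z / x) uw (subst (λ t → S′ j l t ≡ true) (sh z) vw))
            (sym (proj₂ U (z′ / x) (subst (λ t → S′ i t (z′ / x) ≡ true) (sym l≡l′) uw′)
              (subst (λ t → S′ j l t ≡ true) (sh z′) (subst (λ t → S′ j t (z′ / y) ≡ true) (sym l≡l′) vw′))))

      oldAuto : Auto S′ → Auto S
      oldAuto = preserved old-edge

      new-edge : (σ : Auto S′) → ∀ u v → proj₁ u ≢ proj₁ v → proj₂ v / proj₂ u ≡ n (proj₁ u) (proj₁ v) →
                 proj₁ (to σ u) ≢ proj₁ (to σ v) × proj₂ (to σ v) / proj₂ (to σ u) ≡ n (proj₁ (to σ u)) (proj₁ (to σ v))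
      new-edge σ u@(i , x) v@(j , y) i≢j r with S′-split {proj₁ (to σ u)} {proj₁ (to σ v)}
          (trans (pres σ u v) (subst (λ t → S′ i j t ≡ true) (sym r) (S′-new i≢j)))
      ... | inj₂ s = s
      ... | inj₁ s = ⊥-elim (false≢true (trans (cong (S i j) r) (S-n i≢j)) (trans (sym (pres (oldAuto σ) u v)) s))


  -- `s′` and `t′` are chosen outside S 1 2 and S 0 2. With the new elements built from them both
  -- possible apexes over the new edge between parts 0 and 1 disappear, and one of the two over each
  -- other new edge.
  module Step (H : Sub) (gd : Good H) (g : El) (g∉ : g ∉ H) where
    open Good gd
    open Sym3 sym3

    K : Sub
    K = adjoin H g

    H⊑K : H ⊑ K
    H⊑K = adjoin-⊒ H g

    g∈K : g ∈ K
    g∈K = adjoin-∋ H g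

    s′ t′ : El
    s′ = Three.a (out3 1F 2F (λ ()))
    t′ = Three.a (out3 0F 2F (λ ()))

    s′∈ : s′ ∈ H
    s′∈ = proj₁ (Three.Pa (out3 1F 2F (λ ())))
    s′∉S : S 1F 2F s′ ≡ false
    s′∉S = proj₂ (Three.Pa (out3 1F 2F (λ ())))
    t′∈ : t′ ∈ H
    t′∈ = proj₁ (Three.Pa (out3 0F 2F (λ ())))
    t′∉S : S 0F 2F t′ ≡ false
    t′∉S = proj₂ (Three.Pa (out3 0F 2F (λ ())))

    n : Fin 3 → Fin 3 → El
    n 0F 1F = g
    n 1F 0F = inv g
    n 1F 2F = t′ · inv g
    n 2F 1F = inv (t′ · inv g)
    n 0F 2F = s′ · g
    n 2F 0F = inv (s′ · g)
    n 0F 0F = e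
    n 1F 1F = e
    n 2F 2F = e

    n-sym : ∀ i j → n j i ≡ inv (n i j)
    n-sym 0F 0F = sym inv-e
    n-sym 0F 1F = refl
    n-sym 0F 2F = refl
    n-sym 1F 0F = sym (inv-inv _)
    n-sym 1F 1F = sym inv-e
    n-sym 1F 2F = refl
    n-sym 2F 0F = sym (inv-inv _)
    n-sym 2F 1F = sym (inv-inv _)
    n-sym 2F 2F = sym inv-e

    n∉ : ∀ i j → i ≢ j → n i j ∉ H
    n∉ 0F 0F p = ⊥-elim (p refl)
    n∉ 0F 1F _ = g∉
    n∉ 0F 2F _ = ·∉ʳ H s′∈ g∉
    n∉ 1F 0F _ = inv∉ H g∉
    n∉ 1F 1F p = ⊥-elim (p refl)
    n∉ 1F 2F _ = ·∉ʳ H t′∈ (inv∉ H g∉)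
    n∉ 2F 0F _ = inv∉ H (·∉ʳ H s′∈ g∉)
    n∉ 2F 1F _ = inv∉ H (·∉ʳ H t′∈ (inv∉ H g∉))
    n∉ 2F 2F p = ⊥-elim (p refl)

    n∈K : ∀ i j → n i j ∈ K
    n∈K 0F 0F = e∈ K
    n∈K 0F 1F = g∈K
    n∈K 0F 2F = ·∈ K (H⊑K s′∈) g∈K
    n∈K 1F 0F = inv∈ K g∈K
    n∈K 1F 1F = e∈ K
    n∈K 1F 2F = ·∈ K (H⊑K t′∈) (inv∈ K g∈K)
    n∈K 2F 0F = inv∈ K (·∈ K (H⊑K s′∈) g∈K)
    n∈K 2F 1F = inv∈ K (·∈ K (H⊑K t′∈) (inv∈ K g∈K))
    n∈K 2F 2F = e∈ K

    supp₀ : ∀ i j x → S i j x ≡ true → x ∈ H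
    supp₀ i j x = supp {i} {j} {x}

    open Ext H S isC supp₀ n n-sym n∉

    s-no : S′ 1F 2F s′ ≡ false
    s-no = S′-false {1F} {2F} s′∉S (∈≢n {1F} {2F} (λ ()) s′∈)
    t-no : S′ 0F 2F t′ ≡ false
    t-no = S′-false {0F} {2F} t′∉S (∈≢n {0F} {2F} (λ ()) t′∈)
    s-no⁻ : S′ 2F 1F (inv s′) ≡ false
    s-no⁻ = trans (IsConn.symC isC′ 1F 2F s′) s-no
    t-no⁻ : S′ 2F 0F (inv t′) ≡ false
    t-no⁻ = trans (IsConn.symC isC′ 0F 2F t′) t-no

    private
      nope : ∀ {A : Set} {i j x y} → x ≡ y → S′ i j y ≡ false → S′ i j x ≡ true → A
      nope refl p q = ⊥-elim (false≢true p q)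

    uniq : Unique
    uniq 0F 1F 2F _ _ _ = e , λ z p q → case cand {0F} {1F} {2F} (λ ()) p q of λ
      { (inj₁ refl) → nope (grp (s′ ∷ g ∷ []) (v0 ⊙ v1 ⊙ v1 ⁻) v0 refl) s-no q
      ; (inj₂ refl) → nope (grp (t′ ∷ g ∷ []) (v0 ⊙ v1 ⁻ ⊙ v1) v0 refl) t-no p }
    uniq 1F 0F 2F _ _ _ = e , λ z p q → case cand {1F} {0F} {2F} (λ ()) p q of λ
      { (inj₁ refl) → nope (grp (t′ ∷ g ∷ []) (v0 ⊙ v1 ⁻ ⊙ v1 ⁻ ⁻) v0 refl) t-no q
      ; (inj₂ refl) → nope (grp (s′ ∷ g ∷ []) (v0 ⊙ v1 ⊙ v1 ⁻) v0 refl) s-no p }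
    uniq 0F 2F 1F _ _ _ = n 2F 1F · n 0F 2F , λ z p q → case cand {0F} {2F} {1F} (λ ()) p q of λ
      { (inj₁ refl) → nope (grp (s′ ∷ g ∷ []) (v1 ⊙ (v0 ⊙ v1) ⁻) (v0 ⁻) refl) s-no⁻ q
      ; (inj₂ r) → r }
    uniq 2F 0F 1F _ _ _ = n 2F 1F , λ z p q → case cand {2F} {0F} {1F} (λ ()) p q of λ
      { (inj₁ r) → r
      ; (inj₂ refl) → nope (grp (s′ ∷ g ∷ []) (v1 ⊙ (v0 ⊙ v1) ⁻) (v0 ⁻) refl) s-no⁻ p }
    uniq 1F 2F 0F _ _ _ = n 2F 0F · n 1F 2F , λ z p q → case cand {1F} {2F} {0F} (λ ()) p q of λ
      { (inj₁ refl) → nope (grp (t′ ∷ g ∷ []) (v1 ⁻ ⊙ (v0 ⊙ v1 ⁻) ⁻) (v0 ⁻) refl) t-no⁻ q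
      ; (inj₂ r) → r }
    uniq 2F 1F 0F _ _ _ = n 2F 0F , λ z p q → case cand {2F} {1F} {0F} (λ ()) p q of λ
      { (inj₁ r) → r
      ; (inj₂ refl) → nope (grp (t′ ∷ g ∷ []) (v1 ⁻ ⊙ (v0 ⊙ v1 ⁻) ⁻) (v0 ⁻) refl) t-no⁻ p }
    uniq 0F 0F _ p _ _ = ⊥-elim (p refl)
    uniq 1F 1F _ p _ _ = ⊥-elim (p refl)
    uniq 2F 2F _ p _ _ = ⊥-elim (p refl)
    uniq 0F 1F 0F _ p _ = ⊥-elim (p refl)
    uniq 0F 1F 1F _ _ p = ⊥-elim (p refl)
    uniq 0F 2F 0F _ p _ = ⊥-elim (p refl)
    uniq 0F 2F 2F _ _ p = ⊥-elim (p refl)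
    uniq 1F 0F 1F _ p _ = ⊥-elim (p refl)
    uniq 1F 0F 0F _ _ p = ⊥-elim (p refl)
    uniq 1F 2F 1F _ p _ = ⊥-elim (p refl)
    uniq 1F 2F 2F _ _ p = ⊥-elim (p refl)
    uniq 2F 0F 2F _ p _ = ⊥-elim (p refl)
    uniq 2F 0F 0F _ _ p = ⊥-elim (p refl)
    uniq 2F 1F 2F _ p _ = ⊥-elim (p refl)
    uniq 2F 1F 1F _ _ p = ⊥-elim (p refl)

    -- Between parts 0 and 1 the only new element is `g`, so preservation of new edges says z (g c)
    -- = g z c.
    rigid′ : Rigid K S′
    rigid′ σ with blockwise {H} rigid (oldAuto tri2 uniq σ)
    ... | z , val , H⊑ = glue σ z val {K} (adjoin-least H g (Equiv z) H⊑ (∈Equiv z g λ c →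
      /-≡ (proj₂ (subst (λ t → proj₁ (proj₁ t) ≢ proj₁ (proj₂ t) × proj₂ (proj₂ t) / proj₂ (proj₁ t) ≡ n (proj₁ (proj₁ t)) (proj₁ (proj₂ t)))
         (cong₂ _,_ (val 0F c) (val 1F (g · c))) (new-edge tri2 uniq σ (0F , c) (1F , g · c) (λ ()) (·-/ g c))))))

    sym3′ : Sym3 K S′
    sym3′ = record
      { isC = isC′
      ; supp = λ {i} {j} p → case S′-split {i} {j} p of λ { (inj₁ q) → H⊑K (supp q) ; (inj₂ (_ , refl)) → n∈K i j }
      ; rigid = rigid′
      ; size = size + 1
      ; sz = λ i j i≢j → trans (cnt-∨ (S i j) (new i j) (λ x p q → false≢true (n∉ i j i≢j) (subst (_∈ H) (proj₂ (new-elim {i} {j} q)) (supp p))))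
          (cong₂ _+_ (sz i j i≢j) (trans (cnt-cong (λ x → cong (_∧ ⌊ x Fₚ.≟ n i j ⌋) (cong not (⌊⌋-false (i Fₚ.≟ j) i≢j)))) (cnt-single (n i j))))
      ; in3 = λ i j i≢j → Three-map (old {i} {j}) (in3 i j i≢j)
      ; out3 = λ i j i≢j → Three-map (λ { (a , b) → H⊑K a , S′-false {i} {j} b (∈≢n i≢j a) }) (out3 i j i≢j) }

    far : ∀ {i j x} → x ∉ H → x ≢ n i j → S′ i j x ≡ false
    far {i} {j} p = S′-false {i} {j} (S-∉ p)
    near : ∀ {i j x} → i ≢ j → x ∈ H → S i j x ≡ false → S′ i j x ≡ false
    near {i} {j} i≢j p q = S′-false {i} {j} q (∈≢n i≢j p)
    ∈/∉ : ∀ {x y} → x ∈ H → y ∉ H → x / y ∉ H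
    ∈/∉ p q = ·∉ʳ H p (inv∉ H q)
    ∉/∈ : ∀ {x y} → x ∉ H → y ∈ H → x / y ∉ H
    ∉/∈ p q = ·∉ˡ H p (inv∈ H q)
    off : ∀ {x y c} → x ≢ c · y → x / y ≢ c
    off p q = p (/-≡ q)

    star : Star K S′
    star = record { same = same ; diff = diff }
      where
      same : ∀ i y → y ∈ K → y ≢ e → ∃ λ j → ∃ λ l → i ≢ j × i ≢ l × j ≢ l × ∃ λ z₁ → ∃ λ z₂ →
             z₁ ∈ K × z₂ ∈ K × S′ i j z₁ ≡ false × S′ i j (z₁ / y) ≡ false ×
             S′ i l z₂ ≡ false × S′ i l (z₂ / y) ≡ false × S′ j l (z₂ / z₁) ≡ false
      same i y y∈ _ with fin3-others i
      ... | j , l , i≢j , i≢l , j≢l with ∈? y H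
      -- For `y` outside `H` one apex is taken in `H` and the other in H y. Every quotient is then
      -- either in `H`, where `out3` supplies it, or outside, where it only has to miss one new
      -- element.
      ... | inj₂ y∉ with avoid1 (out3 i j i≢j) (n i j · y)
      ... | two {z₁} _ ((z₁∈ , a) , b) _ with avoid2 (out3 i l i≢l) (n i l / y) (n j l · z₁ / y)
      ... | z₂ , (z₂∈ , c) , d , f = j , l , i≢j , i≢l , j≢l , z₁ , z₂ · y , H⊑K z₁∈ , ·∈ K (H⊑K z₂∈) y∈ ,
            near {i} {j} i≢j z₁∈ a , far {i} {j} (∈/∉ z₁∈ y∉) (off b) ,
            far {i} {l} (·∉ʳ H z₂∈ y∉) (λ q → d (trans (sym (·-/ z₂ y)) (cong (_/ y) q))) ,
            trans (cong (S′ i l) (·-/ z₂ y)) (near {i} {l} i≢l z₂∈ c) ,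
            far {j} {l} (∉/∈ (·∉ʳ H z₂∈ y∉) z₁∈) (λ q → f (trans (sym (·-/ z₂ y)) (cong (_/ y) (/-≡ q))))
      same i y y∈ _ | j , l , i≢j , i≢l , j≢l | inj₁ y∈H with avoid2 (out3 i j i≢j) (n i j / g) (n i j · y / g)
      ... | w , (w∈ , _) , a , b with avoid2 (out3 j l j≢l) (n i l / (w · g)) (n i l · y / (w · g))
      ... | z₂ , (z₂∈ , c) , d , f = j , l , i≢j , i≢l , j≢l , z₁ , z₂ · z₁ , ·∈ K (H⊑K w∈) g∈K , ·∈ K (H⊑K z₂∈) (·∈ K (H⊑K w∈) g∈K) ,
            far {i} {j} z₁∉ (λ q → a (trans (sym (·-/ w g)) (cong (_/ g) q))) ,
            far {i} {j} (∉/∈ z₁∉ y∈H) (λ q → b (trans (sym (·-/ w g)) (cong (_/ g) (/-≡ q)))) ,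
            far {i} {l} (·∉ʳ H z₂∈ z₁∉) (λ q → d (trans (sym (·-/ z₂ z₁)) (cong (_/ z₁) q))) ,
            far {i} {l} (∉/∈ (·∉ʳ H z₂∈ z₁∉) y∈H) (λ q → f (trans (sym (·-/ z₂ z₁)) (cong (_/ z₁) (/-≡ q)))) ,
            trans (cong (S′ j l) (·-/ z₂ z₁)) (near {j} {l} j≢l z₂∈ c)
        where
        z₁ = w · g
        z₁∉ : z₁ ∉ H
        z₁∉ = ·∉ʳ H w∈ g∉
      diff : ∀ i j y → i ≢ j → y ∈ K → ∃ λ l → i ≢ l × j ≢ l ×
             (∃ λ z → z ∈ K × S′ i l z ≡ false × S′ j l (z / y) ≡ false) ×
             (S′ i j y ≡ false → Two λ z → z ∈ K × S′ i l z ≡ false × S′ j l (z / y) ≡ false)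
      diff i j y i≢j y∈ with fin3-third i j i≢j
      ... | l , i≢l , j≢l = l , i≢l , j≢l , (Two.a tw , Two.Pa tw) , λ _ → tw
        where
        tw : Two λ z → z ∈ K × S′ i l z ≡ false × S′ j l (z / y) ≡ false
        tw with ∈? y H
        ... | inj₂ y∉ with avoid1 (out3 i l i≢l) (n j l · y)
        ... | two a≢b ((a∈ , a) , a′) ((b∈ , b) , b′) = two a≢b
                (H⊑K a∈ , near {i} {l} i≢l a∈ a , far {j} {l} (∈/∉ a∈ y∉) (off a′)) (H⊑K b∈ , near {i} {l} i≢l b∈ b , far {j} {l} (∈/∉ b∈ y∉) (off b′))
        -- Three elements leave only one after two exclusions; the second witness is taken from
        -- `in3` and differs from the first by lying in `S`.
        tw | inj₁ y∈H with avoid2 (out3 i j i≢j) (n i l / g) (n j l · y / g) | avoid2 (in3 i j i≢j) (n i l / g) (n j l · y / g)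
        ... | z , (z∈ , p) , a , b | z′ , q , a′ , b′ = two (λ r → false≢true p (subst (λ t → S i j t ≡ true) (sym (·-cancelʳ g r)) q))
                (mk z∈ a b) (mk (supp q) a′ b′)
          where
          mk : ∀ {z} → z ∈ H → z ≢ n i l / g → z ≢ n j l · y / g → z · g ∈ K × S′ i l (z · g) ≡ false × S′ j l (z · g / y) ≡ false
          mk {z} z∈ a b = ·∈ K (H⊑K z∈) g∈K , far {i} {l} (·∉ʳ H z∈ g∉) (λ q → a (trans (sym (·-/ z g)) (cong (_/ g) q))) ,
            far {j} {l} (∉/∈ (·∉ʳ H z∈ g∉) y∈H) (λ q → b (trans (sym (·-/ z g)) (cong (_/ g) (/-≡ q))))

    good′ : Good K
    good′ = Reset.good K S′ sym3′ star

module Generic (G : FinGroup) where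
  open Grp G
  open Core G 3
  open Glue G 3 0F
  open M3 G
  open Extend3 G

  -- The missing edges join (0 , g) to (1 , a g), so multiplication by `a` is visible in the
  -- non-edges and multiplication by `x` in the new edges. The new neighbours of a vertex of part 2
  -- have quotient x h x; as this is outside ⟨a⟩, they lie in different cosets, which singles out
  -- part 2.
  module Gen (a : El) (H4 : Four (_∈ gen a)) (x h : El) (x∉ : x ∉ gen a)
             (h∈ : h ∈ gen a) (h≢e : h ≢ e) (xhx∉ : (x · h) · x ∉ gen a) where
    H K : Sub
    H = gen a
    K = adjoin H x

    a∈ : a ∈ H
    a∈ = gen-∋ a

    H⊑K : H ⊑ K
    H⊑K = adjoin-⊒ H x
    x∈K : x ∈ K
    x∈K = adjoin-∋ H x

    -- The unique non-neighbours: S i j is H without d i j.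
    d : Fin 3 → Fin 3 → El
    d 0F 1F = a
    d 1F 0F = inv a
    d _  _  = e

    d-sym : ∀ i j → d j i ≡ inv (d i j)
    d-sym 0F 0F = sym inv-e
    d-sym 0F 1F = refl
    d-sym 0F 2F = sym inv-e
    d-sym 1F 0F = sym (inv-inv a)
    d-sym 1F 1F = sym inv-e
    d-sym 1F 2F = sym inv-e
    d-sym 2F 0F = sym inv-e
    d-sym 2F 1F = sym inv-e
    d-sym 2F 2F = sym inv-e

    d∈ : ∀ i j → d i j ∈ H
    d∈ 0F 1F = a∈
    d∈ 1F 0F = inv∈ H a∈
    d∈ 0F 0F = e∈ H
    d∈ 0F 2F = e∈ H
    d∈ 1F 1F = e∈ H
    d∈ 1F 2F = e∈ H
    d∈ 2F 0F = e∈ H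
    d∈ 2F 1F = e∈ H
    d∈ 2F 2F = e∈ H

    abstract
      S : Conn
      S i j y = not ⌊ i Fₚ.≟ j ⌋ ∧ (Sub.mem H y ∧ not ⌊ y Fₚ.≟ d i j ⌋)

      S-intro : ∀ {i j y} → i ≢ j → y ∈ H → y ≢ d i j → S i j y ≡ true
      S-intro {i} {j} {y} p q r rewrite ⌊⌋-false (i Fₚ.≟ j) p | q | ⌊⌋-false (y Fₚ.≟ d i j) r = refl

      S-elim : ∀ {i j y} → S i j y ≡ true → i ≢ j × y ∈ H × y ≢ d i j
      S-elim {i} {j} {y} p with i Fₚ.≟ j
      ... | no i≢j with Sub.mem H y | y Fₚ.≟ d i j
      ... | true | no q = i≢j , refl , q

      S-cnt : ∀ {i j} → i ≢ j → cnt (S i j) ≡ cnt (λ y → Sub.mem H y ∧ not ⌊ y Fₚ.≟ d i j ⌋)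
      S-cnt {i} {j} p = cnt-cong (λ y → cong (_∧ (Sub.mem H y ∧ not ⌊ y Fₚ.≟ d i j ⌋)) (cong not (⌊⌋-false (i Fₚ.≟ j) p)))

    S-d : ∀ i j → S i j (d i j) ≡ false
    S-d i j = ≢true λ p → proj₂ (proj₂ (S-elim {i} {j} p)) refl

    S-d⁻ : ∀ {i j y} → i ≢ j → y ∈ H → S i j y ≡ false → y ≡ d i j
    S-d⁻ {i} {j} {y} p q r = case y Fₚ.≟ d i j of λ
      { (yes s) → s
      ; (no s)  → ⊥-elim (false≢true r (S-intro {i} {j} p q s)) }

    isC : IsConn S
    isC = record
      { symC = λ i j y → bool-ext
          (λ p → case S-elim {j} {i} p of λ { (u , v , w) → S-intro (≢-sym u) (inv∈⁻ H v) (λ q → w (trans (cong inv q) (sym (d-sym i j)))) })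
          (λ p → case S-elim {i} {j} p of λ { (u , v , w) → S-intro (≢-sym u) (inv∈ H v) (λ q → w (inv-injective (trans q (d-sym i j)))) })
      ; irrC = λ i y → ≢true λ p → proj₁ (S-elim {i} {i} {y} p) refl }

    supp : ∀ {i j y} → S i j y ≡ true → y ∈ H
    supp {i} {j} p = proj₁ (proj₂ (S-elim {i} {j} p))

    n : Fin 3 → Fin 3 → El
    n 0F 1F = x
    n 1F 0F = inv x
    n 1F 2F = inv x
    n 2F 1F = x
    n 0F 2F = h · x
    n 2F 0F = inv (h · x)
    n 0F 0F = e
    n 1F 1F = e
    n 2F 2F = e

    n-sym : ∀ i j → n j i ≡ inv (n i j)
    n-sym 0F 0F = sym inv-e
    n-sym 0F 1F = refl
    n-sym 0F 2F = refl
    n-sym 1F 0F = sym (inv-inv _)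
    n-sym 1F 1F = sym inv-e
    n-sym 1F 2F = sym (inv-inv _)
    n-sym 2F 0F = sym (inv-inv _)
    n-sym 2F 1F = refl
    n-sym 2F 2F = sym inv-e

    hx∉ : h · x ∉ H
    hx∉ = ·∉ʳ H h∈ x∉

    n∉ : ∀ i j → i ≢ j → n i j ∉ H
    n∉ 0F 0F p = ⊥-elim (p refl)
    n∉ 0F 1F _ = x∉
    n∉ 0F 2F _ = hx∉
    n∉ 1F 0F _ = inv∉ H x∉
    n∉ 1F 1F p = ⊥-elim (p refl)
    n∉ 1F 2F _ = inv∉ H x∉
    n∉ 2F 0F _ = inv∉ H hx∉
    n∉ 2F 1F _ = x∉
    n∉ 2F 2F p = ⊥-elim (p refl)

    hx∈K : h · x ∈ K
    hx∈K = ·∈ K (H⊑K h∈) x∈K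

    n∈K : ∀ i j → n i j ∈ K
    n∈K 0F 0F = e∈ K
    n∈K 0F 1F = x∈K
    n∈K 0F 2F = hx∈K
    n∈K 1F 0F = inv∈ K x∈K
    n∈K 1F 1F = e∈ K
    n∈K 1F 2F = inv∈ K x∈K
    n∈K 2F 0F = inv∈ K hx∈K
    n∈K 2F 1F = x∈K
    n∈K 2F 2F = e∈ K

    supp₀ : ∀ i j y → S i j y ≡ true → y ∈ H
    supp₀ i j y = supp {i} {j} {y}

    open Ext H S isC supp₀ n n-sym n∉

    common : ∀ i j y → y ∈ H → ∃ λ l → i ≢ l × j ≢ l × Two (λ z → S i l z ≡ true × S j l (z / y) ≡ true)
    common i j y y∈ = l , i≢l , j≢l , tw
      where
      pick : ∃ λ l → i ≢ l × j ≢ l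
      pick with i Fₚ.≟ j
      ... | no p = fin3-third i j p
      ... | yes refl with fin3-others i
      ... | l , _ , p , _ = l , p , p
      l = proj₁ pick
      i≢l = proj₁ (proj₂ pick)
      j≢l = proj₂ (proj₂ pick)
      tw : Two (λ z → S i l z ≡ true × S j l (z / y) ≡ true)
      tw with four-avoid2 H4 (d i l) (d j l · y)
      ... | two p (z∈ , q , r) (z′∈ , q′ , r′) = two p
              (S-intro i≢l z∈ q , S-intro j≢l (/∈ H z∈ y∈) (λ s → r (/-≡ s)))
              (S-intro i≢l z′∈ q′ , S-intro j≢l (/∈ H z′∈ y∈) (λ s → r′ (/-≡ s)))

    tri2 : ∀ i j y → S i j y ≡ true → ∃ λ l → Two (λ z → S i l z ≡ true × S j l (z / y) ≡ true)
    tri2 i j y p with common i j y (supp {i} {j} p)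
    ... | l , _ , _ , t = l , t

    e-no : S′ 0F 2F e ≡ false
    e-no = S′-false {0F} {2F} (S-d 0F 2F) (∈≢n {0F} {2F} (λ ()) (e∈ H))
    e-no⁻ : S′ 2F 0F e ≡ false
    e-no⁻ = S′-false {2F} {0F} (S-d 2F 0F) (∈≢n {2F} {0F} (λ ()) (e∈ H))
    q-no : S′ 0F 1F ((x · h) · x) ≡ false
    q-no = S′-false {0F} {1F} (S-∉ {0F} {1F} xhx∉) (λ p → false≢true x∉ (subst (_∈ H)
      (trans (sym (idʳ _)) (trans (cong (inv h ·_) (sym (·-cancelˡ x (trans (sym (assoc x h x)) (trans p (sym (idʳ x)))))))
        (grp (h ∷ x ∷ []) (v0 ⁻ ⊙ (v0 ⊙ v1)) v1 refl))) (inv∈ H h∈)))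
    q-no⁻ : S′ 1F 0F (inv ((x · h) · x)) ≡ false
    q-no⁻ = trans (IsConn.symC isC′ 0F 1F ((x · h) · x)) q-no

    private
      nope : ∀ {A : Set} {i j y z} → y ≡ z → S′ i j z ≡ false → S′ i j y ≡ true → A
      nope refl p q = ⊥-elim (false≢true p q)

    uniq : Unique
    uniq 0F 1F 2F _ _ _ = n 0F 2F , λ z p q → case cand {0F} {1F} {2F} (λ ()) p q of λ
      { (inj₁ r) → r
      ; (inj₂ refl) → nope (invˡ x) e-no p }
    uniq 1F 0F 2F _ _ _ = n 0F 2F · n 1F 0F , λ z p q → case cand {1F} {0F} {2F} (λ ()) p q of λ
      { (inj₁ refl) → nope (grp (x ∷ []) (v0 ⁻ ⊙ v0 ⁻ ⁻) ε refl) e-no q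
      ; (inj₂ r) → r }
    uniq 0F 2F 1F _ _ _ = n 0F 1F , λ z p q → case cand {0F} {2F} {1F} (λ ()) p q of λ
      { (inj₁ r) → r
      ; (inj₂ refl) → nope (sym (assoc x h x)) q-no p }
    uniq 2F 0F 1F _ _ _ = n 0F 1F · n 2F 0F , λ z p q → case cand {2F} {0F} {1F} (λ ()) p q of λ
      { (inj₁ refl) → nope (grp (x ∷ h ∷ []) (v0 ⊙ (v1 ⊙ v0) ⁻ ⁻) (v0 ⊙ v1 ⊙ v0) refl) q-no q
      ; (inj₂ r) → r }
    uniq 1F 2F 0F _ _ _ = e , λ z p q → case cand {1F} {2F} {0F} (λ ()) p q of λ
      { (inj₁ refl) → nope (grp (x ∷ []) (v0 ⁻ ⊙ v0 ⁻ ⁻) ε refl) e-no⁻ q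
      ; (inj₂ refl) → nope (grp (x ∷ h ∷ []) ((v1 ⊙ v0) ⁻ ⊙ v0 ⁻) ((v0 ⊙ v1 ⊙ v0) ⁻) refl) q-no⁻ p }
    uniq 2F 1F 0F _ _ _ = e , λ z p q → case cand {2F} {1F} {0F} (λ ()) p q of λ
      { (inj₁ refl) → nope (grp (x ∷ h ∷ []) ((v1 ⊙ v0) ⁻ ⊙ v0 ⁻) ((v0 ⊙ v1 ⊙ v0) ⁻) refl) q-no⁻ q
      ; (inj₂ refl) → nope (invˡ x) e-no⁻ p }
    uniq 0F 0F _ p _ _ = ⊥-elim (p refl)
    uniq 1F 1F _ p _ _ = ⊥-elim (p refl)
    uniq 2F 2F _ p _ _ = ⊥-elim (p refl)
    uniq 0F 1F 0F _ p _ = ⊥-elim (p refl)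
    uniq 0F 1F 1F _ _ p = ⊥-elim (p refl)
    uniq 0F 2F 0F _ p _ = ⊥-elim (p refl)
    uniq 0F 2F 2F _ _ p = ⊥-elim (p refl)
    uniq 1F 0F 1F _ p _ = ⊥-elim (p refl)
    uniq 1F 0F 0F _ _ p = ⊥-elim (p refl)
    uniq 1F 2F 1F _ p _ = ⊥-elim (p refl)
    uniq 1F 2F 2F _ _ p = ⊥-elim (p refl)
    uniq 2F 0F 2F _ p _ = ⊥-elim (p refl)
    uniq 2F 0F 0F _ _ p = ⊥-elim (p refl)
    uniq 2F 1F 2F _ p _ = ⊥-elim (p refl)
    uniq 2F 1F 1F _ _ p = ⊥-elim (p refl)

    -- Any two vertices over one coset of `H` have a common old neighbour, and old edges stay within
    -- cosets.
    block : (σ : Auto S) → ∀ u v → proj₂ v / proj₂ u ∈ H → proj₂ (to σ v) / proj₂ (to σ u) ∈ H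
    block σ u@(i , y) v@(j , z) p with common i j (z / y) p
    ... | l , _ , _ , two {w} _ (q , r) _ = fin (to σ u) (to σ v) (to σ (l , w · y))
          (trans (pres σ _ _) (trans (cong (S i l) (·-/ w y)) q))
          (trans (pres σ _ _) (trans (cong (S j l) (grp (w ∷ y ∷ z ∷ []) (v0 ⊙ v1 ⊙ v2 ⁻) (v0 ⊙ (v2 ⊙ v1 ⁻) ⁻) refl)) r))
      where
      fin : ∀ u v w → adjC S u w ≡ true → adjC S v w ≡ true → proj₂ v / proj₂ u ∈ H
      fin (i , x) (j , y) (l , z) q r = subst (_∈ H) (grp (x ∷ y ∷ z ∷ []) ((v2 ⊙ v1 ⁻) ⁻ ⊙ (v2 ⊙ v0 ⁻)) (v1 ⊙ v0 ⁻) refl)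
        (·∈ H (inv∈ H (supp {j} {l} r)) (supp {i} {l} q))

    -- Part 2 consists of the vertices whose new neighbours lie in different cosets of H.
    near2 : ∀ i j l → i ≢ 2F → i ≢ j → i ≢ l → n i j / n i l ∈ H
    near2 0F 1F 1F _ _ _ = subst (_∈ H) (sym (/-self x)) (e∈ H)
    near2 0F 1F 2F _ _ _ = subst (_∈ H) (grp (x ∷ h ∷ []) (v1 ⁻) (v0 ⊙ (v1 ⊙ v0) ⁻) refl) (inv∈ H h∈)
    near2 0F 2F 1F _ _ _ = subst (_∈ H) (sym (·-/ h x)) h∈
    near2 0F 2F 2F _ _ _ = subst (_∈ H) (sym (/-self _)) (e∈ H)
    near2 1F 0F 0F _ _ _ = subst (_∈ H) (sym (/-self _)) (e∈ H)
    near2 1F 0F 2F _ _ _ = subst (_∈ H) (sym (/-self _)) (e∈ H)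
    near2 1F 2F 0F _ _ _ = subst (_∈ H) (sym (/-self _)) (e∈ H)
    near2 1F 2F 2F _ _ _ = subst (_∈ H) (sym (/-self _)) (e∈ H)
    near2 0F 0F _ _ p _ = ⊥-elim (p refl)
    near2 1F 1F _ _ p _ = ⊥-elim (p refl)
    near2 0F 1F 0F _ _ p = ⊥-elim (p refl)
    near2 0F 2F 0F _ _ p = ⊥-elim (p refl)
    near2 1F 0F 1F _ _ p = ⊥-elim (p refl)
    near2 1F 2F 1F _ _ p = ⊥-elim (p refl)
    near2 2F _ _ p _ _ = ⊥-elim (p refl)

    back : (σ : Auto S) → ∀ u v → proj₂ (to σ v) / proj₂ (to σ u) ∈ H → proj₂ v / proj₂ u ∈ H
    back σ u v p = subst (λ t → proj₂ (proj₂ t) / proj₂ (proj₁ t) ∈ H) (cong₂ _,_ (from-to σ u) (from-to σ v)) (block (flip σ) (to σ u) (to σ v) p)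

    -- In the other parts both new neighbours lie in one coset by `near2`; pulled back by `back`,
    -- this would put x h x into `H`.
    part2 : (σ : Auto S′) → ∀ g → proj₁ (to σ (2F , g)) ≡ 2F
    part2 σ g with proj₁ (to σ (2F , g)) Fₚ.≟ 2F
    ... | yes p = p
    ... | no p = ⊥-elim (false≢true xhx∉ (subst (_∈ H)
          (grp (x ∷ h ∷ g ∷ []) (v0 ⊙ v2 ⊙ ((v1 ⊙ v0) ⁻ ⊙ v2) ⁻) (v0 ⊙ v1 ⊙ v0) refl) (back (oldAuto tri2 uniq σ) w w′ close)))
      where
      u w w′ : Vx
      u  = 2F , g
      w  = 0F , inv (h · x) · g
      w′ = 1F , x · g
      E  = new-edge tri2 uniq σ u w (λ ()) (·-/ _ g)
      E′ = new-edge tri2 uniq σ u w′ (λ ()) (·-/ _ g)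
      close : proj₂ (to σ w′) / proj₂ (to σ w) ∈ H
      close = subst (_∈ H) (/-· _ _ (inv (proj₂ (to σ u)))) (subst (_∈ H) (sym (cong₂ _/_ (proj₂ E′) (proj₂ E)))
        (near2 _ _ _ p (proj₁ E′) (proj₁ E)))

    fin3-cases : ∀ (p : Fin 3) → p ≢ 2F → (p ≡ 0F) ⊎ (p ≡ 1F)
    fin3-cases 0F _ = inj₁ refl
    fin3-cases 1F _ = inj₂ refl
    fin3-cases 2F p = ⊥-elim (p refl)

    module _ (σ : Auto S′) where
      private
        τ = oldAuto tri2 uniq σ
      z : El → El
      z g = proj₂ (to σ (2F , g))

      val2 : ∀ g → to σ (2F , g) ≡ (2F , z g)
      val2 g = cong (_, z g) (part2 σ g)

      not2 : ∀ i g → i ≢ 2F → proj₁ (to σ (i , g)) ≢ 2F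
      not2 i g p q = p (trans (sym (cong proj₁ (from-to σ (i , g)))) (trans (cong (λ t → proj₁ (from σ t)) (cong (_, proj₂ (to σ (i , g))) q))
        (part2 (flip σ) _)))

      d2 : ∀ p → d 2F p ≡ e
      d2 0F = refl
      d2 1F = refl
      d2 2F = refl

      -- Within its coset the only vertex of part 0 or 1 not joined to (2 , g) has the same group
      -- coordinate g, and the image inherits this.
      lab : ∀ i g → i ≢ 2F → proj₂ (to σ (i , g)) ≡ z g
      lab i g i≢2 = /-e (trans (S-d⁻ {2F} {proj₁ (to σ (i , g))} (≢-sym (not2 i g i≢2)) (block τ (2F , g) (i , g) (subst (_∈ H) (sym (/-self g)) (e∈ H)))
        (subst (λ t → adjC S t (to σ (i , g)) ≡ false) (val2 g) (trans (pres τ (2F , g) (i , g)) (trans (cong (S 2F i) (/-self g)) (trans (cong (S 2F i) (sym (d2 i))) (S-d 2F i))))))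
        (d2 (proj₁ (to σ (i , g)))))

      val0 : ∀ g → to σ (0F , g) ≡ (0F , z g)
      val0 g with fin3-cases _ (not2 0F g (λ ()))
      ... | inj₁ p = cong₂ _,_ p (lab 0F g (λ ()))
      -- New edges lead from (2 , g) and from (0 , g) to the same vertex (1 , x g). If (0 , g) moved
      -- to part 1, that vertex would move to part 0 and the two edges would carry (h x)⁻¹ and x⁻¹,
      -- whence h = e.
      ... | inj₂ p = ⊥-elim (h≢e (bad (to σ (1F , x · g)) (subst P (val2 g) E) (subst P (cong₂ _,_ p (lab 0F g (λ ()))) E′)))
        where
        P : Vx → Set
        P u = proj₁ u ≢ proj₁ (to σ (1F , x · g)) × proj₂ (to σ (1F , x · g)) / proj₂ u ≡ n (proj₁ u) (proj₁ (to σ (1F , x · g)))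
        E : P (to σ (2F , g))
        E  = new-edge tri2 uniq σ (2F , g) (1F , x · g) (λ ()) (·-/ x g)
        E′ : P (to σ (0F , g))
        E′ = new-edge tri2 uniq σ (0F , g) (1F , x · g) (λ ()) (·-/ x g)
        bad : ∀ w → (2F ≢ proj₁ w × proj₂ w / z g ≡ n 2F (proj₁ w)) → (1F ≢ proj₁ w × proj₂ w / z g ≡ n 1F (proj₁ w)) → h ≡ e
        bad (0F , y) (_ , q) (_ , r) = ·-cancelʳ x (trans (inv-injective (trans (sym q) r)) (sym (idˡ x)))
        bad (1F , y) _ (p , _) = ⊥-elim (p refl)
        bad (2F , y) (p , _) _ = ⊥-elim (p refl)

      val1 : ∀ g → to σ (1F , g) ≡ (1F , z g)
      val1 g with fin3-cases _ (not2 1F g (λ ()))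
      ... | inj₂ p = cong₂ _,_ p (lab 1F g (λ ()))
      ... | inj₁ p = ⊥-elim (1≢0 (cong proj₁ (to-inj σ (trans (cong₂ _,_ p (lab 1F g (λ ()))) (sym (val0 g))))))
        where
        1≢0 : _≢_ {A = Fin 3} 1F 0F
        1≢0 ()

      val : ∀ i g → to σ (i , g) ≡ (i , z g)
      val 0F = val0
      val 1F = val1
      val 2F = val2

      z-a : ∀ g → z (a · g) ≡ a · z g
      z-a g = /-≡ (S-d⁻ {0F} {1F} (λ ())
        (subst (λ t → proj₂ (proj₂ t) / proj₂ (proj₁ t) ∈ H) (cong₂ _,_ (val0 g) (val1 (a · g))) (block τ (0F , g) (1F , a · g) (subst (_∈ H) (sym (·-/ a g)) a∈)))
        (subst (λ t → adjC S (proj₁ t) (proj₂ t) ≡ false) (cong₂ _,_ (val0 g) (val1 (a · g))) (trans (pres τ (0F , g) (1F , a · g)) (trans (cong (S 0F 1F) (·-/ a g)) (S-d 0F 1F)))))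

      z-x : ∀ g → z (x · g) ≡ x · z g
      z-x g = /-≡ (proj₂ (subst (λ t → proj₁ (proj₁ t) ≢ proj₁ (proj₂ t) × proj₂ (proj₂ t) / proj₂ (proj₁ t) ≡ n (proj₁ (proj₁ t)) (proj₁ (proj₂ t)))
        (cong₂ _,_ (val0 g) (val1 (x · g))) (new-edge tri2 uniq σ (0F , g) (1F , x · g) (λ ()) (·-/ x g))))

    rigid′ : Rigid K S′
    rigid′ σ = glue σ (z σ) (val σ) {K} (adjoin-least H x (Equiv (z σ)) (gen-least a (Equiv (z σ)) (∈Equiv (z σ) a (z-a σ))) (∈Equiv (z σ) x (z-x σ)))

    far : ∀ {i j y} → y ∉ H → y ≢ n i j → S′ i j y ≡ false
    far {i} {j} p = S′-false {i} {j} (S-∉ {i} {j} p)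
    atd : ∀ i j → i ≢ j → S′ i j (d i j) ≡ false
    atd i j p = S′-false {i} {j} (S-d i j) (∈≢n {i} {j} p (d∈ i j))
    off : ∀ {x y c} → x ≢ c · y → x / y ≢ c
    off p q = p (/-≡ q)
    ∈/∉ : ∀ {x y} → x ∈ H → y ∉ H → x / y ∉ H
    ∈/∉ p q = ·∉ʳ H p (inv∉ H q)
    ∉/∈ : ∀ {x y} → x ∉ H → y ∈ H → x / y ∉ H
    ∉/∈ p q = ·∉ˡ H p (inv∈ H q)
    mv : ∀ {w c t} → w ≢ c / t → w · t ≢ c
    mv {w} {c} {t} p q = p (trans (sym (·-/ w t)) (cong (_/ t) q))

    q₀ : El
    q₀ = inv (h · x)

    q₀∉ : q₀ ∉ H
    q₀∉ = inv∉ H hx∉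

    -- Neither of the cosets of `x` and of (h x)⁻¹ is `H`, and they differ because x h x is not in
    -- `H`; so one of them is also different from H y.
    third : ∀ y → ∃ λ t → t ∈ K × t ∉ H × t / y ∉ H
    third y with ∈? (x / y) H
    ... | inj₂ p = x , x∈K , x∉ , p
    ... | inj₁ p = q₀ , inv∈ K hx∈K , q₀∉ , ≢true λ q → false≢true xhx∉ (subst (_∈ H)
          (grp (x ∷ y ∷ h ∷ []) (v0 ⊙ v1 ⁻ ⊙ ((v2 ⊙ v0) ⁻ ⊙ v1 ⁻) ⁻) (v0 ⊙ v2 ⊙ v0) refl) (·∈ H p (inv∈ H q)))

    ·/∉ : ∀ {w t y} → w ∈ H → t / y ∉ H → (w · t) / y ∉ H
    ·/∉ {w} {t} {y} p q = subst (_∉ H) (sym (assoc w t (inv y))) (·∉ʳ H p q)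

    star : Star K S′
    star = record { same = same ; diff = diff }
      where
      same : ∀ i y → y ∈ K → y ≢ e → ∃ λ j → ∃ λ l → i ≢ j × i ≢ l × j ≢ l × ∃ λ z₁ → ∃ λ z₂ →
             z₁ ∈ K × z₂ ∈ K × S′ i j z₁ ≡ false × S′ i j (z₁ / y) ≡ false ×
             S′ i l z₂ ≡ false × S′ i l (z₂ / y) ≡ false × S′ j l (z₂ / z₁) ≡ false
      same i y y∈ _ with fin3-others i
      ... | j , l , i≢j , i≢l , j≢l with ∈? y H
      ... | inj₁ y∈H with four-avoid2 H4 (n i j / x) (n i j · y / x)
      ... | two {w} _ (w∈ , p , p′) _ with four-avoid3 H4 (n i l / q₀) (n i l · y / q₀) ((n j l · (w · x)) / q₀)
      ... | v , v∈ , r , r′ , r″ = j , l , i≢j , i≢l , j≢l , w · x , v · q₀ , ·∈ K (H⊑K w∈) x∈K , ·∈ K (H⊑K v∈) (inv∈ K hx∈K) ,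
            far {i} {j} wx∉ (mv p) , far {i} {j} (∉/∈ wx∉ y∈H) (off (mv p′)) ,
            far {i} {l} vq∉ (mv r) , far {i} {l} (∉/∈ vq∉ y∈H) (off (mv r′)) ,
            far {j} {l} (≢true λ s → false≢true xhx∉ (inv∈⁻ H (subst (_∈ H)
              (grp (w ∷ x ∷ v ∷ h ∷ []) (v2 ⁻ ⊙ (v2 ⊙ (v3 ⊙ v1) ⁻ ⊙ (v0 ⊙ v1) ⁻) ⊙ v0) ((v1 ⊙ v3 ⊙ v1) ⁻) refl) (·∈ H (·∈ H (inv∈ H v∈) s) w∈)))) (off (mv r″))
        where
        wx∉ : w · x ∉ H
        wx∉ = ·∉ʳ H w∈ x∉
        vq∉ : v · q₀ ∉ H
        vq∉ = ·∉ʳ H v∈ q₀∉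
      same i y y∈ _ | j , l , i≢j , i≢l , j≢l | inj₂ y∉ with third y
      -- Three choices for the second apex: the element `d i l`, then `d i l · y`, and if both run
      -- into the new element, the non-neighbour `d j l · z₁` of the first apex.
      ... | t , t∈ , t∉ , ty∉ with d i l Fₚ.≟ n i l · y | d i l · y Fₚ.≟ n i l
      ... | no p | _ with four-avoid3 H4 (n i j / t) (n i j · y / t) (n l j · d i l / t)
      ... | w , w∈ , q , q′ , q″ = j , l , i≢j , i≢l , j≢l , w · t , d i l , ·∈ K (H⊑K w∈) t∈ , H⊑K (d∈ i l) ,
            far {i} {j} wt∉ (mv q) , far {i} {j} (·/∉ w∈ ty∉) (off (mv q′)) ,
            atd i l i≢l , far {i} {l} (∈/∉ (d∈ i l) y∉) (off p) ,
            trans (cong (S′ j l) (sym (inv-/ (w · t) (d i l)))) (trans (IsConn.symC isC′ l j _) (far {l} {j} (∉/∈ wt∉ (d∈ i l)) (off (mv q″))))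
        where
        wt∉ : w · t ∉ H
        wt∉ = ·∉ʳ H w∈ t∉
      same i y y∈ _ | j , l , i≢j , i≢l , j≢l | inj₂ y∉ | t , t∈ , t∉ , ty∉ | yes _ | no p
        with four-avoid3 H4 (n i j / t) (n i j · y / t) (n l j · (d i l · y) / t)
      ... | w , w∈ , q , q′ , q″ = j , l , i≢j , i≢l , j≢l , w · t , d i l · y , ·∈ K (H⊑K w∈) t∈ , ·∈ K (H⊑K (d∈ i l)) y∈ ,
            far {i} {j} wt∉ (mv q) , far {i} {j} (·/∉ w∈ ty∉) (off (mv q′)) ,
            far {i} {l} (·∉ʳ H (d∈ i l) y∉) p , trans (cong (S′ i l) (·-/ (d i l) y)) (atd i l i≢l) ,
            trans (cong (S′ j l) (sym (inv-/ (w · t) (d i l · y)))) (trans (IsConn.symC isC′ l j _)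
              (far {l} {j} (subst (_∉ H) (grp (w ∷ t ∷ y ∷ d i l ∷ []) (v0 ⊙ (v1 ⊙ v2 ⁻) ⊙ v3 ⁻) (v0 ⊙ v1 ⊙ (v3 ⊙ v2) ⁻) refl)
                (∉/∈ (·∉ʳ H w∈ ty∉) (d∈ i l))) (off (mv q″))))
        where
        wt∉ : w · t ∉ H
        wt∉ = ·∉ʳ H w∈ t∉
      same i y y∈ _ | j , l , i≢j , i≢l , j≢l | inj₂ y∉ | t , t∈ , t∉ , ty∉ | yes p | yes p′
        with four-avoid2 H4 (n i j / t) (n i j · y / t)
      ... | two {w} _ (w∈ , q , q′) _ = j , l , i≢j , i≢l , j≢l , w · t , d j l · (w · t) , ·∈ K (H⊑K w∈) t∈ , ·∈ K (H⊑K (d∈ j l)) (·∈ K (H⊑K w∈) t∈) ,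
            far {i} {j} wt∉ (mv q) , far {i} {j} (·/∉ w∈ ty∉) (off (mv q′)) ,
            far {i} {l} dwt∉ (λ r → false≢true ty∉ (subst (_∈ H)
              (trans (cong (λ s → inv (d j l · w) · (s / y)) (sym (trans r (sym p′))))
                (trans (grp (d j l ∷ w ∷ t ∷ y ∷ []) ((v0 ⊙ v1) ⁻ ⊙ (v0 ⊙ (v1 ⊙ v2) ⊙ v3 ⁻)) (v2 ⊙ v3 ⁻) refl) refl))
              (·∈ H (inv∈ H (·∈ H (d∈ j l) w∈)) (subst (_∈ H) (sym (·-/ (d i l) y)) (d∈ i l))))) ,
            far {i} {l} dwty∉ (off (λ r → false≢true dwt∉ (subst (_∈ H) (sym (trans r (sym p))) (d∈ i l)))) ,
            trans (cong (S′ j l) (·-/ (d j l) (w · t))) (atd j l j≢l)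
        where
        wt∉ : w · t ∉ H
        wt∉ = ·∉ʳ H w∈ t∉
        dwt∉ : d j l · (w · t) ∉ H
        dwt∉ = ·∉ʳ H (d∈ j l) wt∉
        dwty∉ : (d j l · (w · t)) / y ∉ H
        dwty∉ = subst (_∉ H) (grp (d j l ∷ w ∷ t ∷ y ∷ []) (v0 ⊙ v1 ⊙ (v2 ⊙ v3 ⁻)) (v0 ⊙ (v1 ⊙ v2) ⊙ v3 ⁻) refl) (·∉ʳ H (·∈ H (d∈ j l) w∈) ty∉)
      diff : ∀ i j y → i ≢ j → y ∈ K → ∃ λ l → i ≢ l × j ≢ l ×
             (∃ λ z → z ∈ K × S′ i l z ≡ false × S′ j l (z / y) ≡ false) ×
             (S′ i j y ≡ false → Two λ z → z ∈ K × S′ i l z ≡ false × S′ j l (z / y) ≡ false)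
      diff i j y i≢j y∈ with fin3-third i j i≢j
      ... | l , i≢l , j≢l = l , i≢l , j≢l , (Two.a tw , Two.Pa tw) , λ _ → tw
        where
        tw : Two λ z → z ∈ K × S′ i l z ≡ false × S′ j l (z / y) ≡ false
        tw with third y
        ... | t , t∈ , t∉ , ty∉ with four-avoid2 H4 (n i l / t) (n j l · y / t)
        ... | two {z} {z′} p (z∈ , a , b) (z′∈ , a′ , b′) = two (λ q → p (·-cancelʳ t q)) (mk z∈ a b) (mk z′∈ a′ b′)
          where
          mk : ∀ {z} → z ∈ H → z ≢ n i l / t → z ≢ n j l · y / t → z · t ∈ K × S′ i l (z · t) ≡ false × S′ j l (z · t / y) ≡ false
          mk z∈ a b = ·∈ K (H⊑K z∈) t∈ , far {i} {l} (·∉ʳ H z∈ t∉) (mv a) , far {j} {l} (·/∉ z∈ ty∉) (off (mv b))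

    sym3′ : Sym3 K S′
    sym3′ = record
      { isC = isC′
      ; supp = λ {i} {j} p → case S′-split {i} {j} p of λ { (inj₁ q) → H⊑K (supp {i} {j} q) ; (inj₂ (_ , refl)) → n∈K i j }
      ; rigid = rigid′
      ; size = cnt (Sub.mem H)
      ; sz = size′
      ; in3 = λ i j i≢j → Three-map (λ { (p , q) → old {i} {j} (S-intro i≢j p q) }) (four-avoid1 H4 (d i j))
      ; out3 = out }
      where
      size′ : ∀ i j → i ≢ j → cnt (S′ i j) ≡ cnt (Sub.mem H)
      size′ i j i≢j = begin
        cnt (S′ i j) ≡⟨ cnt-∨ (S i j) (new i j) (λ y p q → false≢true (n∉ i j i≢j) (subst (_∈ H) (proj₂ (new-elim {i} {j} q)) (supp {i} {j} p))) ⟩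
        cnt (S i j) + cnt (new i j)
          ≡⟨ cong₂ _+_ (S-cnt i≢j)
               (trans (cnt-cong (λ y → cong (_∧ ⌊ y Fₚ.≟ n i j ⌋) ij)) (trans (cnt-single (n i j)) (sym (cnt-single (d i j))))) ⟩
        cnt (λ y → Sub.mem H y ∧ not ⌊ y Fₚ.≟ d i j ⌋) + cnt (λ y → ⌊ y Fₚ.≟ d i j ⌋)
          ≡⟨ cnt-∖ (Sub.mem H) (λ y → ⌊ y Fₚ.≟ d i j ⌋) (λ y p → subst (_∈ H) (sym (⌊⌋-sound (y Fₚ.≟ d i j) p)) (d∈ i j)) ⟩
        cnt (Sub.mem H) ∎
        where
        open ≡-Reasoning
        ij : not ⌊ i Fₚ.≟ j ⌋ ≡ true
        ij = cong not (⌊⌋-false (i Fₚ.≟ j) i≢j)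
      out : ∀ i j → i ≢ j → Three (λ y → y ∈ K × S′ i j y ≡ false)
      out i j i≢j with four-avoid1 H4 (n i j / x)
      ... | three p q r (a∈ , a) (b∈ , b) (c∈ , c) = three (λ s → p (·-cancelʳ x s)) (λ s → q (·-cancelʳ x s)) (λ s → r (·-cancelʳ x s)) (mk a∈ a) (mk b∈ b) (mk c∈ c)
        where
        mk : ∀ {y} → y ∈ H → y ≢ n i j / x → y · x ∈ K × S′ i j (y · x) ≡ false
        mk p q = ·∈ K (H⊑K p) x∈K , far {i} {j} (·∉ʳ H p x∉) (mv q)

    good′ : Good K
    good′ = Reset.good K S′ sym3′ star

-- Three parts: all groups

module Three-parts (G : FinGroup) where
  open Grp G
  open Labels G
  open LabelKinds G
  open SmallGroups G
  open Analysis G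
  open Core G 3
  open M3 G
  open Extend3 G
  open CyclicBase G
  open Table3 G

  rigid-all : ∀ {K S} → Rigid K S → All K → Rigid full S
  rigid-all r all σ with r σ
  ... | g , p = g , λ i x _ → p i x (all x)

  good→HGR : ∀ {H} → Good H → HGR 3 G
  good→HGR {H} gd with grow {Good} (λ H g g∉ p → Step.good′ H p g g∉) H gd
  ... | K , gd′ , all = toHGR₃ (record
    { isC = isC ; supp = λ _ → refl ; rigid = rigid-all {K} rigid all ; size = size ; sz = sz ; in3 = in3
    ; out3 = λ i j p → Three-map (λ { (_ , q) → refl , q }) (out3 i j p) })
    where open M3.Sym3 (M3.Good.sym3 gd′)

  module _ (Λ : Lab) (conn : Fin 3 → Fin 3 → List (Lab.L Λ)) (d : ℕ) where
    module B = Base 2 Λ conn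

    degCk : Fin 3 → Bool
    degCk i = sum (λ j → length (conn i j)) ≡ᵇ d

    baseHGR : (wf : B.wellformed ≡ true) → allF degCk ≡ true → Rigid full B.S → HGR 3 G
    baseHGR wf dc r = toHGR (B.isC wf) r d (λ i → trans (sum-cong-≗ (λ j → B.S-cnt wf i j)) (≡ᵇ-sound _ d (allF-elim degCk dc i))) 0F

  hgr-C6 : ∀ {a} → HasOrder a 6 → All (gen a) → HGR 3 G
  hgr-C6 {a} o all = baseHGR (CLab.toLab (modLab o)) (table conn-C6) 4 refl refl
    (rigid-all {gen a} (Base.base-rigid 2 (CLab.toLab (modLab o)) (table conn-C6) refl (1 ∷ []) patch-C6 refl (gen a) (λ P h → gen-least₁ P (h {1} refl))) all)

  hgr-C7 : ∀ {a} → HasOrder a 7 → All (gen a) → HGR 3 G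
  hgr-C7 {a} o all = baseHGR (CLab.toLab (modLab o)) (table conn-C7) 6 refl refl
    (rigid-all {gen a} (Base.base-rigid 2 (CLab.toLab (modLab o)) (table conn-C7) refl (1 ∷ []) patch-C7 refl (gen a) (λ P h → gen-least₁ P (h {1} refl))) all)

  Exc₃ : Set
  Exc₃ = G ≅ Cyc 1 ⊎ G ≅ Cyc 2 ⊎ G ≅ Cyc 3 ⊎ G ≅ Cyc 4 ⊎ G ≅ Cyc 5 ⊎ G ≅ C2² ⊎ G ≅ D6

  -- Ranks 1 and 2 are exceptional and rank 3 has a graph of its own; from rank 4 on a good graph
  -- over a subgroup of rank 4 is enlarged.
  elementary : (∀ x → x · x ≡ e) → ∀ a → a ≢ e → HGR 3 G ⊎ Exc₃
  elementary ex2 a a≢e with missing (gen a)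
  ... | inj₁ all = inj₂ (inj₂ (inj₁ (iso-2 (ord2 (ex2 a) a≢e) all)))
  ... | inj₂ (b , b∉) with missing (adjoin (gen a) b)
  ... | inj₁ all = inj₂ (inj₂ (inj₂ (inj₂ (inj₂ (inj₂ (inj₁ (iso-V (ex2 a) a≢e (ex2 b) b∉ (Elementary.commute ex2 b a) all)))))))
  ... | inj₂ (c , c∉) with missing (adjoin (adjoin (gen a) b) c)
  ... | inj₁ all = inj₁ (baseHGR (CLab.toLab C₃.Λ′) (table conn-C222) 8 refl refl (rigid-all {W} rigid₃ all))
    where open Elementary.Rank3 ex2 a b c a≢e b∉ c∉
  ... | inj₂ (d , d∉) = inj₁ (good→HGR (Elementary.Rank3.good-C2222 ex2 a b c a≢e b∉ c∉ d d∉))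

  from-small : Small → HGR 3 G ⊎ Exc₃
  from-small (trivialG f) = inj₂ (inj₁ (iso-1 f))
  from-small (exp2 f a a≢e) = elementary f a a≢e
  from-small (c3 c o all) = inj₂ (inj₂ (inj₂ (inj₁ (iso-3 o all))))
  from-small (c33 a b o p q r) = inj₁ (good→HGR (good-C33 a b o p q r))
  from-small (a4 a b c p q r s t u v w x) = inj₁ (good→HGR (good-A4 a b c p q r s t u v w x))
  from-small (s3 c t o p q r all) = inj₂ (inj₂ (inj₂ (inj₂ (inj₂ (inj₂ (inj₂ (iso-D6 o p q r all)))))))

  pow-mod : ∀ {a} n .{{_ : ℕ.NonZero n}} → a ^ n ≡ e → ∀ k → a ^ k ≡ a ^ (k % n)
  pow-mod {a} n p k = begin
    a ^ k ≡⟨ cong (a ^_) (m≡m%n+[m/n]*n k n) ⟩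
    a ^ (k % n + (k div n) * n) ≡⟨ ^-+ a (k % n) _ ⟩
    a ^ (k % n) · a ^ ((k div n) * n) ≡⟨ cong (a ^ (k % n) ·_) (trans (^-* a (k div n) n) (trans (cong (_^ (k div n)) p) (e^ (k div n)))) ⟩
    a ^ (k % n) · e ≡⟨ idʳ _ ⟩
    a ^ (k % n) ∎
    where open ≡-Reasoning

  -- Conjugation by x² lies in ⟨a⟩ and is trivial on `a`, so i² is 1 modulo n; `x` commutes with x²,
  -- so i j is j modulo n.
  module Index2 (a x : El) (n : ℕ) .{{_ : ℕ.NonZero n}} (o : HasOrder a n) (x∉ : x ∉ gen a)
                (i j : ℕ) (i<n : i < n) (j<n : j < n) (act : x · a ≡ a ^ i · x) (sq : x · x ≡ a ^ j) where
    private
      mod-inj : ∀ k l → a ^ k ≡ a ^ l → l < n → (k % n ≡ᵇ l) ≡ true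
      mod-inj k l p l<n = subst (λ t → (t ≡ᵇ l) ≡ true) (sym (ord-inj o (m%n<n k n) l<n (trans (sym (pow-mod n (HasOrder.pow-n o) k)) p))) (≡ᵇ-refl l)

    ii : 1 < n → ((i * i) % n ≡ᵇ 1) ≡ true
    ii 1<n = mod-inj (i * i) 1 (trans (^-* a i i) (trans (·-cancelʳ (x · x) (sym (begin
      a · (x · x) ≡⟨ cong (a ·_) sq ⟩
      a · a ^ j ≡⟨ cong (_· a ^ j) (^1 a) ⟨
      a ^ 1 · a ^ j ≡⟨ ^-comm a 1 j ⟩
      a ^ j · a ^ 1 ≡⟨ cong₂ _·_ sq (sym (^1 a)) ⟨
      (x · x) · a ≡⟨ assoc _ _ _ ⟩
      x · (x · a) ≡⟨ cong (x ·_) act ⟩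
      x · (a ^ i · x) ≡⟨ assoc _ _ _ ⟨
      (x · a ^ i) · x ≡⟨ cong (_· x) (conj-pow act i) ⟩
      ((a ^ i) ^ i · x) · x ≡⟨ assoc _ _ _ ⟩
      (a ^ i) ^ i · (x · x) ∎))) (sym (^1 a)))) 1<n
      where open ≡-Reasoning

    ij : ((i * j) % n ≡ᵇ j) ≡ true
    ij = mod-inj (i * j) j (trans (cong (a ^_) (ℕₚ.*-comm i j)) (trans (^-* a j i) (·-cancelʳ x (begin
      (a ^ i) ^ j · x ≡⟨ conj-pow act j ⟨
      x · a ^ j ≡⟨ cong (x ·_) sq ⟨
      x · (x · x) ≡⟨ assoc _ _ _ ⟨
      (x · x) · x ≡⟨ cong (_· x) sq ⟩
      a ^ j · x ∎)))) j<n
      where open ≡-Reasoning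

  -- If x commutes with a then x may be replaced by x aᵗ, changing x² = aʲ to a^(j+2t).
  module Shift (a x : El) (n : ℕ) .{{_ : ℕ.NonZero n}} (an : a ^ n ≡ e) (x∉ : x ∉ gen a) (j t : ℕ) (act : x · a ≡ a ^ 1 · x) (sq : x · x ≡ a ^ j) where
    y : El
    y = x · a ^ t
    y∉ : y ∉ gen a
    y∉ = ·∉ˡ (gen a) x∉ (^∈gen a t)
    xa : x · a ≡ a · x
    xa = trans act (cong (_· x) (^1 a))
    act′ : y · a ≡ a ^ 1 · y
    act′ = begin
      (x · a ^ t) · a ≡⟨ assoc _ _ _ ⟩
      x · (a ^ t · a) ≡⟨ cong (λ s → x · (a ^ t · s)) (^1 a) ⟨
      x · (a ^ t · a ^ 1) ≡⟨ cong (x ·_) (^-comm a t 1) ⟩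
      x · (a ^ 1 · a ^ t) ≡⟨ cong (λ s → x · (s · a ^ t)) (^1 a) ⟩
      x · (a · a ^ t) ≡⟨ assoc _ _ _ ⟨
      (x · a) · a ^ t ≡⟨ cong (_· a ^ t) act ⟩
      (a ^ 1 · x) · a ^ t ≡⟨ assoc _ _ _ ⟩
      a ^ 1 · (x · a ^ t) ∎
      where open ≡-Reasoning
    sq′ : ∀ b → ((j + (t + t)) % n ≡ᵇ b) ≡ true → y · y ≡ a ^ b
    sq′ b ck = begin
      (x · a ^ t) · (x · a ^ t) ≡⟨ grp (x ∷ a ^ t ∷ []) (v0 ⊙ v1 ⊙ (v0 ⊙ v1)) (v0 ⊙ (v1 ⊙ v0) ⊙ v1) refl ⟩
      (x · (a ^ t · x)) · a ^ t ≡⟨ cong (λ s → (x · s) · a ^ t) (comm-pow xa t) ⟨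
      (x · (x · a ^ t)) · a ^ t ≡⟨ grp (x ∷ a ^ t ∷ []) (v0 ⊙ (v0 ⊙ v1) ⊙ v1) (v0 ⊙ v0 ⊙ (v1 ⊙ v1)) refl ⟩
      (x · x) · (a ^ t · a ^ t) ≡⟨ cong₂ _·_ sq (sym (^-+ a t t)) ⟩
      a ^ j · a ^ (t + t) ≡⟨ ^-+ a j (t + t) ⟨
      a ^ (j + (t + t)) ≡⟨ pow-mod n an (j + (t + t)) ⟩
      a ^ ((j + (t + t)) % n) ≡⟨ cong (a ^_) (≡ᵇ-sound ((j + (t + t)) % n) b ck) ⟩
      a ^ b ∎
      where open ≡-Reasoning

  GoodSub : Set
  GoodSub = ∃ Good

  -- The two congruences leave few pairs (i , j); when `x` commutes with `a`, `Shift` reduces `j`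
  -- further to a tabulated value.
  index2-4 : ∀ {a x} → HasOrder a 4 → x ∉ gen a → ∀ i j → i < 4 → j < 4 → x · a ≡ a ^ i · x → x · x ≡ a ^ j →
             ((i * i) % 4 ≡ᵇ 1) ≡ true → ((i * j) % 4 ≡ᵇ j) ≡ true → GoodSub
  index2-4 {a} {x} o x∉ 1 0 _ _ p q _ _ = _ , good-K410 a x x∉ o p q
  index2-4 {a} {x} o x∉ 1 1 _ _ p q _ _ = _ , good-K411 a x x∉ o p q
  index2-4 {a} {x} o x∉ 1 2 _ _ p q _ _ = _ , good-K410 a y y∉ o act′ (sq′ 0 refl)
    where open Shift a x 4 (HasOrder.pow-n o) x∉ 2 1 p q
  index2-4 {a} {x} o x∉ 1 3 _ _ p q _ _ = _ , good-K411 a y y∉ o act′ (sq′ 1 refl)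
    where open Shift a x 4 (HasOrder.pow-n o) x∉ 3 1 p q
  index2-4 {a} {x} o x∉ 3 0 _ _ p q _ _ = _ , good-K430 a x x∉ o p q
  index2-4 {a} {x} o x∉ 3 2 _ _ p q _ _ = _ , good-K432 a x x∉ o p q
  index2-4 o x∉ 0 _ _ _ _ _ () _
  index2-4 o x∉ 2 _ _ _ _ _ () _
  index2-4 o x∉ 3 1 _ _ _ _ _ ()
  index2-4 o x∉ 3 3 _ _ _ _ _ ()
  index2-4 o x∉ _ (suc (suc (suc (suc j)))) _ (s≤s (s≤s (s≤s (s≤s ())))) _ _ _ _
  index2-4 o x∉ (suc (suc (suc (suc i)))) _ (s≤s (s≤s (s≤s (s≤s ())))) _ _ _ _ _

  index2-5 : ∀ {a x} → HasOrder a 5 → x ∉ gen a → ∀ i j → i < 5 → j < 5 → x · a ≡ a ^ i · x → x · x ≡ a ^ j →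
             ((i * i) % 5 ≡ᵇ 1) ≡ true → ((i * j) % 5 ≡ᵇ j) ≡ true → GoodSub
  index2-5 {a} {x} o x∉ 1 j _ j<5 p q _ _ = _ , good-K510 a y y∉ o act′ (sq′ 0 (ck j j<5))
    where
    -- The shift 2j makes the exponent j + 2 (2j) = 5j vanish modulo 5.
    open Shift a x 5 (HasOrder.pow-n o) x∉ j (2 * j) p q
    ck : ∀ j → j < 5 → ((j + (2 * j + 2 * j)) % 5 ≡ᵇ 0) ≡ true
    ck 0 _ = refl
    ck 1 _ = refl
    ck 2 _ = refl
    ck 3 _ = refl
    ck 4 _ = refl
    ck (suc (suc (suc (suc (suc j))))) (s≤s (s≤s (s≤s (s≤s (s≤s ())))))
  index2-5 {a} {x} o x∉ 4 0 _ _ p q _ _ = _ , good-K540 a x x∉ o p q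
  index2-5 o x∉ 0 _ _ _ _ _ () _
  index2-5 o x∉ 2 _ _ _ _ _ () _
  index2-5 o x∉ 3 _ _ _ _ _ () _
  index2-5 o x∉ 4 1 _ _ _ _ _ ()
  index2-5 o x∉ 4 2 _ _ _ _ _ ()
  index2-5 o x∉ 4 3 _ _ _ _ _ ()
  index2-5 o x∉ 4 4 _ _ _ _ _ ()
  index2-5 o x∉ 4 (suc (suc (suc (suc (suc j))))) _ (s≤s (s≤s (s≤s (s≤s (s≤s ()))))) _ _ _ _
  index2-5 o x∉ (suc (suc (suc (suc (suc i))))) _ (s≤s (s≤s (s≤s (s≤s (s≤s ()))))) _ _ _ _ _

  index2-6 : ∀ {a x} → HasOrder a 6 → x ∉ gen a → ∀ i j → i < 6 → j < 6 → x · a ≡ a ^ i · x → x · x ≡ a ^ j →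
             ((i * i) % 6 ≡ᵇ 1) ≡ true → ((i * j) % 6 ≡ᵇ j) ≡ true → GoodSub
  index2-6 {a} {x} o x∉ 1 0 _ _ p q _ _ = _ , good-K610 a x x∉ o p q
  index2-6 {a} {x} o x∉ 1 1 _ _ p q _ _ = _ , good-K611 a x x∉ o p q
  index2-6 {a} {x} o x∉ 1 2 _ _ p q _ _ = _ , good-K610 a y y∉ o act′ (sq′ 0 refl)
    where open Shift a x 6 (HasOrder.pow-n o) x∉ 2 2 p q
  index2-6 {a} {x} o x∉ 1 3 _ _ p q _ _ = _ , good-K611 a y y∉ o act′ (sq′ 1 refl)
    where open Shift a x 6 (HasOrder.pow-n o) x∉ 3 2 p q
  index2-6 {a} {x} o x∉ 1 4 _ _ p q _ _ = _ , good-K610 a y y∉ o act′ (sq′ 0 refl)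
    where open Shift a x 6 (HasOrder.pow-n o) x∉ 4 1 p q
  index2-6 {a} {x} o x∉ 1 5 _ _ p q _ _ = _ , good-K611 a y y∉ o act′ (sq′ 1 refl)
    where open Shift a x 6 (HasOrder.pow-n o) x∉ 5 1 p q
  index2-6 {a} {x} o x∉ 5 0 _ _ p q _ _ = _ , good-K650 a x x∉ o p q
  index2-6 {a} {x} o x∉ 5 3 _ _ p q _ _ = _ , good-K653 a x x∉ o p q
  index2-6 o x∉ 0 _ _ _ _ _ () _
  index2-6 o x∉ 2 _ _ _ _ _ () _
  index2-6 o x∉ 3 _ _ _ _ _ () _
  index2-6 o x∉ 4 _ _ _ _ _ () _
  index2-6 o x∉ 5 1 _ _ _ _ _ ()
  index2-6 o x∉ 5 2 _ _ _ _ _ ()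
  index2-6 o x∉ 5 4 _ _ _ _ _ ()
  index2-6 o x∉ 5 5 _ _ _ _ _ ()
  index2-6 o x∉ _ (suc (suc (suc (suc (suc (suc j)))))) _ (s≤s (s≤s (s≤s (s≤s (s≤s (s≤s ())))))) _ _ _ _
  index2-6 o x∉ (suc (suc (suc (suc (suc (suc i)))))) _ (s≤s (s≤s (s≤s (s≤s (s≤s (s≤s ())))))) _ _ _ _ _

  index2-7 : ∀ {a x} → HasOrder a 7 → x ∉ gen a → ∀ i j → i < 7 → j < 7 → x · a ≡ a ^ i · x → x · x ≡ a ^ j →
             ((i * i) % 7 ≡ᵇ 1) ≡ true → ((i * j) % 7 ≡ᵇ j) ≡ true → GoodSub
  index2-7 {a} {x} o x∉ 1 j _ j<7 p q _ _ = _ , good-K710 a y y∉ o act′ (sq′ 0 (ck j j<7))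
    where
    -- The shift 3j makes the exponent j + 2 (3j) = 7j vanish modulo 7.
    open Shift a x 7 (HasOrder.pow-n o) x∉ j (3 * j) p q
    ck : ∀ j → j < 7 → ((j + (3 * j + 3 * j)) % 7 ≡ᵇ 0) ≡ true
    ck 0 _ = refl
    ck 1 _ = refl
    ck 2 _ = refl
    ck 3 _ = refl
    ck 4 _ = refl
    ck 5 _ = refl
    ck 6 _ = refl
    ck (suc (suc (suc (suc (suc (suc (suc j))))))) (s≤s (s≤s (s≤s (s≤s (s≤s (s≤s (s≤s ())))))))
  index2-7 {a} {x} o x∉ 6 0 _ _ p q _ _ = _ , good-K760 a x x∉ o p q
  index2-7 o x∉ 0 _ _ _ _ _ () _
  index2-7 o x∉ 2 _ _ _ _ _ () _
  index2-7 o x∉ 3 _ _ _ _ _ () _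
  index2-7 o x∉ 4 _ _ _ _ _ () _
  index2-7 o x∉ 5 _ _ _ _ _ () _
  index2-7 o x∉ 6 1 _ _ _ _ _ ()
  index2-7 o x∉ 6 2 _ _ _ _ _ ()
  index2-7 o x∉ 6 3 _ _ _ _ _ ()
  index2-7 o x∉ 6 4 _ _ _ _ _ ()
  index2-7 o x∉ 6 5 _ _ _ _ _ ()
  index2-7 o x∉ 6 6 _ _ _ _ _ ()
  index2-7 o x∉ 6 (suc (suc (suc (suc (suc (suc (suc j))))))) _ (s≤s (s≤s (s≤s (s≤s (s≤s (s≤s (s≤s ()))))))) _ _ _ _
  index2-7 o x∉ (suc (suc (suc (suc (suc (suc (suc i))))))) _ (s≤s (s≤s (s≤s (s≤s (s≤s (s≤s (s≤s ()))))))) _ _ _ _ _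

  -- Either some h ≠ e has x h x outside ⟨a⟩ and `Generic` applies, or all these products lie in
  -- ⟨a⟩. Then so do x a x⁻¹ = (x a² x) (x a x)⁻¹ and x², and ⟨a⟩ has index 2 in ⟨a, x⟩.
  module Medium {a : El} {n : ℕ} .{{nz : ℕ.NonZero n}} (o : HasOrder a n) (4≤n : 4 ≤ n) (x : El) (x∉ : x ∉ gen a)
                (index2 : x ∉ gen a → ∀ i j → i < n → j < n → x · a ≡ a ^ i · x → x · x ≡ a ^ j →
                          ((i * i) % n ≡ᵇ 1) ≡ true → ((i * j) % n ≡ᵇ j) ≡ true → GoodSub) where
    pw≢ : ∀ {k l} → k < l → l < 4 → a ^ k ≢ a ^ l
    pw≢ {k} {l} k<l l<4 p = ℕₚ.<⇒≢ k<l (ord-inj o (ℕₚ.<-trans k<l (ℕₚ.<-≤-trans l<4 4≤n)) (ℕₚ.<-≤-trans l<4 4≤n) p)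

    H4 : Four (_∈ gen a)
    H4 = four {a = a ^ 0} (^∈gen a 0) (three {a = a ^ 1} {b = a ^ 2} {c = a ^ 3}
      (pw≢ (s≤s (s≤s z≤n)) (s≤s (s≤s (s≤s z≤n)))) (pw≢ (s≤s (s≤s z≤n)) ℕₚ.≤-refl) (pw≢ (s≤s (s≤s (s≤s z≤n))) ℕₚ.≤-refl)
      (^∈gen a 1 , ≢-sym (pw≢ (s≤s z≤n) (s≤s (s≤s z≤n)))) (^∈gen a 2 , ≢-sym (pw≢ (s≤s z≤n) (s≤s (s≤s (s≤s z≤n))))) (^∈gen a 3 , ≢-sym (pw≢ (s≤s z≤n) ℕₚ.≤-refl)))

    result : GoodSub
    result with Fₚ.any? (λ h → (Sub.mem (gen a) h Bₚ.≟ true) ×-dec (¬? (h Fₚ.≟ e) ×-dec (Sub.mem (gen a) ((x · h) · x) Bₚ.≟ false)))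
    ... | yes (h , h∈ , h≢e , xhx) = _ , Generic.Gen.good′ G a H4 x h x∉ h∈ h≢e xhx
    ... | no none = fin (gen-pow o conj∈) (gen-pow o sq∈)
      where
      H = gen a
      tw : ∀ h → h ∈ H → h ≢ e → (x · h) · x ∈ H
      tw h h∈ h≢e = case ∈? ((x · h) · x) H of λ { (inj₁ p) → p ; (inj₂ p) → ⊥-elim (none (h , h∈ , h≢e , p)) }
      A : (x · a) · x ∈ H
      A = tw a (gen-∋ a) (λ p → pw≢ {0} {1} (s≤s z≤n) (s≤s (s≤s z≤n)) (trans (sym p) (sym (^1 a))))
      A² : (x · (a · a)) · x ∈ H
      A² = tw (a · a) (·∈ H (gen-∋ a) (gen-∋ a)) (λ p → pw≢ {0} {2} (s≤s z≤n) (s≤s (s≤s (s≤s z≤n))) (trans (sym p) (cong (a ·_) (sym (^1 a)))))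
      conj∈ : x · (a · inv x) ∈ H
      conj∈ = subst (_∈ H) (grp (x ∷ a ∷ []) (v0 ⊙ (v1 ⊙ v1) ⊙ v0 ⊙ (v0 ⊙ v1 ⊙ v0) ⁻) (v0 ⊙ (v1 ⊙ v0 ⁻)) refl) (·∈ H A² (inv∈ H A))
      sq∈ : x · x ∈ H
      sq∈ = subst (_∈ H) (grp (x ∷ a ∷ []) ((v0 ⊙ (v1 ⊙ v0 ⁻)) ⁻ ⊙ (v0 ⊙ v1 ⊙ v0)) (v0 ⊙ v0) refl) (·∈ H (inv∈ H conj∈) A)
      fin : (∃ λ i → i < n × x · (a · inv x) ≡ a ^ i) → (∃ λ j → j < n × x · x ≡ a ^ j) → GoodSub
      fin (i , i<n , p) (j , j<n , q) = index2 x∉ i j i<n j<n act q (Index2.ii a x n o x∉ i j i<n j<n act q (ℕₚ.≤-trans (s≤s (s≤s z≤n)) 4≤n)) (Index2.ij a x n o x∉ i j i<n j<n act q)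
        where
        act : x · a ≡ a ^ i · x
        act = trans (grp (x ∷ a ∷ []) (v0 ⊙ v1) (v0 ⊙ (v1 ⊙ v0 ⁻) ⊙ v0) refl) (cong (_· x) p)

  medium : ∀ {a n} → HasOrder a n → 4 ≤ n → n < 8 → HGR 3 G ⊎ Exc₃
  medium {a} {n} o 4≤n n<8 with missing (gen a)
  medium {a} {4} o _ _ | inj₁ all = inj₂ (inj₂ (inj₂ (inj₂ (inj₁ (iso-4 o all)))))
  medium {a} {5} o _ _ | inj₁ all = inj₂ (inj₂ (inj₂ (inj₂ (inj₂ (inj₁ (iso-5 o all))))))
  medium {a} {6} o _ _ | inj₁ all = inj₁ (hgr-C6 o all)
  medium {a} {7} o _ _ | inj₁ all = inj₁ (hgr-C7 o all)
  medium {a} {4} o p _ | inj₂ (x , x∉) = inj₁ (good→HGR (proj₂ (Medium.result o p x x∉ (index2-4 o))))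
  medium {a} {5} o p _ | inj₂ (x , x∉) = inj₁ (good→HGR (proj₂ (Medium.result o p x x∉ (index2-5 o))))
  medium {a} {6} o p _ | inj₂ (x , x∉) = inj₁ (good→HGR (proj₂ (Medium.result o p x x∉ (index2-6 o))))
  medium {a} {7} o p _ | inj₂ (x , x∉) = inj₁ (good→HGR (proj₂ (Medium.result o p x x∉ (index2-7 o))))
  medium {a} {0} o () _ | _
  medium {a} {1} o (s≤s ()) _ | _
  medium {a} {2} o (s≤s (s≤s ())) _ | _
  medium {a} {3} o (s≤s (s≤s (s≤s ()))) _ | _
  medium {a} {suc (suc (suc (suc (suc (suc (suc (suc n)))))))} o _ (s≤s (s≤s (s≤s (s≤s (s≤s (s≤s (s≤s (s≤s ())))))))) | _

  le3 : (∀ x → proj₁ (hasOrder x) < 4) → ∀ x → (x ≡ e) ⊎ (x ≢ e × x · x ≡ e) ⊎ (x ≢ e × x ^ 3 ≡ e)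
  le3 f x with hasOrder x | f x
  ... | 0 , o | _ = ⊥-elim (ℕₚ.<⇒≱ (HasOrder.pos o) z≤n)
  ... | 1 , o | _ = inj₁ (trans (sym (^1 x)) (HasOrder.pow-n o))
  ... | 2 , o | _ = inj₂ (inj₁ ((λ p → HasOrder.least o 1 ℕₚ.≤-refl ℕₚ.≤-refl (trans (^1 x) p)) , trans (cong (x ·_) (sym (^1 x))) (HasOrder.pow-n o)))
  ... | 3 , o | _ = inj₂ (inj₂ ((λ p → HasOrder.least o 1 ℕₚ.≤-refl (s≤s (s≤s z≤n)) (trans (^1 x) p)) , HasOrder.pow-n o))
  ... | suc (suc (suc (suc n))) , o | s≤s (s≤s (s≤s (s≤s ())))

  three-parts : HGR 3 G ⊎ Exc₃
  three-parts with Fₚ.any? (λ x → 8 ℕₚ.≤? proj₁ (hasOrder x))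
  ... | yes (x , p) = inj₁ (good→HGR (Z3.good-cyclic (proj₂ (hasOrder x)) p))
  ... | no none with Fₚ.any? (λ x → 4 ℕₚ.≤? proj₁ (hasOrder x))
  ... | yes (x , p) = medium (proj₂ (hasOrder x)) p (ℕₚ.≰⇒> λ q → none (x , q))
  ... | no none′ = from-small (Small3.small (le3 λ x → ℕₚ.≰⇒> λ q → none′ (x , q)))

-- Four to nine parts: all groups

module Middle-parts (G : FinGroup) where
  open Grp G
  open SmallGroups G
  open Analysis G
  open Three-parts G
  open Middle G

  orders : ∀ k → (∃ λ x → ∃ λ n → HasOrder x n × k ≤ n) ⊎ (∀ x → proj₁ (hasOrder x) < k)
  orders k with Fₚ.any? (λ x → k ℕₚ.≤? proj₁ (hasOrder x))
  ... | yes (x , p) = inj₁ (x , proj₁ (hasOrder x) , proj₂ (hasOrder x) , p)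
  ... | no q = inj₂ λ x → ℕₚ.≰⇒> λ r → q (x , r)

  exponent2 : (∀ x → proj₁ (hasOrder x) < 3) → ∀ x → x · x ≡ e
  exponent2 f x with hasOrder x | f x
  ... | 0 , o | _ = ⊥-elim (ℕₚ.<⇒≱ (HasOrder.pos o) z≤n)
  ... | 1 , o | _ = trans (cong (x ·_) x≡e) (trans (idʳ x) x≡e)
    where x≡e = trans (sym (^1 x)) (HasOrder.pow-n o)
  ... | 2 , o | _ = trans (cong (x ·_) (sym (^1 x))) (HasOrder.pow-n o)
  ... | suc (suc (suc n)) , o | s≤s (s≤s (s≤s ()))

  involutions : (∀ x → x · x ≡ e) → (∀ x → x ≡ e) ⊎ (∃ λ a → a ≢ e)
  involutions f with missing trivial
  ... | inj₂ (a , a∉) = inj₂ (a , λ { refl → false≢true a∉ (e∈ trivial) })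
  ... | inj₁ all = inj₁ λ x → ⌊⌋-sound (x Fₚ.≟ e) (all x)

  four-parts : HGR 4 G ⊎ (G ≅ Cyc 1 ⊎ G ≅ Cyc 2 ⊎ G ≅ Cyc 3)
  four-parts with orders 4
  ... | inj₁ (x , n , o , p) = inj₁ (cyclic-4 o p)
  ... | inj₂ f = from (Small3.small (le3 f))
    where
    from : Small → HGR 4 G ⊎ (G ≅ Cyc 1 ⊎ G ≅ Cyc 2 ⊎ G ≅ Cyc 3)
    from (trivialG f) = inj₂ (inj₁ (iso-1 f))
    from (exp2 f a a≢e) with missing (gen a)
    ... | inj₁ all = inj₂ (inj₂ (inj₁ (iso-2 (ord2 (f a) a≢e) all)))
    ... | inj₂ (b , b∉) = inj₁ (hgr-T4V (f a) a≢e (f b) b∉ (Elementary.commute f b a))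
    from (c3 c o all) = inj₂ (inj₂ (inj₂ (iso-3 o all)))
    from (c33 a b o p q r) = inj₁ (hgr-T4N o p q r)
    -- The Klein four-group inside A₄ already carries a base.
    from (a4 a b c p q r s t u v w x) = inj₁ (hgr-T4V p q r s v)
    from (s3 c t o p q r all) = inj₁ (hgr-T4S o p q r)

  five-parts : HGR 5 G ⊎ (G ≅ Cyc 1 ⊎ G ≅ Cyc 2)
  five-parts with orders 3
  ... | inj₁ (x , 0 , o , ())
  ... | inj₁ (x , 1 , o , s≤s ())
  ... | inj₁ (x , 2 , o , s≤s (s≤s ()))
  ... | inj₁ (x , 3 , o , _) = inj₁ (hgr-T53 o)
  ... | inj₁ (x , suc (suc (suc (suc n))) , o , _) = inj₁ (cyclic-5 o (ℕₚ.m≤m+n 4 n))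
  ... | inj₂ f with involutions (exponent2 f)
  ... | inj₁ all = inj₂ (inj₁ (iso-1 all))
  ... | inj₂ (a , a≢e) with missing (gen a)
  ... | inj₁ all = inj₂ (inj₂ (iso-2 (ord2 (exponent2 f a) a≢e) all))
  ... | inj₂ (b , b∉) = inj₁ (hgr-T5V (exponent2 f a) a≢e (exponent2 f b) b∉ (Elementary.commute (exponent2 f) b a))

  module _ (m : ℕ) (large : ∀ {a n} → HasOrder a n → 3 ≤ n → HGR m G) (two : ∀ {a} → HasOrder a 2 → HGR m G) where
    more-parts : HGR m G ⊎ G ≅ Cyc 1
    more-parts with orders 3
    ... | inj₁ (x , n , o , p) = inj₁ (large o p)
    ... | inj₂ f with involutions (exponent2 f)
    ... | inj₁ all = inj₂ (iso-1 all)
    ... | inj₂ (a , a≢e) = inj₁ (two (ord2 (exponent2 f a) a≢e))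

  six-parts : HGR 6 G ⊎ G ≅ Cyc 1
  six-parts = more-parts 6 cyclic-6 hgr-T62
  seven-parts : HGR 7 G ⊎ G ≅ Cyc 1
  seven-parts = more-parts 7 cyclic-7 hgr-T72
  eight-parts : HGR 8 G ⊎ G ≅ Cyc 1
  eight-parts = more-parts 8 cyclic-8 hgr-T82
  nine-parts : HGR 9 G ⊎ G ≅ Cyc 1
  nine-parts = more-parts 9 (λ o p → cyclic-9 o (ℕₚ.<⇒≤ p)) (λ o → cyclic-9 o ℕₚ.≤-refl)

-- Existence and nonexistence combined for every number of parts

module Existence (G : FinGroup) where
  open Three-parts G using (three-parts)
  open Middle-parts G

  exists : ∀ m → 3 ≤ m → HGR m G ⊎ Exceptional m G
  exists 0 ()
  exists 1 (s≤s ())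
  exists 2 (s≤s (s≤s ()))
  exists 3 _ = ⊎.map₂ (λ x → inj₁ (refl , x)) three-parts
  exists 4 _ = ⊎.map₂ (λ x → inj₂ (inj₁ (refl , x))) four-parts
  exists 5 _ = ⊎.map₂ (λ x → inj₂ (inj₂ (inj₁ (refl , x)))) five-parts
  exists 6 _ = ⊎.map₂ (λ x → inj₂ (inj₂ (inj₂ ((ℕₚ.m≤m+n 6 0 , ℕₚ.m≤m+n 6 3) , x)))) six-parts
  exists 7 _ = ⊎.map₂ (λ x → inj₂ (inj₂ (inj₂ ((ℕₚ.m≤m+n 6 1 , ℕₚ.m≤m+n 7 2) , x)))) seven-parts
  exists 8 _ = ⊎.map₂ (λ x → inj₂ (inj₂ (inj₂ ((ℕₚ.m≤m+n 6 2 , ℕₚ.m≤m+n 8 1) , x)))) eight-parts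
  exists 9 _ = ⊎.map₂ (λ x → inj₂ (inj₂ (inj₂ ((ℕₚ.m≤m+n 6 3 , ℕₚ.m≤m+n 9 0) , x)))) nine-parts
  exists (suc (suc (suc (suc (suc (suc (suc (suc (suc (suc t)))))))))) _ = inj₁ (many-parts G t)

none : ∀ {G} m → Exceptional m G → HGR m G → ⊥
none {G} _ (inj₁ (refl , inj₁ i)) = none-C1-3 {G} i
none {G} _ (inj₁ (refl , inj₂ (inj₁ i))) = none-C2-3 {G} i
none {G} _ (inj₁ (refl , inj₂ (inj₂ (inj₁ i)))) = none-C3-3 {G} i
none {G} _ (inj₁ (refl , inj₂ (inj₂ (inj₂ (inj₁ i))))) = none-C4-3 {G} i
none {G} _ (inj₁ (refl , inj₂ (inj₂ (inj₂ (inj₂ (inj₁ i)))))) = none-C5-3 {G} i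
none {G} _ (inj₁ (refl , inj₂ (inj₂ (inj₂ (inj₂ (inj₂ (inj₁ i))))))) = none-V-3 {G} i
none {G} _ (inj₁ (refl , inj₂ (inj₂ (inj₂ (inj₂ (inj₂ (inj₂ i))))))) = none-D-3 {G} i
none {G} _ (inj₂ (inj₁ (refl , inj₁ i))) = none-C1-4 {G} i
none {G} _ (inj₂ (inj₁ (refl , inj₂ (inj₁ i)))) = none-C2-4 {G} i
none {G} _ (inj₂ (inj₁ (refl , inj₂ (inj₂ i)))) = none-C3-4 {G} i
none {G} _ (inj₂ (inj₂ (inj₁ (refl , inj₁ i)))) = none-C1-5 {G} i
none {G} _ (inj₂ (inj₂ (inj₁ (refl , inj₂ i)))) = none-C2-5 {G} i
none {G} 6 (inj₂ (inj₂ (inj₂ (_ , i)))) = none-C1-6 {G} i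
none {G} 7 (inj₂ (inj₂ (inj₂ (_ , i)))) = none-C1-7 {G} i
none {G} 8 (inj₂ (inj₂ (inj₂ (_ , i)))) = none-C1-8 {G} i
none {G} 9 (inj₂ (inj₂ (inj₂ (_ , i)))) = none-C1-9 {G} i
none 0 (inj₂ (inj₂ (inj₂ ((() , _) , _))))
none 1 (inj₂ (inj₂ (inj₂ ((s≤s () , _) , _))))
none 2 (inj₂ (inj₂ (inj₂ ((s≤s (s≤s ()) , _) , _))))
none 3 (inj₂ (inj₂ (inj₂ ((s≤s (s≤s (s≤s ())) , _) , _))))
none 4 (inj₂ (inj₂ (inj₂ ((s≤s (s≤s (s≤s (s≤s ()))) , _) , _))))
none 5 (inj₂ (inj₂ (inj₂ ((s≤s (s≤s (s≤s (s≤s (s≤s ())))) , _) , _))))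
none (suc (suc (suc (suc (suc (suc (suc (suc (suc (suc m)))))))))) (inj₂ (inj₂ (inj₂ ((_ , s≤s (s≤s (s≤s (s≤s (s≤s (s≤s (s≤s (s≤s (s≤s ()))))))))) , _))))

theorem1p3 : (G : FinGroup) (m : ℕ) → 3 ≤ m → HasHGR m G ⇔ (¬ Exceptional m G)
theorem1p3 G m 3≤m = mk⇔ (λ h x → none {G} m x h) λ no → ⊎.fromInj₁ (λ x → ⊥-elim (no x)) (Existence.exists G m 3≤m)
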